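{- If ZFC is consistent, then so is ZFC together with the statement: there exists a Q-set $X\subseteq[\omega]^\omega$ (as a subspace of $P(\omega)\cong 2^\omega$) which is a strong splitting family, i.e. for every $a\in[\omega]^\omega$, for all but countably many $x\in X$ we have $|x\cap a|=|x\setminus a|=\omega$.
   Context: $[\omega]^\omega$ denotes the set of infinite subsets of $\omega$; subsets of $\omega$ are identified with their characteristic functions in $2^\omega$. A Q-set is an uncountable subset of $2^\omega$ every subset of which is a relative $G_\delta$ set (in the subspace topology).
   Formalization: The splitting condition is read as |x∩a| = |a∖x| = ω instead of |x∩a| = |x∖a| = ω, since the latter fails for every x when a = ω; for co-infinite a, the version used, applied to a and ω∖a, gives the original condition. -}

module Defs where

open import Data.Fin using (Fin; zero; suc)
open import Data.List using (List; []; _∷_; map)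
open import Data.List.Membership.Propositional using (_∈_)
open import Data.Nat using (ℕ; zero; suc)
open import Data.Sum using (_⊎_)
import Data.Vec.Functional as V
open import Function using (_∘_; id)
open import Relation.Binary.PropositionalEquality using (_≡_)
open import Relation.Nullary using (¬_)

private
  variable
    m n : ℕ

------------------------------------------------------------------------
-- Classical first-order logic with equality in the language {∈}
------------------------------------------------------------------------

-- Well-scoped de Bruijn syntax.  The language has no function symbols, so
-- the only terms are variables and substitutions are renamings.

Var : ℕ → Set
Var = Fin

infix  9 ↑_ ↑²_ ↑³_
infix  8 _∈̇_ _≐_
infix  7 ¬̇_
infixr 6 _∧̇_
infixr 5 _∨̇_
infixr 4 _⇒_
infix  3 _⇔_

data Formula (n : ℕ) : Set where
  _∈̇_ : Var n → Var n → Formula n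
  _≐_ : Var n → Var n → Formula n
  ⊥̇   : Formula n
  _⇒_ : Formula n → Formula n → Formula n
  ∀̇   : Formula (suc n) → Formula n

Sentence : Set
Sentence = Formula 0

↑_ : Var n → Var (suc n)
↑_ = suc

↑²_ : Var n → Var (suc (suc n))
↑² x = ↑ ↑ x

↑³_ : Var n → Var (suc (suc (suc n)))
↑³ x = ↑ ↑² x

lift : (Var m → Var n) → Var (suc m) → Var (suc n)
lift ρ = zero V.∷ (↑_ ∘ ρ)

ren : (Var m → Var n) → Formula m → Formula n
ren ρ (x ∈̇ y) = ρ x ∈̇ ρ y
ren ρ (x ≐ y) = ρ x ≐ ρ y
ren ρ ⊥̇       = ⊥̇
ren ρ (φ ⇒ ψ) = ren ρ φ ⇒ ren ρ ψ
ren ρ (∀̇ φ)   = ∀̇ (ren (lift ρ) φ)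

_[_] : Formula (suc n) → Var n → Formula n
φ [ x ] = ren (x V.∷ id) φ

¬̇_ : Formula n → Formula n
¬̇ φ = φ ⇒ ⊥̇

_∧̇_ _∨̇_ _⇔_ : Formula n → Formula n → Formula n
φ ∧̇ ψ = ¬̇ (φ ⇒ ¬̇ ψ)
φ ∨̇ ψ = ¬̇ φ ⇒ ψ
φ ⇔ ψ = (φ ⇒ ψ) ∧̇ (ψ ⇒ φ)

∃̇ ∃!̇ : Formula (suc n) → Formula n
∃̇ φ  = ¬̇ ∀̇ (¬̇ φ)
∃!̇ φ = ∃̇ (φ ∧̇ ∀̇ (ren (zero V.∷ ↑²_) φ ⇒ zero ≐ ↑ zero))

-- Named binders: in ∀[ x ] φ the name x stands for the innermost variable of
-- the extended scope.  Names bound further out have to be shifted with ↑, and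
-- a wrong number of shifts is a type error.

all ex ex! : (Var (suc n) → Formula (suc n)) → Formula n
all φ = ∀̇ (φ zero)
ex  φ = ∃̇ (φ zero)
ex! φ = ∃!̇ (φ zero)

allIn exIn : Var n → (Var (suc n) → Formula (suc n)) → Formula n
allIn a φ = all λ x → x ∈̇ ↑ a ⇒ φ x
exIn  a φ = ex  λ x → x ∈̇ ↑ a ∧̇ φ x

infix 2 all ex ex! allIn exIn
syntax all (λ x → φ)     = ∀[ x ] φ
syntax ex  (λ x → φ)     = ∃[ x ] φ
syntax ex! (λ x → φ)     = ∃![ x ] φ
syntax allIn a (λ x → φ) = ∀[ x ∊ a ] φ
syntax exIn  a (λ x → φ) = ∃[ x ∊ a ] φ

closure : Formula n → Sentence
closure {zero}  φ = φ
closure {suc n} φ = closure (∀̇ φ)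

Theory : Set₁
Theory = Sentence → Set

infix 1 _∣_⊢_

-- Natural deduction.  A judgement in scope n may use n free variables;
-- axioms are sentences and are available in every scope.  In scope 0 no
-- witness for a nonempty domain is assumed; for ZFC the axiom of infinity
-- supplies one.
data _∣_⊢_ (T : Theory) {n : ℕ} (Γ : List (Formula n)) : Formula n → Set where
  axiom : ∀ {φ} → T φ → T ∣ Γ ⊢ ren (λ ()) φ
  hyp   : ∀ {φ} → φ ∈ Γ → T ∣ Γ ⊢ φ
  ⇒I    : ∀ {φ ψ} → T ∣ φ ∷ Γ ⊢ ψ → T ∣ Γ ⊢ φ ⇒ ψ
  ⇒E    : ∀ {φ ψ} → T ∣ Γ ⊢ φ ⇒ ψ → T ∣ Γ ⊢ φ → T ∣ Γ ⊢ ψ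
  raa   : ∀ {φ} → T ∣ ¬̇ φ ∷ Γ ⊢ ⊥̇ → T ∣ Γ ⊢ φ
  ∀I    : ∀ {φ} → T ∣ map (ren ↑_) Γ ⊢ φ → T ∣ Γ ⊢ ∀̇ φ
  ∀E    : ∀ {φ} → T ∣ Γ ⊢ ∀̇ φ → (x : Var n) → T ∣ Γ ⊢ φ [ x ]
  ≐I    : ∀ {x} → T ∣ Γ ⊢ x ≐ x
  ≐E    : ∀ {x y} (φ : Formula (suc n)) →
          T ∣ Γ ⊢ x ≐ y → T ∣ Γ ⊢ φ [ x ] → T ∣ Γ ⊢ φ [ y ]

Consistent : Theory → Set
Consistent T = ¬ (T ∣ [] {A = Sentence} ⊢ ⊥̇)

infixl 5 _⊹_

_⊹_ : Theory → Sentence → Theory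
(T ⊹ φ) ψ = T ψ ⊎ ψ ≡ φ

------------------------------------------------------------------------
-- Basic set-theoretic notions
------------------------------------------------------------------------

infix 8 _⊆̇_ _≐∅ _≐｛_,_｝ _≐⟨_,_⟩ _≐_∩_ _≐_∖_ ⟨_,_⟩∈_ _≈_

_⊆̇_ : Var n → Var n → Formula n
x ⊆̇ y = ∀[ z ∊ x ] (z ∈̇ ↑ y)

_≐∅ : Var n → Formula n
x ≐∅ = ∀[ z ] ¬̇ (z ∈̇ ↑ x)

_≐｛_,_｝ : Var n → Var n → Var n → Formula n
p ≐｛ x , y ｝ = ∀[ z ] (z ∈̇ ↑ p ⇔ (z ≐ ↑ x ∨̇ z ≐ ↑ y))

-- Kuratowski pairs
_≐⟨_,_⟩ : Var n → Var n → Var n → Formula n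
p ≐⟨ x , y ⟩ =
  ∃[ s ] ∃[ d ] (↑ s ≐｛ ↑² x , ↑² x ｝ ∧̇ d ≐｛ ↑² x , ↑² y ｝ ∧̇ ↑² p ≐｛ ↑ s , d ｝)

⟨_,_⟩∈_ : Var n → Var n → Var n → Formula n
⟨ x , y ⟩∈ f = ∃[ p ∊ f ] p ≐⟨ ↑ x , ↑ y ⟩

_≐_∩_ _≐_∖_ : Var n → Var n → Var n → Formula n
c ≐ x ∩ y = ∀[ z ] (z ∈̇ ↑ c ⇔ (z ∈̇ ↑ x ∧̇ z ∈̇ ↑ y))
c ≐ x ∖ y = ∀[ z ] (z ∈̇ ↑ c ⇔ (z ∈̇ ↑ x ∧̇ ¬̇ (z ∈̇ ↑ y)))

IsSuccessor : Var n → Var n → Formula n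
IsSuccessor s x = ∀[ z ] (z ∈̇ ↑ s ⇔ (z ∈̇ ↑ x ∨̇ z ≐ ↑ x))

Inductive : Var n → Formula n
Inductive i =
  (∃[ e ∊ i ] e ≐∅) ∧̇ (∀[ x ∊ i ] ∃[ s ∊ ↑ i ] IsSuccessor s (↑ x))

Isω : Var n → Formula n
Isω w = Inductive w ∧̇ (∀[ i ] (Inductive i ⇒ ↑ w ⊆̇ i))

IsFunction : Var n → Var n → Var n → Formula n
IsFunction f a b =
  (∀[ p ∊ f ] ∃[ x ∊ ↑ a ] ∃[ y ∊ ↑² b ] ↑² p ≐⟨ ↑ x , y ⟩) ∧̇
  (∀[ x ∊ a ] ∃![ y ] ⟨ ↑ x , y ⟩∈ ↑² f)

Injective : Var n → Formula n
Injective f =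
  ∀[ x ] ∀[ x′ ] ∀[ y ]
    (⟨ ↑² x , y ⟩∈ ↑³ f ⇒ ⟨ ↑ x′ , y ⟩∈ ↑³ f ⇒ ↑² x ≐ ↑ x′)

Onto : Var n → Var n → Formula n
Onto f b = ∀[ y ∊ b ] ∃[ x ] ⟨ x , ↑ y ⟩∈ ↑² f

_≈_ : Var n → Var n → Formula n
a ≈ b = ∃[ f ] (IsFunction f (↑ a) (↑ b) ∧̇ Injective f ∧̇ Onto f (↑ b))

------------------------------------------------------------------------
-- ZFC
------------------------------------------------------------------------

extensionality foundation pairing union powerset infinity choice : Sentence

extensionality =
  ∀[ x ] ∀[ y ] ((∀[ z ] (z ∈̇ ↑² x ⇔ z ∈̇ ↑ y)) ⇒ ↑ x ≐ y)

foundation =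
  ∀[ x ] (¬̇ (x ≐∅) ⇒ (∃[ y ∊ x ] ∀[ z ∊ y ] ¬̇ (z ∈̇ ↑² x)))

pairing =
  ∀[ x ] ∀[ y ] ∃[ p ] p ≐｛ ↑² x , ↑ y ｝

union =
  ∀[ x ] ∃[ u ] ∀[ z ] (z ∈̇ ↑ u ⇔ (∃[ y ∊ ↑² x ] ↑ z ∈̇ y))

powerset =
  ∀[ x ] ∃[ p ] ∀[ z ] (z ∈̇ ↑ p ⇔ z ⊆̇ ↑² x)

infinity =
  ∃[ i ] Inductive i

-- Every family of nonempty, pairwise disjoint sets has a transversal.
choice =
  ∀[ f ] ((∀[ x ∊ f ] ¬̇ (x ≐∅)) ⇒
          (∀[ x ∊ f ] ∀[ y ∊ ↑ f ] ((∃[ z ∊ y ] z ∈̇ ↑² x) ⇒ ↑ x ≐ y)) ⇒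
          (∃[ c ] ∀[ x ∊ ↑ f ] ∃![ z ] (z ∈̇ ↑ x ∧̇ z ∈̇ ↑² c)))

-- Variable 0 of φ ranges over the elements; the others are parameters.
separation : Formula (suc n) → Sentence
separation φ = closure (
  ∀[ a ] ∃[ b ] ∀[ x ] (x ∈̇ ↑ b ⇔ (x ∈̇ ↑² a ∧̇ ren (x V.∷ ↑³_) φ)))

-- Variable 0 of φ is the argument and variable 1 the value of the class
-- function; the others are parameters.
replacement : Formula (suc (suc n)) → Sentence
replacement φ = closure (
  (∀[ x ] ∀[ y ] ∀[ z ]
     (ren (↑² x V.∷ ↑ y V.∷ ↑³_) φ ⇒ ren (↑² x V.∷ z V.∷ ↑³_) φ ⇒ ↑ y ≐ z)) ⇒
  (∀[ a ] ∃[ b ] ∀[ y ]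
     (y ∈̇ ↑ b ⇔ (∃[ x ∊ ↑² a ] ren (x V.∷ ↑ y V.∷ (↑_ ∘ ↑³_)) φ))))

data ZFC : Theory where
  ext    : ZFC extensionality
  found  : ZFC foundation
  pair   : ZFC pairing
  un     : ZFC union
  pow    : ZFC powerset
  inf    : ZFC infinity
  ac     : ZFC choice
  sep    : (φ : Formula (suc n)) → ZFC (separation φ)
  repl   : (φ : Formula (suc (suc n))) → ZFC (replacement φ)

------------------------------------------------------------------------
-- Q-sets and strong splitting families
------------------------------------------------------------------------

-- In this section the variable w always denotes ω.

-- Finite or countably infinite.
Countable : Var n → Var n → Formula n
Countable w c = ∃[ f ] (IsFunction f (↑ c) (↑ w) ∧̇ Injective f)

Infinite : Var n → Var n → Formula n
Infinite w a = ¬̇ (∃[ k ∊ w ] ↑ a ≈ k)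

∈[ω]^ω : Var n → Var n → Formula n
∈[ω]^ω w a = a ⊆̇ w ∧̇ Infinite w a

-- The topology of 2^ω transported to P(ω) along characteristic functions: the
-- basic open neighbourhoods of x are { y ⊆ ω : χ_y ↾ k = χ_x ↾ k }, k ∈ ω,
-- where k = {0,…,k-1}.
Open : Var n → Var n → Formula n
Open w u =
  (∀[ x ∊ u ] x ⊆̇ ↑ w) ∧̇
  (∀[ x ∊ u ] ∃[ k ∊ ↑ w ] ∀[ y ]
     (y ⊆̇ ↑³ w ⇒ (∀[ i ∊ ↑ k ] (i ∈̇ ↑ y ⇔ i ∈̇ ↑³ x)) ⇒ y ∈̇ ↑³ u))

RelativelyOpen : Var n → Var n → Var n → Formula n
RelativelyOpen w X v = ∃[ u ] (Open (↑ w) u ∧̇ ↑ v ≐ ↑ X ∩ u)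

RelativelyGδ : Var n → Var n → Var n → Formula n
RelativelyGδ w X Y =
  ∃[ g ] (Countable (↑ w) g ∧̇
          (∀[ v ∊ g ] RelativelyOpen (↑² w) (↑² X) v) ∧̇
          (∀[ x ] (x ∈̇ ↑² Y ⇔ (x ∈̇ ↑² X ∧̇ (∀[ v ∊ ↑ g ] ↑ x ∈̇ v)))))

QSet : Var n → Var n → Formula n
QSet w X =
  (∀[ x ∊ X ] x ⊆̇ ↑ w) ∧̇
  ¬̇ (Countable w X) ∧̇
  (∀[ Y ] (Y ⊆̇ ↑ X ⇒ RelativelyGδ (↑ w) (↑ X) Y))

-- x splits a: |x ∩ a| = |a ∖ x| = ω.  (The condition |x ∖ a| = ω would be
-- unsatisfiable for a = ω.)
Splits : Var n → Var n → Var n → Formula n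
Splits w x a =
  (∃[ c ] (c ≐ ↑ x ∩ ↑ a ∧̇ c ≈ ↑ w)) ∧̇
  (∃[ d ] (d ≐ ↑ a ∖ ↑ x ∧̇ d ≈ ↑ w))

-- The exceptional set e = { x ∈ X : x does not split a } is countable.
StrongSplittingFamily : Var n → Var n → Formula n
StrongSplittingFamily w X =
  ∀[ a ] (∈[ω]^ω (↑ w) a ⇒
    (∃[ e ] (Countable (↑² w) e ∧̇
             (∀[ x ] (x ∈̇ ↑ e ⇔ (x ∈̇ ↑³ X ∧̇ ¬̇ (Splits (↑³ w) x (↑² a))))))))

ExistsStrongSplittingQSet : Sentence
ExistsStrongSplittingQSet =
  ∃[ w ] (Isω w ∧̇
          (∃[ X ] ((∀[ x ∊ X ] ∈[ω]^ω (↑² w) x) ∧̇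
                   QSet (↑ w) X ∧̇
                   StrongSplittingFamily (↑ w) X)))

{-# OPTIONS --safe #-}
module Submission where

-- The completeness theorem holds constructively for the fragment ⊥, ⇒, ∀ of classical
-- logic, since a maximal consistent set can be described without deciding membership.
-- So if ZFC is consistent it has a countable Tarski model V with Henkin witnesses, and
-- one can reason about V classically inside the monad ¬¬.  Over V there is a generic
-- filter for every poset, and the Tarski model N of its names satisfies ZFC.
--
-- The poset replaces the usual iteration by a single step.  Let J be a set closed under
-- pairing and containing 𝒫 H, where H is a set closed under adjunction, and call the
-- images of H small.  A condition is a finite set of atoms, which determine digits of
-- generic sets w_ξ (ξ ∈ J), put m into the n-th set c_n of a code K ⊆ J, or promise
-- that no m ∈ c_n has m , m + 1 ∈ w_ξ.  A code K lists a small set of conditions for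
-- every ξ, and is thereby a name of a subset Y of X = { w_ξ : ξ ∈ J }.  A promise is
-- allowed in a condition that contradicts all conditions listed for ξ.  Contradiction
-- is a finitary matter, so this definition is not circular even though the conditions
-- listed by K may mention K.  By genericity w_ξ ∈ Y if and only if for every n there
-- is m ∈ c_n with m , m + 1 ∈ w_ξ, which is a Gδ condition.
--
-- Every family of conditions has a small predense subfamily, so every subset of X in N
-- is given by a code, and X is not small in N.  For infinite a ⊆ ω there is a small
-- set of conditions among which every condition finds compatible ones putting large
-- elements into a; if none of them mentions ξ, the digits of w_ξ at these elements are
-- still free, so w_ξ splits a.  Finally the digits at the index J collapse H to ω,
-- whence the small exceptional set is countable.

open import Defs
open import Data.Empty using (⊥; ⊥-elim)
open import Data.Fin using (Fin; zero; suc; toℕ; fromℕ<; _↑ˡ_; _↑ʳ_)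
open import Data.Fin.Properties using (toℕ-injective; toℕ-fromℕ<; toℕ<n)
open import Data.List using (List; []; _∷_; map; _++_)
open import Data.List.Membership.Propositional using (_∈_)
open import Data.List.Membership.Propositional.Properties using (∈-map⁺; ∈-map⁻; ∈-++⁺ˡ; ∈-++⁺ʳ; ∈-++⁻)
open import Data.List.Relation.Unary.Any using (here; there)
open import Data.Nat using (ℕ; zero; suc; _+_; _∸_; _≤_; _⊔_; _⊓_; z≤n; s≤s; s≤s⁻¹; _≤′_; ≤′-reflexive; ≤′-step)
import Data.Nat.Properties as ℕ
open import Data.Product using (Σ; _×_; _,_; proj₁; proj₂)
open import Data.Sum using (_⊎_; inj₁; inj₂)
open import Data.Unit using (⊤; tt)
open import Data.Vec using (Vec; lookup)
  renaming ([] to ⟨⟩; _∷_ to _◂_; _++_ to _+++_)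
import Data.Vec.Functional as V
open import Data.Vec.Properties using (lookup-++ˡ; lookup-++ʳ)
open import Function using (_∘_; id; case_of_)
open import Relation.Binary.PropositionalEquality using (_≡_; refl; sym; trans; cong; cong₂; subst)
open import Relation.Nullary using (¬_)

-- The promises speak of two consecutive numbers because of splitting. Were w_ξ only kept disjoint
-- from c_n, then for a Y with uncountable complement in X some infinite c_n would be disjoint from
-- uncountably many members of X, none of which splits it. With the pattern m , m + 1 a digit may
-- take any value as long as the digits beside it are undecided. Smallness is measured by H rather
-- than by ω because H is closed under pairing and adjunction: products, finite subsets and small
-- unions of small sets are enumerated directly by codes in H. The price is that small sets may be
-- uncountable in V, which the collapse repairs in N. Set theory is done in a language whose terms
-- denote actual elements of the model, and this rests on Henkin witnesses. None are at hand for N.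
-- Therefore N is only shown to satisfy a sentence free of topology and bijections, and the theorem
-- is derived from that sentence in a second Henkin model, of ZFC together with the sentence.

private
  variable
    k m n : ℕ
    A B : Set

-- Double negation and renaming

infixl 5 _>>=_
infix 3 ¬¬_

¬¬_ : Set → Set
¬¬ A = ¬ ¬ A

return : A → ¬¬ A
return a f = f a

_>>=_ : ¬¬ A → (A → ¬¬ B) → ¬¬ B
(x >>= f) h = x λ a → f a h

em : (A : Set) → ¬¬ (A ⊎ ¬ A)
em A h = h (inj₂ λ a → h (inj₁ a))

-- This is what `sat` makes of a conjunction, since `_∧̇_` is defined from `_⇒_` and `⊥̇`.
∧-in : A → B → ¬ (A → ¬ B)
∧-in a b h = h a b

∧-out : ¬ (A → ¬ B) → ¬¬ (A × B)
∧-out h f = h λ a b → f (a , b)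

ren-ren : (g : Fin k → Fin n) (f : Fin m → Fin k) (h : Fin m → Fin n) →
          (∀ i → g (f i) ≡ h i) → ∀ φ → ren g (ren f φ) ≡ ren h φ
ren-ren g f h e (x ∈̇ y) = cong₂ _∈̇_ (e x) (e y)
ren-ren g f h e (x ≐ y) = cong₂ _≐_ (e x) (e y)
ren-ren g f h e ⊥̇       = refl
ren-ren g f h e (φ ⇒ ψ) = cong₂ _⇒_ (ren-ren g f h e φ) (ren-ren g f h e ψ)
ren-ren g f h e (∀̇ φ)   = cong ∀̇ (ren-ren (lift g) (lift f) (lift h)
  (λ { zero → refl ; (suc i) → cong suc (e i) }) φ)

ren-id : (f : Fin n → Fin n) → (∀ i → f i ≡ i) → ∀ φ → ren f φ ≡ φ
ren-id f e (x ∈̇ y) = cong₂ _∈̇_ (e x) (e y)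
ren-id f e (x ≐ y) = cong₂ _≐_ (e x) (e y)
ren-id f e ⊥̇       = refl
ren-id f e (φ ⇒ ψ) = cong₂ _⇒_ (ren-id f e φ) (ren-id f e ψ)
ren-id f e (∀̇ φ)   = cong ∀̇ (ren-id (lift f) (λ { zero → refl ; (suc i) → cong suc (e i) }) φ)

-- Tarski semantics

-- Equality is a congruence `Q` and not identity, because different names may denote the same set of
-- the extension. Stability of the two relations passes to every formula built from `⊥̇`, `_⇒_` and
-- `∀̇`, which is what validates `raa`.
record Structure : Set₁ where
  field
    D     : Set
    E Q   : D → D → Set
    stE   : ∀ {x y} → ¬¬ E x y → E x y
    stQ   : ∀ {x y} → ¬¬ Q x y → Q x y
    Qrefl : ∀ {x} → Q x x
    Qsym  : ∀ {x y} → Q x y → Q y x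
    Qtr   : ∀ {x y z} → Q x y → Q y z → Q x z
    congE : ∀ {x y x' y'} → Q x x' → Q y y' → E x y → E x' y'

module Semantics (𝔐 : Structure) where
  open Structure 𝔐

  sat : Formula n → Vec D n → Set
  sat (x ∈̇ y) ρ = E (lookup ρ x) (lookup ρ y)
  sat (x ≐ y) ρ = Q (lookup ρ x) (lookup ρ y)
  sat ⊥̇       ρ = ⊥
  sat (φ ⇒ ψ) ρ = sat φ ρ → sat ψ ρ
  sat (∀̇ φ)   ρ = ∀ d → sat φ (d ◂ ρ)

  st : (φ : Formula n) {ρ : Vec D n} → ¬¬ sat φ ρ → sat φ ρ
  st (x ∈̇ y) h   = stE h
  st (x ≐ y) h   = stQ h
  st ⊥̇       h   = h λ b → b
  st (φ ⇒ ψ) h a = st ψ λ f → h λ g → f (g a)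
  st (∀̇ φ)   h d = st φ λ f → h λ g → f (g d)

  sat-ren : {f : Fin m → Fin n} {ρ : Vec D n} {σ : Vec D m} →
            (∀ i → Q (lookup ρ (f i)) (lookup σ i)) → ∀ φ →
            (sat (ren f φ) ρ → sat φ σ) × (sat φ σ → sat (ren f φ) ρ)
  sat-ren e (x ∈̇ y) = congE (e x) (e y) , congE (Qsym (e x)) (Qsym (e y))
  sat-ren e (x ≐ y) = (λ q → Qtr (Qsym (e x)) (Qtr q (e y))) ,
                      (λ q → Qtr (e x) (Qtr q (Qsym (e y))))
  sat-ren e ⊥̇       = (λ b → b) , (λ b → b)
  sat-ren e (φ ⇒ ψ) = (λ h a → proj₁ (sat-ren e ψ) (h (proj₂ (sat-ren e φ) a))) ,
                      (λ h a → proj₂ (sat-ren e ψ) (h (proj₁ (sat-ren e φ) a)))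
  sat-ren {f = f} {ρ} {σ} e (∀̇ φ) =
    (λ h d → proj₁ (sat-ren (e' d) φ) (h d)) , (λ h d → proj₂ (sat-ren (e' d) φ) (h d))
    where
    e' : ∀ d i → Q (lookup (d ◂ ρ) (lift f i)) (lookup (d ◂ σ) i)
    e' d zero    = Qrefl
    e' d (suc i) = e i

  sat-cong : {ρ σ : Vec D n} → (∀ i → Q (lookup ρ i) (lookup σ i)) →
             ∀ φ → sat φ ρ → sat φ σ
  sat-cong {ρ = ρ} {σ} e φ h =
    proj₁ (sat-ren {f = id} e φ) (subst (λ ψ → sat ψ ρ) (sym (ren-id id (λ _ → refl) φ)) h)

  closure-sat : ∀ n (φ : Formula n) →
                (sat (closure φ) ⟨⟩ → ∀ ρ → sat φ ρ) × ((∀ ρ → sat φ ρ) → sat (closure φ) ⟨⟩)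
  closure-sat zero φ = (λ { h ⟨⟩ → h }) , (λ h → h ⟨⟩)
  closure-sat (suc n) φ with closure-sat n (∀̇ φ)
  ... | f , g = (λ { h (d ◂ ρ) → f h ρ d }) , (λ h → g λ ρ d → h (d ◂ ρ))

  Models : Theory → Set
  Models T = ∀ φ → T φ → sat φ ⟨⟩

  soundness : ∀ {T} → Models T → {Γ : List (Formula n)} {φ : Formula n} →
              T ∣ Γ ⊢ φ → ∀ ρ → (∀ ψ → ψ ∈ Γ → sat ψ ρ) → sat φ ρ
  soundness M (axiom {φ} t) ρ h = proj₂ (sat-ren (λ ()) φ) (M φ t)
  soundness M (hyp i) ρ h = h _ i
  soundness M (⇒I d) ρ h a = soundness M d ρ λ { ψ (here refl) → a ; ψ (there i) → h ψ i }
  soundness M (⇒E d e) ρ h = soundness M d ρ h (soundness M e ρ h)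
  soundness M (raa {φ} d) ρ h = st φ λ na → soundness M d ρ λ { ψ (here refl) → na ; ψ (there i) → h ψ i }
  soundness M {Γ} (∀I d) ρ h x = soundness M d (x ◂ ρ) λ ψ i → case ∈-map⁻ (ren ↑_) i of
    λ { (χ , j , refl) → proj₂ (sat-ren (λ _ → Qrefl) χ) (h χ j) }
  soundness M (∀E {φ} d x) ρ h =
    proj₂ (sat-ren (λ { zero → Qrefl ; (suc i) → Qrefl }) φ) (soundness M d ρ h (lookup ρ x))
  soundness M ≐I ρ h = Qrefl
  soundness M (≐E {x} {y} φ d e) ρ h =
    proj₂ (sat-ren {σ = lookup ρ x ◂ ρ} (λ { zero → Qsym (soundness M d ρ h) ; (suc i) → Qrefl }) φ)
      (proj₁ (sat-ren {σ = lookup ρ x ◂ ρ} (λ { zero → Qrefl ; (suc i) → Qrefl }) φ) (soundness M e ρ h))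

  models⇒consistent : ∀ {T} → Models T → Consistent T
  models⇒consistent M d = soundness M d ⟨⟩ λ _ ()

-- Weakening and renaming of derivations

weaken : ∀ {T} {Γ Δ : List (Formula n)} {φ} → (∀ {ψ} → ψ ∈ Γ → ψ ∈ Δ) → T ∣ Γ ⊢ φ → T ∣ Δ ⊢ φ
weaken s (axiom t) = axiom t
weaken s (hyp i) = hyp (s i)
weaken s (⇒I d) = ⇒I (weaken (λ { (here e) → here e ; (there i) → there (s i) }) d)
weaken s (⇒E d e) = ⇒E (weaken s d) (weaken s e)
weaken s (raa d) = raa (weaken (λ { (here e) → here e ; (there i) → there (s i) }) d)
weaken s (∀I d) = ∀I (weaken (λ i → case ∈-map⁻ (ren ↑_) i of λ { (χ , j , refl) → ∈-map⁺ (ren ↑_) (s j) }) d)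
weaken s (∀E d x) = ∀E (weaken s d) x
weaken s ≐I = ≐I
weaken s (≐E φ d e) = ≐E φ (weaken s d) (weaken s e)

ren-[] : (f : Fin m → Fin n) (φ : Formula (suc m)) (x : Fin m) → ren f (φ [ x ]) ≡ ren (lift f) φ [ f x ]
ren-[] f φ x = trans (ren-ren f (x V.∷ id) (f x V.∷ f) (λ { zero → refl ; (suc i) → refl }) φ)
  (sym (ren-ren (f x V.∷ id) (lift f) (f x V.∷ f) (λ { zero → refl ; (suc i) → refl }) φ))

rename : ∀ {T} (f : Fin m → Fin n) {Γ : List (Formula m)} {Δ : List (Formula n)} {φ} →
         (∀ {ψ} → ψ ∈ Γ → ren f ψ ∈ Δ) → T ∣ Γ ⊢ φ → T ∣ Δ ⊢ ren f φ
rename {T = T} f {Δ = Δ} s (axiom {φ} t) =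
  subst (T ∣ Δ ⊢_) (sym (ren-ren f (λ ()) (λ ()) (λ ()) φ)) (axiom t)
rename f s (hyp i) = hyp (s i)
rename f s (⇒I d) = ⇒I (rename f (λ { (here refl) → here refl ; (there i) → there (s i) }) d)
rename f s (⇒E d e) = ⇒E (rename f s d) (rename f s e)
rename f s (raa d) = raa (rename f (λ { (here refl) → here refl ; (there i) → there (s i) }) d)
rename f {Δ = Δ} s (∀I {φ} d) = ∀I (rename (lift f) (λ i → case ∈-map⁻ (ren ↑_) i of
  λ { (χ , j , refl) → subst (_∈ map (ren ↑_) Δ)
        (trans (ren-ren ↑_ f (suc ∘ f) (λ _ → refl) χ) (sym (ren-ren (lift f) ↑_ (suc ∘ f) (λ _ → refl) χ)))
        (∈-map⁺ (ren ↑_) (s j)) }) d)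
rename {T = T} f {Δ = Δ} s (∀E {φ} d x) =
  subst (T ∣ Δ ⊢_) (sym (ren-[] f φ x)) (∀E (rename f s d) (f x))
rename f s ≐I = ≐I
rename {T = T} f {Δ = Δ} s (≐E {x} {y} φ d e) =
  subst (T ∣ Δ ⊢_) (sym (ren-[] f φ y)) (≐E (ren (lift f) φ) (rename f s d)
    (subst (T ∣ Δ ⊢_) (ren-[] f φ x) (rename f s e)))

infix 2 _↔_
_↔_ : Set → Set → Set
A ↔ B = (A → B) × (B → A)

ex-out : {P : A → Set} → ¬ (∀ x → ¬ P x) → ¬¬ Σ A P
ex-out h f = h λ x p → f (x , p)

ex-in : {P : A → Set} → ¬¬ Σ A P → ¬ (∀ x → ¬ P x)
ex-in h f = h λ (x , p) → f x p

iff-out : (¬¬ A → A) → (¬¬ B → B) → ¬ ((A → B) → ¬ (B → A)) → A ↔ B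
iff-out sa sb h = (λ a → sb λ nb → h λ f g → nb (f a)) , (λ b → sa λ na → h λ f g → na (g b))

iff-in : A ↔ B → ¬ ((A → B) → ¬ (B → A))
iff-in (f , g) h = h f g

-- An extension of the language by class abstracts and definable functions

infix  8 _ϵᶠ_ _≃ᶠ_
infix  7 negᶠ_
infixr 6 _&_
infixr 5 _or_
infixr 4 _⊃_
infix  9 _⟨_⟩ _⟪_⟫

data Tm (n : ℕ) : Set
data Fm (n : ℕ) : Set

-- Substitution is a constructor, `_⟨_⟩` for terms and `_⟪_⟫` for formulas, so that a definition
-- applied to arguments evaluates by computation to its meaning at the values of the arguments.
data Tm n where
  v    : Fin n → Tm n
  ⁅_⁆  : Fm (suc n) → Tm n
  _⟨_⟩ : Tm k → Vec (Tm n) k → Tm n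

data Fm n where
  _ϵᶠ_ _≃ᶠ_ : Tm n → Tm n → Fm n
  ⊥ᶠ        : Fm n
  _⊃_ _&_ _or_ : Fm n → Fm n → Fm n
  All Ex    : Fm (suc n) → Fm n
  _⟪_⟫      : Fm k → Vec (Tm n) k → Fm n

negᶠ_ : Fm n → Fm n
negᶠ φ = φ ⊃ ⊥ᶠ

vars : (Fin k → Fin n) → Vec (Tm n) k
vars {zero}  f = ⟨⟩
vars {suc k} f = v (f zero) ◂ vars (f ∘ suc)

v0 : Tm (1 + n)
v0 = v zero
v1 : Tm (2 + n)
v1 = v (suc zero)
v2 : Tm (3 + n)
v2 = v (suc (suc zero))
v3 : Tm (4 + n)
v3 = v (suc (suc (suc zero)))
v4 : Tm (5 + n)
v4 = v (suc (suc (suc (suc zero))))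
v5 : Tm (6 + n)
v5 = v (suc (suc (suc (suc (suc zero)))))
v6 : Tm (7 + n)
v6 = v (suc (suc (suc (suc (suc (suc zero))))))
v7 : Tm (8 + n)
v7 = v (suc (suc (suc (suc (suc (suc (suc zero)))))))
v8 : Tm (9 + n)
v8 = v (suc (suc (suc (suc (suc (suc (suc (suc zero))))))))

-- gr t is the graph of t, with the value as variable 0; an abstract that does
-- not define a set denotes ∅.

gr   : Tm n → Formula (suc n)
tr   : Fm n → Formula n
grs  : Vec (Tm n) k → Vec (Formula (suc n)) k

-- Terms inside a formula are eliminated by quantifying over their values, which become the
-- innermost k variables of φ.
bind : (Fin n → Fin m) → Vec (Formula (suc n)) k → Formula (k + m) → Formula m
bind f ⟨⟩ φ = φ
bind {k = suc k} f (γ ◂ γs) φ = bind f γs (∃̇ (ren (zero V.∷ (λ i → suc (k ↑ʳ f i))) γ ∧̇ φ))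

abs : Formula (suc n) → Formula (suc n)
abs φ = ∀̇ (zero ∈̇ suc zero ⇔ ren (zero V.∷ ↑²_) φ)

gr (v i) = zero ≐ suc i
gr ⁅ φ ⁆ = abs (tr φ) ∨̇ (¬̇ (∃̇ (ren (zero V.∷ ↑²_) (abs (tr φ)))) ∧̇ zero ≐∅)
gr {n} (_⟨_⟩ {k} t us) = bind suc (grs us) (ren ((k ↑ʳ zero) V.∷ (_↑ˡ suc n)) (gr t))

tr (t ϵᶠ u) = bind id (gr t ◂ gr u ◂ ⟨⟩) (zero ∈̇ suc zero)
tr (t ≃ᶠ u) = bind id (gr t ◂ gr u ◂ ⟨⟩) (zero ≐ suc zero)
tr ⊥ᶠ       = ⊥̇
tr (φ ⊃ ψ)  = tr φ ⇒ tr ψ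
tr (φ & ψ)  = tr φ ∧̇ tr ψ
tr (φ or ψ) = tr φ ∨̇ tr ψ
tr (All φ)  = ∀̇ (tr φ)
tr (Ex φ)   = ∃̇ (tr φ)
tr {n} (φ ⟪ us ⟫) = bind id (grs us) (ren (_↑ˡ n) (tr φ))

grs ⟨⟩       = ⟨⟩
grs (u ◂ us) = gr u ◂ grs us

or-out : (¬¬ B → B) → ((¬ A → B) ↔ (¬¬ (A ⊎ B)))
or-out {B = B} {A = A} sb = (λ h f → em A λ { (inj₁ a) → f (inj₁ a) ; (inj₂ na) → f (inj₂ (h na)) }) ,
            (λ h na → sb λ nb → h λ { (inj₁ a) → na a ; (inj₂ b) → nb b })

-- Kuratowski pairs in an arbitrary structure

-- Stated for any structure with unordered pairs because it is used twice: in V with sets, and in N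
-- with names of pairs.
module Kuratowski (𝔐 : Structure) (upair : Structure.D 𝔐 → Structure.D 𝔐 → Structure.D 𝔐)
  (upair-spec : ∀ x y w → Structure.E 𝔐 w (upair x y) ↔ (¬¬ (Structure.Q 𝔐 w x ⊎ Structure.Q 𝔐 w y)))
  (ext' : ∀ x y → (∀ z → Structure.E 𝔐 z x ↔ Structure.E 𝔐 z y) → Structure.Q 𝔐 x y) where
  open Structure 𝔐
  open Semantics 𝔐

  opair : D → D → D
  opair x y = upair (upair x x) (upair x y)

  private
    ˡ : ∀ {x y} → E x (upair x y)
    ˡ = proj₂ (upair-spec _ _ _) (return (inj₁ Qrefl))

    ʳ : ∀ {x y} → E y (upair x y)
    ʳ = proj₂ (upair-spec _ _ _) (return (inj₂ Qrefl))

    ϵʳ : ∀ {x y z} → Q y z → E x y → E x z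
    ϵʳ = congE Qrefl

    sing-upair : ∀ {x y z} → Q (upair x x) (upair y z) → Q x y × Q x z
    sing-upair {x} q = lem (ϵʳ (Qsym q) ˡ) , lem (ϵʳ (Qsym q) ʳ)
      where
      lem : ∀ {y} → E y (upair x x) → Q x y
      lem i = stQ (proj₁ (upair-spec _ _ _) i >>= λ { (inj₁ p) → return (Qsym p) ; (inj₂ p) → return (Qsym p) })

  upair-cong : ∀ {x y x' y'} → Q x x' → Q y y' → Q (upair x y) (upair x' y')
  upair-cong p q = ext' _ _ λ z →
    (λ i → proj₂ (upair-spec _ _ _) (proj₁ (upair-spec _ _ _) i >>= λ { (inj₁ e) → return (inj₁ (Qtr e p)) ; (inj₂ e) → return (inj₂ (Qtr e q)) })) ,
    (λ i → proj₂ (upair-spec _ _ _) (proj₁ (upair-spec _ _ _) i >>= λ { (inj₁ e) → return (inj₁ (Qtr e (Qsym p))) ; (inj₂ e) → return (inj₂ (Qtr e (Qsym q))) }))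

  opair-cong : ∀ {x y x' y'} → Q x x' → Q y y' → Q (opair x y) (opair x' y')
  opair-cong p q = upair-cong (upair-cong p p) (upair-cong p q)

  opair-inj₁ : ∀ {x y x' y'} → Q (opair x y) (opair x' y') → Q x x'
  opair-inj₁ q = stQ (proj₁ (upair-spec _ _ _) (ϵʳ q ˡ) >>= λ { (inj₁ p) → return (proj₁ (sing-upair p)) ; (inj₂ p) → return (proj₁ (sing-upair p)) })

  opair-inj₂ : ∀ {x y x' y'} → Q (opair x y) (opair x' y') → Q y y'
  opair-inj₂ {x} {y} {x'} {y'} q = stQ (proj₁ (upair-spec _ _ _) (ϵʳ q ʳ) >>= λ
    { (inj₂ p) → lem p
    ; (inj₁ p) → do
        let y≃x' = Qsym (proj₂ (sing-upair (Qsym p)))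
            x≃x' = Qsym (proj₁ (sing-upair (Qsym p)))
        inj₁ r ← proj₁ (upair-spec _ _ _) (ϵʳ (Qsym q) ʳ)
          where inj₂ r → lem (Qsym r)
        return (Qtr y≃x' (proj₂ (sing-upair (Qsym (Qtr r (upair-cong x≃x' x≃x'))))))})
    where
    lem : Q (upair x y) (upair x' y') → ¬¬ (Q y y')
    lem p = do
      inj₁ r ← proj₁ (upair-spec _ _ _) (ϵʳ p ʳ)
        where inj₂ r → return r
      inj₁ s ← proj₁ (upair-spec _ _ _) (ϵʳ (Qsym p) ʳ)
        where inj₂ s → return (Qsym s)
      return (Qtr r (Qtr (Qsym (opair-inj₁ q)) (Qsym s)))

  sat-upair : (p x y : Fin n) (ρ : Vec D n) → sat (p ≐｛ x , y ｝) ρ ↔ Q (lookup ρ p) (upair (lookup ρ x) (lookup ρ y))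
  sat-upair p x y ρ =
    (λ h → ext' _ _ λ z → let f , g = iff-out stE (λ k na → stQ λ nb → k λ j → nb (j na)) (h z) in
      (λ i → proj₂ (upair-spec _ _ _) (proj₁ (or-out stQ) (f i))) , (λ i → g (proj₂ (or-out stQ) (proj₁ (upair-spec _ _ _) i)))) ,
    (λ q z → iff-in ((λ i → proj₂ (or-out stQ) (proj₁ (upair-spec _ _ _) (ϵʳ q i))) ,
                     (λ i → ϵʳ (Qsym q) (proj₂ (upair-spec _ _ _) (proj₁ (or-out stQ) i)))))

  sat-opair : (p x y : Fin n) (ρ : Vec D n) → sat (p ≐⟨ x , y ⟩) ρ ↔ Q (lookup ρ p) (opair (lookup ρ x) (lookup ρ y))
  sat-opair p x y ρ =
    (λ h → stQ do
      s , h ← ex-out h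
      d , h ← ex-out h
      a , h ← ∧-out h
      b , c ← ∧-out h
      return (Qtr (proj₁ (sat-upair (↑² p) (suc zero) zero (d ◂ s ◂ ρ)) c)
        (upair-cong (proj₁ (sat-upair (suc zero) (↑² x) (↑² x) (d ◂ s ◂ ρ)) a) (proj₁ (sat-upair zero (↑² x) (↑² y) (d ◂ s ◂ ρ)) b)))) ,
    (λ q → let s = upair (lookup ρ x) (lookup ρ x) ; d = upair (lookup ρ x) (lookup ρ y) in
      λ k → k s λ k → k d (∧-in (proj₂ (sat-upair (suc zero) (↑² x) (↑² x) (d ◂ s ◂ ρ)) Qrefl)
        (∧-in (proj₂ (sat-upair zero (↑² x) (↑² y) (d ◂ s ◂ ρ)) Qrefl) (proj₂ (sat-upair (↑² p) (suc zero) zero (d ◂ s ◂ ρ)) q))))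

  sat-∈ : (x y f : Fin n) (ρ : Vec D n) → sat (⟨ x , y ⟩∈ f) ρ ↔ E (opair (lookup ρ x) (lookup ρ y)) (lookup ρ f)
  sat-∈ x y f ρ =
    (λ h → stE do
      p , h ← ex-out h
      a , b ← ∧-out h
      return (congE (proj₁ (sat-opair zero (↑ x) (↑ y) (p ◂ ρ)) b) Qrefl a)) ,
    (λ i k → k (opair (lookup ρ x) (lookup ρ y)) (∧-in i (proj₂ (sat-opair zero (↑ x) (↑ y) (_ ◂ ρ)) Qrefl)))

-- `choose` turns an existence known only under ¬¬ into an element of `D`; class abstracts and the
-- steps of the generic sequence are obtained from it. `elem` lets that sequence meet every dense
-- set of the model.
record ZFCModel : Set₁ where
  field
    𝔐 : Structure
  open Structure 𝔐 public
  open Semantics 𝔐 public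
  field
    choose    : ∀ {k} (φ : Formula (suc k)) (ρ : Vec D k) → Σ D λ c → ∀ d → sat φ (d ◂ ρ) → sat φ (c ◂ ρ)
    elem      : ℕ → D
    elem-surj : ∀ d → Σ ℕ λ n → elem n ≡ d
    zfc       : Models ZFC

-- The extended language in a model of ZFC

module Universe (𝔙 : ZFCModel) where
  open ZFCModel 𝔙 public

  infix 4 _ϵ_ _≃_
  _ϵ_ _≃_ : D → D → Set
  _ϵ_ = E
  _≃_ = Q

  ≃ext : ∀ {x y} → (∀ z → z ϵ x ↔ z ϵ y) → x ≃ y
  ≃ext {x} {y} h = zfc _ ext x y λ z → iff-in (h z)

  ≡⇒≃ : ∀ {x y} → x ≡ y → x ≃ y
  ≡⇒≃ refl = Qrefl

  ϵʳ : ∀ {x y z} → y ≃ z → x ϵ y → x ϵ z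
  ϵʳ = congE Qrefl

  ϵˡ : ∀ {x y z} → x ≃ y → x ϵ z → y ϵ z
  ϵˡ q = congE q Qrefl

  sep-base : (φ : Formula (suc n)) (ρ : Vec D n) (a : D) →
             ¬¬ Σ D λ b → ∀ x → x ϵ b ↔ (x ϵ a × sat φ (x ◂ ρ))
  sep-base {n} φ ρ a = do
    b , h ← ex-out (proj₁ (closure-sat n _) (zfc _ (sep φ)) ρ a)
    return (b , λ x → case iff-out stE (st (zero ∈̇ suc (suc zero) ∧̇ ren (zero V.∷ ↑³_) φ)) (h x) of λ (f , g) →
      (λ i → stE (λ k → ∧-out (f i) λ (p , _) → k p) ,
             st φ (λ k → ∧-out (f i) λ (_ , p) → k (proj₁ (e b x) p))) ,
      (λ (i , p) → g (∧-in i (proj₂ (e b x) p))))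
    where
    e : ∀ b x → sat (ren (zero V.∷ ↑³_) φ) (x ◂ b ◂ a ◂ ρ) ↔ sat φ (x ◂ ρ)
    e b x = sat-ren (λ { zero → Qrefl ; (suc i) → Qrefl }) φ

  empty-base : ¬¬ Σ D λ b → ∀ x → ¬ (x ϵ b)
  empty-base = do
    i , _ ← ex-out (zfc _ inf)
    b , h ← sep-base {0} ⊥̇ ⟨⟩ i
    return (b , λ x p → proj₂ (proj₁ (h x) p))

  abstract
    cls : Fm (suc n) → Vec D n → D
    cls φ ρ = proj₁ (choose (gr ⁅ φ ⁆) ρ)

  ⟦_⟧  : Tm n → Vec D n → D
  ⟦_⟧* : Vec (Tm n) k → Vec D n → Vec D k
  ⟦ v i ⟧ ρ      = lookup ρ i
  ⟦ ⁅ φ ⁆ ⟧ ρ    = cls φ ρ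
  ⟦ t ⟨ us ⟩ ⟧ ρ = ⟦ t ⟧ (⟦ us ⟧* ρ)
  ⟦ ⟨⟩ ⟧* ρ     = ⟨⟩
  ⟦ u ◂ us ⟧* ρ = ⟦ u ⟧ ρ ◂ ⟦ us ⟧* ρ

  S : Fm n → Vec D n → Set
  S (t ϵᶠ u) ρ = ⟦ t ⟧ ρ ϵ ⟦ u ⟧ ρ
  S (t ≃ᶠ u) ρ = ⟦ t ⟧ ρ ≃ ⟦ u ⟧ ρ
  S ⊥ᶠ       ρ = ⊥
  S (φ ⊃ ψ)  ρ = S φ ρ → S ψ ρ
  S (φ & ψ)  ρ = S φ ρ × S ψ ρ
  S (φ or ψ) ρ = ¬¬ (S φ ρ ⊎ S ψ ρ)
  S (All φ)  ρ = ∀ x → S φ (x ◂ ρ)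
  S (Ex φ)   ρ = ¬¬ Σ D λ x → S φ (x ◂ ρ)
  S (φ ⟪ us ⟫) ρ = S φ (⟦ us ⟧* ρ)

  stS : (φ : Fm n) {ρ : Vec D n} → ¬¬ S φ ρ → S φ ρ
  stS (t ϵᶠ u) h   = stE h
  stS (t ≃ᶠ u) h   = stQ h
  stS ⊥ᶠ       h   = h λ b → b
  stS (φ ⊃ ψ)  h a = stS ψ λ f → h λ g → f (g a)
  stS (φ & ψ)  h   = stS φ (λ f → h λ g → f (proj₁ g)) , stS ψ (λ f → h λ g → f (proj₂ g))
  stS (φ or ψ) h f = h λ g → g f
  stS (All φ)  h x = stS φ λ f → h λ g → f (g x)
  stS (Ex φ)   h f = h λ g → g f
  stS (φ ⟪ us ⟫) h = stS φ h

  abs-ok : (φ : Fm (suc n)) (ρ : Vec D n) (y : D) → (∀ w → sat (tr φ) (w ◂ ρ) ↔ S φ (w ◂ ρ)) →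
           sat (abs (tr φ)) (y ◂ ρ) ↔ (∀ w → w ϵ y ↔ S φ (w ◂ ρ))
  abs-ok φ ρ y ih =
    (λ h w → case iff-out stE (st (ren (zero V.∷ ↑²_) (tr φ))) (h w) of λ (f , g) →
       (λ i → proj₁ (ih w) (proj₁ (e w) (f i))) , (λ s → g (proj₂ (e w) (proj₂ (ih w) s)))) ,
    (λ h w → iff-in ((λ i → proj₂ (e w) (proj₂ (ih w) (proj₁ (h w) i))) ,
                     (λ s → proj₂ (h w) (proj₁ (ih w) (proj₁ (e w) s)))))
    where
    e : ∀ w → sat (ren (zero V.∷ ↑²_) (tr φ)) (w ◂ y ◂ ρ) ↔ sat (tr φ) (w ◂ ρ)
    e w = sat-ren (λ { zero → Qrefl ; (suc i) → Qrefl }) (tr φ)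

  isSet : Fm (suc n) → Vec D n → Set
  isSet φ ρ = ¬¬ Σ D λ b → ∀ w → w ϵ b ↔ S φ (w ◂ ρ)

  module Abstract {n} (φ : Fm (suc n)) (ρ : Vec D n) (ih : ∀ w → sat (tr φ) (w ◂ ρ) ↔ S φ (w ◂ ρ)) where
    private
      e : ∀ y z → sat (ren (zero V.∷ ↑²_) (abs (tr φ))) (z ◂ y ◂ ρ) ↔ sat (abs (tr φ)) (z ◂ ρ)
      e y z = sat-ren {ρ = z ◂ y ◂ ρ} {σ = z ◂ ρ} (λ { zero → Qrefl ; (suc i) → Qrefl }) (abs (tr φ))

    gr-case : ∀ y → sat (gr ⁅ φ ⁆) (y ◂ ρ) → ¬¬ ((∀ w → w ϵ y ↔ S φ (w ◂ ρ)) ⊎ (¬ isSet φ ρ × (∀ w → ¬ (w ϵ y))))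
    gr-case y g f = em (sat (abs (tr φ)) (y ◂ ρ)) λ
      { (inj₁ a) → f (inj₁ (proj₁ (abs-ok φ ρ y ih) a))
      ; (inj₂ na) → ∧-out (g na) λ (p , q) → f (inj₂ ((λ s → s λ (b , h) → p λ k → k b (proj₂ (e y b) (proj₂ (abs-ok φ ρ b ih) h))) , q)) }

    gr-set : ∀ y → (∀ w → w ϵ y ↔ S φ (w ◂ ρ)) → sat (gr ⁅ φ ⁆) (y ◂ ρ)
    gr-set y h na = ⊥-elim (na (proj₂ (abs-ok φ ρ y ih) h))

    gr-empty : ∀ y → ¬ isSet φ ρ → (∀ w → ¬ (w ϵ y)) → sat (gr ⁅ φ ⁆) (y ◂ ρ)
    gr-empty y ns em na = ∧-in (λ s → s λ b h → ns (return (b , proj₁ (abs-ok φ ρ b ih) (proj₁ (e y b) h)))) em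

    gr-exists : ¬¬ Σ D λ y → sat (gr ⁅ φ ⁆) (y ◂ ρ)
    gr-exists = do
      inj₁ s ← em (isSet φ ρ)
        where inj₂ ns → do b , h ← empty-base
                           return (b , gr-empty b ns h)
      b , h ← s
      return (b , gr-set b h)

    gr-unique : ∀ y z → sat (gr ⁅ φ ⁆) (y ◂ ρ) → sat (gr ⁅ φ ⁆) (z ◂ ρ) → y ≃ z
    gr-unique y z g g' = stQ do
      c  ← gr-case y g
      c' ← gr-case z g'
      return (case c , c' of λ
        { (inj₁ h , inj₁ h') → ≃ext λ w → (λ i → proj₂ (h' w) (proj₁ (h w) i)) , (λ i → proj₂ (h w) (proj₁ (h' w) i))
        ; (inj₁ h , inj₂ (ns , _)) → ⊥-elim (ns (return (y , h)))
        ; (inj₂ (ns , _) , inj₁ h) → ⊥-elim (ns (return (z , h)))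
        ; (inj₂ (_ , p) , inj₂ (_ , q)) → ≃ext λ w → (λ i → ⊥-elim (p w i)) , (λ i → ⊥-elim (q w i)) })

  abstract
    gr-cls : (φ : Fm (suc n)) (ρ : Vec D n) → (∀ w → sat (tr φ) (w ◂ ρ) ↔ S φ (w ◂ ρ)) →
             sat (gr ⁅ φ ⁆) (cls φ ρ ◂ ρ)
    gr-cls φ ρ ih = st (gr ⁅ φ ⁆) do
      y , g ← Abstract.gr-exists φ ρ ih
      return (proj₂ (choose (gr ⁅ φ ⁆) ρ) y g)

  bind-ok : (f : Fin n → Fin m) (γs : Vec (Formula (suc n)) k) (ds : Vec D k) (φ : Formula (k + m))
            (ρ : Vec D m) (σ : Vec D n) → (∀ i → lookup ρ (f i) ≃ lookup σ i) →
            (∀ i y → sat (lookup γs i) (y ◂ σ) ↔ (y ≃ lookup ds i)) → sat (bind f γs φ) ρ ↔ sat φ (ds +++ ρ)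
  bind-ok f ⟨⟩ ⟨⟩ φ ρ σ e g = id , id
  bind-ok {k = suc k} f (γ ◂ γs) (d ◂ ds) φ ρ σ e g =
    (λ h → st φ λ kk → proj₁ b h λ x a → ∧-out a λ (g' , p) →
       kk (sat-cong (λ { zero → proj₁ (g zero x) (proj₁ (r x) g') ; (suc i) → Qrefl }) φ p)) ,
    (λ h → proj₂ b λ f → f d (∧-in (proj₂ (r d) (proj₂ (g zero d) Qrefl)) h))
    where
    f' : Fin (suc _) → Fin (suc (k + _))
    f' = zero V.∷ (λ i → suc (k ↑ʳ f i))
    b = bind-ok f γs ds (∃̇ (ren f' γ ∧̇ φ)) ρ σ e (g ∘ suc)
    r : ∀ x → sat (ren f' γ) (x ◂ (ds +++ ρ)) ↔ sat γ (x ◂ σ)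
    r x = sat-ren (λ { zero → Qrefl ; (suc i) → Qtr (≡⇒≃ (lookup-++ʳ ds ρ (f i))) (e i) }) γ

  tr-ok : (φ : Fm n) (ρ : Vec D n) → sat (tr φ) ρ ↔ S φ ρ
  gr-ok : (t : Tm n) (ρ : Vec D n) (y : D) → sat (gr t) (y ◂ ρ) ↔ (y ≃ ⟦ t ⟧ ρ)
  grs-ok : (us : Vec (Tm n) k) (ρ : Vec D n) (i : Fin k) (y : D) →
           sat (lookup (grs us) i) (y ◂ ρ) ↔ (y ≃ lookup (⟦ us ⟧* ρ) i)

  tr-ok (t ϵᶠ u) ρ = bind-ok id (gr t ◂ gr u ◂ ⟨⟩) (⟦ t ⟧ ρ ◂ ⟦ u ⟧ ρ ◂ ⟨⟩) (zero ∈̇ suc zero) ρ ρ (λ _ → Qrefl)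
    λ { zero → gr-ok t ρ ; (suc zero) → gr-ok u ρ }
  tr-ok (t ≃ᶠ u) ρ = bind-ok id (gr t ◂ gr u ◂ ⟨⟩) (⟦ t ⟧ ρ ◂ ⟦ u ⟧ ρ ◂ ⟨⟩) (zero ≐ suc zero) ρ ρ (λ _ → Qrefl)
    λ { zero → gr-ok t ρ ; (suc zero) → gr-ok u ρ }
  tr-ok ⊥ᶠ       ρ = id , id
  tr-ok (φ ⊃ ψ)  ρ = (λ h a → proj₁ (tr-ok ψ ρ) (h (proj₂ (tr-ok φ ρ) a))) ,
                     (λ h a → proj₂ (tr-ok ψ ρ) (h (proj₁ (tr-ok φ ρ) a)))
  tr-ok (φ & ψ)  ρ = (λ h → stS φ (λ k → ∧-out h λ (a , _) → k (proj₁ (tr-ok φ ρ) a)) ,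
                            stS ψ (λ k → ∧-out h λ (_ , b) → k (proj₁ (tr-ok ψ ρ) b))) ,
                     (λ (a , b) → ∧-in (proj₂ (tr-ok φ ρ) a) (proj₂ (tr-ok ψ ρ) b))
  tr-ok (φ or ψ) ρ = (λ h f → em (sat (tr φ) ρ) λ { (inj₁ a) → f (inj₁ (proj₁ (tr-ok φ ρ) a))
                                                   ; (inj₂ na) → f (inj₂ (proj₁ (tr-ok ψ ρ) (h na))) }) ,
                     (λ h na → st (tr ψ) λ nb → h λ { (inj₁ a) → na (proj₂ (tr-ok φ ρ) a) ; (inj₂ b) → nb (proj₂ (tr-ok ψ ρ) b) })
  tr-ok (All φ)  ρ = (λ h x → proj₁ (tr-ok φ (x ◂ ρ)) (h x)) , (λ h x → proj₂ (tr-ok φ (x ◂ ρ)) (h x))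
  tr-ok (Ex φ)   ρ = (λ h f → h λ x a → f (x , proj₁ (tr-ok φ (x ◂ ρ)) a)) ,
                     (λ h f → h λ (x , a) → f x (proj₂ (tr-ok φ (x ◂ ρ)) a))
  tr-ok {n} (φ ⟪ us ⟫) ρ = (λ h → proj₁ (tr-ok φ _) (proj₁ e (proj₁ b h))) , (λ h → proj₂ b (proj₂ e (proj₂ (tr-ok φ _) h)))
    where
    b = bind-ok id (grs us) (⟦ us ⟧* ρ) (ren (_↑ˡ n) (tr φ)) ρ ρ (λ _ → Qrefl) (grs-ok us ρ)
    e : sat (ren (_↑ˡ n) (tr φ)) (⟦ us ⟧* ρ +++ ρ) ↔ sat (tr φ) (⟦ us ⟧* ρ)
    e = sat-ren (λ i → ≡⇒≃ (lookup-++ˡ (⟦ us ⟧* ρ) ρ i)) (tr φ)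

  gr-ok (v i) ρ y = id , id
  gr-ok ⁅ φ ⁆ ρ y = (λ g → Abstract.gr-unique φ ρ (λ w → tr-ok φ (w ◂ ρ)) y (cls φ ρ) g c) ,
    (λ q → sat-cong (λ { zero → Qsym q ; (suc i) → Qrefl }) (gr ⁅ φ ⁆) c)
    where c = gr-cls φ ρ (λ w → tr-ok φ (w ◂ ρ))
  gr-ok {n} (_⟨_⟩ {k} t us) ρ y = (λ h → proj₁ (gr-ok t _ y) (proj₁ e (proj₁ b h))) , (λ h → proj₂ b (proj₂ e (proj₂ (gr-ok t _ y) h)))
    where
    b = bind-ok suc (grs us) (⟦ us ⟧* ρ) (ren ((k ↑ʳ zero) V.∷ (_↑ˡ suc n)) (gr t)) (y ◂ ρ) ρ (λ _ → Qrefl) (grs-ok us ρ)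
    e : sat (ren ((k ↑ʳ zero) V.∷ (_↑ˡ suc n)) (gr t)) (⟦ us ⟧* ρ +++ (y ◂ ρ)) ↔ sat (gr t) (y ◂ ⟦ us ⟧* ρ)
    e = sat-ren (λ { zero → ≡⇒≃ (lookup-++ʳ (⟦ us ⟧* ρ) (y ◂ ρ) zero)
                   ; (suc i) → ≡⇒≃ (lookup-++ˡ (⟦ us ⟧* ρ) (y ◂ ρ) i) }) (gr t)

  grs-ok (u ◂ us) ρ zero    = gr-ok u ρ
  grs-ok (u ◂ us) ρ (suc i) = grs-ok us ρ i

  abstract
    cls-spec : {φ : Fm (suc n)} {ρ : Vec D n} → isSet φ ρ → ∀ {w} → w ϵ cls φ ρ ↔ S φ (w ◂ ρ)
    cls-spec {φ = φ} {ρ} s {w} =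
      (λ i → stS φ do
        c ← Abstract.gr-case φ ρ ih (cls φ ρ) (gr-cls φ ρ ih)
        return (case c of λ { (inj₁ h) → proj₁ (h w) i ; (inj₂ (ns , _)) → ⊥-elim (ns s) })) ,
      (λ i → stE do
        c ← Abstract.gr-case φ ρ ih (cls φ ρ) (gr-cls φ ρ ih)
        return (case c of λ { (inj₁ h) → proj₂ (h w) i ; (inj₂ (ns , _)) → ⊥-elim (ns s) }))
      where
      ih : ∀ w → sat (tr φ) (w ◂ ρ) ↔ S φ (w ◂ ρ)
      ih w = tr-ok φ (w ◂ ρ)

    -- The function `cls` picks a witness and is not visibly extensional in ρ. The translation
    -- `tr φ` is a plain formula, to which `sat-cong` applies.
    S-cong : (φ : Fm n) {ρ σ : Vec D n} → (∀ i → lookup ρ i ≃ lookup σ i) → S φ ρ → S φ σ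
    S-cong φ {ρ} {σ} e h = proj₁ (tr-ok φ σ) (sat-cong e (tr φ) (proj₂ (tr-ok φ ρ) h))

    ⟦⟧-cong : (t : Tm n) {ρ σ : Vec D n} → (∀ i → lookup ρ i ≃ lookup σ i) → ⟦ t ⟧ ρ ≃ ⟦ t ⟧ σ
    ⟦⟧-cong t {ρ} {σ} e = proj₁ (gr-ok t σ _)
      (sat-cong (λ { zero → Qrefl ; (suc i) → e i }) (gr t) (proj₂ (gr-ok t ρ (⟦ t ⟧ ρ)) Qrefl))

    bounded : {φ : Fm (suc n)} {ρ : Vec D n} (a : D) → (∀ w → S φ (w ◂ ρ) → w ϵ a) → isSet φ ρ
    bounded {φ = φ} {ρ} a h = do
      b , s ← sep-base (tr φ) ρ a
      return (b , λ w → (λ i → proj₁ (tr-ok φ _) (proj₂ (proj₁ (s w) i))) ,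
                        (λ p → proj₂ (s w) (h w p , proj₂ (tr-ok φ _) p)))

  separate : (φ : Fm (suc n)) (ρ : Vec D n) (a : D) → ¬¬ Σ D λ b → ∀ x → x ϵ b ↔ (x ϵ a × S φ (x ◂ ρ))
  separate φ ρ a = do
    b , h ← sep-base (tr φ) ρ a
    return (b , λ x → (λ i → let j , s = proj₁ (h x) i in j , proj₁ (tr-ok φ _) s) ,
                      (λ (j , s) → proj₂ (h x) (j , proj₂ (tr-ok φ _) s)))

  cls-bounded : {φ : Fm (suc n)} {ρ : Vec D n} (a : D) → (∀ w → S φ (w ◂ ρ) → w ϵ a) →
                ∀ {w} → w ϵ cls φ ρ ↔ S φ (w ◂ ρ)
  cls-bounded {φ = φ} {ρ} a h = cls-spec {φ = φ} {ρ} (bounded {φ = φ} {ρ} a h)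

  cls-bounded¬ : {φ : Fm (suc n)} {ρ : Vec D n} → ¬¬ (Σ D λ a → ∀ w → S φ (w ◂ ρ) → w ϵ a) →
                 ∀ {w} → w ϵ cls φ ρ ↔ S φ (w ◂ ρ)
  cls-bounded¬ {φ = φ} {ρ} h = cls-spec {φ = φ} {ρ} (h >>= λ (a , k) → bounded {φ = φ} {ρ} a k)

  vars-ok : (f : Fin k → Fin n) (ρ : Vec D n) (i : Fin k) → lookup (⟦ vars f ⟧* ρ) i ≃ lookup ρ (f i)
  vars-ok f ρ zero    = Qrefl
  vars-ok f ρ (suc i) = vars-ok (f ∘ suc) ρ i

  rep : (φ : Fm (suc n)) {ρ : Vec D n} {x y : D} → x ≃ y → S φ (x ◂ ρ) → S φ (y ◂ ρ)
  rep φ q = S-cong φ λ { zero → q ; (suc i) → Qrefl }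

  rept : (t : Tm (suc n)) {ρ : Vec D n} {x y : D} → x ≃ y → ⟦ t ⟧ (x ◂ ρ) ≃ ⟦ t ⟧ (y ◂ ρ)
  rept t q = ⟦⟧-cong t λ { zero → q ; (suc i) → Qrefl }

-- Basic set operations and natural numbers

∅₀ : Tm 0
∅₀ = ⁅ ⊥ᶠ ⁆
∅ᵗ : Tm n
∅ᵗ = ∅₀ ⟨ ⟨⟩ ⟩

abstract
  upφ : Fm 3
  upφ = v0 ≃ᶠ v1 or v0 ≃ᶠ v2
  ∪φ : Fm 3
  ∪φ = v0 ϵᶠ v1 or v0 ϵᶠ v2
  adjφ : Fm 3
  adjφ = v0 ϵᶠ v1 or v0 ≃ᶠ v2
  ⋃φ : Fm 2
  ⋃φ = Ex (v0 ϵᶠ v2 & v1 ϵᶠ v0)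
  𝒫φ : Fm 2
  𝒫φ = All (v0 ϵᶠ v1 ⊃ v0 ϵᶠ v2)

up₂ ∪₂ adj₂ : Tm 2
up₂ = ⁅ upφ ⁆
∪₂  = ⁅ ∪φ ⁆
adj₂ = ⁅ adjφ ⁆

⋃₁ 𝒫₁ : Tm 1
⋃₁ = ⁅ ⋃φ ⁆
𝒫₁ = ⁅ 𝒫φ ⁆

abstract
  opφ : Fm 3
  opφ = v0 ≃ᶠ up₂ ⟨ v1 ◂ v1 ◂ ⟨⟩ ⟩ or v0 ≃ᶠ up₂ ⟨ v1 ◂ v2 ◂ ⟨⟩ ⟩

op₂ : Tm 2
op₂ = ⁅ opφ ⁆

abstract
  -- Application and the projections are written as the union of all matching values, which is the
  -- value itself where it is unique.
  appφ : Fm 3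
  appφ = Ex (op₂ ⟨ v3 ◂ v0 ◂ ⟨⟩ ⟩ ϵᶠ v2 & v1 ϵᶠ v0)
  fstφ : Fm 2
  fstφ = Ex (Ex (v3 ≃ᶠ op₂ ⟨ v1 ◂ v0 ◂ ⟨⟩ ⟩ & v2 ϵᶠ v1))
  sndφ : Fm 2
  sndφ = Ex (Ex (v3 ≃ᶠ op₂ ⟨ v1 ◂ v0 ◂ ⟨⟩ ⟩ & v2 ϵᶠ v0))

app₂ : Tm 2
app₂ = ⁅ appφ ⁆

fst₁ snd₁ : Tm 1
fst₁ = ⁅ fstφ ⁆
snd₁ = ⁅ sndφ ⁆

opᵗ ∪ᵗ adjᵗ appᵗ : Tm n → Tm n → Tm n
opᵗ t u = op₂ ⟨ t ◂ u ◂ ⟨⟩ ⟩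
∪ᵗ t u = ∪₂ ⟨ t ◂ u ◂ ⟨⟩ ⟩
adjᵗ t u = adj₂ ⟨ t ◂ u ◂ ⟨⟩ ⟩
appᵗ t u = app₂ ⟨ t ◂ u ◂ ⟨⟩ ⟩

sucᵗ ⋃ᵗ 𝒫ᵗ fstᵗ sndᵗ : Tm n → Tm n
sucᵗ t = adjᵗ t t
⋃ᵗ t = ⋃₁ ⟨ t ◂ ⟨⟩ ⟩
𝒫ᵗ t = 𝒫₁ ⟨ t ◂ ⟨⟩ ⟩
fstᵗ t = fst₁ ⟨ t ◂ ⟨⟩ ⟩
sndᵗ t = snd₁ ⟨ t ◂ ⟨⟩ ⟩

sub₂ : Fm 2
sub₂ = All (v0 ϵᶠ v1 ⊃ v0 ϵᶠ v2)
infix 8 _⊆ᶠ_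
_⊆ᶠ_ : Tm n → Tm n → Fm n
t ⊆ᶠ u = sub₂ ⟪ t ◂ u ◂ ⟨⟩ ⟫

trans₁ : Fm 1
trans₁ = All (v0 ϵᶠ v1 ⊃ All (v0 ϵᶠ v1 ⊃ v0 ϵᶠ v2))

ind₁ : Fm 1
ind₁ = ∅ᵗ ϵᶠ v0 & All (v0 ϵᶠ v1 ⊃ sucᵗ v0 ϵᶠ v1)

ω₀ : Tm 0
ω₀ = ⁅ All (ind₁ ⟪ v0 ◂ ⟨⟩ ⟫ ⊃ v1 ϵᶠ v0) ⁆
ωᵗ : Tm n
ωᵗ = ω₀ ⟨ ⟨⟩ ⟩

abstract
  prodφ : Fm 3
  prodφ = Ex (Ex (v1 ϵᶠ v3 & v0 ϵᶠ v4 & v2 ≃ᶠ opᵗ v1 v0))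

prod₂ : Tm 2
prod₂ = ⁅ prodφ ⁆

module Basics (𝔙 : ZFCModel) where
  open Universe 𝔙 public

  infix 4 _⊆_
  _⊆_ : D → D → Set
  x ⊆ y = ∀ w → w ϵ x → w ϵ y

  ⊆-antisym : ∀ {x y} → x ⊆ y → y ⊆ x → x ≃ y
  ⊆-antisym p q = ≃ext λ z → p z , q z

  ≃⇒⊆ : ∀ {x y} → x ≃ y → x ⊆ y
  ≃⇒⊆ q w = ϵʳ q

  ∅ ω : D
  ∅ = ⟦ ∅₀ ⟧ ⟨⟩
  ω = ⟦ ω₀ ⟧ ⟨⟩

  ⋃ 𝒫 fst snd succ : D → D
  ⋃ x = ⟦ ⋃₁ ⟧ (x ◂ ⟨⟩)
  𝒫 x = ⟦ 𝒫₁ ⟧ (x ◂ ⟨⟩)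
  fst x = ⟦ fst₁ ⟧ (x ◂ ⟨⟩)
  snd x = ⟦ snd₁ ⟧ (x ◂ ⟨⟩)
  succ x = ⟦ adj₂ ⟧ (x ◂ x ◂ ⟨⟩)

  infixl 6 _∪_
  infixl 7 _·_
  up _∪_ adj op _·_ : D → D → D
  up x y = ⟦ up₂ ⟧ (x ◂ y ◂ ⟨⟩)
  x ∪ y = ⟦ ∪₂ ⟧ (x ◂ y ◂ ⟨⟩)
  adj x y = ⟦ adj₂ ⟧ (x ◂ y ◂ ⟨⟩)
  op x y = ⟦ op₂ ⟧ (x ◂ y ◂ ⟨⟩)
  x · y = ⟦ app₂ ⟧ (x ◂ y ◂ ⟨⟩)

  abstract
    ∅-spec : ∀ {w} → ¬ (w ϵ ∅)
    ∅-spec = proj₁ (cls-spec do b , h ← empty-base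
                                return (b , λ w → h w , λ ()))

    up-spec : ∀ {x y w} → w ϵ up x y ↔ (¬¬ (w ≃ x ⊎ w ≃ y))
    up-spec {x} {y} = cls-spec do
      b , h ← ex-out (zfc _ pair x y)
      return (b , λ w → let f , g = iff-out stE (λ k na → stQ λ nb → k λ j → nb (j na)) (h w) ; p , q = or-out stQ in
        (λ i → p (f i)) , (λ i → g (q i)))

    ⋃-spec : ∀ {x w} → w ϵ ⋃ x ↔ (¬¬ Σ D λ y → y ϵ x × w ϵ y)
    ⋃-spec {x} = cls-spec do
      b , h ← ex-out (zfc _ un x)
      return (b , λ w → let f , g = iff-out stE (λ k l → k λ j → j l) (h w) in
        (λ i → ex-out (f i) >>= λ (y , k) → ∧-out k >>= λ p → return (y , p)) ,
        (λ i → g (ex-in (i >>= λ (y , p , q) → return (y , ∧-in p q)))))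

    𝒫-spec : ∀ {x w} → w ϵ 𝒫 x ↔ w ⊆ x
    𝒫-spec {x} = cls-spec do
      b , h ← ex-out (zfc _ pow x)
      return (b , λ w → iff-out stE (λ k z i → stE λ n → k λ f → n (f z i)) (h w))

    ∪-spec : ∀ {x y w} → w ϵ x ∪ y ↔ (¬¬ (w ϵ x ⊎ w ϵ y))
    ∪-spec {x} {y} = cls-bounded (⋃ (up x y)) λ w i → proj₂ ⋃-spec do
      inj₁ p ← i
        where inj₂ p → return (y , proj₂ up-spec (return (inj₂ Qrefl)) , p)
      return (x , proj₂ up-spec (return (inj₁ Qrefl)) , p)

    adj-spec : ∀ {x y w} → w ϵ adj x y ↔ (¬¬ (w ϵ x ⊎ w ≃ y))
    adj-spec {x} {y} = cls-bounded  (x ∪ up y y) λ w i → proj₂ ∪-spec do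
      inj₁ p ← i
        where inj₂ p → return (inj₂ (proj₂ up-spec (return (inj₁ p))))
      return (inj₁ p)

  upˡ : ∀ {x y} → x ϵ up x y
  upˡ = proj₂ up-spec (return (inj₁ Qrefl))

  upʳ : ∀ {x y} → y ϵ up x y
  upʳ = proj₂ up-spec (return (inj₂ Qrefl))

  ⋃-in : ∀ {x y w} → y ϵ x → w ϵ y → w ϵ ⋃ x
  ⋃-in p q = proj₂ ⋃-spec (return (_ , p , q))

  ∪ˡ : ∀ {x y w} → w ϵ x → w ϵ x ∪ y
  ∪ˡ p = proj₂ ∪-spec (return (inj₁ p))

  ∪ʳ : ∀ {x y w} → w ϵ y → w ϵ x ∪ y
  ∪ʳ p = proj₂ ∪-spec (return (inj₂ p))

  adjˡ : ∀ {x y w} → w ϵ x → w ϵ adj x y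
  adjˡ p = proj₂ adj-spec (return (inj₁ p))

  adjʳ : ∀ {x y w} → w ≃ y → w ϵ adj x y
  adjʳ p = proj₂ adj-spec (return (inj₂ p))

  ∪-elim : ∀ {x y w} {A : Set} → w ϵ x ∪ y → (w ϵ x → ¬¬ A) → (w ϵ y → ¬¬ A) → ¬¬ A
  ∪-elim i f g = proj₁ ∪-spec i >>= λ { (inj₁ p) → f p ; (inj₂ p) → g p }

  adj-elim : ∀ {x y w} {A : Set} → w ϵ adj x y → (w ϵ x → ¬¬ A) → (w ≃ y → ¬¬ A) → ¬¬ A
  adj-elim i f g = proj₁ adj-spec i >>= λ { (inj₁ p) → f p ; (inj₂ p) → g p }

  abstract
    op-def : ∀ {x y} → op x y ≃ up (up x x) (up x y)
    op-def {x} {y} = ≃ext λ w → (λ i → proj₂ up-spec (proj₁ sp i)) , (λ i → proj₂ sp (proj₁ up-spec i))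
      where
      sp : ∀ {w} → w ϵ op x y ↔ (¬¬ (w ≃ up x x ⊎ w ≃ up x y))
      sp = cls-bounded (up (up x x) (up x y)) λ w h → proj₂ up-spec h

  opˡ : ∀ {x y} → up x x ϵ op x y
  opˡ = ϵʳ (Qsym op-def) upˡ

  opʳ : ∀ {x y} → up x y ϵ op x y
  opʳ = ϵʳ (Qsym op-def) upʳ

  module KP = Kuratowski 𝔐 up (λ _ _ _ → up-spec) (λ _ _ → ≃ext)

  op-inj₁ : ∀ {x y x' y'} → op x y ≃ op x' y' → x ≃ x'
  op-inj₁ q = KP.opair-inj₁ (Qtr (Qsym op-def) (Qtr q op-def))

  op-inj₂ : ∀ {x y x' y'} → op x y ≃ op x' y' → y ≃ y'
  op-inj₂ q = KP.opair-inj₂ (Qtr (Qsym op-def) (Qtr q op-def))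

  op-cong : ∀ {x y x' y'} → x ≃ x' → y ≃ y' → op x y ≃ op x' y'
  op-cong {x} {y} {x'} {y'} p q = ⟦⟧-cong op₂ {x ◂ y ◂ ⟨⟩} {x' ◂ y' ◂ ⟨⟩} λ { zero → p ; (suc zero) → q }

  op-⋃⋃ʳ : ∀ {x y f} → op x y ϵ f → y ϵ ⋃ (⋃ f)
  op-⋃⋃ʳ i = ⋃-in (⋃-in i opʳ) upʳ

  abstract
    app-spec : ∀ {f x w} → w ϵ f · x ↔ (¬¬ Σ D λ y → op x y ϵ f × w ϵ y)
    app-spec {f} = cls-bounded  (⋃ (⋃ (⋃ f))) λ w i → stE do
      y , p , q ← i
      return (⋃-in (op-⋃⋃ʳ p) q)

    fst-op : ∀ {x y} → fst (op x y) ≃ x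
    fst-op {x} {y} = ≃ext λ w →
      (λ i → stE do a , h ← proj₁ sp i
                    b , e , k ← h
                    return (ϵʳ (Qsym (op-inj₁ e)) k)) ,
      (λ i → proj₂ sp (return (x , return (y , Qrefl , i))))
      where
      sp : ∀ {w} → w ϵ fst (op x y) ↔ (¬¬ Σ D λ a → ¬¬ Σ D λ b → op x y ≃ op a b × w ϵ a)
      sp = cls-bounded  x λ w i → stE do
        a , h ← i
        b , e , k ← h
        return (ϵʳ (Qsym (op-inj₁ e)) k)

    snd-op : ∀ {x y} → snd (op x y) ≃ y
    snd-op {x} {y} = ≃ext λ w →
      (λ i → stE do a , h ← proj₁ sp i
                    b , e , k ← h
                    return (ϵʳ (Qsym (op-inj₂ e)) k)) ,
      (λ i → proj₂ sp (return (x , return (y , Qrefl , i))))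
      where
      sp : ∀ {w} → w ϵ snd (op x y) ↔ (¬¬ Σ D λ a → ¬¬ Σ D λ b → op x y ≃ op a b × w ϵ b)
      sp = cls-bounded  y λ w i → stE do
        a , h ← i
        b , e , k ← h
        return (ϵʳ (Qsym (op-inj₂ e)) k)

  app-eq : ∀ {f x y} → op x y ϵ f → (∀ z → op x z ϵ f → z ≃ y) → f · x ≃ y
  app-eq {y = y} i u = ≃ext λ w →
    (λ j → stE do z , p , q ← proj₁ app-spec j
                  return (ϵʳ (u z p) q)) ,
    (λ j → proj₂ app-spec (return (y , i , j)))

  ⊆-refl : ∀ {x} → x ⊆ x
  ⊆-refl w i = i

  ⊆-trans : ∀ {x y z} → x ⊆ y → y ⊆ z → x ⊆ z
  ⊆-trans p q w i = q w (p w i)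

  prod : D → D → D
  prod a b = ⟦ prod₂ ⟧ (a ◂ b ◂ ⟨⟩)

  abstract
    prod-spec : ∀ {a b w} → w ϵ prod a b ↔ (¬¬ Σ D λ x → ¬¬ Σ D λ y → x ϵ a × y ϵ b × w ≃ op x y)
    prod-spec {a} {b} = cls-bounded (𝒫 (𝒫 (a ∪ b))) λ w h → stE (h >>= λ (x , h) → h >>= λ (y , i , j , e) →
      return (proj₂ 𝒫-spec λ u k → proj₂ 𝒫-spec λ z l → stE (proj₁ up-spec (ϵʳ (Qtr e op-def) k) >>= λ
        { (inj₁ q) → proj₁ up-spec (ϵʳ q l) >>= λ { (inj₁ r) → return (∪ˡ (ϵˡ (Qsym r) i)) ; (inj₂ r) → return (∪ˡ (ϵˡ (Qsym r) i)) }
        ; (inj₂ q) → proj₁ up-spec (ϵʳ q l) >>= λ { (inj₁ r) → return (∪ˡ (ϵˡ (Qsym r) i)) ; (inj₂ r) → return (∪ʳ (ϵˡ (Qsym r) j)) } })))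

  prod-in : ∀ {a b x y} → x ϵ a → y ϵ b → op x y ϵ prod a b
  prod-in i j = proj₂ prod-spec (return (_ , return (_ , i , j , Qrefl)))

  image-set : (t : Tm (suc n)) (ρ : Vec D n) (a : D) →
              ¬¬ Σ D λ b → ∀ w → w ϵ b ↔ (¬¬ Σ D λ x → x ϵ a × w ≃ ⟦ t ⟧ (x ◂ ρ))
  image-set {n} t ρ a = do
    b , h ← ex-out (proj₁ (closure-sat n _) (zfc _ (repl φ)) ρ func a)
    return (b , λ w → case iff-out stE (λ k l → k λ j → j l) (h w) of λ (f , g) →
      (λ i → ex-out (f i) >>= λ (x , k) → ∧-out k >>= λ (p , q) → return (x , p , proj₁ (gr-ok t (x ◂ ρ) w) (proj₁ (e₃ b w x) q))) ,
      (λ i → g (ex-in (i >>= λ (x , p , q) → return (x , ∧-in p (proj₂ (e₃ b w x) (proj₂ (gr-ok t (x ◂ ρ) w) q)))))))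
    where
    -- Replacement expects the argument as variable 0 and the value as variable 1, whereas `gr` has
    -- the value as variable 0.
    sw : Fin (suc (suc n)) → Fin (suc (suc n))
    sw = suc zero V.∷ zero V.∷ ↑²_
    φ = ren sw (gr t)
    e₀ : ∀ x y → sat φ (x ◂ y ◂ ρ) ↔ sat (gr t) (y ◂ x ◂ ρ)
    e₀ x y = sat-ren (λ { zero → Qrefl ; (suc zero) → Qrefl ; (suc (suc i)) → Qrefl }) (gr t)
    e₁ : ∀ x y z → sat (ren (suc (suc zero) V.∷ suc zero V.∷ ↑³_) φ) (z ◂ y ◂ x ◂ ρ) ↔ sat φ (x ◂ y ◂ ρ)
    e₁ x y z = sat-ren (λ { zero → Qrefl ; (suc zero) → Qrefl ; (suc (suc i)) → Qrefl }) φ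
    e₂ : ∀ x y z → sat (ren (suc (suc zero) V.∷ zero V.∷ ↑³_) φ) (z ◂ y ◂ x ◂ ρ) ↔ sat φ (x ◂ z ◂ ρ)
    e₂ x y z = sat-ren (λ { zero → Qrefl ; (suc zero) → Qrefl ; (suc (suc i)) → Qrefl }) φ
    e₃ : ∀ b y x → sat (ren (zero V.∷ suc zero V.∷ (↑_ ∘ ↑³_)) φ) (x ◂ y ◂ b ◂ a ◂ ρ) ↔ sat (gr t) (y ◂ x ◂ ρ)
    e₃ b y x = let p , q = sat-ren {σ = x ◂ y ◂ ρ} (λ { zero → Qrefl ; (suc zero) → Qrefl ; (suc (suc i)) → Qrefl }) φ in
      (λ h → proj₁ (e₀ x y) (p h)) , (λ h → q (proj₂ (e₀ x y) h))
    func : ∀ x y z → _ → _ → y ≃ z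
    func x y z p q = Qtr (proj₁ (gr-ok t (x ◂ ρ) y) (proj₁ (e₀ x y) (proj₁ (e₁ x y z) p)))
      (Qsym (proj₁ (gr-ok t (x ◂ ρ) z) (proj₁ (e₀ x z) (proj₁ (e₂ x y z) q))))

  lambda : (t : Tm (suc n)) (ρ : Vec D n) (a : D) →
           ¬¬ Σ D λ f → ∀ x → x ϵ a → f · x ≃ ⟦ t ⟧ (x ◂ ρ)
  lambda t ρ a = do
    f , h ← image-set (opᵗ v0 (t ⟨ vars id ⟩)) ρ a
    return (f , λ x i → app-eq (proj₂ (h _) (return (x , i , op-cong Qrefl (Qsym (lem x))))) λ z j → stQ do
      y , k , e ← proj₁ (h _) j
      return (Qtr (op-inj₂ e) (Qtr (lem y) (rept t (Qsym (op-inj₁ e))))))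
    where
    lem : ∀ x → ⟦ t ⟧ (⟦ vars id ⟧* (x ◂ ρ)) ≃ ⟦ t ⟧ (x ◂ ρ)
    lem x = ⟦⟧-cong t (vars-ok id (x ◂ ρ))

  foundation' : ∀ {x} → ¬¬ (Σ D λ y → y ϵ x) → ¬¬ Σ D λ y → y ϵ x × (∀ z → z ϵ y → ¬ (z ϵ x))
  foundation' {x} ne = do
    y , h ← ex-out (zfc _ found x λ e → ne λ (y , i) → e y i)
    p ← ∧-out h
    return (y , p)

  irrefl : ∀ {x} → ¬ (x ϵ x)
  irrefl {x} i = foundation' (return (x , upˡ)) λ (y , j , h) → proj₁ up-spec j λ
    { (inj₁ e) → h x (ϵʳ (Qsym e) i) upˡ ; (inj₂ e) → h x (ϵʳ (Qsym e) i) upˡ }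

  asym : ∀ {x y} → x ϵ y → ¬ (y ϵ x)
  asym {x} {y} i j = foundation' (return (x , upˡ {x} {y})) λ (z , k , h) → proj₁ up-spec k λ
    { (inj₁ e) → h y (ϵʳ (Qsym e) j) upʳ ; (inj₂ e) → h x (ϵʳ (Qsym e) i) upˡ }

  minimal : (φ : Fm (suc n)) (ρ : Vec D n) (a : D) → ¬¬ (Σ D λ x → x ϵ a × S φ (x ◂ ρ)) →
            ¬¬ Σ D λ x → x ϵ a × S φ (x ◂ ρ) × (∀ y → y ϵ x → y ϵ a → ¬ S φ (y ◂ ρ))
  minimal φ ρ a ne = do
    b , h ← separate φ ρ a
    x , i , m ← foundation' (ne >>= λ (x , i , s) → return (x , proj₂ (h x) (i , s)))
    return (x , proj₁ (proj₁ (h x) i) , proj₂ (proj₁ (h x) i) , λ y j k s → m y j (proj₂ (h y) (k , s)))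

  Ind : D → Set
  Ind i = ∅ ϵ i × (∀ x → x ϵ i → succ x ϵ i)

  inductive-set : ¬¬ Σ D Ind
  inductive-set = do
    i , h ← ex-out (zfc _ inf)
    p , q ← ∧-out h
    return (i , stE (do e , k ← ex-out p
                        j , em ← ∧-out k
                        return (ϵˡ (≃ext λ z → (λ w → ⊥-elim (em z w)) , (λ w → ⊥-elim (∅-spec w))) j)) ,
      λ x j → stE (do s , k ← ex-out (q x j)
                      l , e ← ∧-out k
                      return (ϵˡ (≃ext λ z → let f , g = iff-out stE (λ k na → stQ λ nb → k λ j → nb (j na)) (e z) ; a , b = or-out stQ in
                        (λ w → proj₂ adj-spec (a (f w))) , (λ w → g (b (proj₁ adj-spec w)))) l)))

  abstract
    ω-spec : ∀ {w} → w ϵ ω ↔ (∀ i → Ind i → w ϵ i)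
    ω-spec {w} = (λ i → stS φ {w ◂ ⟨⟩} (inductive-set >>= λ s → return (proj₁ (sp s) i))) ,
                 (λ i → stE (inductive-set >>= λ s → return (proj₂ (sp s) i)))
      where
      φ : Fm 1
      φ = All (ind₁ ⟪ v0 ◂ ⟨⟩ ⟫ ⊃ v1 ϵᶠ v0)
      sp : Σ D Ind → w ϵ ω ↔ (∀ i → Ind i → w ϵ i)
      sp (i , h) = cls-bounded i λ w f → f i h

  0ϵω : ∅ ϵ ω
  0ϵω = proj₂ ω-spec λ i h → proj₁ h

  sucϵω : ∀ {x} → x ϵ ω → succ x ϵ ω
  sucϵω p = proj₂ ω-spec λ i h → proj₂ h _ (proj₁ ω-spec p i h)

  ω-ind : (φ : Fm (suc n)) (ρ : Vec D n) → S φ (∅ ◂ ρ) → (∀ m → m ϵ ω → S φ (m ◂ ρ) → S φ (succ m ◂ ρ)) →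
          ∀ m → m ϵ ω → S φ (m ◂ ρ)
  ω-ind φ ρ z s m i = stS φ do
    b , h ← separate φ ρ ω
    return (proj₂ (proj₁ (h m) (proj₁ ω-spec i b (proj₂ (h ∅) (0ϵω , z) ,
       λ x j → let k , p = proj₁ (h x) j in proj₂ (h (succ x)) (sucϵω k , s x k p)))))

  ω-trans : ∀ {m x} → m ϵ ω → x ϵ m → x ϵ ω
  ω-trans {m} {x} i = ω-ind (All (v0 ϵᶠ v1 ⊃ v0 ϵᶠ ωᵗ)) ⟨⟩ (λ x j → ⊥-elim (∅-spec j))
    (λ m i h x j → stE (adj-elim j (λ k → return (h x k)) λ e → return (ϵˡ (Qsym e) i))) m i x

  nat-trans : ∀ {m x y} → m ϵ ω → x ϵ m → y ϵ x → y ϵ m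
  nat-trans {m} {x} {y} i j = ω-ind (trans₁ ⟪ v0 ◂ ⟨⟩ ⟫) ⟨⟩ (λ x j → ⊥-elim (∅-spec j))
    (λ m i h x j y k → adjˡ (stE (adj-elim j (λ l → return (h x l y k)) λ e → return (ϵʳ e k)))) m i x j y

  ω-case : ∀ {m} → m ϵ ω → ¬¬ (m ≃ ∅ ⊎ (Σ D λ k → k ϵ ω × m ≃ succ k))
  ω-case {m} i = ω-ind (v0 ≃ᶠ ∅ᵗ or Ex (v0 ϵᶠ ωᵗ & v1 ≃ᶠ sucᵗ v0)) ⟨⟩ (return (inj₁ Qrefl))
    (λ k j _ → return (inj₂ (return (k , j , Qrefl)))) m i >>= λ
    { (inj₁ e) → return (inj₁ e) ; (inj₂ h) → h >>= λ p → return (inj₂ p) }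

  0ϵsuc : ∀ {m} → m ϵ ω → ∅ ϵ succ m
  0ϵsuc i = ω-ind (∅ᵗ ϵᶠ sucᵗ v0) ⟨⟩ (adjʳ Qrefl) (λ m _ h → adjˡ h) _ i

  succ-cong : ∀ {x y} → x ≃ y → succ x ≃ succ y
  succ-cong = rept (sucᵗ v0) {⟨⟩}

  suc-mono : ∀ {a c} → c ϵ ω → a ϵ c → succ a ϵ succ c
  suc-mono {a} {c} i = ω-ind (v1 ϵᶠ v0 ⊃ sucᵗ v1 ϵᶠ sucᵗ v0) (a ◂ ⟨⟩) (λ j → ⊥-elim (∅-spec j))
    (λ m i h j → stE (adj-elim j (λ k → return (adjˡ (h k))) λ e → return (adjʳ (succ-cong e)))) c i

  trichotomy : ∀ {m n} → m ϵ ω → n ϵ ω → ¬¬ (m ϵ n ⊎ (m ≃ n ⊎ n ϵ m))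
  trichotomy {m} {n} i j = ω-ind (v0 ϵᶠ v1 or (v0 ≃ᶠ v1 or v1 ϵᶠ v0)) (n ◂ ⟨⟩)
    (ω-case j >>= λ { (inj₁ e) → return (inj₂ (return (inj₁ (Qsym e))))
                    ; (inj₂ (k , l , e)) → return (inj₁ (ϵʳ (Qsym e) (0ϵsuc l))) })
    (λ m i h → h >>= λ
      { (inj₁ p) → adj-elim (suc-mono j p) (λ k → return (inj₁ k)) λ e → return (inj₂ (return (inj₁ e)))
      ; (inj₂ h) → h >>= λ { (inj₁ e) → return (inj₂ (return (inj₂ (adjʳ (Qsym e))))) ; (inj₂ p) → return (inj₂ (return (inj₂ (adjˡ p)))) } })
    m i >>= λ { (inj₁ p) → return (inj₁ p) ; (inj₂ h) → h >>= λ q → return (inj₂ q) }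

  directed : ∀ {m n} → m ϵ ω → n ϵ ω → ¬¬ Σ D λ k → k ϵ ω × m ϵ k × n ϵ k
  directed {m} {n} i j = trichotomy i j >>= λ
    { (inj₁ p) → return (succ n , sucϵω j , adjˡ p , adjʳ Qrefl)
    ; (inj₂ (inj₁ e)) → return (succ n , sucϵω j , adjʳ e , adjʳ Qrefl)
    ; (inj₂ (inj₂ p)) → return (succ m , sucϵω i , adjʳ Qrefl , adjˡ p) }

-- Recursion F x = A ∪ ⋃ { T ⟨ y , F y ⟩ : y ∈ x }, where A and T may depend on one
-- further parameter c.

module _ (A : Tm 1) (T : Tm 2) where
  rec-step : Fm 4
  rec-step = v0 ϵᶠ A ⟨ v3 ◂ ⟨⟩ ⟩ or Ex (v0 ϵᶠ v3 & v1 ϵᶠ T ⟨ opᵗ v0 (appᵗ v2 v0) ◂ v4 ◂ ⟨⟩ ⟩)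

  attempt : Fm 3
  attempt = trans₁ ⟪ v1 ◂ ⟨⟩ ⟫ & All (v0 ϵᶠ v2 ⊃ All ((v0 ϵᶠ appᵗ v2 v1 ⊃ st) & (st ⊃ v0 ϵᶠ appᵗ v2 v1)))
    where st = rec-step ⟪ v0 ◂ v2 ◂ v1 ◂ v4 ◂ ⟨⟩ ⟫

  urec-raw : Tm 2
  urec-raw = ⁅ Ex (Ex (attempt ⟪ v1 ◂ v0 ◂ v4 ◂ ⟨⟩ ⟫ & v3 ϵᶠ v0 & v2 ϵᶠ appᵗ v1 v3)) ⁆

  rec-body : Tm 2
  rec-body = ⁅ v0 ϵᶠ A ⟨ v2 ◂ ⟨⟩ ⟩ or Ex (v0 ϵᶠ v2 & v1 ϵᶠ T ⟨ opᵗ v0 (urec-raw ⟨ v0 ◂ v3 ◂ ⟨⟩ ⟩) ◂ v3 ◂ ⟨⟩ ⟩) ⁆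

  has-attempt : Fm 2
  has-attempt = Ex (Ex (attempt ⟪ v1 ◂ v0 ◂ v3 ◂ ⟨⟩ ⟫ & v2 ϵᶠ v0))

  abstract
    recφ : Fm 3
    recφ = Ex (Ex (attempt ⟪ v1 ◂ v0 ◂ v4 ◂ ⟨⟩ ⟫ & v3 ϵᶠ v0 & v2 ϵᶠ appᵗ v1 v3))

  urec : Tm 2
  urec = ⁅ recφ ⁆

sing₁ : Tm 1
sing₁ = up₂ ⟨ v0 ◂ v0 ◂ ⟨⟩ ⟩

tc₂ : Tm 2
tc₂ = urec-raw sing₁ (⋃ᵗ (sndᵗ v0))

W₁ : Tm 1
W₁ = urec ∅ᵗ (𝒫ᵗ (sndᵗ v0)) ⟨ v0 ◂ ∅ᵗ ◂ ⟨⟩ ⟩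
Wᵗ : Tm n → Tm n
Wᵗ t = W₁ ⟨ t ◂ ⟨⟩ ⟩

-- Transfinite recursion, the cumulative hierarchy and collection

module Recursion (𝔙 : ZFCModel) where
  open Basics 𝔙 public

  Trans : D → Set
  Trans d = ∀ x → x ϵ d → ∀ y → y ϵ x → y ϵ d

  module Attempts (A : Tm 1) (T : Tm 2) (c : D) where
    private
      F : D → D
      F x = ⟦ urec-raw A T ⟧ (x ◂ c ◂ ⟨⟩)
      Att : D → D → Set
      Att f d = S (attempt A T) (f ◂ d ◂ c ◂ ⟨⟩)
      Step : D → D → D → Set
      Step w f x = S (rec-step A T) (w ◂ f ◂ x ◂ c ◂ ⟨⟩)
      Has : D → Set
      Has x = S (has-attempt A T) (x ◂ c ◂ ⟨⟩)

      step-mono : ∀ {w f f' x} → (∀ y → y ϵ x → f · y ≃ f' · y) → Step w f x → Step w f' x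
      step-mono {w} {f} {f'} e h = h >>= λ
        { (inj₁ p) → return (inj₁ p)
        ; (inj₂ q) → return (inj₂ (q >>= λ (y , i , k) →
            return (y , i , ϵʳ (rept T (op-cong Qrefl (e y i))) k))) }

      unique : ∀ {f d f' d' x} → Att f d → Att f' d' → x ϵ d → x ϵ d' → f · x ≃ f' · x
      unique {f} {d} {f'} {d'} {x} (t , a) (t' , a') i i' = stQ λ ne →
        minimal (v0 ϵᶠ v1 & negᶠ (appᵗ v2 v0 ≃ᶠ appᵗ v3 v0)) (d' ◂ f ◂ f' ◂ ⟨⟩) d (return (x , i , i' , ne))
          λ (z , j , (j' , nz) , m) →
            let e = λ y (k : y ϵ z) → stQ (λ n → m y k (t z j y k) (t' z j' y k , n)) in
            nz (≃ext λ w →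
              (λ k → proj₂ (a' z j' w) (step-mono {w} {f} {f'} {z} e (proj₁ (a z j w) k))) ,
              (λ k → proj₂ (a z j w) (step-mono {w} {f'} {f} {z} (λ y k → Qsym (e y k)) (proj₁ (a' z j' w) k))))

      F-eq : ∀ {f d x} → Att f d → x ϵ d → F x ≃ f · x
      F-eq {f} {d} {x} a i = ≃ext λ w →
        (λ j → stE (proj₁ sp j >>= λ (f' , h) → h >>= λ (d' , a' , i' , k) → return (ϵʳ (unique {f'} {d'} {f} {d} a' a i' i) k))) ,
        (λ j → proj₂ sp (return (f , return (d , a , i , j))))
        where
        sp : ∀ {w} → w ϵ F x ↔ (¬¬ Σ D λ f → ¬¬ Σ D λ d → Att f d × x ϵ d × w ϵ f · x)
        sp = cls-bounded (f · x) λ w h → stE (h >>= λ (f' , h) → h >>= λ (d' , a' , i' , k) →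
          return (ϵʳ (unique {f'} {d'} {f} {d} a' a i' i) k))

      Fstep : D → D → Set
      Fstep w x = ¬¬ (w ϵ ⟦ A ⟧ (c ◂ ⟨⟩) ⊎ (¬¬ Σ D λ y → y ϵ x × w ϵ ⟦ T ⟧ (op y (F y) ◂ c ◂ ⟨⟩)))

      has⇒eq : ∀ {x} → Has x → ∀ {w} → w ϵ F x ↔ Fstep w x
      has⇒eq {x} h {w} =
        (λ i → h >>= λ (f , h) → h >>= λ (d , (t , a) , j) → proj₁ (a x j w) (ϵʳ (F-eq {f} {d} (t , a) j) i) >>= λ
          { (inj₁ p) → return (inj₁ p)
          ; (inj₂ q) → return (inj₂ (q >>= λ (y , k , l) →
              return (y , k , ϵʳ (rept T (op-cong Qrefl (Qsym (F-eq {f} {d} (t , a) (t x j y k))))) l))) }) ,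
        (λ s → stE (h >>= λ (f , h) → h >>= λ (d , (t , a) , j) → return (ϵʳ (Qsym (F-eq {f} {d} (t , a) j))
          (proj₂ (a x j w) (s >>= λ
          { (inj₁ p) → return (inj₁ p)
          ; (inj₂ q) → return (inj₂ (q >>= λ (y , k , l) →
              return (y , k , ϵʳ (rept T (op-cong Qrefl (F-eq {f} {d} (t , a) (t x j y k)))) l))) })))))

      body : D → D
      body x = ⟦ rec-body A T ⟧ (x ◂ c ◂ ⟨⟩)

      body-spec : ∀ {x w} → w ϵ body x ↔ Fstep w x
      body-spec {x} = cls-bounded¬ do
        b , h ← image-set (T ⟨ opᵗ v0 (urec-raw A T ⟨ v0 ◂ v1 ◂ ⟨⟩ ⟩) ◂ v1 ◂ ⟨⟩ ⟩) (c ◂ ⟨⟩) x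
        return (⟦ A ⟧ (c ◂ ⟨⟩) ∪ ⋃ b , λ w s → stE (s >>= λ
          { (inj₁ p) → return (∪ˡ p)
          ; (inj₂ q) → q >>= λ (y , i , k) → return (∪ʳ (⋃-in (proj₂ (h _) (return (y , i , Qrefl))) k)) }))

    -- Let z be an ∈-minimal counterexample. The elements of d that have attempts form a transitive
    -- set `d*`, which contains all members of z. On `d*` the function is determined, so tabulating
    -- the right-hand side of the recursion on `d*` and z gives an attempt for z.
    has : ∀ {d x} → Trans d → x ϵ d → Has x
    has {d} {x} t i = stS (has-attempt A T) {x ◂ c ◂ ⟨⟩} λ nx →
      minimal (negᶠ (has-attempt A T ⟪ v0 ◂ v1 ◂ ⟨⟩ ⟫)) (c ◂ ⟨⟩) d (return (x , i , nx)) λ (z , j , nz , m) →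
      (do
        d* , h ← separate (has-attempt A T) (c ◂ ⟨⟩) d
        let in* = λ y (k : y ϵ d) (l : Has y) → proj₂ (h y) (k , l)
            out* = λ y (k : y ϵ d*) → proj₂ (proj₁ (h y) k)
            z⊆ = λ y (k : y ϵ z) → in* y (t z j y k) (stS (has-attempt A T) {y ◂ c ◂ ⟨⟩} λ n → m y k (t z j y k) n)
            tr* = λ u (k : u ϵ d*) y (l : y ϵ u) → in* y (t u (proj₁ (proj₁ (h u) k)) y l)
              (out* u k >>= λ (f , h) → h >>= λ (d' , a , i) → return (f , return (d' , a , proj₁ a u i y l)))
        f , g ← lambda (rec-body A T) (c ◂ ⟨⟩) (adj d* z)
        let below = λ u (k : u ϵ adj d* z) y (l : y ϵ u) →
                      stE (adj-elim k (λ k → return (tr* u k y l)) λ e → return (z⊆ y (ϵʳ e l)))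
            val = λ y (k : y ϵ d*) → Qtr (g y (adjˡ k)) (≃ext λ w → (λ p → proj₂ (has⇒eq (out* y k)) (proj₁ body-spec p)) ,
                                                                  (λ p → proj₂ body-spec (proj₁ (has⇒eq (out* y k)) p)))
        return (nz (return (f , return (adj d* z , ((λ u k y l → adjˡ (below u k y l)) ,
          λ u k w → (λ p → proj₁ body-spec (ϵʳ (g u k) p) >>= λ
              { (inj₁ p) → return (inj₁ p)
              ; (inj₂ q) → return (inj₂ (q >>= λ (y , l , o) → return (y , l , ϵʳ (rept T (op-cong Qrefl (Qsym (val y (below u k y l))))) o))) }) ,
            λ s → ϵʳ (Qsym (g u k)) (proj₂ body-spec (s >>= λ
              { (inj₁ p) → return (inj₁ p)
              ; (inj₂ q) → return (inj₂ (q >>= λ (y , l , o) → return (y , l , ϵʳ (rept T (op-cong Qrefl (val y (below u k y l)))) o))) }))) ,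
          adjʳ Qrefl))))) λ b → b

    local-spec : ∀ {d x} → Trans d → x ϵ d → ∀ {w} → w ϵ F x ↔ Fstep w x
    local-spec t i = has⇒eq (has t i)

  ω-transitive : Trans ω
  ω-transitive x i y j = ω-trans i j

  -- Bootstraps the general recursion theorem: ω is already known to be transitive, so recursion
  -- along ω is available and iterates the union, starting from the singleton of x.
  tc-exists : ∀ x → ¬¬ Σ D λ t → Trans t × x ϵ t
  tc-exists x = do
    b , h ← image-set tc₂ (x ◂ ⟨⟩) ω
    return (⋃ b ,
      (λ u i y j → stE do
        z , k , l ← proj₁ ⋃-spec i
        n , o , e ← proj₁ (h z) k
        return (⋃-in (proj₂ (h _) (return (succ n , sucϵω o , Qrefl)))
          (proj₂ (A.local-spec ω-transitive (sucϵω o)) (return (inj₂ (return (n , adjʳ Qrefl , ⋃-in (ϵʳ (Qsym snd-op) (ϵʳ e l)) j))))))) ,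
      ⋃-in (proj₂ (h _) (return (∅ , 0ϵω , Qrefl))) (proj₂ (A.local-spec ω-transitive 0ϵω) (return (inj₁ upˡ))))
    where module A = Attempts sing₁ (⋃ᵗ (sndᵗ v0)) x

  abstract
    rec-spec : (A : Tm 1) (T : Tm 2) (c : D) → ∀ {x w} → w ϵ ⟦ urec A T ⟧ (x ◂ c ◂ ⟨⟩) ↔
               (¬¬ (w ϵ ⟦ A ⟧ (c ◂ ⟨⟩) ⊎ (¬¬ Σ D λ y → y ϵ x × w ϵ ⟦ T ⟧ (op y (⟦ urec A T ⟧ (y ◂ c ◂ ⟨⟩)) ◂ c ◂ ⟨⟩))))
    rec-spec A T c {x} =
      (λ i → tc-exists x >>= λ (t , p , q) → proj₁ (Attempts.local-spec A T c p q) i) ,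
      (λ i → stE (tc-exists x >>= λ (t , p , q) → return (proj₂ (Attempts.local-spec A T c p q) i)))

  ϵ-ind : (φ : Fm (suc n)) (ρ : Vec D n) → (∀ x → (∀ y → y ϵ x → S φ (y ◂ ρ)) → S φ (x ◂ ρ)) → ∀ x → S φ (x ◂ ρ)
  ϵ-ind φ ρ h x = stS φ λ nx → tc-exists x λ (t , p , q) →
    minimal (negᶠ (φ ⟪ vars id ⟫)) ρ t (return (x , q , λ s → nx (to s))) λ (z , i , nz , m) →
      nz (from (h z λ y j → stS φ λ ny → m y j (p z i y j) λ s → ny (to s)))
    where
    to : ∀ {x} → S φ (⟦ vars id ⟧* (x ◂ ρ)) → S φ (x ◂ ρ)
    to = S-cong φ (vars-ok id _)
    from : ∀ {x} → S φ (x ◂ ρ) → S φ (⟦ vars id ⟧* (x ◂ ρ))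
    from = S-cong φ λ i → Qsym (vars-ok id _ i)

  -- The cumulative hierarchy: W x is V_α for the rank α of x

  W : D → D
  W x = ⟦ W₁ ⟧ (x ◂ ⟨⟩)

  abstract
    W-spec : ∀ {x w} → w ϵ W x ↔ (¬¬ Σ D λ y → y ϵ x × w ⊆ W y)
    W-spec {x} {w} =
      (λ i → proj₁ (rec-spec ∅ᵗ (𝒫ᵗ (sndᵗ v0)) ∅) i >>= λ
        { (inj₁ p) → ⊥-elim (∅-spec p)
        ; (inj₂ q) → q >>= λ (y , j , k) → return (y , j , λ u l → ϵʳ snd-op (proj₁ 𝒫-spec k u l)) }) ,
      (λ h → proj₂ (rec-spec ∅ᵗ (𝒫ᵗ (sndᵗ v0)) ∅) (return (inj₂ (h >>= λ (y , j , k) →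
        return (y , j , proj₂ 𝒫-spec λ u l → ϵʳ (Qsym snd-op) (k u l))))))

  W-super : ∀ {x u v} → u ⊆ v → v ϵ W x → u ϵ W x
  W-super s i = proj₂ W-spec (proj₁ W-spec i >>= λ (y , j , k) → return (y , j , λ z l → k z (s z l)))

  W-trans : ∀ {x} → Trans (W x)
  W-trans {x} = ϵ-ind (trans₁ ⟪ Wᵗ v0 ◂ ⟨⟩ ⟫) ⟨⟩ (λ x h u i y j → stE do
    z , k , l ← proj₁ W-spec i
    return (proj₂ W-spec (return (z , k , λ w m → h z k y (l y j) w m)))) x

  ⊆W : ∀ {x} → x ⊆ W x
  ⊆W {x} = ϵ-ind (v0 ⊆ᶠ Wᵗ v0) ⟨⟩ (λ x h z i → proj₂ W-spec (return (z , i , h z i))) x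

  -- Comparison of ranks, with `W x` in the role of the rank. If z belongs to `W x` but not to
  -- `W y`, then z ⊆ `W x'` for some x' ∈ x. For y' ∈ y, `W x'` ⊆ `W y'` would put z into `W y`, so
  -- induction gives `W y'` ∈ `W x'`; hence `W y` ⊆ `W x'`.
  W-compare : ∀ {x y} → ¬¬ (W x ⊆ W y ⊎ W y ϵ W x)
  W-compare {x} {y} = ϵ-ind (All (Wᵗ v1 ⊆ᶠ Wᵗ v0 or Wᵗ v0 ϵᶠ Wᵗ v1)) ⟨⟩ (λ x ih y → do
    inj₂ ns ← em (W x ⊆ W y)
      where inj₁ s → return (inj₁ s)
    z , i , nz ← λ k → ns λ z i → stE λ nz → k (z , i , nz)
    x' , j , l ← proj₁ W-spec i
    return (inj₂ (proj₂ W-spec (return (x' , j , λ u k → stE do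
      y' , m , s ← proj₁ W-spec k
      c ← ih x' j y'
      return (case c of λ
        { (inj₁ s') → ⊥-elim (nz (proj₂ W-spec (return (y' , m , λ w o → s' w (l w o)))))
        ; (inj₂ i') → W-super s i' })))))) x y

  -- Scott's trick: `wmin` maps x to the level `W y` of least rank among its witnesses y.
  -- Replacement collects these levels, and each such y is a subset of its own level.
  collection : (φ : Fm (suc (suc n))) (ρ : Vec D n) (a : D) →
               ¬¬ Σ D λ B → ∀ x → x ϵ a → ¬¬ (Σ D λ y → S φ (y ◂ x ◂ ρ)) → ¬¬ Σ D λ y → y ϵ B × S φ (y ◂ x ◂ ρ)
  collection {n} φ ρ a = do
    b , h ← image-set wmin ρ a
    return (𝒫 (⋃ b) , λ x i ne → do
      y₀ , s₀ ← ne
      w₁ , j , hy , m ← minimal (Ex (v1 ≃ᶠ Wᵗ v0 & φ₁)) (x ◂ ρ) (𝒫 (W y₀))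
        (return (W y₀ , proj₂ 𝒫-spec (λ _ q → q) , return (y₀ , Qrefl , from₁ s₀)))
      y , e , s' ← hy
      let s = to₁ s'
          least = λ y' (s' : S φ (y' ◂ x ◂ ρ)) → W-compare {y} {y'} >>= λ
            { (inj₁ q) → return q
            ; (inj₂ q) → ⊥-elim (m (W y') (ϵʳ (Qsym e) q)
                (proj₂ 𝒫-spec λ u k → proj₁ 𝒫-spec j u (ϵʳ (Qsym e) (W-trans (W y') q u k)))
                (return (y' , Qrefl , from₁ s'))) }
          wm : W y ⊆ ⟦ wmin ⟧ (x ◂ ρ)
          wm = λ u k → proj₂ (wmin-spec y s least) (return (y , from₁ s , (λ y' s' u k → stE (least y' (to₃ s') >>= λ q → return (q u k))) , k))
      return (y , proj₂ 𝒫-spec (λ u k → ⋃-in (proj₂ (h _) (return (x , i , Qrefl))) (wm u (⊆W u k))) , s))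
    where
    φ₁ : Fm (suc (suc (suc n)))
    φ₁ = φ ⟪ v0 ◂ vars (↑²_) ⟫
    φ₃ : Fm (suc (suc (suc (suc n))))
    φ₃ = φ ⟪ v0 ◂ vars (↑³_) ⟫
    wmin : Tm (suc n)
    wmin = ⁅ Ex (φ₁ & All (φ₃ ⊃ Wᵗ v1 ⊆ᶠ Wᵗ v0) & v1 ϵᶠ Wᵗ v0) ⁆
    module _ {x : D} where
      to₁ : ∀ {y w} → S φ₁ (y ◂ w ◂ x ◂ ρ) → S φ (y ◂ x ◂ ρ)
      to₁ {y} {w} = S-cong φ λ { zero → Qrefl ; (suc i) → vars-ok (↑²_) (y ◂ w ◂ x ◂ ρ) i }
      from₁ : ∀ {y w} → S φ (y ◂ x ◂ ρ) → S φ₁ (y ◂ w ◂ x ◂ ρ)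
      from₁ {y} {w} = S-cong φ λ { zero → Qrefl ; (suc i) → Qsym (vars-ok (↑²_) (y ◂ w ◂ x ◂ ρ) i) }
      to₃ : ∀ {y' y w} → S φ₃ (y' ◂ y ◂ w ◂ x ◂ ρ) → S φ (y' ◂ x ◂ ρ)
      to₃ {y'} {y} {w} = S-cong φ λ { zero → Qrefl ; (suc i) → vars-ok (↑³_) (y' ◂ y ◂ w ◂ x ◂ ρ) i }
      from₃ : ∀ {y' y w} → S φ (y' ◂ x ◂ ρ) → S φ₃ (y' ◂ y ◂ w ◂ x ◂ ρ)
      from₃ {y'} {y} {w} = S-cong φ λ { zero → Qrefl ; (suc i) → Qsym (vars-ok (↑³_) (y' ◂ y ◂ w ◂ x ◂ ρ) i) }
      wmin-spec : ∀ y → S φ (y ◂ x ◂ ρ) → (∀ y' → S φ (y' ◂ x ◂ ρ) → ¬¬ (W y ⊆ W y')) → ∀ {w} →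
        w ϵ ⟦ wmin ⟧ (x ◂ ρ) ↔ S (Ex (φ₁ & All (φ₃ ⊃ Wᵗ v1 ⊆ᶠ Wᵗ v0) & v1 ϵᶠ Wᵗ v0)) (w ◂ x ◂ ρ)
      wmin-spec y s l = cls-bounded (W y) λ w h → stE (h >>= λ (y' , s' , m , k) →
        return (m y (from₃ s) w k))

-- Choice functions and the well-ordering theorem

minus₂ inter₂ : Tm 2
minus₂ = ⁅ v0 ϵᶠ v1 & negᶠ (v0 ≃ᶠ appᵗ v2 v1) ⁆
inter₂ = ⁅ v0 ϵᶠ v2 & All (v0 ϵᶠ v2 ⊃ v1 ϵᶠ v0) ⁆

-- Zermelo's Θ-chains, for the choice function in variable 2. The empty family has intersection A,
-- which is how A itself gets into every tower.
tower₃ : Fm 3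
tower₃ = All (v0 ϵᶠ v1 ⊃ minus₂ ⟨ v0 ◂ v3 ◂ ⟨⟩ ⟩ ϵᶠ v1) &
         All (v0 ⊆ᶠ v1 ⊃ inter₂ ⟨ v0 ◂ v2 ◂ ⟨⟩ ⟩ ϵᶠ v1)

least-tower₂ : Tm 2
least-tower₂ = ⁅ v0 ⊆ᶠ v1 & All (tower₃ ⟪ v0 ◂ v2 ◂ v3 ◂ ⟨⟩ ⟫ ⊃ v1 ϵᶠ v0) ⁆

-- x precedes y if some member of the tower Θ has lost x but not y
prec₃ : Fm 3
prec₃ = Ex (v0 ϵᶠ v1 & v3 ϵᶠ v0 & negᶠ (v2 ϵᶠ v0))

module Choice (𝔙 : ZFCModel) where
  open Recursion 𝔙 public

  transversal : ∀ f → (∀ x → x ϵ f → ¬¬ Σ D λ z → z ϵ x) →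
                (∀ x y z → x ϵ f → y ϵ f → z ϵ x → z ϵ y → x ≃ y) →
                ¬¬ Σ D λ c → ∀ x → x ϵ f → ¬¬ Σ D λ z → z ϵ x × z ϵ c × (∀ z' → z' ϵ x → z' ϵ c → z' ≃ z)
  transversal f ne dj = do
    c , h ← ex-out (zfc _ ac f (λ x i e → ne x i λ (z , j) → e z j)
      (λ x i y j h → stQ do z , k ← ex-out h
                            l , m ← ∧-out k
                            return (dj x y z i j m l)))
    return (c , λ x i → do
      z , k ← ex-out (h x i)
      p , u ← ∧-out k
      q , r ← ∧-out p
      return (z , q , r , λ z' a b → u z' (∧-in a b)))

  -- Collection bounds the witnesses by a set B. The sets `t` of pairs ⟨x , y⟩ with y ∈ B a witness
  -- for x are nonempty, and disjoint because x is recorded, so a transversal of them is a choice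
  -- function.
  skolem : (φ : Fm (suc (suc n))) (ρ : Vec D n) (a : D) → (∀ x → x ϵ a → ¬¬ Σ D λ y → S φ (y ◂ x ◂ ρ)) →
           ¬¬ Σ D λ f → ∀ x → x ϵ a → S φ (f · x ◂ x ◂ ρ)
  skolem {n} φ ρ a ne = do
    B , hB ← collection φ ρ a
    b , h ← image-set t (B ◂ ρ) a
    let t-spec : ∀ {x w} → w ϵ ⟦ t ⟧ (x ◂ B ◂ ρ) ↔ S (Ex (v0 ϵᶠ v3 & v1 ≃ᶠ opᵗ v2 v0 & φ')) (w ◂ x ◂ B ◂ ρ)
        t-spec {x} = cls-bounded¬ do
          c , k ← image-set (opᵗ v1 v0) (x ◂ ⟨⟩) B
          return (c , λ w s → stE (s >>= λ (y , i , e , _) → return (proj₂ (k w) (return (y , i , e)))))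
    c , hc ← transversal b
      (λ z i → do x , j , e ← proj₁ (h z) i
                  y , k , s ← hB x j (ne x j)
                  return (op x y , ϵʳ (Qsym e) (proj₂ t-spec (return (y , k , Qrefl , from s)))))
      (λ z z' w i i' j j' → stQ do
        x , _ , e ← proj₁ (h z) i
        x' , _ , e' ← proj₁ (h z') i'
        y , _ , q , _ ← proj₁ t-spec (ϵʳ e j)
        y' , _ , q' , _ ← proj₁ t-spec (ϵʳ e' j')
        return (Qtr e (Qtr (rept t (op-inj₁ (Qtr (Qsym q) q'))) (Qsym e'))))
    f , hf ← separate (Ex (v0 ϵᶠ v2 & v1 ϵᶠ v0)) (b ◂ ⟨⟩) c
    return (f , λ x i → stS φ do
      w , j , k , u ← hc _ (proj₂ (h _) (return (x , i , Qrefl)))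
      y , l , q , s ← proj₁ t-spec j
      let into = λ z z' (m : z ϵ c) (o : z' ϵ b) (r : z ϵ z') → proj₂ (hf z) (m , return (z' , o , r))
          fx = app-eq {f} {x} {y} (ϵˡ q (into w _ k (proj₂ (h _) (return (x , i , Qrefl))) j)) λ z m → stQ do
            let mc , o = proj₁ (hf _) m
            t' , o , r ← o
            x' , _ , e ← proj₁ (h _) o
            y' , l' , q' , s' ← proj₁ t-spec (ϵʳ e r)
            return (op-inj₂ (Qtr (u (op x z) (proj₂ t-spec (return (z , ϵˡ (Qsym (op-inj₂ q')) l' , Qrefl ,
              S-cong φ' {y' ◂ op x z ◂ x' ◂ B ◂ ρ} {z ◂ op x z ◂ x ◂ B ◂ ρ} (λ { zero → Qsym (op-inj₂ q') ; (suc zero) → Qrefl ; (suc (suc zero)) → Qsym (op-inj₁ q') ; (suc (suc (suc i))) → Qrefl }) s'))) mc) q))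
      return (rep φ (Qsym fx) (to s)))
    where
    φ' : Fm (suc (suc (suc (suc n))))
    φ' = φ ⟪ v0 ◂ v2 ◂ vars (↑_ ∘ ↑³_) ⟫
    t : Tm (suc (suc n))
    t = ⁅ Ex (v0 ϵᶠ v3 & v1 ≃ᶠ opᵗ v2 v0 & φ') ⁆
    to : ∀ {y w x B} → S φ' (y ◂ w ◂ x ◂ B ◂ ρ) → S φ (y ◂ x ◂ ρ)
    to {y} {w} {x} {B} = S-cong φ λ { zero → Qrefl ; (suc zero) → Qrefl ; (suc (suc i)) → vars-ok (↑_ ∘ ↑³_) (y ◂ w ◂ x ◂ B ◂ ρ) i }
    from : ∀ {y w x B} → S φ (y ◂ x ◂ ρ) → S φ' (y ◂ w ◂ x ◂ B ◂ ρ)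
    from {y} {w} {x} {B} = S-cong φ λ { zero → Qrefl ; (suc zero) → Qrefl ; (suc (suc i)) → Qsym (vars-ok (↑_ ∘ ↑³_) (y ◂ w ◂ x ◂ B ◂ ρ) i) }

  -- Zermelo's 1908 proof of the well-ordering theorem

  Prec : D → D → D → Set
  Prec Θ x y = S prec₃ (Θ ◂ x ◂ y ◂ ⟨⟩)

  module Zermelo (A c : D) (ch : ∀ x → x ϵ 𝒫 A → ¬¬ (Σ D λ y → y ϵ x) → c · x ϵ x) where
    min : D → D
    min B = ⟦ minus₂ ⟧ (B ◂ c ◂ ⟨⟩)
    int : D → D
    int Z = ⟦ inter₂ ⟧ (Z ◂ A ◂ ⟨⟩)
    Θ : D
    Θ = ⟦ least-tower₂ ⟧ (A ◂ c ◂ ⟨⟩)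
    Tower : D → Set
    Tower T = S tower₃ (T ◂ A ◂ c ◂ ⟨⟩)

    abstract
      min-spec : ∀ {B w} → w ϵ min B ↔ (w ϵ B × ¬ (w ≃ c · B))
      min-spec {B} = cls-bounded B λ w → proj₁

      int-spec : ∀ {Z w} → w ϵ int Z ↔ (w ϵ A × (∀ B → B ϵ Z → w ϵ B))
      int-spec {Z} = cls-bounded A λ w → proj₁

      Θ-spec : ∀ {B} → B ϵ Θ ↔ (B ⊆ A × (∀ T → Tower T → B ϵ T))
      Θ-spec = cls-bounded (𝒫 A) λ w p → proj₂ 𝒫-spec (proj₁ p)

    Θ-min : ∀ {B} → B ϵ Θ → min B ϵ Θ
    Θ-min i = let s , t = proj₁ Θ-spec i in
      proj₂ Θ-spec ((λ w j → s w (proj₁ (proj₁ min-spec j))) , λ T tw → proj₁ tw _ (t T tw))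

    Θ-int : ∀ {Z} → Z ⊆ Θ → int Z ϵ Θ
    Θ-int s = proj₂ Θ-spec ((λ w j → proj₁ (proj₁ int-spec j)) , λ T tw → proj₂ tw _ λ B i → proj₂ (proj₁ Θ-spec (s B i)) T tw)

    tower-ind : (φ : Fm (suc n)) (ρ : Vec D n) → (∀ B → B ϵ Θ → S φ (B ◂ ρ) → S φ (min B ◂ ρ)) →
                (∀ Z → Z ⊆ Θ → (∀ B → B ϵ Z → S φ (B ◂ ρ)) → S φ (int Z ◂ ρ)) → ∀ B → B ϵ Θ → S φ (B ◂ ρ)
    tower-ind φ ρ hm hi B i = stS φ do
      T , h ← separate φ ρ Θ
      return (proj₂ (proj₁ (h B) (proj₂ (proj₁ Θ-spec i) T
        ((λ B j → let k , s = proj₁ (h B) j in proj₂ (h (min B)) (Θ-min k , hm B k s)) ,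
         (λ Z s → proj₂ (h (int Z)) (Θ-int (λ B j → proj₁ (proj₁ (h B) (s B j))) ,
            hi Z (λ B j → proj₁ (proj₁ (h B) (s B j))) λ B j → proj₂ (proj₁ (h B) (s B j))))))))

    private
      minᵗ : Tm n → Tm n → Tm n
      minᵗ t u = minus₂ ⟨ t ◂ u ◂ ⟨⟩ ⟩

    -- Nothing lies strictly between `min C` and C. In the successor step `min B` ⊆ C ⊆ B, and as B
    -- exceeds `min B` by one point at most, C equals B if it contains that point and is `min B`
    -- otherwise.
    claim : ∀ C → C ϵ Θ → (∀ B → B ϵ Θ → ¬¬ (B ⊆ C ⊎ C ⊆ B)) → ∀ B → B ϵ Θ → ¬¬ (C ⊆ B ⊎ B ⊆ min C)
    claim C i cmp = tower-ind (v1 ⊆ᶠ v0 or v0 ⊆ᶠ minᵗ v1 v2) (C ◂ c ◂ ⟨⟩)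
      (λ B j h → h >>= λ
        { (inj₂ s) → return (inj₂ λ w k → s w (proj₁ (proj₁ min-spec k)))
        ; (inj₁ s) → cmp (min B) (Θ-min j) >>= λ
            { (inj₂ s') → return (inj₁ s')
            ; (inj₁ s') → em (c · B ϵ C) >>= λ
                { (inj₂ n) → return (inj₁ λ w k → proj₂ min-spec (s w k , λ e → n (ϵˡ e k)))
                ; (inj₁ p) →
                    let B≃C : B ≃ C
                        B≃C = ⊆-antisym (λ w k → stE (em (w ≃ c · B) >>= λ
                          { (inj₁ e) → return (ϵˡ (Qsym e) p) ; (inj₂ n) → return (s' w (proj₂ min-spec (k , n))) })) s
                    in return (inj₂ (≃⇒⊆ (rept (minᵗ v0 v1) {c ◂ ⟨⟩} B≃C))) } } })
      (λ Z s h → em (¬¬ Σ D λ B → B ϵ Z × B ⊆ min C) >>= λ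
        { (inj₁ e) → e >>= λ (B , j , t) → return (inj₂ λ w k → t w (proj₂ (proj₁ int-spec k) B j))
        ; (inj₂ n) → return (inj₁ λ w k → proj₂ int-spec (proj₁ (proj₁ Θ-spec i) w k , λ B j → stE (h B j >>= λ
            { (inj₁ t) → return (t w k) ; (inj₂ t) → ⊥-elim (n (return (B , j , t))) }))) })

    compare : ∀ C → C ϵ Θ → ∀ B → B ϵ Θ → ¬¬ (B ⊆ C ⊎ C ⊆ B)
    compare = tower-ind (All (v0 ϵᶠ v2 ⊃ v0 ⊆ᶠ v1 or v1 ⊆ᶠ v0)) (Θ ◂ ⟨⟩)
      (λ C i h B j → claim C i h B j >>= λ
        { (inj₁ s) → return (inj₂ λ w k → s w (proj₁ (proj₁ min-spec k))) ; (inj₂ s) → return (inj₁ s) })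
      (λ Z s h B j → em (¬¬ Σ D λ C → C ϵ Z × C ⊆ B) >>= λ
        { (inj₁ e) → e >>= λ (C , k , t) → return (inj₂ λ w l → t w (proj₂ (proj₁ int-spec l) C k))
        ; (inj₂ n) → return (inj₁ λ w k → proj₂ int-spec (proj₁ (proj₁ Θ-spec j) w k , λ C l → stE (h C l B j >>= λ
            { (inj₁ t) → return (t w k) ; (inj₂ t) → ⊥-elim (n (return (C , l , t))) }))) })

    prec-asym : ∀ {x y} → Prec Θ x y → ¬ Prec Θ y x
    prec-asym p q = p λ (B , i , yB , xB) → q λ (C , j , xC , yC) → compare C j B i λ
      { (inj₁ s) → yC (s _ yB) ; (inj₂ s) → xB (s _ xC) }

    -- Let B be the smallest member of Θ that includes Q. Its chosen element is in Q, since
    -- otherwise `min B` would still include Q; and `min B` is the member of Θ that has lost this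
    -- element but no other element of Q.
    least : ∀ Q → Q ⊆ A → ¬¬ (Σ D λ x → x ϵ Q) → ¬¬ Σ D λ x → x ϵ Q × (∀ y → y ϵ Q → ¬ (y ≃ x) → Prec Θ x y)
    least Q s ne = do
      Z , h ← separate (v1 ⊆ᶠ v0) (Q ◂ ⟨⟩) Θ
      let B = int Z
          zin = λ C (i : C ϵ Θ) (t : Q ⊆ C) → proj₂ (h C) (i , t)
          BΘ : B ϵ Θ
          BΘ = Θ-int λ C i → proj₁ (proj₁ (h C) i)
          Q⊆B : Q ⊆ B
          Q⊆B = λ w i → proj₂ int-spec (s w i , λ C j → proj₂ (proj₁ (h C) j) w i)
          cB : c · B ϵ B
          cB = ch B (proj₂ 𝒫-spec (proj₁ (proj₁ Θ-spec BΘ))) (ne >>= λ (x , i) → return (x , Q⊆B x i))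
      return (c · B , stE (λ n → proj₂ (proj₁ min-spec (proj₂ (proj₁ int-spec cB) (min B)
                (zin (min B) (Θ-min BΘ) λ w i → proj₂ min-spec (Q⊆B w i , λ e → n (ϵˡ e i))))) Qrefl) ,
              λ y i ny → return (min B , Θ-min BΘ , proj₂ min-spec (Q⊆B y i , ny) , λ k → proj₂ (proj₁ min-spec k) Qrefl))

  well-order : ∀ A → ¬¬ Σ D λ Θ → (∀ {x y} → Prec Θ x y → ¬ Prec Θ y x) ×
    (∀ Q → Q ⊆ A → ¬¬ (Σ D λ x → x ϵ Q) → ¬¬ Σ D λ x → x ϵ Q × (∀ y → y ϵ Q → ¬ (y ≃ x) → Prec Θ x y))
  well-order A = do
    c , h ← skolem (Ex (v0 ϵᶠ v2) ⊃ v0 ϵᶠ v1) ⟨⟩ (𝒫 A) λ x i → em (¬¬ Σ D λ y → y ϵ x) >>= λ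
      { (inj₁ e) → e >>= λ (y , j) → return (y , λ _ → j) ; (inj₂ n) → return (x , λ e → ⊥-elim (n e)) }
    return (Zermelo.Θ A c h , (λ {x} {y} → Zermelo.prec-asym A c h {x} {y}) , Zermelo.least A c h)

-- Small sets, flat pairs and finite sets

-- iterated power sets over a, and their union
level₂ : Tm 2
level₂ = urec v0 (𝒫ᵗ (sndᵗ v0))

abstract
  Uφ : Fm 2
  Uφ = Ex (v0 ϵᶠ ωᵗ & v1 ϵᶠ level₂ ⟨ v0 ◂ v2 ◂ ⟨⟩ ⟩)

U₁ : Tm 1
U₁ = ⁅ Uφ ⁆

H₀ J₀ : Tm 0
H₀ = U₁ ⟨ ωᵗ ◂ ⟨⟩ ⟩
J₀ = U₁ ⟨ H₀ ◂ ⟨⟩ ⟩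
Hᵗ Jᵗ : Tm n
Hᵗ = H₀ ⟨ ⟨⟩ ⟩
Jᵗ = J₀ ⟨ ⟨⟩ ⟩

one₀ two₀ : Tm 0
one₀ = sucᵗ ∅ᵗ
two₀ = sucᵗ one₀
oneᵗ twoᵗ : Tm n
oneᵗ = one₀ ⟨ ⟨⟩ ⟩
twoᵗ = two₀ ⟨ ⟨⟩ ⟩

-- A pairing under which, unlike under Kuratowski's, 𝒫 J is closed
abstract
  fpφ : Fm 3
  fpφ = Ex ((v0 ϵᶠ v2 & v1 ≃ᶠ opᵗ ∅ᵗ v0) or (v0 ϵᶠ v3 & v1 ≃ᶠ opᵗ oneᵗ v0))

fp₂ : Tm 2
fp₂ = ⁅ fpφ ⁆
fpᵗ : Tm n → Tm n → Tm n
fpᵗ t u = fp₂ ⟨ t ◂ u ◂ ⟨⟩ ⟩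

abstract
  flφ : Fm 2
  flφ = opᵗ ∅ᵗ v0 ϵᶠ v1
  frφ : Fm 2
  frφ = opᵗ oneᵗ v0 ϵᶠ v1

fl₁ fr₁ : Tm 1
fl₁ = ⁅ flφ ⁆
fr₁ = ⁅ frφ ⁆

fin-closed₂ : Fm 2
fin-closed₂ = ∅ᵗ ϵᶠ v0 & All (v0 ϵᶠ v1 ⊃ All (v0 ϵᶠ v3 ⊃ adjᵗ v1 v0 ϵᶠ v2))

abstract
  -- Finiteness in the impredicative form, as membership in every family that contains ∅ and is
  -- closed under adjoining elements of a; this is directly an induction principle.
  Finφ : Fm 2
  Finφ = v0 ⊆ᶠ v1 & All (fin-closed₂ ⟪ v0 ◂ v2 ◂ ⟨⟩ ⟫ ⊃ v1 ϵᶠ v0)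

Fin₁ : Tm 1
Fin₁ = ⁅ Finφ ⁆
Finᵗ : Tm n → Tm n
Finᵗ t = Fin₁ ⟨ t ◂ ⟨⟩ ⟩

-- small sets are the images of subsets of H
enum₂ : Fm 2
enum₂ = All (v0 ϵᶠ v2 ⊃ Ex (v0 ϵᶠ Hᵗ & v1 ≃ᶠ appᵗ v2 v0))
small₁ : Fm 1
small₁ = Ex (enum₂ ⟪ v0 ◂ v1 ◂ ⟨⟩ ⟫)

module Small (𝔙 : ZFCModel) where
  open Choice 𝔙 public

  ⟦U⟧ : D → D
  ⟦U⟧ a = ⟦ U₁ ⟧ (a ◂ ⟨⟩)

  level : D → D → D
  level n a = ⟦ level₂ ⟧ (n ◂ a ◂ ⟨⟩)

  abstract
    level-spec : ∀ {n a w} → w ϵ level n a ↔ (¬¬ (w ϵ a ⊎ (¬¬ Σ D λ k → k ϵ n × w ⊆ level k a)))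
    level-spec {n} {a} {w} =
      (λ i → proj₁ r i >>= λ
        { (inj₁ p) → return (inj₁ p)
        ; (inj₂ q) → return (inj₂ (q >>= λ (k , j , l) → return (k , j , λ u m → ϵʳ snd-op (proj₁ 𝒫-spec l u m)))) }) ,
      (λ h → proj₂ r (h >>= λ
        { (inj₁ p) → return (inj₁ p)
        ; (inj₂ q) → return (inj₂ (q >>= λ (k , j , l) → return (k , j , proj₂ 𝒫-spec λ u m → ϵʳ (Qsym snd-op) (l u m)))) }))
      where
      r : w ϵ level n a ↔ (¬¬ (w ϵ a ⊎ (¬¬ Σ D λ k → k ϵ n × w ϵ 𝒫 (snd (op k (level k a))))))
      r = rec-spec v0 (𝒫ᵗ (sndᵗ v0)) a {n} {w}

    U-spec : ∀ {a w} → w ϵ ⟦U⟧ a ↔ (¬¬ Σ D λ n → n ϵ ω × w ϵ level n a)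
    U-spec {a} = cls-bounded¬ do
      b , h ← image-set level₂ (a ◂ ⟨⟩) ω
      return (⋃ b , λ w s → stE (s >>= λ (n , i , j) → return (⋃-in (proj₂ (h _) (return (n , i , Qrefl))) j)))

  module UProps (a : D) (tra : Trans a) where
    level-mono : ∀ {k n} → n ϵ ω → k ϵ n → level k a ⊆ level n a
    level-mono {k} {n} i j w l = proj₂ level-spec (proj₁ level-spec l >>= λ
      { (inj₁ p) → return (inj₁ p)
      ; (inj₂ q) → return (inj₂ (q >>= λ (m , o , s) → return (m , nat-trans i j o , s))) })

    U-base : a ⊆ ⟦U⟧ a
    U-base w i = proj₂ U-spec (return (∅ , 0ϵω , proj₂ level-spec (return (inj₁ i))))

    U-level : ∀ {n w} → n ϵ ω → w ⊆ level n a → w ϵ ⟦U⟧ a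
    U-level {n} i s = proj₂ U-spec (return (succ n , sucϵω i , proj₂ level-spec (return (inj₂ (return (n , adjʳ Qrefl , s))))))

    U-power : ∀ {w} → w ⊆ a → w ϵ ⟦U⟧ a
    U-power s = U-level 0ϵω λ u i → proj₂ level-spec (return (inj₁ (s u i)))

    U-sub : ∀ {w} → w ϵ ⟦U⟧ a → ¬¬ Σ D λ n → n ϵ ω × w ⊆ level n a
    U-sub i = proj₁ U-spec i >>= λ (n , j , k) → proj₁ level-spec k >>= λ
      { (inj₁ p) → return (n , j , λ u l → proj₂ level-spec (return (inj₁ (tra _ p u l))))
      ; (inj₂ q) → q >>= λ (m , o , s) → return (m , ω-trans j o , s) }

    U-trans : Trans (⟦U⟧ a)
    U-trans x i y j = stE (U-sub i >>= λ (n , k , s) → return (proj₂ U-spec (return (n , k , s y j))))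

    U-adj : ∀ {y b} → y ϵ ⟦U⟧ a → b ϵ ⟦U⟧ a → adj y b ϵ ⟦U⟧ a
    U-adj i j = stE do
      n , k , s ← U-sub i
      m , l , b ← proj₁ U-spec j
      o , oω , n<o , m<o ← directed k l
      return (U-level oω λ u c → stE (adj-elim c (λ p → return (level-mono oω n<o u (s u p)))
        λ e → return (level-mono oω m<o u (ϵˡ (Qsym e) b))))

    U-∅ : ∅ ϵ ⟦U⟧ a
    U-∅ = U-level 0ϵω λ u i → ⊥-elim (∅-spec i)

    U-up : ∀ {x y} → x ϵ ⟦U⟧ a → y ϵ ⟦U⟧ a → up x y ϵ ⟦U⟧ a
    U-up {x} {y} i j = ϵˡ (≃ext λ w →
      (λ k → proj₂ up-spec (adj-elim k (λ l → adj-elim l (λ m → ⊥-elim (∅-spec m)) λ e → return (inj₁ e)) λ e → return (inj₂ e))) ,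
      (λ k → stE (proj₁ up-spec k >>= λ { (inj₁ e) → return (adjˡ (adjʳ e)) ; (inj₂ e) → return (adjʳ e) })))
      (U-adj (U-adj U-∅ i) j)

    U-op : ∀ {x y} → x ϵ ⟦U⟧ a → y ϵ ⟦U⟧ a → op x y ϵ ⟦U⟧ a
    U-op i j = ϵˡ (Qsym op-def) (U-up (U-up i i) (U-up i j))

  H J : D
  H = ⟦ H₀ ⟧ ⟨⟩
  J = ⟦ J₀ ⟧ ⟨⟩

  module HU = UProps ω ω-transitive
  module JU = UProps H HU.U-trans

  ω⊆H : ω ⊆ H
  ω⊆H = HU.U-base

  H⊆J : H ⊆ J
  H⊆J = JU.U-base

  J⊆𝒫J : J ⊆ 𝒫 J
  J⊆𝒫J x i = proj₂ 𝒫-spec λ y j → JU.U-trans x i y j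

  ω⊆𝒫J : ω ⊆ 𝒫 J
  ω⊆𝒫J x i = J⊆𝒫J x (H⊆J x (ω⊆H x i))

  one two : D
  one = ⟦ one₀ ⟧ ⟨⟩
  two = ⟦ two₀ ⟧ ⟨⟩

  1ϵω : one ϵ ω
  1ϵω = sucϵω 0ϵω
  2ϵω : two ϵ ω
  2ϵω = sucϵω 1ϵω

  ϵ⇒≄ : ∀ {x y} → x ϵ y → ¬ (x ≃ y)
  ϵ⇒≄ i e = irrefl (ϵʳ (Qsym e) i)

  0≄1 : ¬ (∅ ≃ one)
  0≄1 = ϵ⇒≄ (adjʳ Qrefl)
  1≄2 : ¬ (one ≃ two)
  1≄2 = ϵ⇒≄ (adjʳ Qrefl)

  fp : D → D → D
  fp x y = ⟦ fp₂ ⟧ (x ◂ y ◂ ⟨⟩)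
  fl fr : D → D
  fl x = ⟦ fl₁ ⟧ (x ◂ ⟨⟩)
  fr x = ⟦ fr₁ ⟧ (x ◂ ⟨⟩)

  abstract
    fp-spec : ∀ {x y w} → w ϵ fp x y ↔ (¬¬ Σ D λ j → ¬¬ ((j ϵ x × w ≃ op ∅ j) ⊎ (j ϵ y × w ≃ op one j)))
    fp-spec {x} {y} = cls-bounded (prod (up ∅ one) (x ∪ y)) λ w h → stE (h >>= λ (j , h) → h >>= λ
      { (inj₁ (i , e)) → return (ϵˡ (Qsym e) (prod-in upˡ (∪ˡ i))) ; (inj₂ (i , e)) → return (ϵˡ (Qsym e) (prod-in upʳ (∪ʳ i))) })

    fl-spec : ∀ {a w} → w ϵ fl a ↔ op ∅ w ϵ a
    fl-spec {a} = cls-bounded (⋃ (⋃ a)) λ w i → op-⋃⋃ʳ i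

    fr-spec : ∀ {a w} → w ϵ fr a ↔ op one w ϵ a
    fr-spec {a} = cls-bounded (⋃ (⋃ a)) λ w i → op-⋃⋃ʳ i

  fl-fp : ∀ {x y} → fl (fp x y) ≃ x
  fl-fp = ≃ext λ w →
    (λ i → stE (proj₁ fp-spec (proj₁ fl-spec i) >>= λ (j , h) → h >>= λ
      { (inj₁ (k , e)) → return (ϵˡ (Qsym (op-inj₂ e)) k) ; (inj₂ (k , e)) → ⊥-elim (0≄1 (op-inj₁ e)) })) ,
    (λ i → proj₂ fl-spec (proj₂ fp-spec (return (w , return (inj₁ (i , Qrefl))))))

  fr-fp : ∀ {x y} → fr (fp x y) ≃ y
  fr-fp = ≃ext λ w →
    (λ i → stE (proj₁ fp-spec (proj₁ fr-spec i) >>= λ (j , h) → h >>= λ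
      { (inj₁ (k , e)) → ⊥-elim (0≄1 (Qsym (op-inj₁ e))) ; (inj₂ (k , e)) → return (ϵˡ (Qsym (op-inj₂ e)) k) })) ,
    (λ i → proj₂ fr-spec (proj₂ fp-spec (return (w , return (inj₂ (i , Qrefl))))))

  fl-cong : ∀ {x y} → x ≃ y → fl x ≃ fl y
  fl-cong e = rept fl₁ {⟨⟩} e
  fr-cong : ∀ {x y} → x ≃ y → fr x ≃ fr y
  fr-cong e = rept fr₁ {⟨⟩} e
  fp-cong : ∀ {x y x' y'} → x ≃ x' → y ≃ y' → fp x y ≃ fp x' y'
  fp-cong p q = ⟦⟧-cong fp₂ λ { zero → p ; (suc zero) → q }

  fp-inj₁ : ∀ {x y x' y'} → fp x y ≃ fp x' y' → x ≃ x'
  fp-inj₁ e = Qtr (Qsym fl-fp) (Qtr (fl-cong e) fl-fp)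
  fp-inj₂ : ∀ {x y x' y'} → fp x y ≃ fp x' y' → y ≃ y'
  fp-inj₂ e = Qtr (Qsym fr-fp) (Qtr (fr-cong e) fr-fp)

  fp-𝒫J : ∀ {x y} → x ϵ 𝒫 J → y ϵ 𝒫 J → fp x y ϵ 𝒫 J
  fp-𝒫J i j = proj₂ 𝒫-spec λ w k → stE (proj₁ fp-spec k >>= λ (u , h) → h >>= λ
    { (inj₁ (l , e)) → return (ϵˡ (Qsym e) (JU.U-op JU.U-∅ (proj₁ 𝒫-spec i u l)))
    ; (inj₂ (l , e)) → return (ϵˡ (Qsym e) (JU.U-op (H⊆J _ (ω⊆H _ 1ϵω)) (proj₁ 𝒫-spec j u l))) })

  J-op : ∀ {x y} → op x y ϵ J → x ϵ J × y ϵ J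
  J-op i = JU.U-trans _ (JU.U-trans _ i _ opʳ) _ upˡ , JU.U-trans _ (JU.U-trans _ i _ opʳ) _ upʳ

  fl-𝒫J : ∀ {a} → a ϵ 𝒫 J → fl a ϵ 𝒫 J
  fl-𝒫J i = proj₂ 𝒫-spec λ w j → proj₂ (J-op (proj₁ 𝒫-spec i _ (proj₁ fl-spec j)))
  fr-𝒫J : ∀ {a} → a ϵ 𝒫 J → fr a ϵ 𝒫 J
  fr-𝒫J i = proj₂ 𝒫-spec λ w j → proj₂ (J-op (proj₁ 𝒫-spec i _ (proj₁ fr-spec j)))

  ⟦Fin⟧ : D → D
  ⟦Fin⟧ a = ⟦ Fin₁ ⟧ (a ◂ ⟨⟩)

  abstract
    Fin-spec : ∀ {a w} → w ϵ ⟦Fin⟧ a ↔ (w ⊆ a × (∀ K → S fin-closed₂ (K ◂ a ◂ ⟨⟩) → w ϵ K))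
    Fin-spec {a} = cls-bounded (𝒫 a) λ w p → proj₂ 𝒫-spec (proj₁ p)

  Fin-⊆ : ∀ {a y} → y ϵ ⟦Fin⟧ a → y ⊆ a
  Fin-⊆ i = proj₁ (proj₁ Fin-spec i)

  Fin-∅ : ∀ {a} → ∅ ϵ ⟦Fin⟧ a
  Fin-∅ = proj₂ Fin-spec ((λ w i → ⊥-elim (∅-spec i)) , λ K c → proj₁ c)

  Fin-adj : ∀ {a y b} → y ϵ ⟦Fin⟧ a → b ϵ a → adj y b ϵ ⟦Fin⟧ a
  Fin-adj i j = proj₂ Fin-spec ((λ w k → stE (adj-elim k (λ l → return (Fin-⊆ i w l)) λ e → return (ϵˡ (Qsym e) j))) ,
    λ K c → proj₂ c _ (proj₂ (proj₁ Fin-spec i) K c) _ j)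

  Fin-ind : (φ : Fm (suc n)) (ρ : Vec D n) (a : D) → S φ (∅ ◂ ρ) →
            (∀ y b → y ϵ ⟦Fin⟧ a → b ϵ a → S φ (y ◂ ρ) → S φ (adj y b ◂ ρ)) → ∀ {y} → y ϵ ⟦Fin⟧ a → S φ (y ◂ ρ)
  Fin-ind φ ρ a z s {y} i = stS φ do
    K , h ← separate φ ρ (⟦Fin⟧ a)
    return (proj₂ (proj₁ (h y) (proj₂ (proj₁ Fin-spec i) K (proj₂ (h ∅) (Fin-∅ , z) ,
      λ y j b k → let l , p = proj₁ (h y) j in proj₂ (h _) (Fin-adj l k , s y b l k p)))))

  Fin-∪ : ∀ {a p q} → p ϵ ⟦Fin⟧ a → q ϵ ⟦Fin⟧ a → p ∪ q ϵ ⟦Fin⟧ a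
  Fin-∪ {a} {p} i = Fin-ind (∪ᵗ v1 v0 ϵᶠ Finᵗ v2) (p ◂ a ◂ ⟨⟩) a
    (ϵˡ (≃ext λ w → ∪ˡ , λ j → stE (∪-elim j return λ k → ⊥-elim (∅-spec k))) i)
    λ y b _ j h → ϵˡ (≃ext λ w →
      (λ k → stE (adj-elim k (λ l → ∪-elim l (λ m → return (∪ˡ m)) λ m → return (∪ʳ (adjˡ m))) λ e → return (∪ʳ (adjʳ e)))) ,
      (λ k → stE (∪-elim k (λ l → return (adjˡ (∪ˡ l))) λ l → adj-elim l (λ m → return (adjˡ (∪ʳ m))) λ e → return (adjʳ e)))) (Fin-adj h j)

  Enum : D → D → Set
  Enum f a = ∀ x → x ϵ a → ¬¬ Σ D λ h → h ϵ H × x ≃ f · h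

  Sm : D → Set
  Sm a = ¬¬ Σ D λ f → Enum f a

  Sm-⊆ : ∀ {a b} → a ⊆ b → Sm b → Sm a
  Sm-⊆ s h = h >>= λ (f , e) → return (f , λ x i → e x (s x i))

  Sm-image : (t : Tm (suc n)) (ρ : Vec D n) {a b : D} → Sm a → (∀ y → y ϵ b → ¬¬ Σ D λ x → x ϵ a × y ≃ ⟦ t ⟧ (x ◂ ρ)) → Sm b
  Sm-image t ρ sa im = do
    f , e ← sa
    f' , h ← lambda (t ⟨ appᵗ v1 v0 ◂ vars ↑²_ ⟩) (f ◂ ρ) H
    return (f' , λ y i → do
      x , j , q ← im y i
      k , l , r ← e x j
      return (k , l , Qtr q (Qtr (⟦⟧-cong t (λ { zero → r ; (suc i) → Qsym (vars-ok ↑²_ (k ◂ f ◂ ρ) i) })) (Qsym (h k l)))))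

  Sm-H : Sm H
  Sm-H = lambda v0 ⟨⟩ H >>= λ (f , h) → return (f , λ x i → return (x , i , Qsym (h x i)))

  Sm-ω : Sm ω
  Sm-ω = Sm-⊆ ω⊆H Sm-H

  Sm-prod : ∀ {a b} → Sm a → Sm b → Sm (prod a b)
  Sm-prod sa sb = do
    f , e ← sa
    f' , e' ← sb
    F , h ← lambda (opᵗ (appᵗ v1 (fstᵗ v0)) (appᵗ v2 (sndᵗ v0))) (f ◂ f' ◂ ⟨⟩) H
    return (F , λ w i → do
      x , i ← proj₁ prod-spec i
      y , j , k , q ← i
      hx , l , r ← e x j
      hy , m , s ← e' y k
      return (op hx hy , HU.U-op l m , Qtr q (Qsym (Qtr (h _ (HU.U-op l m)) (op-cong
        (Qsym (Qtr r (rept (appᵗ v1 v0) {f ◂ ⟨⟩} (Qsym fst-op)))) (Qsym (Qtr s (rept (appᵗ v1 v0) {f' ◂ ⟨⟩} (Qsym snd-op)))))))))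

  -- A pair of codes in H is again in H: its first component selects a member of a, its second an
  -- element of that member in an enumeration supplied by `skolem`.
  Sm-⋃ : ∀ {a} → Sm a → (∀ x → x ϵ a → Sm x) → Sm (⋃ a)
  Sm-⋃ {a} sa sx = do
    f , e ← sa
    F , hF ← skolem (enum₂ ⟪ v0 ◂ v1 ◂ ⟨⟩ ⟫) ⟨⟩ a sx
    f' , h ← lambda (appᵗ (appᵗ v2 (appᵗ v1 (fstᵗ v0))) (sndᵗ v0)) (f ◂ F ◂ ⟨⟩) H
    return (f' , λ w i → do
      x , j , k ← proj₁ ⋃-spec i
      hx , l , r ← e x j
      hw , m , s ← hF x j w k
      return (op hx hw , HU.U-op l m , Qtr s (Qsym (Qtr (h _ (HU.U-op l m))
        (⟦⟧-cong app₂ {F · (f · fst (op hx hw)) ◂ snd (op hx hw) ◂ ⟨⟩} {F · x ◂ hw ◂ ⟨⟩}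
          λ { zero → rept (appᵗ v1 v0) {F ◂ ⟨⟩} (Qtr (rept (appᵗ v1 v0) {f ◂ ⟨⟩} fst-op) (Qsym r)) ; (suc zero) → snd-op })))))

  -- ∅ is not a pair and can therefore code the new element, while the pairs `op ∅ k` code the old
  -- ones.
  Sm-adj : ∀ {a b} → Sm a → Sm (adj a b)
  Sm-adj {a} {b} sa = do
    f , e ← sa
    f' , h ← lambda t (f ◂ b ◂ ⟨⟩) H
    return (f' , λ x i → adj-elim i
      (λ j → e x j >>= λ (k , l , r) → return (op ∅ k , HU.U-op HU.U-∅ l , Qtr r (Qsym (Qtr (h _ (HU.U-op HU.U-∅ l)) (≃ext λ w →
        (λ m → stE (proj₁ sp m >>= λ { (inj₁ (z , _)) → ⊥-elim (∅-spec (ϵʳ z opˡ)) ; (inj₂ (_ , o)) → return (ϵʳ (rept (appᵗ v1 v0) {f ◂ ⟨⟩} snd-op) o) })) ,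
        (λ m → proj₂ sp (return (inj₂ ((λ z → ∅-spec (ϵʳ z opˡ)) , ϵʳ (rept (appᵗ v1 v0) {f ◂ ⟨⟩} (Qsym snd-op)) m)))))))))
      λ q → return (∅ , HU.U-∅ , Qtr q (Qsym (Qtr (h _ HU.U-∅) (≃ext λ w →
        (λ m → stE (proj₁ sp m >>= λ { (inj₁ (_ , o)) → return o ; (inj₂ (z , _)) → ⊥-elim (z Qrefl) })) ,
        (λ m → proj₂ sp (return (inj₁ (Qrefl , m)))))))))
    where
    t : Tm 3
    t = ⁅ (v1 ≃ᶠ ∅ᵗ & v0 ϵᶠ v3) or (negᶠ (v1 ≃ᶠ ∅ᵗ) & v0 ϵᶠ appᵗ v2 (sndᵗ v1)) ⁆
    sp : ∀ {f x w} → w ϵ ⟦ t ⟧ (x ◂ f ◂ b ◂ ⟨⟩) ↔ (¬¬ ((x ≃ ∅ × w ϵ b) ⊎ (¬ (x ≃ ∅) × w ϵ f · snd x)))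
    sp {f} {x} = cls-bounded (b ∪ (f · snd x)) λ w h → stE (h >>= λ { (inj₁ (_ , i)) → return (∪ˡ i) ; (inj₂ (_ , i)) → return (∪ʳ i) })

  Sm-∅ : Sm ∅
  Sm-∅ = return (∅ , λ x i → ⊥-elim (∅-spec i))

  Sm-∪ : ∀ {a b} → Sm a → Sm b → Sm (a ∪ b)
  Sm-∪ {a} {b} sa sb = Sm-⊆ (λ w i → stE (∪-elim i (λ j → return (⋃-in (adjˡ (adjʳ Qrefl)) j)) λ j → return (⋃-in (adjʳ Qrefl) j)))
    (Sm-⋃ {adj (adj ∅ a) b} (Sm-adj (Sm-adj Sm-∅)) λ x i → adj-elim i
      (λ j → adj-elim j (λ k → ⊥-elim (∅-spec k)) λ e → Sm-⊆ (≃⇒⊆ e) sa) λ e → Sm-⊆ (≃⇒⊆ e) sb)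

  Sm-finite : ∀ {a y} → y ϵ ⟦Fin⟧ a → Sm y
  Sm-finite {a} = Fin-ind small₁ ⟨⟩ a Sm-∅ λ y b _ _ h → Sm-adj h

  -- A finite subset of a is the image of a finite set of codes, and such a set is itself an element
  -- of H because H is closed under adjunction.
  Sm-Fin : ∀ {a} → Sm a → Sm (⟦Fin⟧ a)
  Sm-Fin {a} sa = do
    f , e ← sa
    F , h ← lambda t (f ◂ ⟨⟩) H
    return (F , λ y i → Fin-ind (Ex (v0 ϵᶠ Hᵗ & v1 ≃ᶠ t ⟨ v0 ◂ v2 ◂ ⟨⟩ ⟩)) (f ◂ ⟨⟩) a
      (return (∅ , HU.U-∅ , ≃ext λ w → (λ j → ⊥-elim (∅-spec j)) , λ j → ⊥-elim (proj₁ sp j λ (k , l , _) → ∅-spec l)))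
      (λ y b _ j h → do
        u , uH , q ← h
        k , kH , r ← e b j
        return (adj u k , HU.U-adj uH kH , ≃ext λ w →
          (λ i → proj₂ sp (adj-elim i (λ m → proj₁ sp (ϵʳ q m) >>= λ (z , o , p) → return (z , adjˡ o , p)) λ p → return (k , adjʳ Qrefl , Qtr p r))) ,
          (λ i → stE (proj₁ sp i >>= λ (z , o , p) → adj-elim o (λ m → return (adjˡ (ϵʳ (Qsym q) (proj₂ sp (return (z , m , p))))))
            λ s → return (adjʳ (Qtr p (Qtr (rept (appᵗ v1 v0) {f ◂ ⟨⟩} s) (Qsym r))))))))
      i >>= λ (k , l , q) → return (k , l , Qtr q (Qsym (h k l))))
    where
    t : Tm 2
    t = ⁅ Ex (v0 ϵᶠ v2 & v1 ≃ᶠ appᵗ v3 v0) ⁆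
    sp : ∀ {f x w} → w ϵ ⟦ t ⟧ (x ◂ f ◂ ⟨⟩) ↔ (¬¬ Σ D λ k → k ϵ x × w ≃ f · k)
    sp {f} {x} = cls-bounded¬ (image-set (appᵗ v1 v0) (f ◂ ⟨⟩) x >>= λ (b , h) → return (b , λ w s → proj₂ (h w) s))

  -- Cantor's diagonal set is a subset of H and hence an element of J.
  ¬Sm-J : ¬ Sm J
  ¬Sm-J s = s λ (f , e) → separate (negᶠ (v0 ϵᶠ appᵗ v1 v0)) (f ◂ ⟨⟩) H λ (d , h) →
    e d (JU.U-power λ w i → proj₁ (proj₁ (h w) i)) λ (k , l , q) →
      em (k ϵ d) λ { (inj₁ i) → proj₂ (proj₁ (h k) i) (ϵʳ q i) ; (inj₂ n) → n (proj₂ (h k) (l , λ i → n (ϵʳ (Qsym q) i))) }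

-- The poset of conditions

three₀ : Tm 0
three₀ = sucᵗ two₀
threeᵗ : Tm n
threeᵗ = three₀ ⟨ ⟨⟩ ⟩

-- The tags used are 1, 2 and 3. They are nonempty sets, so no proper atom is ∅, and ∅ can occur in
-- a code as padding that never causes a clash.
atᵗ : Tm n → Tm n → Tm n → Tm n → Tm n
atᵗ t x y z = fpᵗ t (fpᵗ x (fpᵗ y z))

-- Atoms of information: "the m-th digit of the generic function ξ is b", "m belongs
-- to the n-th set of the code K", and the promise "no m in the n-th set of K has both
-- m and m + 1 in the generic set ξ".
dgᵗ cdᵗ prᵗ : Tm n → Tm n → Tm n → Tm n
dgᵗ = atᵗ oneᵗ
cdᵗ = atᵗ twoᵗ
prᵗ = atᵗ threeᵗ

clash₁ : Fm 1
clash₁ = Ex (Ex (Ex (Ex (dgᵗ v3 v2 v1 ϵᶠ v4 & dgᵗ v3 v2 v0 ϵᶠ v4 & negᶠ (v1 ≃ᶠ v0))))) or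
         Ex (Ex (Ex (Ex (cdᵗ v3 v2 v0 ϵᶠ v4 & prᵗ v3 v1 v2 ϵᶠ v4 & dgᵗ v1 v0 oneᵗ ϵᶠ v4 & dgᵗ v1 (sucᵗ v0) oneᵗ ϵᶠ v4))))

-- A code K ⊆ J lists, for ξ ∈ J and h ∈ H, a set dec K ξ h of atoms; it is used as the
-- name of { ξ : some dec K ξ h is contained in the generic filter }.
abstract
  secφ : Fm 5
  secφ = v0 ϵᶠ Jᵗ & opᵗ (opᵗ v2 v3) (opᵗ v4 v0) ϵᶠ v1

sec₄ : Tm 4
sec₄ = ⁅ secφ ⁆

abstract
  -- An atom is a subset of J and need not be an element of it, so K lists an atom through its
  -- elements: h' ∈ H numbers the atoms for ξ and h, and `sec₄` is the atom with number h'. A number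
  -- without entries contributes ∅.
  decφ : Fm 4
  decφ = Ex (v0 ϵᶠ Hᵗ & v1 ≃ᶠ sec₄ ⟨ v2 ◂ v3 ◂ v4 ◂ v0 ◂ ⟨⟩ ⟩)

dec₃ : Tm 3
dec₃ = ⁅ decφ ⁆

-- A promise about ξ and K is legal if the condition excludes every dec K ξ h.  Since
-- exclusion is a finitary matter this definition is not recursive, although K may
-- itself mention atoms involving K.
legal₁ good₁ : Fm 1
legal₁ = All (All (All (prᵗ v2 v1 v0 ϵᶠ v3 ⊃ All (v0 ϵᶠ Hᵗ ⊃ clash₁ ⟪ ∪ᵗ v4 (dec₃ ⟨ v3 ◂ v2 ◂ v0 ◂ ⟨⟩ ⟩) ◂ ⟨⟩ ⟫))))
-- Digits and code entries are confined to H so that a small set of indices admits only a small set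
-- of such atoms.
good₁ = All (All (All ((dgᵗ v2 v1 v0 ϵᶠ v3 or cdᵗ v2 v1 v0 ϵᶠ v3) ⊃ v1 ϵᶠ Hᵗ & v0 ϵᶠ Hᵗ)))

abstract
  Pφ : Fm 1
  Pφ = v0 ϵᶠ Finᵗ (𝒫ᵗ Jᵗ) & negᶠ (clash₁ ⟪ v0 ◂ ⟨⟩ ⟫) & legal₁ ⟪ v0 ◂ ⟨⟩ ⟫ & good₁ ⟪ v0 ◂ ⟨⟩ ⟫

P₀ : Tm 0
P₀ = ⁅ Pφ ⁆

module Poset (𝔙 : ZFCModel) where
  open Small 𝔙 public

  three : D
  three = ⟦ three₀ ⟧ ⟨⟩
  3ϵω : three ϵ ω
  3ϵω = sucϵω 2ϵω

  1≄3 : ¬ (one ≃ three)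
  1≄3 = ϵ⇒≄ (adjˡ (adjʳ Qrefl))
  2≄3 : ¬ (two ≃ three)
  2≄3 = ϵ⇒≄ (adjʳ Qrefl)

  at : D → D → D → D → D
  at t x y z = fp t (fp x (fp y z))
  dg cd pr : D → D → D → D
  dg = at one
  cd = at two
  pr = at three

  at-inj : ∀ {t x y z t' x' y' z'} → at t x y z ≃ at t' x' y' z' → t ≃ t' × x ≃ x' × y ≃ y' × z ≃ z'
  at-inj e = fp-inj₁ e , fp-inj₁ (fp-inj₂ e) , fp-inj₁ (fp-inj₂ (fp-inj₂ e)) , fp-inj₂ (fp-inj₂ (fp-inj₂ e))

  at-cong : ∀ {t t' x x' y y' z z'} → t ≃ t' → x ≃ x' → y ≃ y' → z ≃ z' → at t x y z ≃ at t' x' y' z'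
  at-cong e f g h = fp-cong e (fp-cong f (fp-cong g h))

  at-ϵ : ∀ {p t x x' y y' z z'} → x ≃ x' → y ≃ y' → z ≃ z' → at t x y z ϵ p → at t x' y' z' ϵ p
  at-ϵ f g h i = ϵˡ (at-cong Qrefl f g h) i

  at-𝒫J : ∀ {t x y z} → t ϵ ω → x ϵ 𝒫 J → y ϵ 𝒫 J → z ϵ 𝒫 J → at t x y z ϵ 𝒫 J
  at-𝒫J i j k l = fp-𝒫J (ω⊆𝒫J _ i) (fp-𝒫J j (fp-𝒫J k l))

  H⊆𝒫J : H ⊆ 𝒫 J
  H⊆𝒫J x i = J⊆𝒫J x (H⊆J x i)

  Clash : D → Set
  Clash p = S clash₁ (p ◂ ⟨⟩)

  dec : D → D → D → D
  dec K ξ h = ⟦ dec₃ ⟧ (K ◂ ξ ◂ h ◂ ⟨⟩)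

  Func Kept Legal Good : D → Set
  Func p = ∀ ξ m b b' → dg ξ m b ϵ p → dg ξ m b' ϵ p → b ≃ b'
  Kept p = ∀ K n ξ m → cd K n m ϵ p → pr K ξ n ϵ p → dg ξ m one ϵ p → ¬ (dg ξ (succ m) one ϵ p)
  Legal p = ∀ K ξ n → pr K ξ n ϵ p → ∀ h → h ϵ H → Clash (p ∪ dec K ξ h)
  Good p = ∀ x y z → ¬¬ (dg x y z ϵ p ⊎ cd x y z ϵ p) → y ϵ H × z ϵ H

  free : ∀ {p} → ¬ Clash p → Func p × Kept p
  free nc = (λ ξ m b b' i j → stQ λ n → nc (return (inj₁ (return (ξ , return (m , return (b , return (b' , i , j , n)))))))) ,
            (λ K n ξ m i j k l → nc (return (inj₂ (return (K , return (n , return (ξ , return (m , i , j , k , l))))))))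

  unclash : ∀ {p} → Func p → Kept p → ¬ Clash p
  unclash f k c = c λ
    { (inj₁ h) → h λ (ξ , h) → h λ (m , h) → h λ (b , h) → h λ (b' , i , j , n) → n (f ξ m b b' i j)
    ; (inj₂ h) → h λ (K , h) → h λ (n , h) → h λ (ξ , h) → h λ (m , i , j , l , o) → k K n ξ m i j l o }

  clash-atoms : ∀ {p q} → (∀ t x y z → ¬ (t ≃ ∅) → at t x y z ϵ p → at t x y z ϵ q) → Clash p → Clash q
  clash-atoms {p} {q} s c = stS clash₁ {q ◂ ⟨⟩} λ nc → let f , k = free {q} nc in
    unclash {p} (λ ξ m b b' i j → f ξ m b b' (s _ _ _ _ ≄0 i) (s _ _ _ _ ≄0 j))
      (λ K n ξ m i j l o → k K n ξ m (s _ _ _ _ ≄0 i) (s _ _ _ _ ≄0 j) (s _ _ _ _ ≄0 l) (s _ _ _ _ ≄0 o)) c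
    where
    ≄0 : ∀ {x} → ¬ (succ x ≃ ∅)
    ≄0 e = ∅-spec (ϵʳ e (adjʳ Qrefl))

  clash-mono : ∀ {p q} → p ⊆ q → Clash p → Clash q
  clash-mono s = clash-atoms λ _ _ _ _ _ → s _

  𝔓 : D
  𝔓 = ⟦ P₀ ⟧ ⟨⟩

  abstract
    P-spec : ∀ {p} → p ϵ 𝔓 ↔ (p ϵ ⟦Fin⟧ (𝒫 J) × ¬ Clash p × Legal p × Good p)
    P-spec = cls-bounded (⟦Fin⟧ (𝒫 J)) λ w → proj₁

    dec-spec : ∀ {K ξ h w} → w ϵ dec K ξ h ↔ (¬¬ Σ D λ h' → h' ϵ H × w ≃ ⟦ sec₄ ⟧ (K ◂ ξ ◂ h ◂ h' ◂ ⟨⟩))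
    dec-spec {K} {ξ} {h} = cls-bounded¬ (image-set (sec₄ ⟨ v1 ◂ v2 ◂ v3 ◂ v0 ◂ ⟨⟩ ⟩) (K ◂ ξ ◂ h ◂ ⟨⟩) H >>= λ (b , k) →
      return (b , λ w s → proj₂ (k w) s))

    sec-spec : ∀ {K ξ h h' w} → w ϵ ⟦ sec₄ ⟧ (K ◂ ξ ◂ h ◂ h' ◂ ⟨⟩) ↔ (w ϵ J × op (op ξ h) (op h' w) ϵ K)
    sec-spec = cls-bounded J λ w → proj₁

  ∪-mono : ∀ {x y z} → x ⊆ y → x ∪ z ⊆ y ∪ z
  ∪-mono s w i = stE (∪-elim i (λ j → return (∪ˡ (s w j))) λ j → return (∪ʳ j))

  P-∅ : ∅ ϵ 𝔓
  P-∅ = proj₂ P-spec (Fin-∅ , unclash (λ _ _ _ _ i → ⊥-elim (∅-spec i)) (λ _ _ _ _ i → ⊥-elim (∅-spec i)) ,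
    (λ _ _ _ i → ⊥-elim (∅-spec i)) , λ _ _ _ h → ⊥-elim (h λ { (inj₁ i) → ∅-spec i ; (inj₂ i) → ∅-spec i }))

  -- Clashes persist under enlargement, so legal promises stay legal in a union. Two conditions are
  -- thus incompatible only if their union clashes.
  P-∪ : ∀ {p q} → p ϵ 𝔓 → q ϵ 𝔓 → ¬ Clash (p ∪ q) → p ∪ q ϵ 𝔓
  P-∪ {p} {q} i j nc = let f , _ , l , g = proj₁ P-spec i ; f' , _ , l' , g' = proj₁ P-spec j in
    proj₂ P-spec (Fin-∪ f f' , nc ,
      (λ K ξ n k h hH → stS clash₁ {(p ∪ q) ∪ dec K ξ h ◂ ⟨⟩} (∪-elim k
        (λ k → return (clash-mono (∪-mono λ _ → ∪ˡ) (l K ξ n k h hH))) λ k → return (clash-mono (∪-mono λ _ → ∪ʳ) (l' K ξ n k h hH)))) ,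
      λ x y z h → stS (v0 ϵᶠ Hᵗ & v1 ϵᶠ Hᵗ) {y ◂ z ◂ ⟨⟩} (h >>= λ
        { (inj₁ k) → ∪-elim k (λ k → return (g x y z (return (inj₁ k)))) λ k → return (g' x y z (return (inj₁ k)))
        ; (inj₂ k) → ∪-elim k (λ k → return (g x y z (return (inj₂ k)))) λ k → return (g' x y z (return (inj₂ k))) }))

  adj-at : ∀ {p t x y z t' x' y' z'} → ¬ (t ≃ t') → at t x y z ϵ adj p (at t' x' y' z') → at t x y z ϵ p
  adj-at n i = stE (adj-elim i return λ e → ⊥-elim (n (proj₁ (at-inj e))))

  -- A promise watches adjacent digits, so a new digit at l can complete a forbidden pattern with
  -- the digit at l + 1 or with the one at l - 1; the last two hypotheses exclude one case each.
  add-dg : ∀ {p ξ l b} → p ϵ 𝔓 → ξ ϵ 𝒫 J → l ϵ ω → b ϵ H → (∀ b' → ¬ (dg ξ l b' ϵ p)) →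
           (∀ K n → cd K n l ϵ p → pr K ξ n ϵ p → ¬ (dg ξ (succ l) one ϵ p)) →
           (∀ K n m → succ m ≃ l → cd K n m ϵ p → pr K ξ n ϵ p → ¬ (dg ξ m one ϵ p)) → adj p (dg ξ l b) ϵ 𝔓
  add-dg {p} {ξ} {l} {b} i ξJ lω bH new up dn = let f , nc , le , go = proj₁ P-spec i ; fu , ke = free {p} nc in
    proj₂ P-spec (Fin-adj f (at-𝒫J 1ϵω ξJ (ω⊆𝒫J _ lω) (H⊆𝒫J _ bH)) ,
      unclash
        (λ ξ' m c c' j k → stQ (adj-elim j
          (λ j → adj-elim k (λ k → return (fu ξ' m c c' j k))
            λ e → let _ , p , q , _ = at-inj e in ⊥-elim (new c (at-ϵ p q Qrefl j)))
          λ e → adj-elim k (λ k → let _ , p , q , _ = at-inj e in ⊥-elim (new c' (at-ϵ p q Qrefl k)))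
            λ e' → let _ , _ , _ , r = at-inj e ; _ , _ , _ , r' = at-inj e' in return (Qtr r (Qsym r'))))
        (λ K n ξ' m j k u w → let j = adj-at 2≄1 j ; k = adj-at 3≄1 k in adj-elim u
          (λ u → adj-elim w (λ w → ⊥-elim (ke K n ξ' m j k u w))
            λ e → let _ , p , q , _ = at-inj e in ⊥-elim (dn K n m q j (at-ϵ Qrefl p Qrefl k) (at-ϵ p Qrefl Qrefl u)))
          (λ e → let _ , p , q , _ = at-inj e in adj-elim w
            (λ w → ⊥-elim (up K n (at-ϵ Qrefl Qrefl q j) (at-ϵ Qrefl p Qrefl k) (at-ϵ p (succ-cong q) Qrefl w)))
            λ e' → let _ , _ , q' , _ = at-inj e' in ⊥-elim (irrefl (ϵʳ (Qtr q' (Qsym q)) (adjʳ Qrefl)))) λ b → b) ,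
      (λ K ξ' n j h hH → clash-mono (∪-mono λ _ → adjˡ) (le K ξ' n (adj-at 3≄1 j) h hH)) ,
      λ x y z h → stS (v0 ϵᶠ Hᵗ & v1 ϵᶠ Hᵗ) {y ◂ z ◂ ⟨⟩} (h >>= λ
        { (inj₁ k) → adj-elim k (λ k → return (go x y z (return (inj₁ k)))) λ e → let _ , _ , q , r = at-inj e in
            return (ϵˡ (Qsym q) (ω⊆H _ lω) , ϵˡ (Qsym r) bH)
        ; (inj₂ k) → return (go x y z (return (inj₂ (adj-at 2≄1 k)))) }))
    where
    2≄1 : ¬ (two ≃ one)
    2≄1 e = 1≄2 (Qsym e)
    3≄1 : ¬ (three ≃ one)
    3≄1 e = 1≄3 (Qsym e)

  add-cd : ∀ {p K n m} → p ϵ 𝔓 → K ϵ 𝒫 J → n ϵ ω → m ϵ ω → (∀ ξ → pr K ξ n ϵ p → ¬ (dg ξ m one ϵ p)) → adj p (cd K n m) ϵ 𝔓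
  add-cd {p} {K} {n} {m} i KJ nω mω ok = let f , nc , le , go = proj₁ P-spec i ; fu , ke = free {p} nc in
    proj₂ P-spec (Fin-adj f (at-𝒫J 2ϵω KJ (ω⊆𝒫J _ nω) (ω⊆𝒫J _ mω)) ,
      unclash (λ ξ m' b b' j k → fu ξ m' b b' (adj-at 1≄2 j) (adj-at 1≄2 k))
        (λ K' n' ξ m' j k u w → let k = adj-at 3≄2 k ; u = adj-at 1≄2 u ; w = adj-at 1≄2 w in
          adj-elim j (λ j → ⊥-elim (ke K' n' ξ m' j k u w))
            (λ e → let _ , p , q , r = at-inj e in ⊥-elim (ok ξ (at-ϵ p Qrefl q k) (at-ϵ Qrefl r Qrefl u))) λ b → b) ,
      (λ K ξ' n j h hH → clash-mono (∪-mono λ _ → adjˡ) (le K ξ' n (adj-at 3≄2 j) h hH)) ,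
      λ x y z h → stS (v0 ϵᶠ Hᵗ & v1 ϵᶠ Hᵗ) {y ◂ z ◂ ⟨⟩} (h >>= λ
        { (inj₁ k) → return (go x y z (return (inj₁ (adj-at 1≄2 k))))
        ; (inj₂ k) → adj-elim k (λ k → return (go x y z (return (inj₂ k)))) λ e → let _ , _ , q , r = at-inj e in
            return (ϵˡ (Qsym q) (ω⊆H _ nω) , ϵˡ (Qsym r) (ω⊆H _ mω)) }))
    where
    3≄2 : ¬ (three ≃ two)
    3≄2 e = 2≄3 (Qsym e)

  add-pr : ∀ {p K ξ n} → p ϵ 𝔓 → K ϵ 𝒫 J → ξ ϵ 𝒫 J → n ϵ ω → (∀ m → ¬ (cd K n m ϵ p)) →
           (∀ h → h ϵ H → Clash (p ∪ dec K ξ h)) → adj p (pr K ξ n) ϵ 𝔓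
  add-pr {p} {K} {ξ} {n} i KJ ξJ nω new leg = let f , nc , le , go = proj₁ P-spec i ; fu , ke = free {p} nc in
    proj₂ P-spec (Fin-adj f (at-𝒫J 3ϵω KJ ξJ (ω⊆𝒫J _ nω)) ,
      unclash (λ ξ m' b b' j k → fu ξ m' b b' (adj-at 1≄3 j) (adj-at 1≄3 k))
        (λ K' n' ξ m' j k u w → let j = adj-at 2≄3 j ; u = adj-at 1≄3 u ; w = adj-at 1≄3 w in
          adj-elim k (λ k → ⊥-elim (ke K' n' ξ m' j k u w))
            (λ e → let _ , p , q , r = at-inj e in ⊥-elim (new m' (at-ϵ p r Qrefl j))) λ b → b) ,
      (λ K' ξ' n' j h hH → clash-mono (∪-mono λ _ → adjˡ) (stS clash₁ {p ∪ dec K' ξ' h ◂ ⟨⟩} (adj-elim j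
        (λ j → return (le K' ξ' n' j h hH))
        λ e → let _ , q , r , _ = at-inj e in return (clash-mono
          (λ w u → stE (∪-elim u (λ u → return (∪ˡ u)) λ u → return (∪ʳ (ϵʳ (⟦⟧-cong dec₃ {K ◂ ξ ◂ h ◂ ⟨⟩} {K' ◂ ξ' ◂ h ◂ ⟨⟩}
            λ { zero → Qsym q ; (suc zero) → Qsym r ; (suc (suc zero)) → Qrefl }) u)))) (leg h hH))))) ,
      λ x y z h → go x y z (h >>= λ { (inj₁ k) → return (inj₁ (adj-at 1≄3 k)) ; (inj₂ k) → return (inj₂ (adj-at 2≄3 k)) }))

  -- The bound is put on successors so that not only l and l + 1 but also l - 1 is absent from p; a
  -- digit at l then has no decided neighbour.
  fresh : ∀ {p k} → p ϵ ⟦Fin⟧ (𝒫 J) → k ϵ ω → ¬¬ Σ D λ l → l ϵ ω × k ϵ l ×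
          (∀ t x y z → at t x y z ϵ p → (y ϵ ω → succ y ϵ l) × (z ϵ ω → succ z ϵ l))
  fresh {p} {k} i kω = Fin-ind φ (k ◂ ⟨⟩) (𝒫 J)
    (return (succ k , sucϵω kω , adjʳ Qrefl , λ _ _ _ _ j → ⊥-elim (∅-spec j)))
    (λ q a _ _ h → do
      l , lω , kl , b ← h
      l₁ , l₁ω , ll₁ , c ← bound l (ay a) lω
      l₂ , l₂ω , ll₂ , d ← bound l₁ (az a) l₁ω
      return (l₂ , l₂ω , nat-trans l₂ω ll₂ (nat-trans l₁ω ll₁ kl) , λ t x y z j →
        (λ yω → stE (adj-elim j (λ j → return (nat-trans l₂ω ll₂ (nat-trans l₁ω ll₁ (proj₁ (b t x y z j) yω))))
          λ e → let q = ay-at e in return (nat-trans l₂ω ll₂ (ϵˡ (succ-cong (Qsym q)) (c (ϵˡ q yω)))))) ,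
        (λ zω → stE (adj-elim j (λ j → return (nat-trans l₂ω ll₂ (nat-trans l₁ω ll₁ (proj₂ (b t x y z j) zω))))
          λ e → let q = az-at e in return (ϵˡ (succ-cong (Qsym q)) (d (ϵˡ q zω)))))))
    i
    where
    ay az : D → D
    ay a = fl (fr (fr a))
    az a = fr (fr (fr a))
    ay-at : ∀ {t x y z a} → at t x y z ≃ a → y ≃ ay a
    ay-at e = Qtr (Qsym fl-fp) (fl-cong (Qtr (Qsym fr-fp) (fr-cong (Qtr (Qsym fr-fp) (fr-cong e)))))
    az-at : ∀ {t x y z a} → at t x y z ≃ a → z ≃ az a
    az-at e = Qtr (Qsym fr-fp) (fr-cong (Qtr (Qsym fr-fp) (fr-cong (Qtr (Qsym fr-fp) (fr-cong e)))))
    bound : ∀ l y → l ϵ ω → ¬¬ Σ D λ l' → l' ϵ ω × l ϵ l' × (y ϵ ω → succ y ϵ l')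
    bound l y lω = em (y ϵ ω) >>= λ
      { (inj₁ yω) → directed lω (sucϵω yω) >>= λ (l' , i , j , k) → return (l' , i , j , λ _ → k)
      ; (inj₂ n) → return (succ l , sucϵω lω , adjʳ Qrefl , λ yω → ⊥-elim (n yω)) }
    φ : Fm 2
    φ = Ex (v0 ϵᶠ ωᵗ & v2 ϵᶠ v0 & All (All (All (All (atᵗ v3 v2 v1 v0 ϵᶠ v5 ⊃ (v1 ϵᶠ ωᵗ ⊃ sucᵗ v1 ϵᶠ v4) & (v0 ϵᶠ ωᵗ ⊃ sucᵗ v0 ϵᶠ v4))))))

  -- Each `F · op ξ h` is finite, hence small, and its atoms can be numbered by elements of H; K
  -- collects their elements. Numbers h' whose value is not such an atom get the empty section,
  -- which is where the exceptional ∅ comes from.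
  coding : ∀ F → (∀ ξ h → ξ ϵ J → h ϵ H → F · op ξ h ϵ ⟦Fin⟧ (𝒫 J)) →
           ¬¬ Σ D λ K → K ϵ 𝒫 J × (∀ ξ h → ξ ϵ J → h ϵ H →
             (∀ a → a ϵ dec K ξ h → ¬¬ (a ≃ ∅ ⊎ a ϵ F · op ξ h)) × F · op ξ h ⊆ dec K ξ h)
  coding F fin = do
    e , he ← skolem (enum₂ ⟪ v0 ◂ appᵗ v2 v1 ◂ ⟨⟩ ⟫) (F ◂ ⟨⟩) (prod J H) λ x i → proj₁ prod-spec i >>= λ (ξ , i) → i >>= λ (h , a , b , q) →
      Sm-finite {𝒫 J} (ϵˡ (rept (appᵗ v1 v0) {F ◂ ⟨⟩} (Qsym q)) (fin ξ h a b))
    K , hK ← separate ψ (e ◂ F ◂ ⟨⟩) J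
    let val = λ ξ h h' → (e · op ξ h) · h'
        sec = λ ξ h h' → ⟦ sec₄ ⟧ (K ◂ ξ ◂ h ◂ h' ◂ ⟨⟩)
        valeq : ∀ ξ h h' j → (e · fst (op (op ξ h) (op h' j))) · fst (snd (op (op ξ h) (op h' j))) ≃ val ξ h h'
        valeq = λ ξ h h' j → ⟦⟧-cong app₂ {e · fst (op (op ξ h) (op h' j)) ◂ fst (snd (op (op ξ h) (op h' j))) ◂ ⟨⟩} {e · op ξ h ◂ h' ◂ ⟨⟩}
          λ { zero → rept (appᵗ v1 v0) {e ◂ ⟨⟩} fst-op ; (suc zero) → Qtr (rept fst₁ {⟨⟩} snd-op) fst-op }
        Feq = λ ξ h h' j → rept (appᵗ v1 v0) {F ◂ ⟨⟩} (fst-op {op ξ h} {op h' j})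
        secin : ∀ ξ h h' → ξ ϵ J → h ϵ H → h' ϵ H → val ξ h h' ϵ F · op ξ h → sec ξ h h' ≃ val ξ h h'
        secin = λ ξ h h' a b c d → ≃ext λ j →
          (λ i → ϵʳ (valeq ξ h h' j) (ϵˡ (Qtr (rept snd₁ {⟨⟩} snd-op) snd-op) (proj₁ (proj₂ (proj₁ (hK _) (proj₂ (proj₁ sec-spec i))))))) ,
          (λ i → let jJ = proj₁ 𝒫-spec (Fin-⊆ (fin ξ h a b) _ d) j i in proj₂ sec-spec (jJ ,
            proj₂ (hK _) (JU.U-op (JU.U-op a (H⊆J _ b)) (JU.U-op (H⊆J _ c) jJ) ,
              ϵʳ (Qsym (valeq ξ h h' j)) (ϵˡ (Qsym (Qtr (rept snd₁ {⟨⟩} snd-op) snd-op)) i) ,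
              congE (Qsym (valeq ξ h h' j)) (Qsym (Feq ξ h h' j)) d)))
    return (K , proj₂ 𝒫-spec (λ w i → proj₁ (proj₁ (hK w) i)) , λ ξ h a b →
      (λ w i → do
        h' , c , q ← proj₁ dec-spec i
        inj₁ d ← em (val ξ h h' ϵ F · op ξ h)
          where inj₂ nd → return (inj₁ (Qtr q (≃ext λ j → (λ k → ⊥-elim (nd (congE (valeq ξ h h' j) (Feq ξ h h' j)
                   (proj₂ (proj₂ (proj₁ (hK _) (proj₂ (proj₁ sec-spec k)))))))) , λ k → ⊥-elim (∅-spec k))))
        return (inj₂ (ϵˡ (Qsym (Qtr q (secin ξ h h' a b c d))) d))) ,
      (λ w i → stE do
        h' , c , q ← he (op ξ h) (prod-in a b) w i
        return (proj₂ dec-spec (return (h' , c , Qtr q (Qsym (secin ξ h h' a b c (ϵˡ q i))))))))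
    where
    ψ : Fm 3
    ψ = sndᵗ (sndᵗ v0) ϵᶠ appᵗ (appᵗ v1 (fstᵗ v0)) (fstᵗ (sndᵗ v0)) & appᵗ (appᵗ v1 (fstᵗ v0)) (fstᵗ (sndᵗ v0)) ϵᶠ appᵗ v2 (fstᵗ v0)

-- The chain condition

-- The first two arguments of an atom, the atoms with first argument in S and the
-- others in H, and the trace of a condition on these
ax₁ ay₁ : Tm 1
ax₁ = fl₁ ⟨ fr₁ ⟨ v0 ◂ ⟨⟩ ⟩ ◂ ⟨⟩ ⟩
ay₁ = fl₁ ⟨ fr₁ ⟨ fr₁ ⟨ v0 ◂ ⟨⟩ ⟩ ◂ ⟨⟩ ⟩ ◂ ⟨⟩ ⟩
abstract
  suppφ SAφ : Fm 2
  suppφ = Ex (v0 ϵᶠ v2 & (v1 ≃ᶠ ax₁ ⟨ v0 ◂ ⟨⟩ ⟩ or v1 ≃ᶠ ay₁ ⟨ v0 ◂ ⟨⟩ ⟩))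
  SAφ = Ex (v0 ϵᶠ prod₂ ⟨ prod₂ ⟨ ωᵗ ◂ v2 ◂ ⟨⟩ ⟩ ◂ prod₂ ⟨ Hᵗ ◂ Hᵗ ◂ ⟨⟩ ⟩ ◂ ⟨⟩ ⟩ &
    v1 ≃ᶠ atᵗ (fstᵗ (fstᵗ v0)) (sndᵗ (fstᵗ v0)) (fstᵗ (sndᵗ v0)) (sndᵗ (sndᵗ v0)))

supp₁ SA₁ : Tm 1
supp₁ = ⁅ suppφ ⁆
SA₁ = ⁅ SAφ ⁆

abstract
  traceφ : Fm 3
  traceφ = v0 ϵᶠ v1 & v0 ϵᶠ SA₁ ⟨ v2 ◂ ⟨⟩ ⟩

trace₂ : Tm 2
trace₂ = ⁅ traceφ ⁆

-- The conditions that c chooses for the finite traces on S; the closure of ∅ under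
-- adding the supports of these
pick₃ : Tm 3
pick₃ = appᵗ v2 (opᵗ (fstᵗ v0) (opᵗ (sndᵗ v0) v1))

abstract
  picksφ : Fm 3
  picksφ = v0 ϵᶠ P₀ ⟨ ⟨⟩ ⟩ & Ex (v0 ϵᶠ prod₂ ⟨ ωᵗ ◂ Finᵗ (SA₁ ⟨ v2 ◂ ⟨⟩ ⟩) ◂ ⟨⟩ ⟩ & v1 ≃ᶠ pick₃ ⟨ v0 ◂ v2 ◂ v3 ◂ ⟨⟩ ⟩)

picks₂ : Tm 2
picks₂ = ⁅ picksφ ⁆

abstract
  closφ : Fm 3
  closφ = Ex (v0 ϵᶠ picks₂ ⟨ v2 ◂ v3 ◂ ⟨⟩ ⟩ & v1 ϵᶠ supp₁ ⟨ v0 ◂ ⟨⟩ ⟩)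

clos₂ stage₂ : Tm 2
clos₂ = ⁅ closφ ⁆
stage₂ = urec ∅ᵗ (clos₂ ⟨ sndᵗ v0 ◂ v1 ◂ ⟨⟩ ⟩)

module ChainCondition (𝔙 : ZFCModel) where
  open Poset 𝔙 public

  ax ay supp SA : D → D
  ax a = fl (fr a)
  ay a = fl (fr (fr a))
  supp p = ⟦ supp₁ ⟧ (p ◂ ⟨⟩)
  SA s = ⟦ SA₁ ⟧ (s ◂ ⟨⟩)

  trace picks clos stage : D → D → D
  trace p s = ⟦ trace₂ ⟧ (p ◂ s ◂ ⟨⟩)
  picks s c = ⟦ picks₂ ⟧ (s ◂ c ◂ ⟨⟩)
  clos s c = ⟦ clos₂ ⟧ (s ◂ c ◂ ⟨⟩)
  stage n c = ⟦ stage₂ ⟧ (n ◂ c ◂ ⟨⟩)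

  ax-at : ∀ {t x y z} → ax (at t x y z) ≃ x
  ax-at = Qtr (fl-cong fr-fp) fl-fp
  ay-at : ∀ {t x y z} → ay (at t x y z) ≃ y
  ay-at = Qtr (fl-cong (Qtr (fr-cong fr-fp) fr-fp)) fl-fp

  abstract
    supp-spec : ∀ {p w} → w ϵ supp p ↔ (¬¬ Σ D λ a → a ϵ p × (¬¬ (w ≃ ax a ⊎ w ≃ ay a)))
    supp-spec {p} = cls-bounded¬ do
      b , h ← image-set ax₁ ⟨⟩ p
      b' , h' ← image-set ay₁ ⟨⟩ p
      return (b ∪ b' , λ w s → stE (s >>= λ (a , i , s) → s >>= λ
        { (inj₁ e) → return (∪ˡ (proj₂ (h w) (return (a , i , e)))) ; (inj₂ e) → return (∪ʳ (proj₂ (h' w) (return (a , i , e)))) }))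

    SA-spec : ∀ {s w} → w ϵ SA s ↔ (¬¬ Σ D λ u → u ϵ prod (prod ω s) (prod H H) ×
                w ≃ at (fst (fst u)) (snd (fst u)) (fst (snd u)) (snd (snd u)))
    SA-spec {s} = cls-bounded¬ (image-set (atᵗ (fstᵗ (fstᵗ v0)) (sndᵗ (fstᵗ v0)) (fstᵗ (sndᵗ v0)) (sndᵗ (sndᵗ v0))) ⟨⟩ (prod (prod ω s) (prod H H)) >>= λ (b , h) →
      return (b , λ w s → proj₂ (h w) s))

    trace-spec : ∀ {p s w} → w ϵ trace p s ↔ (w ϵ p × w ϵ SA s)
    trace-spec {p} = cls-bounded p λ w → proj₁

    picks-spec : ∀ {s c w} → w ϵ picks s c ↔ (w ϵ 𝔓 × (¬¬ Σ D λ u → u ϵ prod ω (⟦Fin⟧ (SA s)) × w ≃ c · op (fst u) (op (snd u) s)))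
    picks-spec = cls-bounded 𝔓 λ w → proj₁

    clos-spec : ∀ {s c w} → w ϵ clos s c ↔ (¬¬ Σ D λ q → q ϵ picks s c × w ϵ supp q)
    clos-spec {s} {c} = cls-bounded¬ (image-set supp₁ ⟨⟩ (picks s c) >>= λ (b , h) →
      return (⋃ b , λ w s → stE (s >>= λ (q , i , j) → return (⋃-in (proj₂ (h _) (return (q , i , Qrefl))) j))))

    stage-spec : ∀ {n c w} → w ϵ stage n c ↔ (¬¬ Σ D λ k → k ϵ n × w ϵ clos (stage k c) c)
    stage-spec {n} {c} {w} =
      (λ i → proj₁ r i >>= λ { (inj₁ p) → ⊥-elim (∅-spec p) ; (inj₂ q) → q >>= λ (k , j , l) → return (k , j , ϵʳ (rept clos₂ snd-op) l) }) ,
      (λ h → proj₂ r (return (inj₂ (h >>= λ (k , j , l) → return (k , j , ϵʳ (rept clos₂ (Qsym snd-op)) l)))))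
      where
      r : w ϵ stage n c ↔ (¬¬ (w ϵ ∅ ⊎ (¬¬ Σ D λ k → k ϵ n × w ϵ clos (snd (op k (stage k c))) c)))
      r = rec-spec ∅ᵗ (clos₂ ⟨ sndᵗ v0 ◂ v1 ◂ ⟨⟩ ⟩) c {n} {w}

  SA-in : ∀ {s t x y z} → t ϵ ω → x ϵ s → y ϵ H → z ϵ H → at t x y z ϵ SA s
  SA-in i j k l = proj₂ SA-spec (return (_ , prod-in (prod-in i j) (prod-in k l) , at-cong
    (Qsym (Qtr (rept fst₁ {⟨⟩} fst-op) fst-op)) (Qsym (Qtr (rept snd₁ {⟨⟩} fst-op) snd-op))
    (Qsym (Qtr (rept fst₁ {⟨⟩} snd-op) fst-op)) (Qsym (Qtr (rept snd₁ {⟨⟩} snd-op) snd-op))))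

  supp-x : ∀ {p t x y z} → at t x y z ϵ p → x ϵ supp p
  supp-x i = proj₂ supp-spec (return (_ , i , return (inj₁ (Qsym ax-at))))
  supp-y : ∀ {p t x y z} → at t x y z ϵ p → y ϵ supp p
  supp-y i = proj₂ supp-spec (return (_ , i , return (inj₂ (Qsym ay-at))))

  trace-fin : ∀ {p s B} → (∀ b → b ϵ 𝒫 J → b ϵ SA s → b ϵ B) → p ϵ ⟦Fin⟧ (𝒫 J) → trace p s ϵ ⟦Fin⟧ B
  trace-fin {p} {s} {B} sub = Fin-ind (trace₂ ⟨ v0 ◂ v1 ◂ ⟨⟩ ⟩ ϵᶠ Finᵗ v2) (s ◂ B ◂ ⟨⟩) (𝒫 J)
    (ϵˡ (≃ext λ w → (λ i → ⊥-elim (∅-spec i)) , λ i → ⊥-elim (∅-spec (proj₁ (proj₁ trace-spec i)))) Fin-∅)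
    λ y b _ bJ h → stE (em (b ϵ SA s) >>= λ
      { (inj₁ j) → return (ϵˡ (≃ext λ w →
          (λ i → stE (adj-elim i (λ i → let k , l = proj₁ trace-spec i in return (proj₂ trace-spec (adjˡ k , l))) λ e → return (proj₂ trace-spec (adjʳ e , ϵˡ (Qsym e) j)))) ,
          (λ i → let k , l = proj₁ trace-spec i in stE (adj-elim k (λ k → return (adjˡ (proj₂ trace-spec (k , l)))) λ e → return (adjʳ e)))) (Fin-adj h (sub b bJ j)))
      ; (inj₂ nj) → return (ϵˡ (≃ext λ w →
          (λ i → let k , l = proj₁ trace-spec i in proj₂ trace-spec (adjˡ k , l)) ,
          (λ i → let k , l = proj₁ trace-spec i in stE (adj-elim k (λ k → return (proj₂ trace-spec (k , l))) λ e → ⊥-elim (nj (ϵˡ e l))))) h) })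

  Sm-supp : ∀ {p} → p ϵ 𝔓 → Sm (supp p)
  Sm-supp {p} i = do
    b , h ← image-set ax₁ ⟨⟩ p
    b' , h' ← image-set ay₁ ⟨⟩ p
    Sm-⊆ (λ w s → stE (proj₁ supp-spec s >>= λ (a , i , s) → s >>= λ
        { (inj₁ e) → return (∪ˡ (proj₂ (h w) (return (a , i , e)))) ; (inj₂ e) → return (∪ʳ (proj₂ (h' w) (return (a , i , e)))) }))
      (Sm-∪ (Sm-image ax₁ ⟨⟩ sp λ y j → proj₁ (h y) j) (Sm-image ay₁ ⟨⟩ sp λ y j → proj₁ (h' y) j))
    where
    sp : Sm p
    sp = Sm-finite (proj₁ (proj₁ P-spec i))

  module _ (c : D) where
    Sm-SA : ∀ {s} → Sm s → Sm (SA s)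
    Sm-SA sm = Sm-image (atᵗ (fstᵗ (fstᵗ v0)) (sndᵗ (fstᵗ v0)) (fstᵗ (sndᵗ v0)) (sndᵗ (sndᵗ v0))) ⟨⟩
      (Sm-prod (Sm-prod Sm-ω sm) (Sm-prod Sm-H Sm-H)) λ y i → proj₁ SA-spec i

    Sm-picks : ∀ {s} → Sm s → Sm (picks s c)
    Sm-picks {s} sm = Sm-image pick₃ (s ◂ c ◂ ⟨⟩) (Sm-prod Sm-ω (Sm-Fin (Sm-SA sm))) λ y i → proj₂ (proj₁ picks-spec i)

    Sm-clos : ∀ {s} → Sm s → Sm (clos s c)
    Sm-clos {s} sm = do
      b , h ← image-set supp₁ ⟨⟩ (picks s c)
      Sm-⊆ (λ w i → stE (proj₁ clos-spec i >>= λ (q , j , k) → return (⋃-in (proj₂ (h _) (return (q , j , Qrefl))) k)))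
        (Sm-⋃ {b} (Sm-image supp₁ ⟨⟩ (Sm-picks sm) λ y i → proj₁ (h y) i)
          λ x i → proj₁ (h x) i >>= λ (q , j , e) → Sm-⊆ (≃⇒⊆ e) (Sm-supp (proj₁ (proj₁ picks-spec j))))

    Sm-stage : ∀ n → n ϵ ω → Sm (stage n c)
    Sm-stage = ϵ-ind (v0 ϵᶠ ωᵗ ⊃ small₁ ⟪ stage₂ ⟨ v0 ◂ v1 ◂ ⟨⟩ ⟩ ◂ ⟨⟩ ⟫) (c ◂ ⟨⟩) λ n ih i → do
      b , h ← image-set (clos₂ ⟨ stage₂ ⟨ v0 ◂ v1 ◂ ⟨⟩ ⟩ ◂ v1 ◂ ⟨⟩ ⟩) (c ◂ ⟨⟩) n
      Sm-⊆ (λ w j → stE (proj₁ stage-spec j >>= λ (k , l , m) → return (⋃-in (proj₂ (h _) (return (k , l , Qrefl))) m)))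
        (Sm-⋃ {b} (Sm-image (clos₂ ⟨ stage₂ ⟨ v0 ◂ v1 ◂ ⟨⟩ ⟩ ◂ v1 ◂ ⟨⟩ ⟩) (c ◂ ⟨⟩) (Sm-⊆ (λ x j → ω-trans i j) Sm-ω) λ y j → proj₁ (h y) j)
          λ x j → proj₁ (h x) j >>= λ (k , l , e) → Sm-⊆ (≃⇒⊆ e) (Sm-clos (ih k l (ω-trans i l))))

    stage-mono : ∀ {k n} → n ϵ ω → k ϵ n → stage k c ⊆ stage n c
    stage-mono i j w l = proj₂ stage-spec (proj₁ stage-spec l >>= λ (m , o , p) → return (m , nat-trans i j o , p))

    stage-𝒫J : ∀ n → stage n c ϵ 𝒫 (𝒫 J)
    stage-𝒫J n = proj₂ 𝒫-spec λ w i → stE do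
      k , _ , j ← proj₁ stage-spec i
      q , l , m ← proj₁ clos-spec j
      a , o , s ← proj₁ supp-spec m
      let aJ = Fin-⊆ (proj₁ (proj₁ P-spec (proj₁ (proj₁ picks-spec l)))) a o
      inj₁ e ← s
        where inj₂ e → return (ϵˡ (Qsym e) (fl-𝒫J (fr-𝒫J (fr-𝒫J aJ))))
      return (ϵˡ (Qsym e) (fl-𝒫J (fr-𝒫J aJ)))

    -- The support of q is finite and the stages increase, so whatever part of it lies in some stage
    -- lies in a single one.
    stage-fin : ∀ {q} → q ϵ ⟦Fin⟧ (𝒫 J) → ¬¬ Σ D λ n → n ϵ ω × (∀ w → w ϵ supp q → (¬¬ Σ D λ m → m ϵ ω × w ϵ stage m c) → w ϵ stage n c)
    stage-fin = Fin-ind φ (c ◂ ⟨⟩) (𝒫 J)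
      (return (∅ , 0ϵω , λ w i → ⊥-elim (proj₁ supp-spec i λ (a , j , _) → ∅-spec j)))
      λ y a _ _ h → do
        n , nω , f ← h
        n₁ , n₁ω , nn₁ , f₁ ← bound n (ax a) nω
        n₂ , n₂ω , n₁n₂ , f₂ ← bound n₁ (ay a) n₁ω
        return (n₂ , n₂ω , λ w i s → stE do
          b , j , e ← proj₁ supp-spec i
          adj-elim j (λ j → return (stage-mono n₂ω n₁n₂ w (stage-mono n₁ω nn₁ w (f w (proj₂ supp-spec (return (b , j , e))) s))))
            λ q → e >>= λ
              { (inj₁ e) → let e' = Qtr e (fl-cong (fr-cong q)) in
                  return (ϵˡ (Qsym e') (stage-mono n₂ω n₁n₂ _ (f₁ (s >>= λ (m , o , k) → return (m , o , ϵˡ e' k)))))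
              ; (inj₂ e) → let e' = Qtr e (fl-cong (fr-cong (fr-cong q))) in
                  return (ϵˡ (Qsym e') (f₂ (s >>= λ (m , o , k) → return (m , o , ϵˡ e' k)))) })
      where
      φ : Fm 2
      φ = Ex (v0 ϵᶠ ωᵗ & All (v0 ϵᶠ supp₁ ⟨ v2 ◂ ⟨⟩ ⟩ ⊃ Ex (v0 ϵᶠ ωᵗ & v1 ϵᶠ stage₂ ⟨ v0 ◂ v4 ◂ ⟨⟩ ⟩) ⊃ v0 ϵᶠ stage₂ ⟨ v1 ◂ v3 ◂ ⟨⟩ ⟩))
      bound : ∀ n x → n ϵ ω → ¬¬ Σ D λ n' → n' ϵ ω × n ϵ n' × ((¬¬ Σ D λ m → m ϵ ω × x ϵ stage m c) → x ϵ stage n' c)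
      bound n x nω = em (¬¬ Σ D λ m → m ϵ ω × x ϵ stage m c) >>= λ
        { (inj₁ s) → s >>= λ (m , mω , i) → directed nω mω >>= λ (n' , n'ω , a , b) → return (n' , n'ω , a , λ _ → stage-mono n'ω b x i)
        ; (inj₂ ns) → return (succ n , sucϵω nω , adjʳ Qrefl , λ s → ⊥-elim (ns s)) }

  -- In a clash of p ∪ q all atoms can be moved into one of the two conditions, which has none. For
  -- two digits the shared index is in both supports, hence in s, and the traces agree there. For a
  -- broken promise the promise stays in its condition; its supports contain the code and the index
  -- ξ, so the code entry and the digits are moved to it in the same way.
  compatible : ∀ {p q s} → p ϵ 𝔓 → q ϵ 𝔓 → trace p s ≃ trace q s →
               (∀ x → x ϵ supp p → x ϵ supp q → x ϵ s) → p ∪ q ϵ 𝔓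
  compatible {p} {q} {s} pP qP tr sh = P-∪ pP qP (unclash
    (λ ξ m b b' i j → stQ (∪-elim i (λ i → return (proj₁ fp' ξ m b b' i (in-p (supp-x i) (inj₁ Qrefl) j)))
                                    λ i → return (proj₁ fq ξ m b b' i (in-q (supp-x i) (inj₁ Qrefl) j))))
    (λ K n ξ m i j k l → ∪-elim j
      (λ j → return (proj₂ fp' K n ξ m (in-p (supp-x j) (inj₂ Qrefl) i) j (in-p (supp-y j) (inj₁ Qrefl) k) (in-p (supp-y j) (inj₁ Qrefl) l)))
      (λ j → return (proj₂ fq K n ξ m (in-q (supp-x j) (inj₂ Qrefl) i) j (in-q (supp-y j) (inj₁ Qrefl) k) (in-q (supp-y j) (inj₁ Qrefl) l)))
      λ b → b))
    where
    fp' = free {p} (proj₁ (proj₂ (proj₁ P-spec pP)))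
    fq = free {q} (proj₁ (proj₂ (proj₁ P-spec qP)))
    tag : ∀ {t} → (t ≃ one ⊎ t ≃ two) → t ϵ ω
    tag (inj₁ e) = ϵˡ (Qsym e) 1ϵω
    tag (inj₂ e) = ϵˡ (Qsym e) 2ϵω
    good : ∀ {p t x y z} → p ϵ 𝔓 → (t ≃ one ⊎ t ≃ two) → at t x y z ϵ p → y ϵ H × z ϵ H
    good pP (inj₁ e) i = proj₂ (proj₂ (proj₂ (proj₁ P-spec pP))) _ _ _ (return (inj₁ (ϵˡ (at-cong e Qrefl Qrefl Qrefl) i)))
    good pP (inj₂ e) i = proj₂ (proj₂ (proj₂ (proj₁ P-spec pP))) _ _ _ (return (inj₂ (ϵˡ (at-cong e Qrefl Qrefl Qrefl) i)))
    in-p : ∀ {t x y z} → x ϵ supp p → (t ≃ one ⊎ t ≃ two) → at t x y z ϵ p ∪ q → at t x y z ϵ p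
    in-p i e j = stE (∪-elim j return λ j → let a , b = good qP e j in
      return (proj₁ (proj₁ trace-spec (ϵʳ (Qsym tr) (proj₂ trace-spec (j , SA-in (tag e) (sh _ i (supp-x j)) a b))))))
    in-q : ∀ {t x y z} → x ϵ supp q → (t ≃ one ⊎ t ≃ two) → at t x y z ϵ p ∪ q → at t x y z ϵ q
    in-q i e j = stE (∪-elim j (λ j → let a , b = good pP e j in
      return (proj₁ (proj₁ trace-spec (ϵʳ tr (proj₂ trace-spec (j , SA-in (tag e) (sh _ (supp-x j) i) a b)))))) return)

  -- The choice function takes arguments ⟨j , ⟨τ , s⟩⟩ and returns a condition q with φ j q whose
  -- trace on s is τ, if there is one.
  module Pick {n} (φ : Fm (suc (suc n))) (ρ : Vec D n) where
    ψ : Fm (suc (suc n))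
    ψ = v0 ϵᶠ P₀ ⟨ ⟨⟩ ⟩ & φ ⟪ fstᵗ v1 ◂ v0 ◂ vars ↑²_ ⟫ & trace₂ ⟨ v0 ◂ sndᵗ (sndᵗ v1) ◂ ⟨⟩ ⟩ ≃ᶠ fstᵗ (sndᵗ v1)
    ψ₁ : Fm (suc (suc (suc n)))
    ψ₁ = ψ ⟪ v0 ◂ vars ↑²_ ⟫
    dom : D
    dom = prod ω (prod (⟦Fin⟧ (𝒫 J)) (𝒫 (𝒫 J)))
    e : ∀ {q j τ s} (i : Fin (suc (suc n))) → lookup (⟦ fstᵗ v1 ◂ v0 ◂ vars ↑²_ ⟧* (q ◂ op j (op τ s) ◂ ρ)) i ≃ lookup (j ◂ q ◂ ρ) i
    e zero = fst-op
    e (suc zero) = Qrefl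
    e {q} {j} {τ} {s} (suc (suc i)) = vars-ok ↑²_ (q ◂ op j (op τ s) ◂ ρ) i
    tq : ∀ {q j τ s} → trace q (snd (snd (op j (op τ s)))) ≃ trace q s
    tq {q} = rept (trace₂ ⟨ v1 ◂ v0 ◂ ⟨⟩ ⟩) {q ◂ ⟨⟩} (Qtr (rept snd₁ {⟨⟩} snd-op) snd-op)
    tτ : ∀ {j τ s} → fst (snd (op j (op τ s))) ≃ τ
    tτ = Qtr (rept fst₁ {⟨⟩} snd-op) fst-op
    to : ∀ {q j τ s} → S ψ (q ◂ op j (op τ s) ◂ ρ) → q ϵ 𝔓 × S φ (j ◂ q ◂ ρ) × trace q s ≃ τ
    to (a , b , c) = a , S-cong φ e b , Qtr (Qsym tq) (Qtr c tτ)
    from : ∀ {q j τ s} → q ϵ 𝔓 × S φ (j ◂ q ◂ ρ) × trace q s ≃ τ → S ψ (q ◂ op j (op τ s) ◂ ρ)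
    from (a , b , c) = a , S-cong φ (λ i → Qsym (e i)) b , Qtr tq (Qtr c (Qsym tτ))
    module _ (c : D) (hc : ∀ x → x ϵ dom → S (Ex ψ₁ ⊃ ψ) (c · x ◂ x ◂ ρ)) (j q n : D) (jω : j ϵ ω) (qP : q ϵ 𝔓) (sq : S φ (j ◂ q ◂ ρ)) where
      picked : D
      picked = c · op j (op (trace q (stage n c)) (stage n c))
      private
        qf : q ϵ ⟦Fin⟧ (𝒫 J)
        qf = proj₁ (proj₁ P-spec qP)
        x : D
        x = op j (op (trace q (stage n c)) (stage n c))
        xdom : x ϵ dom
        xdom = prod-in jω (prod-in (trace-fin {q} {stage n c} (λ _ j _ → j) qf) (stage-𝒫J c n))
        qψ : S ψ₁ (q ◂ picked ◂ x ◂ ρ)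
        qψ = S-cong ψ {q ◂ x ◂ ρ} {⟦ v0 ◂ vars ↑²_ ⟧* (q ◂ picked ◂ x ◂ ρ)}
          (λ { zero → Qrefl ; (suc i) → Qsym (vars-ok ↑²_ (q ◂ picked ◂ x ◂ ρ) i) }) (from {q} {j} {trace q (stage n c)} {stage n c} (qP , sq , Qrefl))
      picked-spec : picked ϵ 𝔓 × S φ (j ◂ picked ◂ ρ) × trace picked (stage n c) ≃ trace q (stage n c)
      picked-spec = to {picked} {j} {trace q (stage n c)} {stage n c} (hc x xdom (return (q , qψ)))
      private
        τ : D
        τ = trace q (stage n c)
        u : D
        u = op j τ
        u-in : u ϵ prod ω (⟦Fin⟧ (SA (stage n c)))
        u-in = prod-in jω (trace-fin {q} {stage n c} (λ _ _ j → j) qf)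
        opq : op j (op τ (stage n c)) ≃ op (fst u) (op (snd u) (stage n c))
        opq = op-cong (Qsym (fst-op {j} {τ})) (op-cong (Qsym (snd-op {j} {τ})) Qrefl)
        u-eq : picked ≃ c · op (fst u) (op (snd u) (stage n c))
        u-eq = rept (appᵗ v1 v0) {c ◂ ⟨⟩} opq
        u-spec : Σ D λ u → u ϵ prod ω (⟦Fin⟧ (SA (stage n c))) × picked ≃ c · op (fst u) (op (snd u) (stage n c))
        u-spec = u , u-in , u-eq
        u-conj : picked ϵ 𝔓 × (¬¬ Σ D λ u → u ϵ prod ω (⟦Fin⟧ (SA (stage n c))) × picked ≃ c · op (fst u) (op (snd u) (stage n c)))
        u-conj = proj₁ picked-spec , return u-spec
      picked-picks : picked ϵ picks (stage n c) c
      picked-picks = proj₂ (picks-spec {stage n c} {c} {picked}) u-conj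

    chooser : ¬¬ Σ D λ c → ∀ x → x ϵ dom → S (Ex ψ₁ ⊃ ψ) (c · x ◂ x ◂ ρ)
    chooser = skolem (Ex ψ₁ ⊃ ψ) ρ dom λ x i → em (¬¬ Σ D λ y → S ψ (y ◂ x ◂ ρ)) >>= λ
      { (inj₁ h) → h >>= λ (y , s) → return (y , λ _ → s)
      ; (inj₂ nh) → return (∅ , λ h → ⊥-elim (nh (h >>= λ (y , s) → return (y , S-cong ψ (λ { zero → Qrefl ; (suc i) → vars-ok ↑²_ (y ◂ ∅ ◂ x ◂ ρ) i }) s)))) }

    module Result (c : D) (hc : ∀ x → x ϵ dom → S (Ex ψ₁ ⊃ ψ) (c · x ◂ x ◂ ρ)) (b : D)
                  (hb : ∀ w → w ϵ b ↔ (¬¬ Σ D λ n → n ϵ ω × w ≃ picks (stage n c) c)) where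
      Sm-A : Sm (⋃ b)
      Sm-A = Sm-⋃ {b} (Sm-image (picks₂ ⟨ stage₂ ⟨ v0 ◂ v1 ◂ ⟨⟩ ⟩ ◂ v1 ◂ ⟨⟩ ⟩) (c ◂ ⟨⟩) Sm-ω λ y i → proj₁ (hb y) i)
        (λ x i → proj₁ (hb x) i >>= λ (n , j , e) → Sm-⊆ (≃⇒⊆ e) (Sm-picks c (Sm-stage c n j)))

      A⊆P : ⋃ b ⊆ 𝔓
      A⊆P w i = stE do
        x , j , k ← proj₁ ⋃-spec i
        n , _ , e ← proj₁ (hb x) j
        return (proj₁ (proj₁ (picks-spec {stage n c} {c} {w}) (ϵʳ e k)))

      -- Take a stage n that contains everything `supp q` has in common with any stage, and let a be
      -- the condition picked for the trace of q on it. The support of a lies in stage n + 1, so the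
      -- supports of q and a meet only inside stage n, where the traces agree.
      meets : ∀ j q → j ϵ ω → q ϵ 𝔓 → S φ (j ◂ q ◂ ρ) → ¬¬ Σ D λ a → a ϵ ⋃ b × S φ (j ◂ a ◂ ρ) × q ∪ a ϵ 𝔓
      meets j q jω qP s = stage-fin c (proj₁ (proj₁ P-spec qP)) >>= λ (n , nω , f) → return (at-stage n nω f)
        where
        at-stage : ∀ n → n ϵ ω → (∀ w → w ϵ supp q → (¬¬ Σ D λ m → m ϵ ω × w ϵ stage m c) → w ϵ stage n c) →
                   Σ D λ a → a ϵ ⋃ b × S φ (j ◂ a ◂ ρ) × q ∪ a ϵ 𝔓
        at-stage n nω f = a , a-in , proj₁ (proj₂ a-spec) , compatible qP (proj₁ a-spec) (Qsym (proj₂ (proj₂ a-spec))) share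
          where
          a : D
          a = picked c hc j q n jω qP s
          a-spec : a ϵ 𝔓 × S φ (j ◂ a ◂ ρ) × trace a (stage n c) ≃ trace q (stage n c)
          a-spec = picked-spec c hc j q n jω qP s
          a-picks : a ϵ picks (stage n c) c
          a-picks = picked-picks c hc j q n jω qP s
          n-spec : Σ D λ m → m ϵ ω × picks (stage n c) c ≃ picks (stage m c) c
          n-spec = n , nω , Qrefl
          a-in : a ϵ ⋃ b
          a-in = ⋃-in (proj₂ (hb (picks (stage n c) c)) (return n-spec)) a-picks
          share : ∀ w → w ϵ supp q → w ϵ supp a → w ϵ stage n c
          share w i k = f w i (return (succ n , sucϵω nω , w-in))
            where
            a-clos : Σ D λ r → r ϵ picks (stage n c) c × w ϵ supp r
            a-clos = a , a-picks , k
            w-clos : Σ D λ m → m ϵ succ n × w ϵ clos (stage m c) c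
            w-clos = n , adjʳ Qrefl , proj₂ (clos-spec {stage n c} {c} {w}) (return a-clos)
            w-in : w ϵ stage (succ n) c
            w-in = proj₂ (stage-spec {succ n} {c} {w}) (return w-clos)

  -- Instead of a maximal antichain: choose a member of E j for every finite trace on a
  -- small set S, and close S under the supports of the chosen conditions.
  ccc : (φ : Fm (suc (suc n))) (ρ : Vec D n) → ¬¬ Σ D λ A → Sm A × A ⊆ 𝔓 ×
        (∀ j q → j ϵ ω → q ϵ 𝔓 → S φ (j ◂ q ◂ ρ) → ¬¬ Σ D λ a → a ϵ A × S φ (j ◂ a ◂ ρ) × q ∪ a ϵ 𝔓)
  ccc φ ρ = do
    c , hc ← chooser
    b , hb ← image-set (picks₂ ⟨ stage₂ ⟨ v0 ◂ v1 ◂ ⟨⟩ ⟩ ◂ v1 ◂ ⟨⟩ ⟩) (c ◂ ⟨⟩) ω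
    return (⋃ b , Result.Sm-A c hc b hb , Result.A⊆P c hc b hb , Result.meets c hc b hb)
    where open Pick φ ρ

-- The forcing relation

-- Conditions are the elements of the set P₀, ordered by reverse inclusion; every
-- set is regarded as a name, of which only the elements ⟨x , r⟩ matter.

module Syntax (P₀ : Tm 0) where
  Pᵗ : Tm n
  Pᵗ = P₀ ⟨ ⟨⟩ ⟩

  -- half φ p x y : below p, every member of x is forced to be φ-related to a member of y
  half : Fm 3 → Fm 3
  half φ = All (All (opᵗ v1 v0 ϵᶠ v3 ⊃ All (v0 ϵᶠ Pᵗ & v3 ⊆ᶠ v0 & v1 ⊆ᶠ v0 ⊃
    Ex (v0 ϵᶠ Pᵗ & v1 ⊆ᶠ v0 & Ex (Ex (opᵗ v1 v0 ϵᶠ v8 & v0 ⊆ᶠ v2 & φ ⟪ v2 ◂ v5 ◂ v1 ◂ ⟨⟩ ⟫))))))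

  -- Forced equality is the largest relation E such that E p x y implies E p y x
  -- and half E p x y.
  bis₁ : Fm 1
  bis₁ = All (All (All (opᵗ v2 (opᵗ v1 v0) ϵᶠ v3 ⊃
    All (All (opᵗ v1 v0 ϵᶠ v3 ⊃ All (v0 ϵᶠ Pᵗ & v5 ⊆ᶠ v0 & v1 ⊆ᶠ v0 ⊃
      Ex (v0 ϵᶠ Pᵗ & v1 ⊆ᶠ v0 & Ex (Ex (opᵗ v1 v0 ϵᶠ v6 & v0 ⊆ᶠ v2 & opᵗ v2 (opᵗ v5 v1) ϵᶠ v9)))))) &
    opᵗ v2 (opᵗ v0 v1) ϵᶠ v3)))
    where
    v9 : Tm (10 + n)
    v9 = v (suc (suc (suc (suc (suc (suc (suc (suc (suc zero)))))))))

  eq₃ mem₃ : Fm 3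
  eq₃ = Ex (bis₁ ⟪ v0 ◂ ⟨⟩ ⟫ & opᵗ v1 (opᵗ v2 v3) ϵᶠ v0)
  mem₃ = All (v0 ϵᶠ Pᵗ & v1 ⊆ᶠ v0 ⊃ Ex (v0 ϵᶠ Pᵗ & v1 ⊆ᶠ v0 &
    Ex (Ex (opᵗ v1 v0 ϵᶠ v6 & v0 ⊆ᶠ v2 & eq₃ ⟪ v2 ◂ v5 ◂ v1 ◂ ⟨⟩ ⟫))))

  forces : Formula n → Fm (suc n)
  forces (x ∈̇ y) = mem₃ ⟪ v0 ◂ v (suc x) ◂ v (suc y) ◂ ⟨⟩ ⟫
  forces (x ≐ y) = eq₃ ⟪ v0 ◂ v (suc x) ◂ v (suc y) ◂ ⟨⟩ ⟫
  forces ⊥̇       = ⊥ᶠ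
  forces (φ ⇒ ψ) = All (v0 ϵᶠ Pᵗ ⊃ v1 ⊆ᶠ v0 ⊃ forces φ ⟪ v0 ◂ vars ↑²_ ⟫ ⊃ forces ψ ⟪ v0 ◂ vars ↑²_ ⟫)
  forces (∀̇ φ)   = All (forces φ ⟪ v1 ◂ v0 ◂ vars ↑²_ ⟫)

  none : Fm (suc n) → Fm (suc n)
  none φ = All (v0 ϵᶠ Pᵗ & v1 ⊆ᶠ v0 ⊃ negᶠ (φ ⟪ v0 ◂ vars ↑²_ ⟫))

  nameᵗ : Fm (suc (suc n)) → Tm (suc n)
  nameᵗ ψ = ⁅ Ex (Ex (v2 ≃ᶠ opᵗ v1 v0 & v1 ϵᶠ v3 & v0 ϵᶠ Pᵗ & ψ ⟪ v1 ◂ v0 ◂ vars (↑_ ∘ ↑³_) ⟫)) ⁆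

module Forcing (𝔙 : ZFCModel) (P₀ : Tm 0)
               (∅ϵP : Universe._ϵ_ 𝔙 (Basics.∅ 𝔙) (Universe.⟦_⟧ 𝔙 P₀ ⟨⟩)) where
  open ChainCondition 𝔙 public
  open Syntax P₀ public

  Trans-op : ∀ {t x y} → Trans t → op x y ϵ t → x ϵ t × y ϵ t
  Trans-op t i = t _ (t _ i _ opʳ) _ upˡ , t _ (t _ i _ opʳ) _ upʳ

  P : D
  P = ⟦ P₀ ⟧ ⟨⟩

  Half : (D → D → D → Set) → D → D → D → Set
  Half Φ p x y = ∀ x' r → op x' r ϵ x → ∀ q → q ϵ P × p ⊆ q × r ⊆ q →
    ¬¬ Σ D λ s → s ϵ P × q ⊆ s × (¬¬ Σ D λ y' → ¬¬ Σ D λ r' → op y' r' ϵ y × r' ⊆ s × Φ s x' y')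

  Eq Mem : D → D → D → Set
  Eq p x y = S eq₃ (p ◂ x ◂ y ◂ ⟨⟩)
  Mem p x y = S mem₃ (p ◂ x ◂ y ◂ ⟨⟩)

  Half-map : {Φ Ψ : D → D → D → Set} {p x y : D} → (∀ {s x y} → s ϵ P → p ⊆ s → Φ s x y → Ψ s x y) → Half Φ p x y → Half Ψ p x y
  Half-map f h x' r i q (a , b , c) = h x' r i q (a , b , c) >>= λ (s , j , k , l) →
    return (s , j , k , (l >>= λ (y' , l) → return (y' , l >>= λ (r' , m , n , o) → return (r' , m , n , f j (⊆-trans b k) o))))

  -- The class relation φ is cut down to a set: only names from a transitive set T around x and y
  -- can occur in the course of comparing these two.
  coinduction : (φ : Fm (3 + n)) (ρ : Vec D n) →
    (∀ p x y → S φ (p ◂ x ◂ y ◂ ρ) → S φ (p ◂ y ◂ x ◂ ρ)) →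
    (∀ p x y → p ϵ P → S φ (p ◂ x ◂ y ◂ ρ) → Half (λ s x' y' → S φ (s ◂ x' ◂ y' ◂ ρ)) p x y) →
    ∀ {p x y} → p ϵ P → S φ (p ◂ x ◂ y ◂ ρ) → Eq p x y
  coinduction {n} φ ρ sy hf {p} {x} {y} pP s = do
    T , tT , i ← tc-exists (op x y)
    R , h ← separate ψ ρ (prod P (prod T T))
    let Rin : ∀ {p x y} → p ϵ P → x ϵ T → y ϵ T → S φ (p ◂ x ◂ y ◂ ρ) → op p (op x y) ϵ R
        Rin a b c s = proj₂ (h _) (prod-in a (prod-in b c) , from s)
        Rout : ∀ {p x y} → op p (op x y) ϵ R → ¬¬ (p ϵ P × x ϵ T × y ϵ T × S φ (p ◂ x ◂ y ◂ ρ))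
        Rout j = let k , s = proj₁ (h _) j in proj₁ prod-spec k >>= λ (p' , k) → k >>= λ (w , a , b , e) →
          proj₁ prod-spec b >>= λ (x' , b) → b >>= λ (y' , c , d , e') →
          return (ϵˡ (Qsym (op-inj₁ e)) a , ϵˡ (Qsym (op-inj₁ (Qtr (op-inj₂ e) e'))) c , ϵˡ (Qsym (op-inj₂ (Qtr (op-inj₂ e) e'))) d , to s)
    return (R , (λ p x y j →
        (λ x' r k q c → do
          pP , xT , yT , s ← Rout j
          s' , sP , q⊆s , l ← hf p x y pP s x' r k q c
          return (s' , sP , q⊆s , l >>= λ (y' , l) → return (y' , l >>= λ (r' , m , o , z) → return (r' , m , o ,
            Rin sP (proj₁ (Trans-op tT (tT x xT _ k))) (proj₁ (Trans-op tT (tT y yT _ m))) z)))) ,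
        stE (Rout j >>= λ (a , b , c , s) → return (Rin a c b (sy p x y s)))) ,
      Rin pP (proj₁ (Trans-op tT i)) (proj₂ (Trans-op tT i)) s)
    where
    ψ : Fm (suc n)
    ψ = φ ⟪ fstᵗ v0 ◂ fstᵗ (sndᵗ v0) ◂ sndᵗ (sndᵗ v0) ◂ vars ↑_ ⟫
    to : ∀ {p x y} → S ψ (op p (op x y) ◂ ρ) → S φ (p ◂ x ◂ y ◂ ρ)
    e : ∀ {p x y} (i : Fin (3 + n)) → lookup (⟦ fstᵗ v0 ◂ fstᵗ (sndᵗ v0) ◂ sndᵗ (sndᵗ v0) ◂ vars ↑_ ⟧* (op p (op x y) ◂ ρ)) i ≃ lookup (p ◂ x ◂ y ◂ ρ) i
    e zero = fst-op
    e (suc zero) = Qtr (rept fst₁ {⟨⟩} snd-op) fst-op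
    e (suc (suc zero)) = Qtr (rept snd₁ {⟨⟩} snd-op) snd-op
    e {p} {x} {y} (suc (suc (suc i))) = vars-ok ↑_ (op p (op x y) ◂ ρ) i
    to = S-cong φ e
    from : ∀ {p x y} → S φ (p ◂ x ◂ y ◂ ρ) → S ψ (op p (op x y) ◂ ρ)
    from = S-cong φ (λ i → Qsym (e i))

  eq-half : ∀ {p x y} → Eq p x y → Half Eq p x y
  eq-half h x' r i q c = h >>= λ (R , b , j) → proj₁ (b _ _ _ j) x' r i q c >>= λ (s , a , d , l) →
    return (s , a , d , l >>= λ (y' , l) → return (y' , l >>= λ (r' , m , n , o) → return (r' , m , n , return (R , b , o))))

  eq-sym : ∀ {p x y} → Eq p x y → Eq p y x
  eq-sym h = h >>= λ (R , b , j) → return (R , b , proj₂ (b _ _ _ j))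

  eq-refl : ∀ {p x} → p ϵ P → Eq p x x
  eq-refl {p} {x} pP = coinduction (v1 ≃ᶠ v2) ⟨⟩ (λ _ _ _ → Qsym)
    (λ p x y _ e x' r i q (a , b , c) → return (q , a , ⊆-refl , return (x' , return (r , ϵʳ e i , c , Qrefl))))
    pP Qrefl

  eq-mono : ∀ {p q x y} → q ϵ P → p ⊆ q → Eq p x y → Eq q x y
  eq-mono {p} qP s h = coinduction (Ex (v0 ⊆ᶠ v1 & eq₃ ⟪ v0 ◂ v2 ◂ v3 ◂ ⟨⟩ ⟫)) ⟨⟩
    (λ p x y h → h >>= λ (p' , s , e) → return (p' , s , eq-sym {p'} {x} {y} e))
    (λ p x y pP h x' r i q (a , b , c) → h >>= λ (p' , s , e) → Half-map {Φ = Eq} {Ψ = λ s x y → ¬¬ Σ D λ p → p ⊆ s × Eq p x y} {p = p'} {x} {y}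
      (λ {s} _ _ e → return (s , ⊆-refl , e)) (eq-half {p'} {x} {y} e) x' r i q (a , ⊆-trans s b , c))
    qP (return (p , s , h))

  eq-trans : ∀ {p x y z} → p ϵ P → Eq p x y → Eq p y z → Eq p x z
  eq-trans {y = y} pP h k = coinduction (Ex (eq₃ ⟪ v1 ◂ v2 ◂ v0 ◂ ⟨⟩ ⟫ & eq₃ ⟪ v1 ◂ v0 ◂ v3 ◂ ⟨⟩ ⟫)) ⟨⟩
    (λ p x z h → h >>= λ (y , a , b) → return (y , eq-sym {p} {y} {z} b , eq-sym {p} {x} {y} a))
    (λ p x z pP h x' r i q c → do
      y , a , b ← h
      s , sP , qs , l ← eq-half {p} {x} {y} a x' r i q c
      y' , l ← l
      r' , j , rs , e ← l
      s' , sP' , ss , l ← eq-half {p} {y} {z} b y' r' j s (sP , ⊆-trans (proj₁ (proj₂ c)) qs , rs)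
      return (s' , sP' , ⊆-trans qs ss , l >>= λ (z' , l) → return (z' , l >>= λ (r'' , k , rs , e') →
        return (r'' , k , rs , return (y' , eq-mono {s} {s'} {x'} {y'} sP' ss e , e')))))
    pP (return (y , h , k))

  eq-intro : ∀ {p x y} → p ϵ P → Half Eq p x y → Half Eq p y x → Eq p x y
  eq-intro pP h k = coinduction (eq₃ or half eq₃ & half eq₃ ⟪ v0 ◂ v2 ◂ v1 ◂ ⟨⟩ ⟫) ⟨⟩
    (λ p x y h → h >>= λ { (inj₁ e) → return (inj₁ (eq-sym {p} {x} {y} e)) ; (inj₂ (a , b)) → return (inj₂ (b , a)) })
    (λ p x y _ h x' r i q c → (h >>= λ
      { (inj₁ e) → return (Half-map {Φ = Eq} {Ψ = Ψ} {p = p} {x} {y} (λ _ _ e → return (inj₁ e)) (eq-half {p} {x} {y} e))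
      ; (inj₂ (a , b)) → return (Half-map {Φ = Eq} {Ψ = Ψ} {p = p} {x} {y} (λ _ _ e → return (inj₁ e)) a) }) >>= λ f → f x' r i q c)
    pP (return (inj₂ (h , k)))
    where
    Ψ : D → D → D → Set
    Ψ s x y = ¬¬ (Eq s x y ⊎ (Half Eq s x y × Half Eq s y x))

  Dense : D → (D → Set) → Set
  Dense p Φ = ∀ q → q ϵ P → p ⊆ q → ¬¬ Σ D λ s → s ϵ P × q ⊆ s × Φ s

  eq-dense : ∀ {p x y} → p ϵ P → Dense p (λ s → Eq s x y) → Eq p x y
  eq-dense {p} {x} {y} pP d = eq-intro pP (lem d)
    (lem λ q a b → d q a b >>= λ (s , c , f , e) → return (s , c , f , eq-sym {s} {x} {y} e))
    where
    lem : ∀ {x y} → Dense p (λ s → Eq s x y) → Half Eq p x y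
    lem {x} {y} d x' r i q (a , b , c) = d q a b >>= λ (s , e , f , g) →
      eq-half {s} {x} {y} g x' r i s (e , ⊆-refl , ⊆-trans c f) >>= λ (s' , j , k , l) → return (s' , j , ⊆-trans f k , l)

  Force : Formula n → D → Vec D n → Set
  Force (x ∈̇ y) p ρ = Mem p (lookup ρ x) (lookup ρ y)
  Force (x ≐ y) p ρ = Eq p (lookup ρ x) (lookup ρ y)
  Force ⊥̇       p ρ = ⊥
  Force (φ ⇒ ψ) p ρ = ∀ q → q ϵ P → p ⊆ q → Force φ q ρ → Force ψ q ρ
  Force (∀̇ φ)   p ρ = ∀ x → Force φ p (x ◂ ρ)

  forces-ok : (φ : Formula n) {p : D} {ρ : Vec D n} → S (forces φ) (p ◂ ρ) ↔ Force φ p ρ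
  forces-ok (x ∈̇ y) = id , id
  forces-ok (x ≐ y) = id , id
  forces-ok ⊥̇       = id , id
  forces-ok {n} (φ ⇒ ψ) {p} {ρ} =
    (λ h q a b c → proj₁ (forces-ok ψ) (S-cong (forces ψ) (e q) (h q a b (S-cong (forces φ) (λ i → Qsym (e q i)) (proj₂ (forces-ok φ) c))))) ,
    (λ h q a b c → S-cong (forces ψ) (λ i → Qsym (e q i)) (proj₂ (forces-ok ψ) (h q a b (proj₁ (forces-ok φ) (S-cong (forces φ) (e q) c)))))
    where
    e : ∀ q (i : Fin (suc n)) → lookup (⟦ v0 ◂ vars ↑²_ ⟧* (q ◂ p ◂ ρ)) i ≃ lookup (q ◂ ρ) i
    e q zero    = Qrefl
    e q (suc i) = vars-ok ↑²_ (q ◂ p ◂ ρ) i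
  forces-ok {n} (∀̇ φ) {p} {ρ} =
    (λ h x → proj₁ (forces-ok φ) (S-cong (forces φ) (e x) (h x))) ,
    (λ h x → S-cong (forces φ) (λ i → Qsym (e x i)) (proj₂ (forces-ok φ) (h x)))
    where
    e : ∀ x (i : Fin (suc (suc n))) → lookup (⟦ v1 ◂ v0 ◂ vars ↑²_ ⟧* (x ◂ p ◂ ρ)) i ≃ lookup (p ◂ x ◂ ρ) i
    e x zero          = Qrefl
    e x (suc zero)    = Qrefl
    e x (suc (suc i)) = vars-ok ↑²_ (x ◂ p ◂ ρ) i

  mono : (φ : Formula n) {p q : D} {ρ : Vec D n} → q ϵ P → p ⊆ q → Force φ p ρ → Force φ q ρ
  mono (x ∈̇ y) qP s h q' (a , b) = h q' (a , ⊆-trans s b)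
  mono (x ≐ y) {p} {q} {ρ} qP s h = eq-mono {p} {q} {lookup ρ x} {lookup ρ y} qP s h
  mono ⊥̇       qP s h = h
  mono (φ ⇒ ψ) qP s h r a b c = h r a (⊆-trans s b) c
  mono (∀̇ φ)   qP s h x = mono φ qP s (h x)

  -- The clauses for `_⇒_` and `∀̇` are those of Kripke semantics. The density built into the atomic
  -- clauses passes through them and makes forcing classical.
  dense : (φ : Formula n) {p : D} {ρ : Vec D n} → p ϵ P → Dense p (λ s → Force φ s ρ) → Force φ p ρ
  dense (x ∈̇ y) pP d q (a , b) = d q a b >>= λ (s , c , e , f) → f s (c , ⊆-refl) >>= λ (s' , i , j , k) → return (s' , i , ⊆-trans e j , k)
  dense (x ≐ y) {p} {ρ} pP d = eq-dense {p} {lookup ρ x} {lookup ρ y} pP d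
  dense ⊥̇ {p}   pP d = d p pP ⊆-refl λ (_ , _ , _ , b) → b
  dense (φ ⇒ ψ) pP d q a b c = dense ψ a λ q' a' b' → d q' a' (⊆-trans b b') >>= λ (s , e , f , g) →
    return (s , e , f , g s e ⊆-refl (mono φ e (⊆-trans b' f) c))
  dense (∀̇ φ)   pP d x = dense φ pP λ q a b → d q a b >>= λ (s , e , f , g) → return (s , e , f , g x)

  none-ok : (φ : Fm (suc n)) {q : D} {ρ : Vec D n} → S (none φ) (q ◂ ρ) ↔ (∀ s → s ϵ P → q ⊆ s → ¬ S φ (s ◂ ρ))
  none-ok {n} φ {q} {ρ} = (λ h s a b c → h s (a , b) (S-cong φ (λ i → Qsym (e s i)) c)) ,
                      (λ h s (a , b) c → h s a b (S-cong φ (e s) c))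
    where
    e : ∀ s (i : Fin (suc n)) → lookup (⟦ v0 ◂ vars ↑²_ ⟧* (s ◂ q ◂ ρ)) i ≃ lookup (s ◂ ρ) i
    e s zero    = Qrefl
    e s (suc i) = vars-ok ↑²_ (s ◂ q ◂ ρ) i

  -- A generic filter, as the sequence g of conditions generating it: the n-th step
  -- enters the n-th element of the universe if that is a dense set.

  next : Fm 3
  next = v0 ϵᶠ Pᵗ & v1 ⊆ᶠ v0 & (All (v0 ϵᶠ Pᵗ ⊃ Ex (v0 ϵᶠ Pᵗ & v1 ⊆ᶠ v0 & v0 ϵᶠ v4)) ⊃ v0 ϵᶠ v2)

  abstract
    g : ℕ → D
    g zero    = ∅
    g (suc n) = proj₁ (choose (tr next) (g n ◂ elem n ◂ ⟨⟩))

    gP : ∀ n → g n ϵ P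
    g-next : ∀ n → S next (g (suc n) ◂ g n ◂ elem n ◂ ⟨⟩)
    gP zero    = ∅ϵP
    gP (suc n) = proj₁ (g-next n)
    g-next n = stS next {g (suc n) ◂ g n ◂ elem n ◂ ⟨⟩} do
      q , h ← em (∀ p → p ϵ P → ¬¬ Σ D λ s → s ϵ P × p ⊆ s × s ϵ elem n) >>= λ
        { (inj₁ d) → d (g n) (gP n) >>= λ (s , a , b , c) → return (s , a , b , λ _ → c)
        ; (inj₂ nd) → return (g n , gP n , ⊆-refl , λ d → ⊥-elim (nd d)) }
      return (proj₁ (tr-ok next _) (proj₂ (choose (tr next) (g n ◂ elem n ◂ ⟨⟩)) q (proj₂ (tr-ok next (q ◂ g n ◂ elem n ◂ ⟨⟩)) h)))

  g-mono : ∀ {m n} → m ≤ n → g m ⊆ g n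
  g-mono l = go (ℕ.≤⇒≤′ l)
    where
    go : ∀ {m n} → m ≤′ n → g m ⊆ g n
    go (≤′-reflexive refl) = ⊆-refl
    go {n = suc n} (≤′-step l) = ⊆-trans (go l) (proj₁ (proj₂ (g-next n)))

  -- The conditions that satisfy φ or have no extension satisfying it form a dense set of V. This
  -- set is `elem n` for some n, and the next member of the sequence enters it.
  decide : (φ : Fm (suc n)) (ρ : Vec D n) →
           ¬¬ ((Σ ℕ λ n → S φ (g n ◂ ρ)) ⊎ (Σ ℕ λ n → ∀ q → q ϵ P → g n ⊆ q → ¬ S φ (q ◂ ρ)))
  decide φ ρ = do
    d , h ← separate (φ ⟪ vars id ⟫ or none φ ⟪ vars id ⟫) ρ P
    let n , e = elem-surj d
    let gd = proj₂ (proj₂ (g-next n)) λ p i → subst (λ x → ¬¬ Σ D λ s → s ϵ P × p ⊆ s × s ϵ x) (sym e)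
               (em (¬¬ Σ D λ s → s ϵ P × p ⊆ s × S φ (s ◂ ρ)) >>= λ
                 { (inj₁ x) → x >>= λ (s , a , b , c) → return (s , a , b , proj₂ (h s) (a , return (inj₁ (from φ c))))
                 ; (inj₂ nx) → return (p , i , ⊆-refl , proj₂ (h p) (i , return (inj₂ (from (none φ) (proj₂ (none-ok φ) λ s a b c → nx (return (s , a , b , c))))))) })
    c ← proj₂ (proj₁ (h (g (suc n))) (subst (g (suc n) ϵ_) e gd))
    return (case c of λ { (inj₁ x) → inj₁ (suc n , to φ x) ; (inj₂ x) → inj₂ (suc n , proj₁ (none-ok φ) (to (none φ) x)) })
    where
    to : ∀ φ {x} → S φ (⟦ vars id ⟧* (x ◂ ρ)) → S φ (x ◂ ρ)
    to φ {x} = S-cong φ (vars-ok id (x ◂ ρ))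
    from : ∀ φ {x} → S φ (x ◂ ρ) → S φ (⟦ vars id ⟧* (x ◂ ρ))
    from φ {x} = S-cong φ λ i → Qsym (vars-ok id (x ◂ ρ) i)

  generic : (φ : Fm (suc n)) (ρ : Vec D n) (m : ℕ) → Dense (g m) (λ s → S φ (s ◂ ρ)) → ¬¬ Σ ℕ λ n → S φ (g n ◂ ρ)
  generic φ ρ m d = decide φ ρ >>= λ
    { (inj₁ x) → return x
    ; (inj₂ (n , h)) → ⊥-elim (d (g (m ⊔ n)) (gP _) (g-mono (ℕ.m≤m⊔n m n)) λ (s , a , b , c) → h s a (⊆-trans (g-mono (ℕ.m≤n⊔m m n)) b) c) }

  -- The generic extension

  EN QN : D → D → Set
  EN x y = ¬¬ Σ ℕ λ n → Mem (g n) x y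
  QN x y = ¬¬ Σ ℕ λ n → Eq (g n) x y

  G : D → Set
  G r = ¬¬ Σ ℕ λ n → r ⊆ g n

  QN-refl : ∀ {x} → QN x x
  QN-refl = return (0 , eq-refl (gP 0))

  QN-sym : ∀ {x y} → QN x y → QN y x
  QN-sym {x} {y} h = h >>= λ (n , e) → return (n , eq-sym {g n} {x} {y} e)

  QN-trans : ∀ {x y z} → QN x y → QN y z → QN x z
  QN-trans {x} {y} {z} h k = h >>= λ (m , a) → k >>= λ (n , b) →
    return (m ⊔ n , eq-trans {g (m ⊔ n)} {x} {y} {z} (gP _) (eq-mono {g m} {g (m ⊔ n)} {x} {y} (gP _) (g-mono (ℕ.m≤m⊔n m n)) a)
                                    (eq-mono {g n} {g (m ⊔ n)} {y} {z} (gP _) (g-mono (ℕ.m≤n⊔m m n)) b))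

  -- Forced membership asks for witnesses only in a dense set of extensions; genericity supplies
  -- them in the filter and thus recovers the usual evaluation of names.
  EN-spec : ∀ {x y} → EN x y ↔ (¬¬ Σ D λ x' → Σ D λ r → op x' r ϵ y × G r × QN x x')
  EN-spec {x} {y} =
    (λ h → do
      m , a ← h
      n , b ← generic (Ex (Ex (opᵗ v1 v0 ϵᶠ v4 & v0 ⊆ᶠ v2 & eq₃ ⟪ v2 ◂ v3 ◂ v1 ◂ ⟨⟩ ⟫))) (x ◂ y ◂ ⟨⟩) m λ q i j → a q (i , j)
      x' , b ← b
      r , i , j , k ← b
      return (x' , r , i , return (n , j) , return (n , k))) ,
    (λ h → do
      x' , r , i , a , b ← h
      m , j ← a
      n , k ← b
      return (m ⊔ n , λ q (c , d) → return (q , c , ⊆-refl , return (x' , return (r , i , ⊆-trans (⊆-trans j (g-mono (ℕ.m≤m⊔n m n))) d ,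
        eq-mono {g n} {q} {x} {x'} c (⊆-trans (g-mono (ℕ.m≤n⊔m m n)) d) k)))))

  EN-congˡ : ∀ {x x' y} → QN x x' → EN x y → EN x' y
  EN-congˡ {x} {x'} q h = proj₂ EN-spec (proj₁ EN-spec h >>= λ (z , r , i , a , b) → return (z , r , i , a , QN-trans {x'} {x} {z} (QN-sym {x} {x'} q) b))

  EN-congʳ : ∀ {x y y'} → QN y y' → EN x y → EN x y'
  EN-congʳ {x} {y} {y'} q h = do
    z , r , i , a , b ← proj₁ EN-spec h
    m , j ← a
    n , e ← q
    let l = m ⊔ n ; lp = g-mono (ℕ.m≤m⊔n m n) ; lq = g-mono (ℕ.m≤n⊔m m n)
    k , c ← generic (Ex (Ex (opᵗ v1 v0 ϵᶠ v4 & v0 ⊆ᶠ v2 & eq₃ ⟪ v2 ◂ v3 ◂ v1 ◂ ⟨⟩ ⟫))) (z ◂ y' ◂ ⟨⟩) l λ q c d →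
      eq-half {g n} {y} {y'} e z r i q (c , ⊆-trans lq d , ⊆-trans (⊆-trans j lp) d)
    z' , c ← c
    r' , i' , j' , e' ← c
    proj₂ EN-spec (return (z' , r' , i' , return (k , j') , QN-trans {x} {z} {z'} b (return (k , e'))))

  𝔑 : Structure
  𝔑 = record { D = D ; E = EN ; Q = QN ; stE = λ h k → h λ a → a k ; stQ = λ h k → h λ a → a k
             ; Qrefl = λ {x} → QN-refl {x} ; Qsym = λ {x} {y} → QN-sym {x} {y} ; Qtr = λ {x} {y} {z} → QN-trans {x} {y} {z}
             ; congE = λ {x} {y} {x'} {y'} p q h → EN-congʳ {x'} {y} {y'} q (EN-congˡ {x} {x'} {y} p h) }

  module N = Semantics 𝔑

  -- Genericity is used to go from truth to forcing. For φ ⇒ ψ, `decide` is applied to forcing φ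
  -- while no extension forces ψ; for ∀ φ, to having a name x such that no extension forces φ at x.
  -- In both cases a member of the sequence with that property would refute the truth of the
  -- formula.
  truth : (φ : Formula n) (ρ : Vec D n) → N.sat φ ρ ↔ (¬¬ Σ ℕ λ n → Force φ (g n) ρ)
  truth (x ∈̇ y) ρ = id , id
  truth (x ≐ y) ρ = id , id
  truth ⊥̇       ρ = ⊥-elim , λ h → h λ (_ , b) → b
  truth (φ ⇒ ψ) ρ =
    (λ f → decide (forces φ & none (forces ψ)) ρ >>= λ
      { (inj₁ (m , a , b)) → ⊥-elim (proj₁ (truth ψ ρ) (f (proj₂ (truth φ ρ) (return (m , proj₁ (forces-ok φ) a)))) λ (n , c) →
          proj₁ (none-ok (forces ψ)) b (g (m ⊔ n)) (gP _) (g-mono (ℕ.m≤m⊔n m n))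
            (proj₂ (forces-ok ψ) (mono ψ (gP _) (g-mono (ℕ.m≤n⊔m m n)) c)))
      ; (inj₂ (n , h)) → return (n , λ q a b c → dense ψ a λ s d e k → h s d (⊆-trans b e)
          (proj₂ (forces-ok φ) (mono φ d e c) , proj₂ (none-ok (forces ψ)) λ t i j l → k (t , i , j , proj₁ (forces-ok ψ) l))) }) ,
    (λ h a → proj₂ (truth ψ ρ) (h >>= λ (m , b) → proj₁ (truth φ ρ) a >>= λ (n , c) →
      return (m ⊔ n , b (g (m ⊔ n)) (gP _) (g-mono (ℕ.m≤m⊔n m n)) (mono φ (gP _) (g-mono (ℕ.m≤n⊔m m n)) c))))
  truth (∀̇ φ) ρ =
    (λ f → decide (Ex (none (forces φ) ⟪ v1 ◂ v0 ◂ vars ↑²_ ⟫)) ρ >>= λ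
      { (inj₁ (m , b)) → ⊥-elim (b λ (x , b) → proj₁ (truth φ (x ◂ ρ)) (f x) λ (n , c) →
          proj₁ (none-ok (forces φ) {g m} {x ◂ ρ}) (S-cong (none (forces φ)) (e (g m) x) b) (g (m ⊔ n)) (gP _) (g-mono (ℕ.m≤m⊔n m n))
            (proj₂ (forces-ok φ) (mono φ (gP _) (g-mono (ℕ.m≤n⊔m m n)) c)))
      ; (inj₂ (n , h)) → return (n , λ x → dense φ (gP n) λ s d i k → h s d i (return (x , S-cong (none (forces φ)) (λ i → Qsym (e s x i))
          (proj₂ (none-ok (forces φ)) λ t a b l → k (t , a , b , proj₁ (forces-ok φ) l))))) }) ,
    (λ h x → proj₂ (truth φ (x ◂ ρ)) (h >>= λ (n , f) → return (n , f x)))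
    where
    e : ∀ q x (i : Fin (suc (suc _))) → lookup (⟦ v1 ◂ v0 ◂ vars ↑²_ ⟧* (x ◂ q ◂ ρ)) i ≃ lookup (q ◂ x ◂ ρ) i
    e q x zero          = Qrefl
    e q x (suc zero)    = Qrefl
    e q x (suc (suc i)) = vars-ok ↑²_ (x ◂ q ◂ ρ) i

-- ZFC in the generic extension

chk₁ : Tm 1
chk₁ = urec ∅ᵗ (sing₁ ⟨ opᵗ (sndᵗ v0) ∅ᵗ ◂ ⟨⟩ ⟩) ⟨ v0 ◂ ∅ᵗ ◂ ⟨⟩ ⟩
chkᵗ : Tm n → Tm n
chkᵗ t = chk₁ ⟨ t ◂ ⟨⟩ ⟩

module Extension (𝔙 : ZFCModel) (P₀ : Tm 0)
                 (∅ϵP : Universe._ϵ_ 𝔙 (Basics.∅ 𝔙) (Universe.⟦_⟧ 𝔙 P₀ ⟨⟩)) where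
  open Forcing 𝔙 P₀ ∅ϵP public

  diff₃ : Fm 3
  diff₃ = Ex (Ex (opᵗ v1 v0 ϵᶠ v3 & v0 ⊆ᶠ v2 & All (v0 ϵᶠ Pᵗ & v3 ⊆ᶠ v0 ⊃
    negᶠ (Ex (Ex (opᵗ v1 v0 ϵᶠ v7 & v0 ⊆ᶠ v2 & eq₃ ⟪ v2 ◂ v4 ◂ v1 ◂ ⟨⟩ ⟫))))))

  -- `diff₃` says that a condition puts some x' into x while no extension makes it equal to a member
  -- of y. No g m can satisfy it when x ⊆ y holds in N; and if some g n has no extension satisfying
  -- it, that g n forces one half of the equality.
  half-N : ∀ {x y} → (∀ z → EN z x → EN z y) → ¬¬ Σ ℕ λ n → Half Eq (g n) x y
  half-N {x} {y} h = decide diff₃ (x ◂ y ◂ ⟨⟩) >>= λ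
    { (inj₁ (m , d)) → ⊥-elim (d λ (x' , d) → d λ (r , i , j , f) →
        proj₁ EN-spec (h x' (proj₂ EN-spec (return (x' , r , i , return (m , j) , QN-refl {x'})))) λ (y' , r' , k , a , b) →
        a λ (n , l) → b λ (o , e) →
        let N = m ⊔ (n ⊔ o)
            n≤ = g-mono (ℕ.≤-trans (ℕ.m≤m⊔n n o) (ℕ.m≤n⊔m m (n ⊔ o)))
            o≤ = g-mono (ℕ.≤-trans (ℕ.m≤n⊔m n o) (ℕ.m≤n⊔m m (n ⊔ o)))
        in f (g N) (gP _ , g-mono (ℕ.m≤m⊔n m (n ⊔ o)))
             (return (y' , return (r' , k , ⊆-trans l n≤ , eq-mono {g o} {g N} {x'} {y'} (gP _) o≤ e))))
    ; (inj₂ (n , f)) → return (n , λ x' r i q (a , b , c) k → f q a b (return (x' , return (r , i , c , λ s (d , e) l → k (s , d , e , l))))) }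

  N-ext : ∀ {x y} → (∀ z → EN z x ↔ EN z y) → QN x y
  N-ext {x} {y} h = do
    m , a ← half-N {x} {y} λ z → proj₁ (h z)
    n , b ← half-N {y} {x} λ z → proj₂ (h z)
    return (m ⊔ n , eq-intro (gP _) (later m (m ⊔ n) (ℕ.m≤m⊔n m n) a) (later n (m ⊔ n) (ℕ.m≤n⊔m m n) b))
    where
    later : ∀ m n {x y} → m ≤ n → Half Eq (g m) x y → Half Eq (g n) x y
    later m n l h x' r i q (a , b , c) = h x' r i q (a , ⊆-trans (g-mono l) b , c)

  nm : Fm (suc (suc n)) → Vec D n → D → D
  nm ψ ρ d = ⟦ nameᵗ ψ ⟧ (d ◂ ρ)

  module _ (ψ : Fm (suc (suc n))) (ρ : Vec D n) (d : D) where
    private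
      e : ∀ {w x r} (i : Fin (suc (suc n))) → lookup (⟦ v1 ◂ v0 ◂ vars (↑_ ∘ ↑³_) ⟧* (r ◂ x ◂ w ◂ d ◂ ρ)) i ≃ lookup (x ◂ r ◂ ρ) i
      e zero       = Qrefl
      e (suc zero) = Qrefl
      e {w} {x} {r} (suc (suc i)) = vars-ok (↑_ ∘ ↑³_) (r ◂ x ◂ w ◂ d ◂ ρ) i

    abstract
      nm-spec : ∀ {w} → w ϵ nm ψ ρ d ↔ (¬¬ Σ D λ x → ¬¬ Σ D λ r → w ≃ op x r × x ϵ d × r ϵ P × S ψ (x ◂ r ◂ ρ))
      nm-spec {w} =
        (λ h → proj₁ sp h >>= λ (x , h) → return (x , h >>= λ (r , a , b , c , s) → return (r , a , b , c , S-cong ψ e s))) ,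
        (λ h → proj₂ sp (h >>= λ (x , h) → return (x , h >>= λ (r , a , b , c , s) → return (r , a , b , c , S-cong ψ (λ i → Qsym (e {w} i)) s))))
        where
        sp : ∀ {w} → w ϵ nm ψ ρ d ↔ S (Ex (Ex (v2 ≃ᶠ opᵗ v1 v0 & v1 ϵᶠ v3 & v0 ϵᶠ Pᵗ & ψ ⟪ v1 ◂ v0 ◂ vars (↑_ ∘ ↑³_) ⟫))) (w ◂ d ◂ ρ)
        sp = cls-bounded (prod d P) λ w h → stE (h >>= λ (x , h) → h >>= λ (r , a , b , c , _) → return (ϵˡ (Qsym a) (prod-in b c)))

    EN-nm : (∀ x r s → r ϵ P → s ϵ P → r ⊆ s → S ψ (x ◂ r ◂ ρ) → S ψ (x ◂ s ◂ ρ)) →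
            ∀ {z} → EN z (nm ψ ρ d) ↔ (¬¬ Σ D λ x → x ϵ d × (Σ ℕ λ n → S ψ (x ◂ g n ◂ ρ)) × QN z x)
    EN-nm mo {z} =
      (λ h → do
        x , r , i , a , b ← proj₁ EN-spec h
        n , j ← a
        x' , k ← proj₁ nm-spec i
        r' , q , l , m , s ← k
        return (x , ϵˡ (Qsym (op-inj₁ q)) l , (n , mo x r (g n) (ϵˡ (Qsym (op-inj₂ q)) m) (gP n) j
          (S-cong ψ (λ { zero → Qsym (op-inj₁ q) ; (suc zero) → Qsym (op-inj₂ q) ; (suc (suc _)) → Qrefl }) s)) , b)) ,
      (λ h → h >>= λ (x , i , (n , s) , b) → proj₂ EN-spec (return (x , g n ,
        proj₂ nm-spec (return (x , return (g n , Qrefl , i , gP n , s))) , return (n , ⊆-refl) , b)))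

  -- With this the closure axioms reduce to finding, in the ground model, a set d that contains a
  -- name for every element in question.
  comprehension : (φ : Formula (suc n)) (ρ : Vec D n) (d : D) → (∀ z → N.sat φ (z ◂ ρ) → ¬¬ Σ D λ x → x ϵ d × QN z x) →
                  ¬¬ Σ D λ b → ∀ z → EN z b ↔ N.sat φ (z ◂ ρ)
  comprehension {n} φ ρ d bd = return (nm ψ ρ d , λ z →
    (λ h → N.st φ (proj₁ (en z) h >>= λ (x , i , (m , s) , q) →
      return (N.sat-cong (λ { zero → QN-sym {z} {x} q ; (suc i) → QN-refl {lookup ρ i} }) φ
        (proj₂ (truth φ (x ◂ ρ)) (return (m , proj₁ (forces-ok φ) (S-cong (forces φ) e s))))))) ,
    (λ s → proj₂ (en z) (bd z s >>= λ (x , i , q) →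
      proj₁ (truth φ (x ◂ ρ)) (N.sat-cong (λ { zero → q ; (suc i) → QN-refl {lookup ρ i} }) φ s) >>= λ (m , f) →
      return (x , i , (m , S-cong (forces φ) (λ i → Qsym (e {x} {g m} i)) (proj₂ (forces-ok φ) f)) , q))))
    where
    ψ : Fm (suc (suc n))
    ψ = forces φ ⟪ v1 ◂ v0 ◂ vars ↑²_ ⟫
    e : ∀ {x r} (i : Fin (suc (suc n))) → lookup (⟦ v1 ◂ v0 ◂ vars ↑²_ ⟧* (x ◂ r ◂ ρ)) i ≃ lookup (r ◂ x ◂ ρ) i
    e zero       = Qrefl
    e (suc zero) = Qrefl
    e {x} {r} (suc (suc i)) = vars-ok ↑²_ (x ◂ r ◂ ρ) i
    en : ∀ z → _
    en z = EN-nm ψ ρ d (λ x r s a b c h → S-cong (forces φ) (λ i → Qsym (e {x} {s} i))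
      (proj₂ (forces-ok φ) (mono φ b c (proj₁ (forces-ok φ) (S-cong (forces φ) (e {x} {r}) h))))) {z}

  members : ∀ {a t} → Trans t → a ϵ t → ∀ {z} → EN z a → ¬¬ Σ D λ x → x ϵ t × QN z x × EN x a
  members tr i h = proj₁ EN-spec h >>= λ (x , r , j , a , b) →
    return (x , proj₁ (Trans-op tr (tr _ i _ j)) , b , proj₂ EN-spec (return (x , r , j , a , QN-refl {x})))

  -- Minimal elements transfer to the extension, for relations of the ground model
  -- that are well-founded there.
  module Minimum (A : Fm 3) (lt : Fm 4) (a b : D)
    (hmin : ∀ {k} (ψ : Fm (suc k)) (τ : Vec D k) → ¬¬ (Σ D λ x → S A (x ◂ a ◂ b ◂ ⟨⟩) × S ψ (x ◂ τ)) →
            ¬¬ Σ D λ x → S A (x ◂ a ◂ b ◂ ⟨⟩) × S ψ (x ◂ τ) ×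
              (∀ y → S A (y ◂ a ◂ b ◂ ⟨⟩) → S lt (y ◂ x ◂ a ◂ b ◂ ⟨⟩) → ¬ S ψ (y ◂ τ))) where
    -- Among the x for which some extension of a given stage forces φ, take a minimal one; the
    -- extension in question then has no further extension that forces φ for a smaller y. The
    -- minimality is about all extensions of `g m`, a statement of the ground model, because
    -- `N-choice` has to write it into a name.
    N-min : (t : Tm 1) (φ : Formula (suc n)) (ρ : Vec D n) →
            ¬¬ (Σ D λ x → S A (x ◂ a ◂ b ◂ ⟨⟩) × N.sat φ (⟦ t ⟧ (x ◂ ⟨⟩) ◂ ρ)) →
            ¬¬ Σ D λ x → S A (x ◂ a ◂ b ◂ ⟨⟩) × Σ ℕ λ m → Force φ (g m) (⟦ t ⟧ (x ◂ ⟨⟩) ◂ ρ) ×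
              (∀ y → S A (y ◂ a ◂ b ◂ ⟨⟩) → S lt (y ◂ x ◂ a ◂ b ◂ ⟨⟩) → ∀ s → s ϵ P → g m ⊆ s → ¬ Force φ s (⟦ t ⟧ (y ◂ ⟨⟩) ◂ ρ))
    N-min {n} t φ ρ ne = decide χ (a ◂ b ◂ ρ) >>= λ
      { (inj₁ (m , h)) → h >>= λ (x , i , f , l) → return (x , i , m , proj₁ (forces-ok φ) (S-cong (forces φ) e₁ f) ,
          λ y j k s sP u fs → l y j k s (sP , u) (S-cong (forces φ) (λ i → Qsym (e₂ {s} {y} {x} {g m} i)) (proj₂ (forces-ok φ) fs)))
      ; (inj₂ (n , h)) → ⊥-elim (ne λ (x₀ , i₀ , s₀) → proj₁ (truth φ _) s₀ λ (n₀ , f₀) →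
          let q = g (n ⊔ n₀) in
          hmin ψ (q ◂ ρ) (return (x₀ , i₀ , return (q , gP _ , ⊆-refl , from₃ (mono φ (gP _) (g-mono (ℕ.m≤n⊔m n n₀)) f₀)))) λ (x , i , k , l) →
          k λ (s , sP , qs , f) → h s sP (⊆-trans (g-mono (ℕ.m≤m⊔n n n₀)) qs)
            (return (x , i , S-cong (forces φ) (λ i → Qsym (e₁ {x} {s} i)) (proj₂ (forces-ok φ) (to₃ f)) ,
              λ y j u s' (sP' , ss) f' → l y j u (return (s' , sP' , ⊆-trans qs ss ,
                from₃ (proj₁ (forces-ok φ) (S-cong (forces φ) (e₂ {s'} {y} {x} {s}) f')))))) ) }
      where
      χ : Fm (3 + n)
      χ = Ex (A ⟪ v0 ◂ v2 ◂ v3 ◂ ⟨⟩ ⟫ & forces φ ⟪ v1 ◂ t ⟨ v0 ◂ ⟨⟩ ⟩ ◂ vars (λ i → suc (↑³ i)) ⟫ &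
        All (A ⟪ v0 ◂ v3 ◂ v4 ◂ ⟨⟩ ⟫ ⊃ lt ⟪ v0 ◂ v1 ◂ v3 ◂ v4 ◂ ⟨⟩ ⟫ ⊃ All (v0 ϵᶠ Pᵗ & v3 ⊆ᶠ v0 ⊃
          negᶠ (forces φ ⟪ v0 ◂ t ⟨ v1 ◂ ⟨⟩ ⟩ ◂ vars (λ i → ↑³ (↑³ i)) ⟫))))
      ψ : Fm (2 + n)
      ψ = Ex (v0 ϵᶠ Pᵗ & v2 ⊆ᶠ v0 & forces φ ⟪ v0 ◂ t ⟨ v1 ◂ ⟨⟩ ⟩ ◂ vars ↑³_ ⟫)
      e₁ : ∀ {x q} (i : Fin (suc (suc n))) →
        lookup (⟦ v1 ◂ t ⟨ v0 ◂ ⟨⟩ ⟩ ◂ vars (λ i → suc (↑³ i)) ⟧* (x ◂ q ◂ a ◂ b ◂ ρ)) i ≃ lookup (q ◂ ⟦ t ⟧ (x ◂ ⟨⟩) ◂ ρ) i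
      e₁ zero = Qrefl
      e₁ (suc zero) = Qrefl
      e₁ {x} {q} (suc (suc i)) = vars-ok (λ i → suc (↑³ i)) (x ◂ q ◂ a ◂ b ◂ ρ) i
      e₂ : ∀ {s y x q} (i : Fin (suc (suc n))) →
        lookup (⟦ v0 ◂ t ⟨ v1 ◂ ⟨⟩ ⟩ ◂ vars (λ i → ↑³ (↑³ i)) ⟧* (s ◂ y ◂ x ◂ q ◂ a ◂ b ◂ ρ)) i ≃ lookup (s ◂ ⟦ t ⟧ (y ◂ ⟨⟩) ◂ ρ) i
      e₂ zero = Qrefl
      e₂ (suc zero) = Qrefl
      e₂ {s} {y} {x} {q} (suc (suc i)) = vars-ok (λ i → ↑³ (↑³ i)) (s ◂ y ◂ x ◂ q ◂ a ◂ b ◂ ρ) i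
      e₃ : ∀ {s x q} (i : Fin (suc (suc n))) →
        lookup (⟦ v0 ◂ t ⟨ v1 ◂ ⟨⟩ ⟩ ◂ vars ↑³_ ⟧* (s ◂ x ◂ q ◂ ρ)) i ≃ lookup (s ◂ ⟦ t ⟧ (x ◂ ⟨⟩) ◂ ρ) i
      e₃ zero = Qrefl
      e₃ (suc zero) = Qrefl
      e₃ {s} {x} {q} (suc (suc i)) = vars-ok ↑³_ (s ◂ x ◂ q ◂ ρ) i
      from₃ : ∀ {s x q} → Force φ s (⟦ t ⟧ (x ◂ ⟨⟩) ◂ ρ) → S (forces φ) (⟦ v0 ◂ t ⟨ v1 ◂ ⟨⟩ ⟩ ◂ vars ↑³_ ⟧* (s ◂ x ◂ q ◂ ρ))
      from₃ f = S-cong (forces φ) (λ i → Qsym (e₃ i)) (proj₂ (forces-ok φ) f)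
      to₃ : ∀ {s x q} → S (forces φ) (⟦ v0 ◂ t ⟨ v1 ◂ ⟨⟩ ⟩ ◂ vars ↑³_ ⟧* (s ◂ x ◂ q ◂ ρ)) → Force φ s (⟦ t ⟧ (x ◂ ⟨⟩) ◂ ρ)
      to₃ f = proj₁ (forces-ok φ) (S-cong (forces φ) e₃ f)

    N-least : (t : Tm 1) (φ : Formula (suc n)) (ρ : Vec D n) →
            ¬¬ (Σ D λ x → S A (x ◂ a ◂ b ◂ ⟨⟩) × N.sat φ (⟦ t ⟧ (x ◂ ⟨⟩) ◂ ρ)) →
            ¬¬ Σ D λ x → S A (x ◂ a ◂ b ◂ ⟨⟩) × N.sat φ (⟦ t ⟧ (x ◂ ⟨⟩) ◂ ρ) ×
              (∀ y → S A (y ◂ a ◂ b ◂ ⟨⟩) → S lt (y ◂ x ◂ a ◂ b ◂ ⟨⟩) → ¬ N.sat φ (⟦ t ⟧ (y ◂ ⟨⟩) ◂ ρ))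
    N-least t φ ρ ne = N-min t φ ρ ne >>= λ (x , i , m , f , l) → return (x , i , proj₂ (truth φ _) (return (m , f)) ,
      λ y j k s → proj₁ (truth φ _) s λ (n , f') → l y j k (g (m ⊔ n)) (gP _) (g-mono (ℕ.m≤m⊔n m n)) (mono φ (gP _) (g-mono (ℕ.m≤n⊔m m n)) f'))

  W-ϵ : ∀ {x y} → x ϵ y → W x ϵ W y
  W-ϵ i = proj₂ W-spec (return (_ , i , ⊆-refl))

  rank-min : (ψ : Fm (suc n)) (τ : Vec D n) → ¬¬ (Σ D λ x → ⊤ × S ψ (x ◂ τ)) →
             ¬¬ Σ D λ x → ⊤ × S ψ (x ◂ τ) × (∀ y → ⊤ → W y ϵ W x → ¬ S ψ (y ◂ τ))
  rank-min {n} ψ τ ne = do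
    x₀ , _ , s₀ ← ne
    w , i , h , m ← minimal (Ex (v1 ≃ᶠ Wᵗ v0 & ψ ⟪ v0 ◂ vars ↑²_ ⟫)) τ (𝒫 (W x₀))
      (return (W x₀ , proj₂ 𝒫-spec ⊆-refl , return (x₀ , Qrefl , S-cong ψ (λ i → Qsym (e i)) s₀)))
    x , q , s ← h
    return (x , tt , S-cong ψ e s , λ y _ j s' → m (W y) (ϵʳ (Qsym q) j)
      (proj₂ 𝒫-spec λ u k → proj₁ 𝒫-spec i u (ϵʳ (Qsym q) (W-trans (W y) j u k))) (return (y , Qrefl , S-cong ψ (λ i → Qsym (e i)) s')))
    where
    e : ∀ {x w} (i : Fin (suc n)) → lookup (⟦ v0 ◂ vars ↑²_ ⟧* (x ◂ w ◂ τ)) i ≃ lookup (x ◂ τ) i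
    e zero = Qrefl
    e {x} {w} (suc i) = vars-ok ↑²_ (x ◂ w ◂ τ) i

  ⊤ᶠ : Fm n
  ⊤ᶠ = ⊥ᶠ ⊃ ⊥ᶠ

  -- Take an element of x whose name has least rank: by `EN-spec` each of its members has a name of
  -- smaller rank.
  N-foundation : ∀ {x} → ¬¬ (Σ D λ y → EN y x) → ¬¬ Σ D λ y → EN y x × (∀ z → EN z y → ¬ EN z x)
  N-foundation {x} ne = M.N-least v0 (zero ∈̇ suc zero) (x ◂ ⟨⟩) (ne >>= λ (y , i) → return (y , id , i)) >>= λ (y , _ , i , l) →
    return (y , i , λ z j k → proj₁ EN-spec j λ (z' , r , o , _ , q) →
      l z' id (W-trans _ (W-trans _ (W-ϵ o) _ (W-ϵ opˡ)) _ (W-ϵ upˡ)) (EN-congˡ {z} {z'} {x} q k))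
    where
    module M = Minimum ⊤ᶠ (Wᵗ v0 ϵᶠ Wᵗ v1) ∅ ∅ (λ ψ τ ne → rank-min ψ τ (ne >>= λ (x , _ , s) → return (x , tt , s)) >>=
      λ (x , _ , s , l) → return (x , id , s , λ y _ j → l y tt j))

  N-irrefl : ∀ {x} → ¬ EN x x
  N-irrefl {x} i = comprehension (zero ≐ suc zero) (x ◂ ⟨⟩) (up x x) (λ z q → return (x , upˡ , q)) λ (b , h) →
    N-foundation {b} (return (x , proj₂ (h x) (QN-refl {x}))) λ (y , j , l) →
      l x (EN-congʳ {x} {x} {y} (QN-sym {y} {x} (proj₁ (h y) j)) i) (proj₂ (h x) (QN-refl {x}))

  chk : D → D
  chk x = ⟦ chk₁ ⟧ (x ◂ ⟨⟩)

  abstract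
    chk-spec : ∀ {x w} → w ϵ chk x ↔ (¬¬ Σ D λ y → y ϵ x × w ≃ op (chk y) ∅)
    chk-spec {x} {w} =
      (λ i → proj₁ r i >>= λ
        { (inj₁ p) → ⊥-elim (∅-spec p)
        ; (inj₂ q) → q >>= λ (y , j , k) → proj₁ up-spec k >>= λ
            { (inj₁ e) → return (y , j , Qtr e (op-cong snd-op Qrefl)) ; (inj₂ e) → return (y , j , Qtr e (op-cong snd-op Qrefl)) } }) ,
      (λ h → proj₂ r (return (inj₂ (h >>= λ (y , j , e) → return (y , j , proj₂ up-spec (return (inj₁ (Qtr e (op-cong (Qsym snd-op) Qrefl)))))))))
      where
      r : w ϵ chk x ↔ (¬¬ (w ϵ ∅ ⊎ (¬¬ Σ D λ y → y ϵ x × w ϵ up (op (snd (op y (chk y))) ∅) (op (snd (op y (chk y))) ∅))))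
      r = rec-spec ∅ᵗ (sing₁ ⟨ opᵗ (sndᵗ v0) ∅ᵗ ◂ ⟨⟩ ⟩) ∅ {x} {w}

  ≃⇒QN : ∀ {x y} → x ≃ y → QN x y
  ≃⇒QN {x} {y} e = return (0 , rep (eq₃ ⟪ v1 ◂ v2 ◂ v0 ◂ ⟨⟩ ⟫) {g 0 ◂ x ◂ ⟨⟩} e (eq-refl {g 0} {x} (gP 0)))

  EN-chk : ∀ {x z} → EN z (chk x) ↔ (¬¬ Σ D λ y → y ϵ x × QN z (chk y))
  EN-chk {x} {z} =
    (λ h → proj₁ EN-spec h >>= λ (z' , r , i , _ , q) → proj₁ chk-spec i >>= λ (y , j , e) →
      return (y , j , QN-trans {z} {z'} {chk y} q (≃⇒QN (op-inj₁ e)))) ,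
    (λ h → h >>= λ (y , j , q) → proj₂ EN-spec (return (chk y , ∅ , proj₂ chk-spec (return (y , j , Qrefl)) ,
      return (0 , λ w i → ⊥-elim (∅-spec i)) , q)))

  N-zero : ∀ {z} → ¬ EN z (chk ∅)
  N-zero {z} h = proj₁ (EN-chk {∅} {z}) h λ (y , i , _) → ∅-spec i

  N-succ : ∀ {n z} → EN z (chk (succ n)) ↔ (¬¬ (EN z (chk n) ⊎ QN z (chk n)))
  N-succ {n} {z} =
    (λ h → proj₁ (EN-chk {succ n} {z}) h >>= λ (y , i , q) → adj-elim i (λ j → return (inj₁ (proj₂ (EN-chk {n} {z}) (return (y , j , q)))))
      λ e → return (inj₂ (QN-trans {z} {chk y} {chk n} q (≃⇒QN (rept chk₁ {⟨⟩} e))))) ,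
    (λ h → h >>= λ { (inj₁ i) → proj₂ (EN-chk {succ n} {z}) (proj₁ (EN-chk {n} {z}) i >>= λ (y , j , q) → return (y , adjˡ j , q))
                   ; (inj₂ q) → proj₂ (EN-chk {succ n} {z}) (return (n , adjʳ Qrefl , q)) })

  N-inductive : N.sat (Inductive zero) (chk ω ◂ ⟨⟩)
  N-inductive = ∧-in
    (ex-in (return (chk ∅ , ∧-in (proj₂ (EN-chk {ω} {chk ∅}) (return (∅ , 0ϵω , QN-refl {chk ∅}))) λ z → N-zero {z})))
    (λ x i → ex-in (proj₁ (EN-chk {ω} {x}) i >>= λ (n , j , q) → return (chk (succ n) ,
      ∧-in (proj₂ (EN-chk {ω} {chk (succ n)}) (return (succ n , sucϵω j , QN-refl {chk (succ n)}))) λ z → iff-in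
        ((λ k → proj₂ (or-out λ s f → s λ a → a f) (proj₁ (N-succ {n} {z}) k >>= λ
           { (inj₁ a) → return (inj₁ (EN-congʳ {z} {chk n} {x} (QN-sym {x} {chk n} q) a))
           ; (inj₂ a) → return (inj₂ (QN-trans {z} {chk n} {x} a (QN-sym {x} {chk n} q))) })) ,
         (λ k → proj₂ (N-succ {n} {z}) (proj₁ (or-out λ s f → s λ a → a f) k >>= λ
           { (inj₁ a) → return (inj₁ (EN-congʳ {z} {x} {chk n} q a))
           ; (inj₂ a) → return (inj₂ (QN-trans {z} {x} {chk n} a q)) })))) ))

  -- Every subset z of x in N equals the set named by pairs ⟨w , r⟩ with w ∈ T and r forcing w ∈ z.
  -- All these names are elements of the power set of T × P.
  N-power : ∀ x → ¬¬ Σ D λ p → ∀ z → EN z p ↔ (∀ w → EN w z → EN w x)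
  N-power x = tc-exists x >>= λ (T , tT , i) →
    comprehension (∀̇ (zero ∈̇ suc zero ⇒ zero ∈̇ suc (suc zero))) (x ◂ ⟨⟩) (𝒫 (prod T P)) λ z s →
      return (nm mem (z ◂ ⟨⟩) T , proj₂ 𝒫-spec (λ w j → stE (proj₁ (nm-spec mem (z ◂ ⟨⟩) T) j >>= λ (a , h) → h >>= λ (r , e , b , c , _) →
          return (ϵˡ (Qsym e) (prod-in b c)))) ,
        N-ext {z} {nm mem (z ◂ ⟨⟩) T} λ w →
          (λ k → proj₂ (en z w) (members tT i (s w k) >>= λ (w' , j , q , _) → EN-congˡ {w} {w'} {z} q k >>= λ m → return (w' , j , m , q))) ,
          (λ k → proj₁ (en z w) k >>= λ (w' , j , m , q) → EN-congˡ {w'} {w} {z} (QN-sym {w} {w'} q) (return m)))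
    where
    mem : Fm 3
    mem = mem₃ ⟪ v1 ◂ v0 ◂ v2 ◂ ⟨⟩ ⟫
    en : ∀ z w {T} → _
    en z w {T} = EN-nm mem (z ◂ ⟨⟩) T (λ x r s _ b c h → mono (zero ∈̇ suc zero) {r} {s} {x ◂ z ◂ ⟨⟩} b c h) {w}

  -- Collection in V is applied to pairs of a name x and a condition, and bounds one name y such
  -- that the condition forces φ x y. Since φ is functional in N, this y names the image of x.
  N-replacement : (φ : Formula (suc (suc n))) (ρ : Vec D n) →
    (∀ x y z → N.sat φ (x ◂ y ◂ ρ) → N.sat φ (x ◂ z ◂ ρ) → QN y z) → ∀ a →
    ¬¬ Σ D λ b → ∀ y → EN y b ↔ (¬¬ Σ D λ x → EN x a × N.sat φ (x ◂ y ◂ ρ))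
  N-replacement {n} φ ρ func a = do
    T , tT , i ← tc-exists a
    B , h ← collection (forces φ ⟪ sndᵗ v1 ◂ fstᵗ v1 ◂ v0 ◂ vars ↑²_ ⟫) ρ (prod T P)
    b , k ← comprehension (∃̇ (zero ∈̇ suc (suc zero) ∧̇ ren (zero V.∷ suc zero V.∷ ↑³_) φ)) (a ◂ ρ) B λ y s → do
      x , c ← ex-out s
      j , f ← ∧-out c
      x' , l , q , _ ← members tT i j
      let f' = N.sat-cong (λ { zero → q ; (suc zero) → QN-refl {y} ; (suc (suc i)) → QN-refl {lookup ρ i} }) φ (proj₁ (e x y) f)
      m , fo ← proj₁ (truth φ (x' ◂ y ◂ ρ)) f'
      y' , o , fo' ← h (op x' (g m)) (prod-in l (gP m)) (return (y , S-cong (forces φ) (λ i → Qsym (e' x' (g m) y i)) (proj₂ (forces-ok φ) fo)))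
      return (y' , o , func x' y y' f' (proj₂ (truth φ (x' ◂ y' ◂ ρ)) (return (m , proj₁ (forces-ok φ) (S-cong (forces φ) (e' x' (g m) y') fo')))))
    return (b , λ y → (λ j → ex-out (proj₁ (k y) j) >>= λ (x , c) → ∧-out c >>= λ (l , f) → return (x , l , proj₁ (e x y) f)) ,
                      (λ s → proj₂ (k y) (ex-in (s >>= λ (x , l , f) → return (x , ∧-in l (proj₂ (e x y) f))))))
    where
    e : ∀ x y → N.sat (ren (zero V.∷ suc zero V.∷ ↑³_) φ) (x ◂ y ◂ a ◂ ρ) ↔ N.sat φ (x ◂ y ◂ ρ)
    e x y = N.sat-ren (λ { zero → QN-refl {x} ; (suc zero) → QN-refl {y} ; (suc (suc i)) → QN-refl {lookup ρ i} }) φ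
    e' : ∀ x p y (i : Fin (suc (suc (suc n)))) →
      lookup (⟦ sndᵗ v1 ◂ fstᵗ v1 ◂ v0 ◂ vars ↑²_ ⟧* (y ◂ op x p ◂ ρ)) i ≃ lookup (p ◂ x ◂ y ◂ ρ) i
    e' x p y zero = snd-op
    e' x p y (suc zero) = fst-op
    e' x p y (suc (suc zero)) = Qrefl
    e' x p y (suc (suc (suc i))) = vars-ok ↑²_ (y ◂ op x p ◂ ρ) i

  -- In the extension the transversal consists of the elements that have a name
  -- which is the first one, in a well-order of the ground model, for its member of f.
  N-choice : ∀ f → (∀ x → EN x f → ¬¬ Σ D λ z → EN z x) →
             (∀ x y → EN x f → EN y f → (¬¬ Σ D λ z → EN z y × EN z x) → QN x y) →
             ¬¬ Σ D λ c → ∀ x → EN x f → ¬¬ Σ D λ z → (EN z x × EN z c) × (∀ z' → EN z' x → EN z' c → QN z' z)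
  N-choice f ne dj = do
    T , tT , i ← tc-exists f
    Θ , asy , lst ← well-order T
    let module M = Minimum (v0 ϵᶠ v1) (prec₃ ⟪ v3 ◂ v0 ◂ v1 ◂ ⟨⟩ ⟫) T Θ (λ ψ τ ne → do
          Q , h ← separate ψ τ T
          x , j , l ← lst Q (λ w j → proj₁ (proj₁ (h w) j)) (ne >>= λ (x , j , s) → return (x , proj₂ (h x) (j , s)))
          return (x , proj₁ (proj₁ (h x) j) , proj₂ (proj₁ (h x) j) , λ y k p s → asy {y} {x} p
            (l y (proj₂ (h y) (k , s)) λ q → asy {y} {x} p (S-cong prec₃ {Θ ◂ y ◂ x ◂ ⟨⟩} {Θ ◂ x ◂ y ◂ ⟨⟩}
              (λ { zero → Qrefl ; (suc zero) → q ; (suc (suc zero)) → Qsym q }) p))))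
        c = nm ψ (f ◂ T ◂ Θ ◂ ⟨⟩) T
        en : ∀ z → EN z c ↔ (¬¬ Σ D λ x → x ϵ T × (Σ ℕ λ n → Ψ f T Θ x (g n)) × QN z x)
        en z = EN-nm ψ (f ◂ T ◂ Θ ◂ ⟨⟩) T (λ d r s rP sP rs h → h >>= λ (y , a , b , l) → return (y ,
          mono (zero ∈̇ suc zero) {r} {s} {y ◂ f ◂ ⟨⟩} sP rs a , mono (zero ∈̇ suc zero) {r} {s} {d ◂ y ◂ ⟨⟩} sP rs b ,
          λ d' j p s' (sP' , ss) → l d' j p s' (sP' , ⊆-trans rs ss))) {z}
    return (c , λ x xf → do
      x' , xT , xx , xf' ← members tT i xf
      d , dT , m , fd , l ← M.N-min v0 (zero ∈̇ suc zero) (x' ◂ ⟨⟩) (ne x' xf' >>= λ (z , k) → members tT xT k >>= λ (z' , o , _ , k') → return (z' , o , k'))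
      n , xf'' ← xf'
      let big = g (m ⊔ n)
          dx' : EN d x'
          dx' = return (m , fd)
          Ψd : Ψ f T Θ d big
          Ψd = return (x' , mono (zero ∈̇ suc zero) {g n} {big} {x' ◂ f ◂ ⟨⟩} (gP _) (g-mono (ℕ.m≤n⊔m m n)) xf'' ,
                            mono (zero ∈̇ suc zero) {g m} {big} {d ◂ x' ◂ ⟨⟩} (gP _) (g-mono (ℕ.m≤m⊔n m n)) fd ,
                            λ d' j p s (sP , ss) → l d' j p s sP (⊆-trans (g-mono (ℕ.m≤m⊔n m n)) ss))
      return (d , (EN-congʳ {d} {x'} {x} (QN-sym {x} {x'} xx) dx' , proj₂ (en d) (return (d , dT , (m ⊔ n , Ψd) , QN-refl {d}))) ,
        λ z zx zc → do
          d' , dT' , (k , Ψd') , q ← proj₁ (en z) zc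
          y , yf , dy , l' ← Ψd'
          o , yx ← dj y x' (return (k , yf)) (return (n , xf'')) (return (d' , EN-congˡ {z} {d'} {x'} q (EN-congʳ {z} {x} {x'} xx zx) , return (k , dy)))
          inj₂ nq ← em (d' ≃ d)
            where inj₁ e → QN-trans {z} {d'} {d} q (≃⇒QN e)
          -- One of the names d and d' precedes the other. Both were first for their sets, and y
          -- equals x' in N, so either order contradicts the minimality of the later name.
          Q , h ← separate (v0 ≃ᶠ v1 or v0 ≃ᶠ v2) (d ◂ d' ◂ ⟨⟩) T
          w , wQ , wl ← lst Q (λ w j → proj₁ (proj₁ (h w) j)) (return (d , proj₂ (h d) (dT , return (inj₁ Qrefl))))
          N' , dx ← EN-congʳ {d} {x'} {y} (QN-sym {y} {x'} (return (o , yx))) dx'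
          N'' , d'x ← EN-congʳ {d'} {y} {x'} (return (o , yx)) (return (k , dy))
          inj₁ e ← proj₂ (proj₁ (h w) wQ)
            where inj₂ e → ⊥-elim (l d' dT' (S-cong prec₃ {Θ ◂ w ◂ d ◂ ⟨⟩} {Θ ◂ d' ◂ d ◂ ⟨⟩} (λ { zero → Qrefl ; (suc zero) → e ; (suc (suc zero)) → Qrefl })
                                (wl d (proj₂ (h d) (dT , return (inj₁ Qrefl))) λ r → nq (Qsym (Qtr r e))))
                              (g (m ⊔ N'')) (gP _) (g-mono (ℕ.m≤m⊔n m N''))
                              (mono (zero ∈̇ suc zero) {g N''} {g (m ⊔ N'')} {d' ◂ x' ◂ ⟨⟩} (gP _) (g-mono (ℕ.m≤n⊔m m N'')) d'x))
          ⊥-elim (l' d dT (S-cong prec₃ {Θ ◂ w ◂ d' ◂ ⟨⟩} {Θ ◂ d ◂ d' ◂ ⟨⟩} (λ { zero → Qrefl ; (suc zero) → e ; (suc (suc zero)) → Qrefl })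
                              (wl d' (proj₂ (h d') (dT' , return (inj₂ Qrefl))) λ r → nq (Qtr r e)))
                              (g (k ⊔ N')) (gP _ , g-mono (ℕ.m≤m⊔n k N'))
                              (mono (zero ∈̇ suc zero) {g N'} {g (k ⊔ N')} {d ◂ y ◂ ⟨⟩} (gP _) (g-mono (ℕ.m≤n⊔m k N')) dx))))
    where
    ψ : Fm 5
    ψ = Ex (mem₃ ⟪ v2 ◂ v0 ◂ v3 ◂ ⟨⟩ ⟫ & mem₃ ⟪ v2 ◂ v1 ◂ v0 ◂ ⟨⟩ ⟫ &
          All (v0 ϵᶠ v5 ⊃ prec₃ ⟪ v6 ◂ v0 ◂ v2 ◂ ⟨⟩ ⟫ ⊃ All (v0 ϵᶠ Pᵗ & v4 ⊆ᶠ v0 ⊃ negᶠ (mem₃ ⟪ v0 ◂ v1 ◂ v2 ◂ ⟨⟩ ⟫))))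
    Ψ : D → D → D → D → D → Set
    Ψ f T Θ d r = ¬¬ Σ D λ y → Mem r y f × Mem r d y × (∀ d' → d' ϵ T → Prec Θ d' d → ∀ s → s ϵ P × r ⊆ s → ¬ Mem s d' y)

  private
    st¬ : ¬¬ ¬ A → ¬ A
    st¬ h a = h λ f → f a

  N-zfc : N.Models ZFC
  N-zfc _ ext x y h = N-ext {x} {y} λ z → iff-out st¬ st¬ (h z)
  N-zfc _ found x ne = ex-in (N-foundation {x} (λ k → ne λ z i → k (z , i)) >>= λ (y , i , h) → return (y , ∧-in i h))
  N-zfc _ pair x y = ex-in (comprehension (zero ≐ suc (suc zero) ∨̇ zero ≐ suc zero) (y ◂ x ◂ ⟨⟩) (up x y)
    (λ z s → proj₁ (or-out st¬) s >>= λ { (inj₁ q) → return (x , upˡ , q) ; (inj₂ q) → return (y , upʳ , q) }) >>= λ (b , h) → return (b , λ z → iff-in (h z)))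
  N-zfc _ un x = ex-in (tc-exists x >>= λ (T , tT , i) → comprehension (∃̇ (zero ∈̇ suc (suc zero) ∧̇ suc zero ∈̇ zero)) (x ◂ ⟨⟩) T
    (λ z s → ex-out s >>= λ (y , k) → ∧-out k >>= λ (p , q) → members tT i p >>= λ (y' , yT , yy , _) →
      members tT yT (EN-congʳ {z} {y} {y'} yy q) >>= λ (z' , zT , zz , _) → return (z' , zT , zz)) >>= λ (b , h) → return (b , λ z → iff-in (h z)))
  N-zfc _ pow x = ex-in (N-power x >>= λ (b , h) → return (b , λ z → iff-in (h z)))
  N-zfc _ inf = ex-in (return (chk ω , N-inductive))
  N-zfc _ ac f ne dj = ex-in (N-choice f (λ x i k → ne x i λ z j → k (z , j))
      (λ x y i j h → dj x i y j (ex-in (h >>= λ (z , a , b) → return (z , ∧-in a b)))) >>= λ (c , h) → return (c , λ x i → ex-in (h x i >>= λ (z , (a , b) , u) →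
        return (z , ∧-in (∧-in a b) λ z' k l → ∧-out k λ (p , q) → u z' p q l))))
  N-zfc _ (sep {n} φ) = proj₂ (N.closure-sat n _) λ ρ a → ex-in (tc-exists a >>= λ (T , tT , i) →
    comprehension (zero ∈̇ suc zero ∧̇ ren (zero V.∷ ↑²_) φ) (a ◂ ρ) T
      (λ z s → ∧-out s >>= λ (p , _) → members tT i p >>= λ (z' , zT , zz , _) → return (z' , zT , zz)) >>= λ (b , h) → return (b , λ x → iff-in
        (let e₁ = N.sat-ren {f = zero V.∷ ↑²_} {x ◂ a ◂ ρ} {x ◂ ρ} (λ { zero → QN-refl {x} ; (suc i) → QN-refl {lookup ρ i} }) φ
             e₂ = N.sat-ren {f = zero V.∷ ↑³_} {x ◂ b ◂ a ◂ ρ} {x ◂ ρ} (λ { zero → QN-refl {x} ; (suc i) → QN-refl {lookup ρ i} }) φ in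
         (λ k l → ∧-out (proj₁ (h x) k) λ (p , q) → l p (proj₂ e₂ (proj₁ e₁ q))) ,
         (λ k → proj₂ (h x) λ l → ∧-out k λ (p , q) → l p (proj₂ e₁ (proj₁ e₂ q))))))
  N-zfc _ (repl {n} φ) = proj₂ (N.closure-sat n _) λ ρ func a → ex-in (N-replacement φ ρ
      (λ x y z p q → func x y z
        (proj₂ (N.sat-ren {f = suc (suc zero) V.∷ suc zero V.∷ ↑³_} {z ◂ y ◂ x ◂ ρ} {x ◂ y ◂ ρ} (λ { zero → QN-refl {x} ; (suc zero) → QN-refl {y} ; (suc (suc i)) → QN-refl {lookup ρ i} }) φ) p)
        (proj₂ (N.sat-ren {f = suc (suc zero) V.∷ zero V.∷ ↑³_} {z ◂ y ◂ x ◂ ρ} {x ◂ z ◂ ρ} (λ { zero → QN-refl {x} ; (suc zero) → QN-refl {z} ; (suc (suc i)) → QN-refl {lookup ρ i} }) φ) q)) a >>= λ (b , h) →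
    return (b , λ y → iff-in
      (let e = λ x → N.sat-ren {f = zero V.∷ suc zero V.∷ (↑_ ∘ ↑³_)} {x ◂ y ◂ b ◂ a ◂ ρ} {x ◂ y ◂ ρ} (λ { zero → QN-refl {x} ; (suc zero) → QN-refl {y} ; (suc (suc i)) → QN-refl {lookup ρ i} }) φ in
       (λ i → ex-in (proj₁ (h y) i >>= λ (x , j , s) → return (x , ∧-in j (proj₂ (e x) s)))) ,
       (λ k → proj₂ (h y) (ex-out k >>= λ (x , k) → ∧-out k >>= λ (j , s) → return (x , j , proj₁ (e x) s))))))

-- The generic sets and the family X

upN₂ opN₂ : Tm 2
upN₂ = up₂ ⟨ opᵗ v0 ∅ᵗ ◂ opᵗ v1 ∅ᵗ ◂ ⟨⟩ ⟩
opN₂ = upN₂ ⟨ upN₂ ⟨ v0 ◂ v0 ◂ ⟨⟩ ⟩ ◂ upN₂ ⟨ v0 ◂ v1 ◂ ⟨⟩ ⟩ ◂ ⟨⟩ ⟩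
opNᵗ : Tm n → Tm n → Tm n
opNᵗ t u = opN₂ ⟨ t ◂ u ◂ ⟨⟩ ⟩

-- The name { ⟨ t u , r ⟩ : u ∈ d , α u ∈ r } of the set of all t u such that the
-- atom α u is in the generic filter
famᵗ : Tm (suc n) → Tm (suc n) → Tm (suc n)
famᵗ t α = ⁅ Ex (Ex (v1 ϵᶠ v3 & v0 ϵᶠ P₀ ⟨ ⟨⟩ ⟩ & v2 ≃ᶠ opᵗ (t ⟨ v1 ◂ vars (↑_ ∘ ↑³_) ⟩) v0 & α ⟨ v1 ◂ vars (↑_ ∘ ↑³_) ⟩ ϵᶠ v0)) ⁆

abstract
  wφ : Fm 2
  wφ = Ex (Ex (v1 ϵᶠ ωᵗ & v0 ϵᶠ P₀ ⟨ ⟨⟩ ⟩ & v2 ≃ᶠ opᵗ (chkᵗ v1) v0 & dgᵗ v3 v1 oneᵗ ϵᶠ v0))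

-- the ξ-th generic set
w₁ : Tm 1
w₁ = ⁅ wφ ⁆

X₀ : Tm 0
X₀ = ⁅ Ex (v0 ϵᶠ Jᵗ & v1 ≃ᶠ opᵗ (w₁ ⟨ v0 ◂ ⟨⟩ ⟩) ∅ᵗ) ⁆

module Generic (𝔙 : ZFCModel) where
  open Extension 𝔙 P₀ (Poset.P-∅ 𝔙) public

  upN opN : D → D → D
  upN x y = ⟦ upN₂ ⟧ (x ◂ y ◂ ⟨⟩)
  opN x y = ⟦ opN₂ ⟧ (x ◂ y ◂ ⟨⟩)

  G-∅ : G ∅
  G-∅ = return (0 , λ w i → ⊥-elim (∅-spec i))

  upN-spec : ∀ x y z → EN z (upN x y) ↔ (¬¬ (QN z x ⊎ QN z y))
  upN-spec x y z =
    (λ h → proj₁ (EN-spec {z} {upN x y}) h >>= λ (z' , r , i , _ , q) → proj₁ up-spec i >>= λ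
      { (inj₁ e) → return (inj₁ (QN-trans {z} {z'} {x} q (≃⇒QN (op-inj₁ e)))) ; (inj₂ e) → return (inj₂ (QN-trans {z} {z'} {y} q (≃⇒QN (op-inj₁ e)))) }) ,
    (λ h → h >>= λ { (inj₁ q) → proj₂ (EN-spec {z} {upN x y}) (return (x , ∅ , upˡ , G-∅ , q))
                   ; (inj₂ q) → proj₂ (EN-spec {z} {upN x y}) (return (y , ∅ , upʳ , G-∅ , q)) })

  module KN = Kuratowski 𝔑 upN upN-spec (λ x y → N-ext {x} {y})

  In : D → Set
  In a = ¬¬ Σ ℕ λ n → a ϵ g n

  both : ∀ {a b} → In a → In b → ¬¬ Σ ℕ λ n → a ϵ g n × b ϵ g n
  both h k = h >>= λ (m , i) → k >>= λ (n , j) → return (m ⊔ n , g-mono (ℕ.m≤m⊔n m n) _ i , g-mono (ℕ.m≤n⊔m m n) _ j)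

  In-cong : ∀ {a b} → a ≃ b → In a → In b
  In-cong e h = h >>= λ (n , i) → return (n , ϵˡ e i)

  g-free : ∀ n → Func (g n) × Kept (g n)
  g-free n = free {g n} (proj₁ (proj₂ (proj₁ P-spec (gP n))))

  In-func : ∀ {ξ m b b'} → In (dg ξ m b) → In (dg ξ m b') → b ≃ b'
  In-func h k = stQ (both h k >>= λ (n , i , j) → return (proj₁ (g-free n) _ _ _ _ i j))

  In-kept : ∀ {K n ξ m} → In (cd K n m) → In (pr K ξ n) → In (dg ξ m one) → ¬ In (dg ξ (succ m) one)
  In-kept h k l o = h λ (n₁ , a) → k λ (n₂ , b) → l λ (n₃ , c) → o λ (n₄ , d) →
    let N = (n₁ ⊔ n₂) ⊔ (n₃ ⊔ n₄) in
    proj₂ (g-free N) _ _ _ _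
      (g-mono (ℕ.≤-trans (ℕ.m≤m⊔n n₁ n₂) (ℕ.m≤m⊔n (n₁ ⊔ n₂) (n₃ ⊔ n₄))) _ a)
      (g-mono (ℕ.≤-trans (ℕ.m≤n⊔m n₁ n₂) (ℕ.m≤m⊔n (n₁ ⊔ n₂) (n₃ ⊔ n₄))) _ b)
      (g-mono (ℕ.≤-trans (ℕ.m≤m⊔n n₃ n₄) (ℕ.m≤n⊔m (n₁ ⊔ n₂) (n₃ ⊔ n₄))) _ c)
      (g-mono (ℕ.≤-trans (ℕ.m≤n⊔m n₃ n₄) (ℕ.m≤n⊔m (n₁ ⊔ n₂) (n₃ ⊔ n₄))) _ d)

  chk-inj : ∀ {m n} → m ϵ ω → n ϵ ω → QN (chk m) (chk n) → m ≃ n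
  chk-inj {m} {n} i j q = stQ (trichotomy i j >>= λ
    { (inj₁ p) → ⊥-elim (N-irrefl {chk m} (EN-congʳ {chk m} {chk n} {chk m} (QN-sym {chk m} {chk n} q) (proj₂ (EN-chk {n} {chk m}) (return (m , p , QN-refl {chk m})))))
    ; (inj₂ (inj₁ e)) → return e
    ; (inj₂ (inj₂ p)) → ⊥-elim (N-irrefl {chk n} (EN-congʳ {chk n} {chk m} {chk n} q (proj₂ (EN-chk {m} {chk n}) (return (n , p , QN-refl {chk n}))))) })

  -- Otherwise there is a least n ∈ ω whose check name is outside i, because the well-foundedness of
  -- ω in V transfers by `Minimum`; neither ∅ nor a successor can be this n. Hence ω has no new
  -- elements in N.
  N-ω-least : ∀ i → N.sat (Inductive zero) (i ◂ ⟨⟩) → ∀ n → n ϵ ω → EN (chk n) i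
  N-ω-least i ind n nω no = ∧-out ind λ (z , s) →
    M.N-least chk₁ (¬̇ (zero ∈̇ suc zero)) (i ◂ ⟨⟩) (return (n , nω , λ k → k no)) λ (x , xω , nx , l) →
      ω-case xω λ
        { (inj₁ e) → ex-out z λ (y , h) → ∧-out h λ (yi , ye) → nx (EN-congˡ {y} {chk x} {i}
            (QN-trans {y} {chk ∅} {chk x} (N-ext {y} {chk ∅} λ w → (λ j → ⊥-elim (ye w j)) , (λ j → ⊥-elim (N-zero {w} j))) (≃⇒QN (rept chk₁ {⟨⟩} (Qsym e)))) yi)
        ; (inj₂ (k , kω , e)) → (λ nk → l k kω (ϵʳ (Qsym e) (adjʳ Qrefl)) nk) λ ki → ex-out (s (chk k) ki) λ (y , h) → ∧-out h λ (yi , ys) →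
            nx (EN-congˡ {y} {chk x} {i} (QN-trans {y} {chk (succ k)} {chk x} (N-ext {y} {chk (succ k)} λ w →
              let f , f' = iff-out (λ h a → h λ b → b a) (λ h a b → h λ c → c a b) (ys w) in
              (λ j → proj₂ (N-succ {k} {w}) (proj₁ (or-out (λ h a → h λ b → b a)) (f j))) ,
              (λ j → f' (proj₂ (or-out (λ h a → h λ b → b a)) (proj₁ (N-succ {k} {w}) j)))) (≃⇒QN (rept chk₁ {⟨⟩} (Qsym e)))) yi) }
    where
    module M = Minimum (v0 ϵᶠ v1) (v0 ϵᶠ v1) ω ∅ (λ ψ τ ne → minimal ψ τ ω ne >>= λ (x , a , b , c) → return (x , a , b , λ y d e → c y e d))

  N-ω : N.sat (Isω zero) (chk ω ◂ ⟨⟩)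
  N-ω = ∧-in N-inductive λ i ind z zω → proj₁ (EN-chk {ω} {z}) zω >>= λ (n , nω , q) →
    EN-congˡ {chk n} {z} {i} (QN-sym {z} {chk n} q) (N-ω-least i (N.sat-cong {ρ = i ◂ chk ω ◂ ⟨⟩} {σ = i ◂ chk ω ◂ ⟨⟩} (λ { zero → QN-refl {i} ; (suc zero) → QN-refl {chk ω} }) (Inductive zero) ind) n nω)

  module _ (t α : Tm (suc n)) (ρ : Vec D n) (d : D) where
    private
      val atom : D → D
      val u = ⟦ t ⟧ (u ◂ ρ)
      atom u = ⟦ α ⟧ (u ◂ ρ)
      e : ∀ {r u w} (i : Fin (suc n)) → lookup (⟦ v1 ◂ vars (↑_ ∘ ↑³_) ⟧* (r ◂ u ◂ w ◂ d ◂ ρ)) i ≃ lookup (u ◂ ρ) i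
      e zero = Qrefl
      e {r} {u} {w} (suc i) = vars-ok (↑_ ∘ ↑³_) (r ◂ u ◂ w ◂ d ◂ ρ) i

    fam : D
    fam = ⟦ famᵗ t α ⟧ (d ◂ ρ)

    private
      fam-spec : ∀ {w} → w ϵ fam ↔ (¬¬ Σ D λ u → ¬¬ Σ D λ r → u ϵ d × r ϵ 𝔓 × w ≃ op (val u) r × atom u ϵ r)
      fam-spec {w} =
        (λ i → proj₁ sp i >>= λ (u , h) → return (u , h >>= λ (r , a , b , c , f) → return (r , a , b , Qtr c (op-cong (⟦⟧-cong t e) Qrefl) , ϵˡ (⟦⟧-cong α e) f))) ,
        (λ h → proj₂ sp (h >>= λ (u , h) → return (u , h >>= λ (r , a , b , c , f) → return (r , a , b ,
          Qtr c (op-cong (Qsym (⟦⟧-cong t (e {r} {u} {w}))) Qrefl) , ϵˡ (Qsym (⟦⟧-cong α (e {r} {u} {w}))) f))))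
        where
        sp : ∀ {w} → w ϵ fam ↔ S (Ex (Ex (v1 ϵᶠ v3 & v0 ϵᶠ P₀ ⟨ ⟨⟩ ⟩ & v2 ≃ᶠ opᵗ (t ⟨ v1 ◂ vars (↑_ ∘ ↑³_) ⟩) v0 & α ⟨ v1 ◂ vars (↑_ ∘ ↑³_) ⟩ ϵᶠ v0))) (w ◂ d ◂ ρ)
        sp = cls-bounded¬ (image-set t ρ d >>= λ (b , h) → return (prod b 𝔓 , λ w s → stE (s >>= λ (u , s) → s >>= λ (r , i , j , k , _) →
          return (ϵˡ (Qsym (Qtr k (op-cong (⟦⟧-cong t e) Qrefl))) (prod-in (proj₂ (h _) (return (u , i , Qrefl))) j)))))

    EN-fam : ∀ {z} → EN z fam ↔ (¬¬ Σ D λ u → u ϵ d × In (⟦ α ⟧ (u ◂ ρ)) × QN z (⟦ t ⟧ (u ◂ ρ)))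
    EN-fam {z} =
      (λ h → do
        x , r , i , Gr , q ← proj₁ (EN-spec {z} {fam}) h
        u , h ← proj₁ fam-spec i
        r' , a , b , c , f ← h
        return (u , a , (Gr >>= λ (n , s) → return (n , s _ (ϵʳ (Qsym (op-inj₂ c)) f))) , QN-trans {z} {x} {val u} q (≃⇒QN (op-inj₁ c)))) ,
      (λ h → h >>= λ (u , i , In , q) → In >>= λ (n , f) →
        proj₂ (EN-spec {z} {fam}) (return (val u , g n , proj₂ fam-spec (return (u , return (g n , i , gP n , Qrefl , f))) , return (n , ⊆-refl) , q)))

  wN : D → D
  wN ξ = ⟦ w₁ ⟧ (ξ ◂ ⟨⟩)
  XN : D
  XN = ⟦ X₀ ⟧ ⟨⟩

  abstract
    wN-spec : ∀ {ξ w} → w ϵ wN ξ ↔ (¬¬ Σ D λ u → ¬¬ Σ D λ r → u ϵ ω × r ϵ 𝔓 × w ≃ op (chk u) r × dg ξ u one ϵ r)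
    wN-spec {ξ} = cls-bounded¬ (image-set chk₁ ⟨⟩ ω >>= λ (b , h) → return (prod b 𝔓 , λ w s → stE (s >>= λ (u , s) → s >>= λ (r , i , j , k , _) →
      return (ϵˡ (Qsym k) (prod-in (proj₂ (h _) (return (u , i , Qrefl))) j)))))

    XN-spec : ∀ {w} → w ϵ XN ↔ (¬¬ Σ D λ ξ → ξ ϵ J × w ≃ op (wN ξ) ∅)
    XN-spec = cls-bounded¬ (image-set (opᵗ (w₁ ⟨ v0 ◂ ⟨⟩ ⟩) ∅ᵗ) ⟨⟩ J >>= λ (b , h) → return (b , λ w s → proj₂ (h w) s))

  EN-w : ∀ {ξ z} → EN z (wN ξ) ↔ (¬¬ Σ D λ m → m ϵ ω × In (dg ξ m one) × QN z (chk m))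
  EN-w {ξ} {z} =
    (λ h → do
      x , r , i , Gr , q ← proj₁ (EN-spec {z} {wN ξ}) h
      u , h ← proj₁ wN-spec i
      r' , a , b , c , f ← h
      return (u , a , (Gr >>= λ (n , s) → return (n , s _ (ϵʳ (Qsym (op-inj₂ c)) f))) , QN-trans {z} {x} {chk u} q (≃⇒QN (op-inj₁ c)))) ,
    (λ h → h >>= λ (u , i , In , q) → In >>= λ (n , f) →
      proj₂ (EN-spec {z} {wN ξ}) (return (chk u , g n , proj₂ wN-spec (return (u , return (g n , i , gP n , Qrefl , f))) , return (n , ⊆-refl) , q)))

  EN-X : ∀ {z} → EN z XN ↔ (¬¬ Σ D λ ξ → ξ ϵ J × QN z (wN ξ))
  EN-X {z} =
    (λ h → do
      x , r , i , Gr , q ← proj₁ (EN-spec {z} {XN}) h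
      ξ , a , c ← proj₁ XN-spec i
      return (ξ , a , QN-trans {z} {x} {wN ξ} q (≃⇒QN (op-inj₁ c)))) ,
    (λ h → h >>= λ (ξ , i , q) → proj₂ (EN-spec {z} {XN}) (return (wN ξ , ∅ , proj₂ XN-spec (return (ξ , i , Qrefl)) , G-∅ , q)))

  digit : ∀ {ξ m} → m ϵ ω → EN (chk m) (wN ξ) ↔ In (dg ξ m one)
  digit {ξ} {m} i =
    (λ h → proj₁ (EN-w {ξ} {chk m}) h >>= λ (m' , j , k , q) → In-cong (at-cong Qrefl Qrefl (Qsym (chk-inj i j q)) Qrefl) k) ,
    (λ h → proj₂ (EN-w {ξ} {chk m}) (return (m , i , h , QN-refl {chk m})))

  Fresh : D → D → Set
  Fresh l p = ∀ t x y z → at t x y z ϵ p → (y ϵ ω → succ y ϵ l) × (z ϵ ω → succ z ϵ l)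

  fresh-y : ∀ {l p t x z} → l ϵ ω → Fresh l p → ¬ (at t x l z ϵ p)
  fresh-y lω f i = asym (adjʳ Qrefl) (proj₁ (f _ _ _ _ i) lω)

  fresh-z : ∀ {l p t x y} → l ϵ ω → Fresh l p → ¬ (at t x y l ϵ p)
  fresh-z lω f i = asym (adjʳ Qrefl) (proj₂ (f _ _ _ _ i) lω)

  add-fresh : ∀ {p l ξ b} → p ϵ 𝔓 → l ϵ ω → Fresh l p → ξ ϵ 𝒫 J → b ϵ H → adj p (dg ξ l b) ϵ 𝔓
  add-fresh pP lω f ξJ bH = add-dg pP ξJ lω bH (λ b' i → fresh-y lω f i) (λ K n i _ _ → fresh-z lω f i)
    λ K n m e i _ _ → irrefl (ϵʳ (Qsym e) (proj₂ (f _ _ _ _ i) (ω-trans (ϵˡ (Qsym e) lω) (adjʳ Qrefl))))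

  -- Used with b = 1 to see that `wN ξ` is unbounded, and with ξ = J and any b ∈ H for the collapse.
  -- J is an element of 𝒫 J, not of J, which is why ξ ranges over 𝒫 J.
  some-digit : ∀ {ξ b k} → ξ ϵ 𝒫 J → b ϵ H → k ϵ ω → ¬¬ Σ D λ l → l ϵ ω × k ϵ l × In (dg ξ l b)
  some-digit {ξ} {b} {k} ξJ bH kω = generic φ (ξ ◂ b ◂ k ◂ ⟨⟩) 0 dn >>= λ (n , h) → out n h
    where
    φ : Fm 4
    φ = Ex (v0 ϵᶠ ωᵗ & v4 ϵᶠ v0 & dgᵗ v2 v0 v3 ϵᶠ v1)
    Φ : D → Set
    Φ p = ¬¬ Σ D λ l → l ϵ ω × k ϵ l × dg ξ l b ϵ p
    extend : ∀ q l → q ϵ 𝔓 → l ϵ ω → k ϵ l → Fresh l q → Σ D λ s → s ϵ 𝔓 × q ⊆ s × Φ s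
    extend q l qP lω kl f = adj q (dg ξ l b) , add-fresh qP lω f ξJ bH , (λ _ → adjˡ) , return new
      where
      new : Σ D λ l' → l' ϵ ω × k ϵ l' × dg ξ l' b ϵ adj q (dg ξ l b)
      new = l , lω , kl , adjʳ Qrefl
    dn : Dense (g 0) Φ
    dn q qP _ = fresh (proj₁ (proj₁ P-spec qP)) kω >>= λ (l , lω , kl , f) → return (extend q l qP lω kl f)
    out : ∀ n → Φ (g n) → ¬¬ Σ D λ l → l ϵ ω × k ϵ l × In (dg ξ l b)
    out n h = h >>= λ (l , lω , kl , i) → return (l , lω , kl , return (n , i))

  0ϵH : ∅ ϵ H
  0ϵH = ω⊆H _ 0ϵω
  1ϵH : one ϵ H
  1ϵH = ω⊆H _ 1ϵω

  2≄1 : ¬ (two ≃ one)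
  2≄1 e = 1≄2 (Qsym e)

  w-inj : ∀ {ξ ξ'} → ξ ϵ J → ξ' ϵ J → QN (wN ξ) (wN ξ') → ξ ≃ ξ'
  w-inj {ξ} {ξ'} i j q = stQ λ ne → generic φ (ξ ◂ ξ' ◂ ⟨⟩) 0 (dn ne) λ (n , h) → out n h
    where
    φ : Fm 3
    φ = Ex (v0 ϵᶠ ωᵗ & dgᵗ v2 v0 oneᵗ ϵᶠ v1 & dgᵗ v3 v0 ∅ᵗ ϵᶠ v1)
    Φ : D → Set
    Φ p = ¬¬ Σ D λ l → l ϵ ω × dg ξ l one ϵ p × dg ξ' l ∅ ϵ p
    module _ (ne : ¬ (ξ ≃ ξ')) (p l : D) (pP : p ϵ 𝔓) (lω : l ϵ ω) (f : Fresh l p) where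
      p₁ p₂ : D
      p₁ = adj p (dg ξ l one)
      p₂ = adj p₁ (dg ξ' l ∅)
      p₁P : p₁ ϵ 𝔓
      p₁P = add-fresh pP lω f (J⊆𝒫J ξ i) 1ϵH
      new : ∀ b' → ¬ (dg ξ' l b' ϵ p₁)
      new b' k = adj-elim k (λ k → ⊥-elim (fresh-y lω f k)) (λ e → ⊥-elim (ne (Qsym (proj₁ (proj₂ (at-inj e)))))) λ b → b
      p₂P : p₂ ϵ 𝔓
      p₂P = add-dg p₁P (J⊆𝒫J ξ' j) lω 0ϵH new
        (λ K n k _ _ → fresh-z lω f (adj-at 2≄1 k))
        (λ K n m e k _ _ → irrefl (ϵʳ (Qsym e) (proj₂ (f _ _ _ _ (adj-at 2≄1 k)) (ω-trans (ϵˡ (Qsym e) lω) (adjʳ Qrefl)))))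
      both-in : Σ D λ l → l ϵ ω × dg ξ l one ϵ p₂ × dg ξ' l ∅ ϵ p₂
      both-in = l , lω , adjˡ (adjʳ Qrefl) , adjʳ Qrefl
      extend : Σ D λ s → s ϵ 𝔓 × p ⊆ s × Φ s
      extend = p₂ , p₂P , (λ _ k → adjˡ (adjˡ k)) , return both-in
    dn : ¬ (ξ ≃ ξ') → Dense (g 0) Φ
    dn ne p pP _ = fresh (proj₁ (proj₁ P-spec pP)) 0ϵω >>= λ (l , lω , _ , f) → return (extend ne p l pP lω f)
    out : ∀ n → ¬ Φ (g n)
    out n h = h λ (l , lω , a , b) → 0≄1 (In-func (return (n , b))
      (proj₁ (digit lω) (EN-congʳ {chk l} {wN ξ} {wN ξ'} q (proj₂ (digit lω) (return (n , a))))))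

  -- If `g m` satisfies φ j, then by `ccc` it is dense below `g m` to include a member of A that
  -- satisfies φ j, so the filter contains such a member.
  cccN : (φ : Fm (suc (suc n))) (ρ : Vec D n) →
         (∀ j p q → p ϵ 𝔓 → q ϵ 𝔓 → p ⊆ q → S φ (j ◂ p ◂ ρ) → S φ (j ◂ q ◂ ρ)) →
         ¬¬ Σ D λ A → Sm A × A ⊆ 𝔓 ×
           (∀ j m → j ϵ ω → S φ (j ◂ g m ◂ ρ) → ¬¬ Σ D λ a → a ϵ A × S φ (j ◂ a ◂ ρ) × G a)
  cccN {n} φ ρ mo = ccc φ ρ >>= λ (A , sm , A⊆ , h) → return (A , sm , A⊆ , λ j m jω s → meets A h j m jω s)
    where
    e : ∀ {a p A j} (i : Fin (suc (suc n))) → lookup (⟦ v3 ◂ v0 ◂ vars (↑_ ∘ ↑³_) ⟧* (a ◂ p ◂ A ◂ j ◂ ρ)) i ≃ lookup (j ◂ a ◂ ρ) i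
    e zero = Qrefl
    e (suc zero) = Qrefl
    e {a} {p} {A} {j} (suc (suc i)) = vars-ok (↑_ ∘ ↑³_) (a ◂ p ◂ A ◂ j ◂ ρ) i
    ψ : Fm (suc (suc (suc n)))
    ψ = Ex (v0 ϵᶠ v2 & φ ⟪ v3 ◂ v0 ◂ vars (↑_ ∘ ↑³_) ⟫ & v0 ⊆ᶠ v1)
    module _ (A : D) (h : ∀ j q → j ϵ ω → q ϵ 𝔓 → S φ (j ◂ q ◂ ρ) → ¬¬ Σ D λ a → a ϵ A × S φ (j ◂ a ◂ ρ) × q ∪ a ϵ 𝔓)
             (j : D) (m : ℕ) (jω : j ϵ ω) (s : S φ (j ◂ g m ◂ ρ)) where
      Ψ : D → Set
      Ψ p = ¬¬ Σ D λ a → a ϵ A × S φ (⟦ v3 ◂ v0 ◂ vars (↑_ ∘ ↑³_) ⟧* (a ◂ p ◂ A ◂ j ◂ ρ)) × a ⊆ p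
      extend : ∀ q → Σ D (λ a → a ϵ A × S φ (j ◂ a ◂ ρ) × q ∪ a ϵ 𝔓) → Σ D λ s → s ϵ 𝔓 × q ⊆ s × Ψ s
      extend q (a , i , sa , qa) = q ∪ a , qa , (λ _ → ∪ˡ) , return x
        where
        x : Σ D λ a' → a' ϵ A × S φ (⟦ v3 ◂ v0 ◂ vars (↑_ ∘ ↑³_) ⟧* (a' ◂ q ∪ a ◂ A ◂ j ◂ ρ)) × a' ⊆ q ∪ a
        x = a , i , S-cong φ (λ k → Qsym (e {a} {q ∪ a} {A} {j} k)) sa , λ _ → ∪ʳ
      dn : Dense (g m) Ψ
      dn q qP gq = h j q jω qP (mo j (g m) q (gP m) qP gq s) >>= λ x → return (extend q x)
      meets : ¬¬ Σ D λ a → a ϵ A × S φ (j ◂ a ◂ ρ) × G a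
      meets = generic ψ (A ◂ j ◂ ρ) m dn >>= λ (k , x) → out k x
        where
        out : ∀ k → Ψ (g k) → ¬¬ Σ D λ a → a ϵ A × S φ (j ◂ a ◂ ρ) × G a
        out k x = x >>= λ (a , i , sa , s) → return (a , i , S-cong φ (e {a} {g k} {A} {j}) sa , return (k , s))

-- The Gδ property, uncountability and splitting

-- Two values for one digit. This fills the entries of a code for which there is no condition to be
-- listed: it clashes with everything and so never stands in the way of a promise.
bot₀ : Tm 0
bot₀ = adjᵗ (adjᵗ ∅ᵗ (dgᵗ ∅ᵗ ∅ᵗ ∅ᵗ)) (dgᵗ ∅ᵗ ∅ᵗ oneᵗ)

module Splitting (𝔙 : ZFCModel) where
  open Generic 𝔙 public

  wᵗ : Tm n → Tm n
  wᵗ t = w₁ ⟨ t ◂ ⟨⟩ ⟩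

  fst-op' : ∀ {f x y} → f · fst (op x y) ≃ f · x
  fst-op' {f} = rept (appᵗ v1 v0) {f ◂ ⟨⟩} fst-op

  succ-inj : ∀ {m n} → succ m ≃ succ n → m ≃ n
  succ-inj {m} {n} e = stQ (adj-elim {n} (ϵʳ e (adjʳ Qrefl)) (λ i → adj-elim {m} (ϵʳ (Qsym e) (adjʳ Qrefl)) (λ j → ⊥-elim (asym i j)) λ q → return (Qsym q)) return)

  at-∅ : ∀ {t x y z} → at t x y z ≃ ∅ → t ≃ ∅
  at-∅ {t} e = Qtr (Qsym fl-fp) (Qtr (fl-cong e) (≃ext λ w → (λ i → ⊥-elim (∅-spec (proj₁ fl-spec i))) , λ i → ⊥-elim (∅-spec i)))

  Mem-mono : ∀ {p q x y} → q ϵ 𝔓 → p ⊆ q → Mem p x y → Mem q x y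
  Mem-mono {p} {q} {x} {y} = mono (zero ∈̇ suc zero) {p} {q} {x ◂ y ◂ ⟨⟩}

  Mem-G : ∀ {a x y} → G a → Mem a x y → EN x y
  Mem-G {a} {x} {y} h m = h >>= λ (n , s) → return (n , Mem-mono {a} {g n} {x} {y} (gP n) s m)

  -- The Gδ property

  module Gδ (Y : D) where
    Good' : D → D → D → Set
    Good' F ξ h = (F · ξ) · h ϵ 𝔓 × Mem ((F · ξ) · h) (wN ξ) Y

    good₄ : Fm 4
    good₄ = appᵗ (appᵗ v2 v0) v1 ϵᶠ P₀ ⟨ ⟨⟩ ⟩ & mem₃ ⟪ appᵗ (appᵗ v2 v0) v1 ◂ wᵗ v0 ◂ v3 ◂ ⟨⟩ ⟫

    cover₃ : Fm 3
    cover₃ = All (v0 ϵᶠ P₀ ⟨ ⟨⟩ ⟩ ⊃ mem₃ ⟪ v0 ◂ wᵗ v2 ◂ v3 ◂ ⟨⟩ ⟫ ⊃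
      Ex (v0 ϵᶠ Hᵗ & (appᵗ v2 v0 ϵᶠ P₀ ⟨ ⟨⟩ ⟩ & mem₃ ⟪ appᵗ v2 v0 ◂ wᵗ v3 ◂ v4 ◂ ⟨⟩ ⟫) & ∪ᵗ v1 (appᵗ v2 v0) ϵᶠ P₀ ⟨ ⟨⟩ ⟩))

    Covers : D → Set
    Covers F = ∀ ξ → ξ ϵ J → ∀ q → q ϵ 𝔓 → Mem q (wN ξ) Y → ¬¬ Σ D λ h → h ϵ H × Good' F ξ h × q ∪ ((F · ξ) · h) ϵ 𝔓

    -- By the chain condition a small set of conditions forcing w_ξ ∈ Y is predense among all of
    -- these; the function `F · ξ` enumerates it along H.
    cover-exists : ¬¬ Σ D Covers
    cover-exists = skolem cover₃ (Y ◂ ⟨⟩) J one-cover >>= λ (F , h) → return (F , h)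
      where
      Cover : D → D → Set
      Cover f ξ = ∀ q → q ϵ 𝔓 → Mem q (wN ξ) Y → ¬¬ Σ D λ h → h ϵ H × (f · h ϵ 𝔓 × Mem (f · h) (wN ξ) Y) × q ∪ (f · h) ϵ 𝔓
      conv : ∀ ξ q f A → A ⊆ 𝔓 → Enum f A → (Σ D λ a → a ϵ A × Mem a (wN ξ) Y × q ∪ a ϵ 𝔓) →
             ¬¬ Σ D λ h → h ϵ H × (f · h ϵ 𝔓 × Mem (f · h) (wN ξ) Y) × q ∪ (f · h) ϵ 𝔓
      conv ξ q f A s en (a , i , m , u) = en a i >>= λ (h , hH , e) → return (x h hH e)
        where
        x : ∀ h → h ϵ H → a ≃ f · h → Σ D λ h → h ϵ H × (f · h ϵ 𝔓 × Mem (f · h) (wN ξ) Y) × q ∪ (f · h) ϵ 𝔓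
        x h hH e = h , hH , (ϵˡ e (s a i) , rep (mem₃ ⟪ v0 ◂ v1 ◂ v2 ◂ ⟨⟩ ⟫) {wN ξ ◂ Y ◂ ⟨⟩} e m) , rep (∪ᵗ v1 v0 ϵᶠ P₀ ⟨ ⟨⟩ ⟩) {q ◂ ⟨⟩} e u
      one-cover : ∀ ξ → ξ ϵ J → ¬¬ Σ D λ f → Cover f ξ
      one-cover ξ _ = ccc (mem₃ ⟪ v1 ◂ wᵗ v2 ◂ v3 ◂ ⟨⟩ ⟫) (ξ ◂ Y ◂ ⟨⟩) >>= λ (A , sm , A⊆ , h) → sm >>= λ (f , en) →
        return (f , λ q qP m → h ∅ q 0ϵω qP m >>= conv ξ q f A A⊆ en)

    Coded' : D → D → Set
    Coded' F K = ∀ ξ h → ξ ϵ J → h ϵ H →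
      (Good' F ξ h → (∀ a → a ϵ dec K ξ h → ¬¬ (a ≃ ∅ ⊎ a ϵ (F · ξ) · h)) × (F · ξ) · h ⊆ dec K ξ h) ×
      (¬ Good' F ξ h → Clash (dec K ξ h))

    bot : D
    bot = ⟦ bot₀ ⟧ ⟨⟩

    bot-fin : bot ϵ ⟦Fin⟧ (𝒫 J)
    bot-fin = Fin-adj (Fin-adj Fin-∅ (at-𝒫J 1ϵω ∅J ∅J ∅J)) (at-𝒫J 1ϵω ∅J ∅J (ω⊆𝒫J _ 1ϵω))
      where
      ∅J : ∅ ϵ 𝒫 J
      ∅J = ω⊆𝒫J _ 0ϵω

    bot-clash : Clash bot
    bot-clash = stS clash₁ {bot ◂ ⟨⟩} λ nc → 0≄1 (proj₁ (free {bot} nc) ∅ ∅ ∅ one (adjˡ (adjʳ Qrefl)) (adjʳ Qrefl))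

    value₄ : Fm 4
    value₄ = Ex (Ex (v3 ≃ᶠ opᵗ v1 v0 & ((good₄ ⟪ v1 ◂ v0 ◂ v4 ◂ v5 ◂ ⟨⟩ ⟫ & v2 ≃ᶠ appᵗ (appᵗ v4 v1) v0) or
                                         (negᶠ (good₄ ⟪ v1 ◂ v0 ◂ v4 ◂ v5 ◂ ⟨⟩ ⟫) & v2 ≃ᶠ bot₀ ⟨ ⟨⟩ ⟩))))

    Value : D → D → D → D → Set
    Value F r ξ h = ¬¬ ((Good' F ξ h × r ≃ (F · ξ) · h) ⊎ (¬ Good' F ξ h × r ≃ bot))

    value-cong : ∀ {F r ξ h ξ' h'} → ξ' ≃ ξ → h' ≃ h → Value F r ξ' h' → Value F r ξ h
    value-cong {F} {r} {ξ} {h} {ξ'} {h'} e e' val = val >>= λ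
      { (inj₁ (a , b)) → return (inj₁ (good-cong e e' a , Qtr b app-e))
      ; (inj₂ (a , b)) → return (inj₂ ((λ x → a (good-cong (Qsym e) (Qsym e') x)) , b)) }
      where
      good-cong : ∀ {ξ h ξ' h'} → ξ' ≃ ξ → h' ≃ h → Good' F ξ' h' → Good' F ξ h
      good-cong {ξ} {h} {ξ'} {h'} e e' = S-cong good₄ {ξ' ◂ h' ◂ F ◂ Y ◂ ⟨⟩} {ξ ◂ h ◂ F ◂ Y ◂ ⟨⟩}
        λ { zero → e ; (suc zero) → e' ; (suc (suc zero)) → Qrefl ; (suc (suc (suc zero))) → Qrefl }
      app-e : (F · ξ') · h' ≃ (F · ξ) · h
      app-e = ⟦⟧-cong (appᵗ (appᵗ v2 v0) v1) {ξ' ◂ h' ◂ F ◂ ⟨⟩} {ξ ◂ h ◂ F ◂ ⟨⟩} λ { zero → e ; (suc zero) → e' ; (suc (suc zero)) → Qrefl }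

    values-exist : ∀ F → ¬¬ Σ D λ R → ∀ ξ h → ξ ϵ J → h ϵ H → Value F (R · op ξ h) ξ h
    values-exist F = skolem value₄ (F ◂ Y ◂ ⟨⟩) (prod J H) total >>= λ (R , k) → return (R , λ ξ h i j → fix R ξ h (k (op ξ h) (prod-in i j)))
      where
      Val : D → D → Set
      Val r x = ¬¬ Σ D λ ξ → ¬¬ Σ D λ h → x ≃ op ξ h × Value F r ξ h
      total : ∀ x → x ϵ prod J H → ¬¬ Σ D λ r → Val r x
      total x i = proj₁ prod-spec i >>= λ (ξ , i) → i >>= λ (h , a , b , e) → em (Good' F ξ h) >>= λ
        { (inj₁ y) → return ((F · ξ) · h , return (ξ , return (h , e , return (inj₁ (y , Qrefl)))))
        ; (inj₂ n) → return (bot , return (ξ , return (h , e , return (inj₂ (n , Qrefl))))) }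
      fix : ∀ R ξ h → Val (R · op ξ h) (op ξ h) → Value F (R · op ξ h) ξ h
      fix R ξ h x = x >>= λ (ξ' , x) → x >>= λ (h' , e , w) → value-cong {F} {R · op ξ h} {ξ} {h} {ξ'} {h'} (Qsym (op-inj₁ e)) (Qsym (op-inj₂ e)) w

    code-exists : ∀ F → ¬¬ Σ D λ K → K ϵ 𝒫 J × Coded' F K
    code-exists F = values-exist F >>= λ (R , val) → coding R (λ ξ h i j → stE (val ξ h i j >>= λ
        { (inj₁ (y , e)) → return (ϵˡ (Qsym e) (proj₁ (proj₁ P-spec (proj₁ y)))) ; (inj₂ (_ , e)) → return (ϵˡ (Qsym e) bot-fin) })) >>= λ (K , KJ , c) →
      return (K , KJ , λ ξ h i j →
        (λ y → let e = good-val R ξ h (val ξ h i j) y ; a , b = c ξ h i j in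
          (λ w k → a w k >>= λ { (inj₁ z) → return (inj₁ z) ; (inj₂ z) → return (inj₂ (ϵʳ e z)) }) , λ w k → b w (ϵʳ (Qsym e) k)) ,
        (λ n → clash-mono (λ w k → proj₂ (c ξ h i j) w (ϵʳ (Qsym (bad-val R ξ h (val ξ h i j) n)) k)) bot-clash))
      where
      good-val : ∀ R ξ h → Value F (R · op ξ h) ξ h → Good' F ξ h → R · op ξ h ≃ (F · ξ) · h
      good-val R ξ h val y = stQ (val >>= λ { (inj₁ (_ , e)) → return e ; (inj₂ (n , _)) → ⊥-elim (n y) })
      bad-val : ∀ R ξ h → Value F (R · op ξ h) ξ h → ¬ Good' F ξ h → R · op ξ h ≃ bot
      bad-val R ξ h val n = stQ (val >>= λ { (inj₁ (y , _)) → ⊥-elim (n y) ; (inj₂ (_ , e)) → return e })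

    module Code (F K : D) (cov : Covers F) (KJ : K ϵ 𝒫 J) (cod : Coded' F K) (ξ : D) (ξJ : ξ ϵ J) where
      met : EN (wN ξ) Y → ¬¬ Σ D λ h → h ϵ H × Good' F ξ h × G ((F · ξ) · h)
      met mem = mem >>= λ (m , x) → generic φ (ξ ◂ F ◂ Y ◂ ⟨⟩) m (dn m x) >>= λ (n , h) → out n h
        where
        φ : Fm 4
        φ = Ex (v0 ϵᶠ Hᵗ & good₄ ⟪ v2 ◂ v0 ◂ v3 ◂ v4 ◂ ⟨⟩ ⟫ & appᵗ (appᵗ v3 v2) v0 ⊆ᶠ v1)
        Φ : D → Set
        Φ q = ¬¬ Σ D λ h → h ϵ H × Good' F ξ h × (F · ξ) · h ⊆ q
        extend : ∀ q → (Σ D λ h → h ϵ H × Good' F ξ h × q ∪ ((F · ξ) · h) ϵ 𝔓) → Σ D λ s → s ϵ 𝔓 × q ⊆ s × Φ s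
        extend q (h , hH , y , u) = q ∪ ((F · ξ) · h) , u , (λ _ → ∪ˡ) , return x
          where
          x : Σ D λ h' → h' ϵ H × Good' F ξ h' × (F · ξ) · h' ⊆ q ∪ ((F · ξ) · h)
          x = h , hH , y , λ _ → ∪ʳ
        dn : ∀ m → Mem (g m) (wN ξ) Y → Dense (g m) Φ
        dn m x q qP gq = cov ξ ξJ q qP (Mem-mono {g m} {q} {wN ξ} {Y} qP gq x) >>= λ z → return (extend q z)
        out : ∀ n → Φ (g n) → ¬¬ Σ D λ h → h ϵ H × Good' F ξ h × G ((F · ξ) · h)
        out n h = h >>= λ (h , hH , y , s) → return (h , hH , y , return (n , s))

      -- A promise in p would be legal, so p would clash with `dec K ξ h`; but apart from the
      -- harmless ∅ this set is already included in p.
      no-promise : ∀ {h p n} → h ϵ H → Good' F ξ h → p ϵ 𝔓 → (F · ξ) · h ⊆ p → ¬ (pr K ξ n ϵ p)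
      no-promise {h} {p} {n} hH y pP s i = proj₁ (proj₂ (proj₁ P-spec pP)) (clash-atoms into (proj₁ (proj₂ (proj₂ (proj₁ P-spec pP))) K ξ n i h hH))
        where
        into : ∀ t x y' z → ¬ (t ≃ ∅) → at t x y' z ϵ p ∪ dec K ξ h → at t x y' z ϵ p
        into t x y' z ne j = stE (∪-elim j return λ j → proj₁ (proj₁ (cod ξ h ξJ hH) y) _ j >>= λ
          { (inj₁ e) → ⊥-elim (ne (at-∅ e)) ; (inj₂ k) → return (s _ k) })

      Pattern : D → D → D → Set
      Pattern n m p = cd K n m ϵ p × dg ξ m one ϵ p × dg ξ (succ m) one ϵ p

      module _ (n q m : D) (nω : n ϵ ω) (qP : q ϵ 𝔓) (npr : ¬ (pr K ξ n ϵ q)) (mω : m ϵ ω) (f : Fresh m q) where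
        private
          q₁ q₂ q₃ : D
          -- The entry and the two digits are added one by one at a fresh m. Freshness leaves the
          -- new entry as the only code entry m, so the last digit could only break a promise about
          -- K, ξ and n, which `npr` excludes.
          q₁ = adj q (cd K n m)
          q₂ = adj q₁ (dg ξ m one)
          q₃ = adj q₂ (dg ξ (succ m) one)
          smω : succ m ϵ ω
          smω = sucϵω mω
          back₁ : ∀ {x y z} → dg x y z ϵ q₁ → dg x y z ϵ q
          back₁ = adj-at 1≄2
          old-digit : ∀ {m' b} → m' ϵ ω → dg ξ m' b ϵ q → succ m' ϵ m
          old-digit m'ω i = proj₁ (f _ _ _ _ i) m'ω
          q₁P : q₁ ϵ 𝔓
          q₁P = add-cd qP KJ nω mω λ ξ' _ i → fresh-y mω f i
          no-sm : ∀ {b} → ¬ (dg ξ (succ m) b ϵ q)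
          no-sm i = asym (adjʳ Qrefl) (nat-trans mω (old-digit smω i) (adjʳ Qrefl))
          q₂P : q₂ ϵ 𝔓
          q₂P = add-dg q₁P (J⊆𝒫J ξ ξJ) mω 1ϵH (λ b' i → fresh-y mω f (back₁ i)) (λ K' n' _ _ i → no-sm (back₁ i))
            λ K' n' m' e _ _ i → irrefl (ϵʳ (Qsym e) (old-digit (ω-trans (ϵˡ (Qsym e) mω) (adjʳ Qrefl)) (back₁ i)))
          old₂ : ∀ {y b} → ¬ (y ≃ m) → dg ξ y b ϵ q₂ → dg ξ y b ϵ q
          old₂ ne i = stE (adj-elim i (λ i → return (back₁ i)) λ e → ⊥-elim (ne (proj₁ (proj₂ (proj₂ (at-inj e))))))
          m-sm : ¬ (succ m ≃ m)
          m-sm e = irrefl (ϵʳ e (adjʳ Qrefl))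
          m-ssm : ¬ (succ (succ m) ≃ m)
          m-ssm e = asym (adjʳ Qrefl) (ϵʳ e (adjʳ Qrefl))
          clear : ∀ K' n' m' → succ m' ≃ succ m → cd K' n' m' ϵ q₂ → pr K' ξ n' ϵ q₂ → ⊥
          clear K' n' m' e i j = adj-elim (adj-at 2≄1 i)
            (λ i → ⊥-elim (fresh-z mω f (at-ϵ Qrefl Qrefl (succ-inj e) i)))
            (λ e' → let _ , a , b , _ = at-inj e' in ⊥-elim (npr (at-ϵ a Qrefl b (adj-at (λ e → 2≄3 (Qsym e)) (adj-at (λ e → 1≄3 (Qsym e)) j))))) λ b → b
          q₃P : q₃ ϵ 𝔓
          q₃P = add-dg q₂P (J⊆𝒫J ξ ξJ) smω 1ϵH (λ b' i → no-sm (old₂ m-sm i))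
            (λ K' n' _ _ i → asym (adjʳ Qrefl) (nat-trans mω (nat-trans mω (old-digit (sucϵω smω) (old₂ m-ssm i)) (adjʳ Qrefl)) (adjʳ Qrefl)))
            λ K' n' m' e i j _ → clear K' n' m' e i j
          pattern' : Σ D λ m → m ϵ ω × Pattern n m q₃
          pattern' = m , mω , adjˡ (adjˡ (adjʳ Qrefl)) , adjˡ (adjʳ Qrefl) , adjʳ Qrefl
        extend-pattern : Σ D λ s → s ϵ 𝔓 × q ⊆ s × (¬¬ Σ D λ m → m ϵ ω × Pattern n m s)
        extend-pattern = q₃ , q₃P , (λ _ i → adjˡ (adjˡ (adjˡ i))) , return pattern'

      -- The filter contains a condition that K lists for ξ. Beyond it no promise about K and ξ can
      -- occur, so for every n the pattern m , m + 1 can be added densely.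
      forward : EN (wN ξ) Y → ∀ n → n ϵ ω → ¬¬ Σ D λ m → m ϵ ω × In (cd K n m) × In (dg ξ m one) × In (dg ξ (succ m) one)
      forward mem n nω = met mem >>= λ (h , hH , y , Gh) → Gh >>= λ (k , s) → generic φ (K ◂ n ◂ ξ ◂ ⟨⟩) k (dn h hH y k s) >>= λ (l , x) → out l x
        where
        φ : Fm 4
        φ = Ex (v0 ϵᶠ ωᵗ & cdᵗ v2 v3 v0 ϵᶠ v1 & dgᵗ v4 v0 oneᵗ ϵᶠ v1 & dgᵗ v4 (sucᵗ v0) oneᵗ ϵᶠ v1)
        Φ : D → Set
        Φ s = ¬¬ Σ D λ m → m ϵ ω × Pattern n m s
        dn : ∀ h → h ϵ H → Good' F ξ h → ∀ k → (F · ξ) · h ⊆ g k → Dense (g k) Φ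
        dn h hH y k s q qP gq = fresh (proj₁ (proj₁ P-spec qP)) 0ϵω >>= λ (m , mω , _ , f) →
          return (extend-pattern n q m nω qP (no-promise hH y qP (⊆-trans s gq)) mω f)
        out : ∀ l → Φ (g l) → ¬¬ Σ D λ m → m ϵ ω × In (cd K n m) × In (dg ξ m one) × In (dg ξ (succ m) one)
        out l x = x >>= λ (m , mω , a , b , c) → return (m , mω , return (l , a) , return (l , b) , return (l , c))

      -- Some stage has no extension that forces w_ξ ∈ Y. A condition q beyond it clashes with every
      -- listed one, for otherwise the union would force membership. So the promise about K and ξ is
      -- legal, and it is added with a fresh n, whose set has no entries in q.
      backward : ¬ EN (wN ξ) Y → ¬¬ Σ D λ n → n ϵ ω × In (pr K ξ n)
      backward no = decide (mem₃ ⟪ v0 ◂ wᵗ v1 ◂ v2 ◂ ⟨⟩ ⟫) (ξ ◂ Y ◂ ⟨⟩) >>= λ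
        { (inj₁ (n , m)) → ⊥-elim (no (return (n , m)))
        ; (inj₂ (n , nm)) → generic (Ex (v0 ϵᶠ ωᵗ & prᵗ v2 v3 v0 ϵᶠ v1)) (K ◂ ξ ◂ ⟨⟩) n (dn n nm) >>= λ (l , x) → out l x }
        where
        Φ : D → Set
        Φ s = ¬¬ Σ D λ n → n ϵ ω × pr K ξ n ϵ s
        module _ (k : ℕ) (nm : ∀ q → q ϵ 𝔓 → g k ⊆ q → ¬ Mem q (wN ξ) Y) (q : D) (qP : q ϵ 𝔓) (gq : g k ⊆ q) where
          excluded : ∀ h → h ϵ H → Clash (q ∪ dec K ξ h)
          excluded h hH = stS clash₁ {q ∪ dec K ξ h ◂ ⟨⟩} (em (Good' F ξ h) >>= λ
            { (inj₁ y) → return (clash-mono (λ w i → stE (∪-elim i (λ i → return (∪ˡ i)) λ i → return (∪ʳ (proj₂ (proj₁ (cod ξ h ξJ hH) y) w i)))) (hit y))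
            ; (inj₂ n) → return (clash-mono (λ _ → ∪ʳ) (proj₂ (cod ξ h ξJ hH) n)) })
            where
            hit : Good' F ξ h → Clash (q ∪ ((F · ξ) · h))
            hit y = stS clash₁ {q ∪ ((F · ξ) · h) ◂ ⟨⟩} λ nc → let u = P-∪ qP (proj₁ y) nc in
              nm _ u (λ w i → ∪ˡ (gq w i)) (Mem-mono {(F · ξ) · h} {q ∪ ((F · ξ) · h)} {wN ξ} {Y} u (λ _ → ∪ʳ) (proj₂ y))
          extend : ∀ n → n ϵ ω → Fresh n q → Σ D λ s → s ϵ 𝔓 × q ⊆ s × Φ s
          extend n nω f = adj q (pr K ξ n) , add-pr qP KJ (J⊆𝒫J ξ ξJ) nω (λ m i → fresh-y nω f i) excluded , (λ _ → adjˡ) , return x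
            where
            x : Σ D λ n' → n' ϵ ω × pr K ξ n' ϵ adj q (pr K ξ n)
            x = n , nω , adjʳ Qrefl
        dn : ∀ k → (∀ q → q ϵ 𝔓 → g k ⊆ q → ¬ Mem q (wN ξ) Y) → Dense (g k) Φ
        dn k nm q qP gq = fresh (proj₁ (proj₁ P-spec qP)) 0ϵω >>= λ (n , nω , _ , f) → return (extend k nm q qP gq n nω f)
        out : ∀ l → Φ (g l) → ¬¬ Σ D λ n → n ϵ ω × In (pr K ξ n)
        out l x = x >>= λ (n , nω , i) → return (n , nω , return (l , i))

  -- Uncountability

  -- The chain condition yields a small set A such that each true ⟨w_ξ , n⟩ ∈ f is accompanied by
  -- some a ∈ A in the filter forcing ⟨w_ξ' , n⟩ ∈ f for some ξ'. Let c choose such a ξ' for n and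
  -- a; injectivity gives ξ' = ξ. Hence J is covered by the image of ω × A, contrary to `¬Sm-J`.
  uncountable : ∀ f → (∀ ξ → ξ ϵ J → ¬¬ Σ D λ n → n ϵ ω × EN (opN (wN ξ) (chk n)) f) →
                (∀ x x' n → EN (opN x n) f → EN (opN x' n) f → QN x x') → ⊥
  uncountable f tot inj = cccN φ (f ◂ ⟨⟩) φ-mono λ (A , sm , A⊆ , h) → skolem ψ (f ◂ ⟨⟩) (prod ω A) (total A) λ (c , hc) →
      ¬Sm-J (Sm-image (appᵗ v1 v0) (c ◂ ⟨⟩) (Sm-prod Sm-ω sm) λ ξ ξJ → found' A A⊆ h c hc ξ ξJ)
    where
    φ ψ : Fm 3
    φ = Ex (v0 ϵᶠ Jᵗ & mem₃ ⟪ v2 ◂ opNᵗ (wᵗ v0) (chkᵗ v1) ◂ v3 ◂ ⟨⟩ ⟫)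
    ψ = Ex (v0 ϵᶠ Jᵗ & mem₃ ⟪ sndᵗ v2 ◂ opNᵗ (wᵗ v0) (chkᵗ (fstᵗ v2)) ◂ v3 ◂ ⟨⟩ ⟫) ⊃
        (v0 ϵᶠ Jᵗ & mem₃ ⟪ sndᵗ v1 ◂ opNᵗ (wᵗ v0) (chkᵗ (fstᵗ v1)) ◂ v2 ◂ ⟨⟩ ⟫)
    At : D → D → D → Set
    At j q ξ = Mem q (opN (wN ξ) (chk j)) f
    Φ : D → D → Set
    Φ j q = ¬¬ Σ D λ ξ → ξ ϵ J × At j q ξ
    φ-mono : ∀ j p q → p ϵ 𝔓 → q ϵ 𝔓 → p ⊆ q → Φ j p → Φ j q
    φ-mono j p q _ qP s h = h >>= λ (ξ , i , m) → return (ξ , i , Mem-mono {p} {q} {opN (wN ξ) (chk j)} {f} qP s m)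
    At' : D → D → Set
    At' x ξ = ξ ϵ J × At (fst x) (snd x) ξ
    total : ∀ A x → x ϵ prod ω A → ¬¬ Σ D λ ξ → ((¬¬ Σ D λ ξ → At' x ξ) → At' x ξ)
    total A x _ = em (¬¬ Σ D λ ξ → At' x ξ) >>= λ
      { (inj₁ h) → h >>= λ (ξ , a) → return (ξ , λ _ → a) ; (inj₂ n) → return (∅ , λ h → ⊥-elim (n h)) }
    module _ (A : D) (A⊆ : A ⊆ 𝔓) (h : ∀ j m → j ϵ ω → Φ j (g m) → ¬¬ Σ D λ a → a ϵ A × Φ j a × G a)
             (c : D) (hc : ∀ x → x ϵ prod ω A → (¬¬ Σ D λ ξ → At' x ξ) → At' x (c · x)) where
      conv : ∀ {j a ξ j' a'} → j ≃ j' → a ≃ a' → At j a ξ → At j' a' ξ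
      conv {j} {a} {ξ} {j'} {a'} e e' = S-cong (mem₃ ⟪ v1 ◂ opNᵗ (wᵗ v2) (chkᵗ v0) ◂ v3 ◂ ⟨⟩ ⟫) {j ◂ a ◂ ξ ◂ f ◂ ⟨⟩} {j' ◂ a' ◂ ξ ◂ f ◂ ⟨⟩}
        λ { zero → e ; (suc zero) → e' ; (suc (suc zero)) → Qrefl ; (suc (suc (suc zero))) → Qrefl }
      hit : ∀ ξ n → ξ ϵ J → n ϵ ω → EN (opN (wN ξ) (chk n)) f → (Σ D λ a → a ϵ A × Φ n a × G a) → Σ D λ x → x ϵ prod ω A × ξ ≃ c · x
      hit ξ n ξJ nω mem (a , aA , fa , Ga) = op n a , prod-in nω aA , w-inj ξJ (proj₁ cx) (inj (wN ξ) (wN (c · op n a)) (chk n) mem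
          (Mem-G {a} {opN (wN (c · op n a)) (chk n)} {f} Ga (conv {fst (op n a)} {snd (op n a)} {c · op n a} {n} {a} fst-op snd-op (proj₂ cx))))
        where
        cx : At' (op n a) (c · op n a)
        cx = hc (op n a) (prod-in nω aA) (fa >>= λ (ξ' , i , m) → return (ξ' , i , conv {n} {a} {ξ'} {fst (op n a)} {snd (op n a)} (Qsym fst-op) (Qsym snd-op) m))
      found' : ∀ ξ → ξ ϵ J → ¬¬ Σ D λ x → x ϵ prod ω A × ξ ≃ c · x
      found' ξ ξJ = tot ξ ξJ >>= λ (n , nω , mem) → mem >>= λ (m , x) → h n m nω (return (ξ , ξJ , x)) >>= λ y →
        return (hit ξ n ξJ nω (return (m , x)) y)

  -- Splitting

  module Split' (a : D) (unb : ∀ k → k ϵ ω → ¬¬ Σ D λ l → l ϵ ω × k ϵ l × EN (chk l) a) where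
    φ : Fm 3
    φ = Ex (v0 ϵᶠ ωᵗ & v1 ϵᶠ v0 & mem₃ ⟪ v2 ◂ chkᵗ v0 ◂ v3 ◂ ⟨⟩ ⟫)
    Φ : D → D → Set
    Φ j q = ¬¬ Σ D λ l → l ϵ ω × j ϵ l × Mem q (chk l) a

    Meets : D → Set
    Meets A = ∀ j m → j ϵ ω → Φ j (g m) → ¬¬ Σ D λ b → b ϵ A × Φ j b × G b

    meets-exist : ¬¬ Σ D λ A → Sm A × A ⊆ 𝔓 × Meets A
    meets-exist = cccN φ (a ◂ ⟨⟩) λ j p q _ qP s h → h >>= λ (l , lω , jl , m) → return (l , lω , jl , Mem-mono {p} {q} {chk l} {a} qP s m)

    -- Given `g n`, take j fresh for it, and in A a condition c of the filter that forces some l ∈ a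
    -- with j ∈ l. In `g n` ∪ c no digit of ξ at l or beside it is decided: `g n` has only digits
    -- below j, and c does not mention ξ at all. Hence the digit at l can be set to b.
    splits : ∀ A → A ⊆ 𝔓 → Meets A → ∀ ξ → ξ ϵ J → (∀ b → b ϵ A → ¬ (ξ ϵ supp b)) → ∀ b → b ϵ H → ∀ k → k ϵ ω →
             ¬¬ Σ D λ l → l ϵ ω × k ϵ l × EN (chk l) a × In (dg ξ l b)
    splits A A⊆ h ξ ξJ new b bH k kω = decide χ (k ◂ ξ ◂ b ◂ a ◂ ⟨⟩) >>= λ
      { (inj₁ (n , x)) → out n x ; (inj₂ (n , no)) → ⊥-elim (fresh (proj₁ (proj₁ P-spec (gP n))) kω λ (j , jω , kj , f) →
          unb j jω λ (l₀ , l₀ω , jl₀ , mem) → mem λ (m , mm) → h j m jω (return (l₀ , l₀ω , jl₀ , mm)) λ (c , cA , cφ , Gc) →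
          Gc λ (o , co) → cφ λ (l , lω , jl , ml) → let s , sP , gs , x = extend n j jω kj f c cA o co l lω jl ml in no s sP gs x) }
      where
      χ : Fm 5
      χ = Ex (v0 ϵᶠ ωᵗ & v2 ϵᶠ v0 & mem₃ ⟪ v1 ◂ chkᵗ v0 ◂ v5 ◂ ⟨⟩ ⟫ & dgᵗ v3 v0 v4 ϵᶠ v1)
      X : D → Set
      X q = ¬¬ Σ D λ l → l ϵ ω × k ϵ l × Mem q (chk l) a × dg ξ l b ϵ q
      out : ∀ n → X (g n) → ¬¬ Σ D λ l → l ϵ ω × k ϵ l × EN (chk l) a × In (dg ξ l b)
      out n x = x >>= λ (l , lω , kl , m , i) → return (l , lω , kl , return (n , m) , return (n , i))
      extend : ∀ n j → j ϵ ω → k ϵ j → Fresh j (g n) → ∀ c → c ϵ A → ∀ o → c ⊆ g o → ∀ l → l ϵ ω → j ϵ l → Mem c (chk l) a →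
               Σ D λ s → s ϵ 𝔓 × g n ⊆ s × X s
      extend n j jω kj f c cA o co l lω jl ml = s , sP , (λ w i → adjˡ (∪ˡ i)) , return x
        where
        q s : D
        q = g n ∪ c
        s = adj q (dg ξ l b)
        nc : ¬ Clash q
        nc cl = proj₁ (proj₂ (proj₁ P-spec (gP (n ⊔ o)))) (clash-mono (λ w i → stE (∪-elim i (λ i → return (g-mono (ℕ.m≤m⊔n n o) w i))
          λ i → return (g-mono (ℕ.m≤n⊔m n o) w (co w i)))) cl)
        qP : q ϵ 𝔓
        qP = P-∪ (gP n) (A⊆ c cA) nc
        old : ∀ {y z} → y ϵ ω → dg ξ y z ϵ q → succ y ϵ j
        old yω i = stE (∪-elim i (λ i → return (proj₁ (f _ _ _ _ i) yω)) λ i → ⊥-elim (new c cA (supp-x i)))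
        sP : s ϵ 𝔓
        sP = add-dg qP (J⊆𝒫J ξ ξJ) lω bH (λ b' i → asym jl (nat-trans jω (old lω i) (adjʳ Qrefl)))
          (λ K n' _ _ i → asym jl (nat-trans jω (nat-trans jω (old (sucϵω lω) i) (adjʳ Qrefl)) (adjʳ Qrefl)))
          λ K n' m e _ _ i → asym jl (ϵˡ e (old (ω-trans (ϵˡ (Qsym e) lω) (adjʳ Qrefl)) i))
        x : Σ D λ l → l ϵ ω × k ϵ l × Mem s (chk l) a × dg ξ l b ϵ s
        x = l , lω , nat-trans lω jl kj , Mem-mono {c} {s} {chk l} {a} sP (λ w i → adjˡ (∪ʳ i)) ml , adjʳ Qrefl

-- A combinatorial form of the existence of a strong splitting Q-set

-- Counting is by an injective relation, which may give several numbers to one element. The collapse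
-- yields such a relation, and least numbers turn it into a function later, in `counted`.
CountedBy : Var n → Var n → Formula n
CountedBy w c = ∃[ f ] ((∀[ x ∊ ↑ c ] ∃[ k ∊ ↑² w ] ⟨ ↑ x , k ⟩∈ ↑² f) ∧̇ Injective f)

Unbounded : Var n → Var n → Formula n
Unbounded w a = ∀[ k ∊ w ] ∃[ m ∊ ↑ a ] ↑ k ∈̇ m

-- The relation c encodes the sequence of the sets c_k; each condition on k depends on finitely many
-- digits of x and is therefore open.
Coded : Var n → Var n → Var n → Formula n
Coded w X Y = ∃[ c ] (∀[ x ∊ ↑ X ] (x ∈̇ ↑² Y ⇔
  (∀[ k ∊ ↑² w ] ∃[ m ∊ ↑³ w ] (⟨ ↑ k , m ⟩∈ ↑³ c ∧̇ m ∈̇ ↑² x ∧̇ (∃[ s ∊ ↑² x ] IsSuccessor s (↑ m))))))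

AlmostSplit : Var n → Var n → Var n → Formula n
AlmostSplit w X a = ∃[ R ] (Injective R ∧̇ (∀[ x ∊ ↑ X ]
  (((∀[ k ∊ ↑² w ] ∃[ m ∊ ↑³ a ] (↑ k ∈̇ m ∧̇ m ∈̇ ↑² x)) ∧̇
    (∀[ k ∊ ↑² w ] ∃[ m ∊ ↑³ a ] (↑ k ∈̇ m ∧̇ ¬̇ (m ∈̇ ↑² x)))) ∨̇
   (∃[ k ∊ ↑² w ] ⟨ ↑ x , k ⟩∈ ↑² R))))

CombinatorialFamily : Var n → Formula n
CombinatorialFamily w = ∃[ X ]
  ((∀[ x ∊ X ] (x ⊆̇ ↑² w ∧̇ Unbounded (↑² w) x)) ∧̇
   ¬̇ (CountedBy (↑ w) X) ∧̇
   (∀[ Y ] (Y ⊆̇ ↑ X ⇒ Coded (↑² w) (↑ X) Y)) ∧̇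
   (∀[ a ] (a ⊆̇ ↑² w ⇒ Unbounded (↑² w) a ⇒ AlmostSplit (↑² w) (↑ X) a)))

Combinatorial : Sentence
Combinatorial = ∃[ w ] (Isω w ∧̇ CombinatorialFamily w)

-- The combinatorial sentence in the extension

module Verification (𝔙 : ZFCModel) where
  open Splitting 𝔙 public

  private
    st¬ : {A : Set} → ¬¬ ¬ A → ¬ A
    st¬ h a = h λ f → f a

    wc : D
    wc = chk ω

  chk-in : ∀ {m n} → m ϵ n → EN (chk m) (chk n)
  chk-in {m} {n} i = proj₂ (EN-chk {n} {chk m}) (return (m , i , QN-refl {chk m}))

  chk-out : ∀ {m n} → m ϵ ω → n ϵ ω → EN (chk m) (chk n) → m ϵ n
  chk-out {m} {n} mω nω h = stE (proj₁ (EN-chk {n} {chk m}) h >>= λ (y , i , q) → return (ϵˡ (Qsym (chk-inj mω (ω-trans nω i) q)) i))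

  nat : ∀ {k} → EN k (chk ω) → ¬¬ Σ D λ n → n ϵ ω × QN k (chk n)
  nat {k} = proj₁ (EN-chk {ω} {k})

  opN-cong : ∀ {x y x' y' c} → QN x x' → QN y y' → EN (opN x y) c → EN (opN x' y') c
  opN-cong {x} {y} {x'} {y'} {c} p q = EN-congˡ {opN x y} {opN x' y'} {c} (KN.opair-cong {x} {y} {x'} {y'} p q)

  successor : ∀ {s m k} → QN m (chk k) → (∀ z → EN z s ↔ (¬¬ (EN z m ⊎ QN z m))) → QN s (chk (succ k))
  successor {s} {m} {k} q h = N-ext {s} {chk (succ k)} λ z →
    (λ i → proj₂ (N-succ {k} {z}) (proj₁ (h z) i >>= λ { (inj₁ a) → return (inj₁ (EN-congʳ {z} {m} {chk k} q a)) ; (inj₂ a) → return (inj₂ (QN-trans {z} {m} {chk k} a q)) })) ,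
    (λ i → proj₂ (h z) (proj₁ (N-succ {k} {z}) i >>= λ
      { (inj₁ a) → return (inj₁ (EN-congʳ {z} {chk k} {m} (QN-sym {m} {chk k} q) a)) ; (inj₂ a) → return (inj₂ (QN-trans {z} {chk k} {m} a (QN-sym {m} {chk k} q))) }))

  members-unbounded : N.sat (∀[ x ∊ zero ] (x ⊆̇ ↑ (suc zero) ∧̇ Unbounded (↑ (suc zero)) x)) (XN ◂ wc ◂ ⟨⟩)
  members-unbounded x i = λ f → proj₁ (EN-X {x}) i λ (ξ , ξJ , q) → f
    (λ z j → proj₁ (EN-w {ξ} {z}) (EN-congʳ {z} {x} {wN ξ} q j) >>= λ (m , mω , _ , r) → proj₂ (EN-chk {ω} {z}) (return (m , mω , r)))
    (λ k j → ex-in (nat j >>= λ (n , nω , r) → some-digit (J⊆𝒫J ξ ξJ) 1ϵH nω >>= λ (l , lω , nl , d) →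
      return (chk l , ∧-in (EN-congʳ {chk l} {wN ξ} {x} (QN-sym {x} {wN ξ} q) (proj₂ (digit lω) d)) (EN-congˡ {chk n} {k} {chk l} (QN-sym {k} {chk n} r) (chk-in nl)))))

  not-counted : ¬ N.sat (CountedBy (suc zero) zero) (XN ◂ wc ◂ ⟨⟩)
  not-counted h = ex-out h λ (f , h) → ∧-out h λ (tot , inj) → uncountable f
    (λ ξ ξJ → ex-out (tot (wN ξ) (proj₂ (EN-X {wN ξ}) (return (ξ , ξJ , QN-refl {wN ξ})))) >>= λ (k , h) → ∧-out h >>= λ (kω , p) → nat kω >>= λ (n , nω , q) →
      return (n , nω , opN-cong {wN ξ} {k} {wN ξ} {chk n} {f} (QN-refl {wN ξ}) q (proj₁ (KN.sat-∈ (suc zero) zero (suc (suc zero)) (k ◂ wN ξ ◂ f ◂ XN ◂ wc ◂ ⟨⟩)) p)))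
    λ x x' n p p' → inj x x' n (proj₂ (KN.sat-∈ (suc (suc zero)) zero (suc (suc (suc zero))) (n ◂ x' ◂ x ◂ f ◂ XN ◂ wc ◂ ⟨⟩)) p)
                               (proj₂ (KN.sat-∈ (suc zero) zero (suc (suc (suc zero))) (n ◂ x' ◂ x ◂ f ◂ XN ◂ wc ◂ ⟨⟩)) p')

  module Codes (K : D) where
    t α : Tm 2
    t = opNᵗ (chkᵗ (fstᵗ v0)) (chkᵗ (sndᵗ v0))
    α = cdᵗ v1 (fstᵗ v0) (sndᵗ v0)

    cN : D
    cN = fam t α (K ◂ ⟨⟩) (prod ω ω)

    prod-ω : ∀ {a b u} → u ϵ prod a b → ¬¬ (fst u ϵ a × snd u ϵ b)
    prod-ω i = proj₁ prod-spec i >>= λ (x , i) → i >>= λ (y , a , b , e) →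
      return (ϵˡ (Qsym (Qtr (rept fst₁ {⟨⟩} e) fst-op)) a , ϵˡ (Qsym (Qtr (rept snd₁ {⟨⟩} e) snd-op)) b)

    cN-in : ∀ {n m} → n ϵ ω → m ϵ ω → In (cd K n m) → EN (opN (chk n) (chk m)) cN
    cN-in {n} {m} nω mω i = proj₂ (EN-fam t α (K ◂ ⟨⟩) (prod ω ω) {opN (chk n) (chk m)}) (return x)
      where
      x : Σ D λ u → u ϵ prod ω ω × In (cd K (fst u) (snd u)) × QN (opN (chk n) (chk m)) (opN (chk (fst u)) (chk (snd u)))
      x = op n m , prod-in nω mω , In-cong (at-cong Qrefl Qrefl (Qsym fst-op) (Qsym snd-op)) i ,
          KN.opair-cong {chk n} {chk m} {chk (fst (op n m))} {chk (snd (op n m))} (≃⇒QN (rept chk₁ {⟨⟩} (Qsym fst-op))) (≃⇒QN (rept chk₁ {⟨⟩} (Qsym snd-op)))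

    cN-out : ∀ {n m} → n ϵ ω → m ϵ ω → EN (opN (chk n) (chk m)) cN → In (cd K n m)
    cN-out {n} {m} nω mω h = proj₁ (EN-fam t α (K ◂ ⟨⟩) (prod ω ω) {opN (chk n) (chk m)}) h >>= go
      where
      go : (Σ D λ u → u ϵ prod ω ω × In (cd K (fst u) (snd u)) × QN (opN (chk n) (chk m)) (opN (chk (fst u)) (chk (snd u)))) → In (cd K n m)
      go (u , i , j , q) = prod-ω i >>= λ (a , b) → In-cong (at-cong Qrefl Qrefl
        (Qsym (chk-inj nω a (KN.opair-inj₁ {chk n} {chk m} {chk (fst u)} {chk (snd u)} q)))
        (Qsym (chk-inj mω b (KN.opair-inj₂ {chk n} {chk m} {chk (fst u)} {chk (snd u)} q)))) j

  module Subset (Y F K : D) (cov : Gδ.Covers Y F) (KJ : K ϵ 𝒫 J) (cod : Gδ.Coded' Y F K) where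
    open Codes K

    Rhs : D → Set
    Rhs x = ∀ k → EN k wc → N.sat (∃[ m ∊ suc (suc (suc (suc (suc zero)))) ] (⟨ ↑ zero , m ⟩∈ ↑ (suc (suc zero)) ∧̇ m ∈̇ ↑ (suc zero) ∧̇ (∃[ s ∊ ↑ (suc zero) ] IsSuccessor s (↑ m))))
                                  (k ◂ x ◂ cN ◂ Y ◂ XN ◂ wc ◂ ⟨⟩)

    module _ (x ξ : D) (ξJ : ξ ϵ J) (q : QN x (wN ξ)) where
      open Gδ.Code Y F K cov KJ cod ξ ξJ

      private
        digit-x : ∀ {m} → m ϵ ω → In (dg ξ m one) → EN (chk m) x
        digit-x {m} mω d = EN-congʳ {chk m} {wN ξ} {x} (QN-sym {x} {wN ξ} q) (proj₂ (digit mω) d)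
        x-digit : ∀ {m} → m ϵ ω → EN (chk m) x → In (dg ξ m one)
        x-digit {m} mω h = proj₁ (digit mω) (EN-congʳ {chk m} {x} {wN ξ} q h)

      ⇒Rhs : EN x Y → Rhs x
      ⇒Rhs i k kω = ex-in (nat kω >>= λ (n , nω , r) → forward (EN-congˡ {x} {wN ξ} {Y} q i) n nω >>= λ (m , mω , a , b , c) →
        return (chk m , ∧-in (chk-in mω) (∧-in
          (proj₂ (KN.sat-∈ (suc zero) zero (suc (suc (suc zero))) (chk m ◂ k ◂ x ◂ cN ◂ Y ◂ XN ◂ wc ◂ ⟨⟩))
            (opN-cong {chk n} {chk m} {k} {chk m} {cN} (QN-sym {k} {chk n} r) (QN-refl {chk m}) (cN-in nω mω a)))
          (∧-in (digit-x mω b) (ex-in (return (chk (succ m) , ∧-in (digit-x (sucϵω mω) c) λ z → iff-in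
            ((λ j → proj₂ (or-out st¬) (proj₁ (N-succ {m} {z}) j)) , (λ j → proj₂ (N-succ {m} {z}) (proj₁ (or-out st¬) j))))))))))

      Rhs⇒ : Rhs x → EN x Y
      Rhs⇒ h no = backward (λ i → EN-congˡ {wN ξ} {x} {Y} (QN-sym {x} {wN ξ} q) i no) λ (n , nω , p) → ex-out (h (chk n) (chk-in nω)) λ (m , h) →
        ∧-out h λ (mω , h) → ∧-out h λ (c , h) → ∧-out h λ (mx , h) → ex-out h λ (s , h) → ∧-out h λ (sx , su) → nat mω λ (m' , m'ω , r) →
        let r' = successor {s} {m} {m'} r (λ z → let f , f' = iff-out st¬ (λ h a b → h λ c → c a b) (su z) in (λ i → proj₁ (or-out st¬) (f i)) , (λ i → f' (proj₂ (or-out st¬) i))) in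
        In-kept (cN-out nω m'ω (opN-cong {chk n} {m} {chk n} {chk m'} {cN} (QN-refl {chk n}) r
                  (proj₁ (KN.sat-∈ (suc zero) zero (suc (suc (suc zero))) (m ◂ chk n ◂ x ◂ cN ◂ Y ◂ XN ◂ wc ◂ ⟨⟩)) c))) p
                (x-digit m'ω (EN-congˡ {m} {chk m'} {x} r mx)) (x-digit (sucϵω m'ω) (EN-congˡ {s} {chk (succ m')} {x} r' sx))

    coded : ∀ x → EN x XN → ¬ ((EN x Y → Rhs x) → ¬ (Rhs x → EN x Y))
    coded x i f = proj₁ (EN-X {x}) i λ (ξ , ξJ , q) → f (⇒Rhs x ξ ξJ q) (Rhs⇒ x ξ ξJ q)

  all-coded : ∀ Y → N.sat (Coded (suc (suc zero)) (suc zero) zero) (Y ◂ XN ◂ wc ◂ ⟨⟩)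
  all-coded Y = ex-in (Gδ.cover-exists Y >>= λ (F , cov) → Gδ.code-exists Y F >>= λ (K , KJ , cod) →
    return (Codes.cN K , Subset.coded Y F K cov KJ cod))

  -- The digits at the index J map natural numbers onto H: every h occurs, and l determines the h at
  -- l. So R, which relates w_ξ with ξ = `f · h` to every l at which h occurs, is injective and
  -- covers all ξ in the small set `S₀`.
  module Exceptional (a A S₀ f : D) (unb : ∀ k → k ϵ ω → ¬¬ Σ D λ l → l ϵ ω × k ϵ l × EN (chk l) a)
                     (A⊆ : A ⊆ 𝔓) (meets : Split'.Meets a unb A) (en : Enum f S₀) (sup : ∀ b → b ϵ A → supp b ⊆ S₀) where
    t α : Tm 2
    t = opNᵗ (wᵗ (appᵗ v1 (fstᵗ v0))) (chkᵗ (sndᵗ v0))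
    α = dgᵗ Jᵗ (sndᵗ v0) (fstᵗ v0)

    R : D
    R = fam t α (f ◂ ⟨⟩) (prod H ω)

    Entry : D → Set
    Entry z = Σ D λ u → u ϵ prod H ω × In (dg J (snd u) (fst u)) × QN z (opN (wN (f · fst u)) (chk (snd u)))

    R-out : ∀ {z} → EN z R → ¬¬ Entry z
    R-out {z} = proj₁ (EN-fam t α (f ◂ ⟨⟩) (prod H ω) {z})

    injective : ∀ x x' y → EN (opN x y) R → EN (opN x' y) R → QN x x'
    injective x x' y h h' = R-out {opN x y} h >>= λ e → R-out {opN x' y} h' >>= λ e' → go e e'
      where
      go : Entry (opN x y) → Entry (opN x' y) → QN x x'
      go (u , i , d , q) (u' , i' , d' , q') = Codes.prod-ω ∅ i >>= λ (_ , b) → Codes.prod-ω ∅ i' >>= λ (_ , b') →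
        let y₁ = KN.opair-inj₂ {x} {y} {wN (f · fst u)} {chk (snd u)} q
            y₂ = KN.opair-inj₂ {x'} {y} {wN (f · fst u')} {chk (snd u')} q'
            s = chk-inj b b' (QN-trans {chk (snd u)} {y} {chk (snd u')} (QN-sym {y} {chk (snd u)} y₁) y₂)
            e = In-func d (In-cong (at-cong Qrefl Qrefl (Qsym s) Qrefl) d')
            e' = rept (wᵗ (appᵗ v1 v0)) {f ◂ ⟨⟩} e
        in QN-trans {x} {wN (f · fst u)} {x'} (KN.opair-inj₁ {x} {y} {wN (f · fst u)} {chk (snd u)} q)
             (QN-trans {wN (f · fst u)} {wN (f · fst u')} {x'} (≃⇒QN e')
               (QN-sym {x'} {wN (f · fst u')} (KN.opair-inj₁ {x'} {y} {wN (f · fst u')} {chk (snd u')} q')))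

    listed : ∀ {ξ} → ξ ϵ S₀ → ¬¬ Σ D λ l → l ϵ ω × EN (opN (wN ξ) (chk l)) R
    listed {ξ} i = en ξ i >>= λ (h , hH , e) → some-digit J𝒫 hH 0ϵω >>= λ (l , lω , _ , d) → return (l , lω , entry h hH e l lω d)
      where
      J𝒫 : J ϵ 𝒫 J
      J𝒫 = proj₂ 𝒫-spec λ _ i → i
      entry : ∀ h → h ϵ H → ξ ≃ f · h → ∀ l → l ϵ ω → In (dg J l h) → EN (opN (wN ξ) (chk l)) R
      entry h hH e l lω d = proj₂ (EN-fam t α (f ◂ ⟨⟩) (prod H ω) {opN (wN ξ) (chk l)}) (return x)
        where
        x : Entry (opN (wN ξ) (chk l))
        x = op h l , prod-in hH lω , In-cong (at-cong Qrefl Qrefl (Qsym snd-op) (Qsym fst-op)) d ,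
            KN.opair-cong {wN ξ} {chk l} {wN (f · fst (op h l))} {chk (snd (op h l))}
              (≃⇒QN (rept w₁ (Qtr e (Qsym fst-op')))) (≃⇒QN (rept chk₁ {⟨⟩} (Qsym snd-op)))

    In-half Out-half : D → Set
    In-half x = ∀ k → EN k wc → ¬ (∀ m → ¬ ¬ (EN m a → ¬ ¬ (EN k m → ¬ EN m x)))
    Out-half x = ∀ k → EN k wc → ¬ (∀ m → ¬ ¬ (EN m a → ¬ ¬ (EN k m → ¬ ¬ EN m x)))

    module _ (x ξ : D) (ξJ : ξ ϵ J) (q : QN x (wN ξ)) (new : ¬ (ξ ϵ S₀)) where
      private
        find : ∀ b → b ϵ H → ∀ {k n} → n ϵ ω → QN k (chk n) → ¬¬ Σ D λ l → l ϵ ω × EN (chk l) a × EN k (chk l) × In (dg ξ l b)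
        find b bH {k} {n} nω r = Split'.splits a unb A A⊆ meets ξ ξJ (λ c cA i → new (sup c cA ξ i)) b bH n nω >>= λ (l , lω , nl , la , d) →
          return (l , lω , la , EN-congˡ {chk n} {k} {chk l} (QN-sym {k} {chk n} r) (chk-in nl) , d)

      in-half : In-half x
      in-half k kω = ex-in (nat kω >>= λ (n , nω , r) → find one 1ϵH nω r >>= λ (l , lω , la , kl , d) →
        return (chk l , ∧-in la (∧-in kl (EN-congʳ {chk l} {wN ξ} {x} (QN-sym {x} {wN ξ} q) (proj₂ (digit lω) d)))))

      out-half : Out-half x
      out-half k kω = ex-in (nat kω >>= λ (n , nω , r) → find ∅ 0ϵH nω r >>= λ (l , lω , la , kl , d) →
        return (chk l , ∧-in la (∧-in kl λ i → 0≄1 (In-func d (proj₁ (digit lω) (EN-congʳ {chk l} {x} {wN ξ} q i))))))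

    either : ∀ x → EN x XN → ¬ ¬ (In-half x → ¬ Out-half x) → N.sat (∃[ k ∊ suc (suc (suc (suc zero))) ] ⟨ ↑ zero , k ⟩∈ ↑ (suc zero)) (x ◂ R ◂ a ◂ XN ◂ wc ◂ ⟨⟩)
    either x i no = ex-in (proj₁ (EN-X {x}) i >>= λ (ξ , ξJ , q) → em (ξ ϵ S₀) >>= λ
      { (inj₁ j) → listed j >>= λ (l , lω , e) → return (chk l , ∧-in (chk-in lω) (proj₂ (KN.sat-∈ (suc zero) zero (suc (suc zero)) (chk l ◂ x ◂ R ◂ a ◂ XN ◂ wc ◂ ⟨⟩))
          (opN-cong {wN ξ} {chk l} {x} {chk l} {R} (QN-sym {x} {wN ξ} q) (QN-refl {chk l}) e)))
      ; (inj₂ n) → ⊥-elim (no (∧-in (in-half x ξ ξJ q n) (out-half x ξ ξJ q n))) })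

    almost-split : N.sat (AlmostSplit (suc (suc zero)) (suc zero) zero) (a ◂ XN ◂ wc ◂ ⟨⟩)
    almost-split = ex-in (return (R , ∧-in
      (λ x x' y h h' → injective x x' y (proj₁ (KN.sat-∈ (suc (suc zero)) zero (suc (suc (suc zero))) (y ◂ x' ◂ x ◂ R ◂ a ◂ XN ◂ wc ◂ ⟨⟩)) h)
                                        (proj₁ (KN.sat-∈ (suc zero) zero (suc (suc (suc zero))) (y ◂ x' ◂ x ◂ R ◂ a ◂ XN ◂ wc ◂ ⟨⟩)) h'))
      λ x i no → either x i no))

  splitting : ∀ a → (∀ z → EN z a → EN z wc) → N.sat (Unbounded (suc (suc zero)) zero) (a ◂ XN ◂ wc ◂ ⟨⟩) →
              N.sat (AlmostSplit (suc (suc zero)) (suc zero) zero) (a ◂ XN ◂ wc ◂ ⟨⟩)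
  splitting a sub unb = N.st (AlmostSplit (suc (suc zero)) (suc zero) zero) {a ◂ XN ◂ wc ◂ ⟨⟩} do
    A , sm , A⊆ , meets ← Split'.meets-exist a unb'
    b , h ← image-set supp₁ ⟨⟩ A
    f , en ← Sm-⋃ {b} (Sm-image supp₁ ⟨⟩ sm λ y i → proj₁ (h y) i) λ x i → proj₁ (h x) i >>= λ (c , j , e) → Sm-⊆ (≃⇒⊆ e) (Sm-supp (A⊆ c j))
    return (Exceptional.almost-split a A (⋃ b) f unb' A⊆ meets en λ c cA w i → ⋃-in (proj₂ (h (supp c)) (return (c , cA , Qrefl))) i)
    where
    unb' : ∀ k → k ϵ ω → ¬¬ Σ D λ l → l ϵ ω × k ϵ l × EN (chk l) a
    unb' k kω = ex-out (unb (chk k) (chk-in kω)) >>= λ (m , h) → ∧-out h >>= λ (ma , km) → nat (sub m ma) >>= λ (l , lω , q) →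
      return (l , lω , chk-out kω lω (EN-congʳ {chk k} {m} {chk l} q km) , EN-congˡ {m} {chk l} {a} q ma)

  N-combinatorial : N.sat Combinatorial ⟨⟩
  N-combinatorial = ex-in (return (wc , ∧-in N-ω (ex-in (return (XN , ∧-in members-unbounded (∧-in not-counted
    (∧-in (λ Y _ → all-coded Y) splitting)))))))

-- From the combinatorial sentence to a strong splitting Q-set

abstract
  collφ : Fm 3
  collφ = v0 ≃ᶠ sndᵗ v1 & fstᵗ v1 ϵᶠ v2

-- π m a is the order type of m ∩ a
π₂ : Tm 2
π₂ = urec ∅ᵗ ⁅ collφ ⁆

module Sufficiency (𝔙 : ZFCModel) where
  open Choice 𝔙

  π : D → D → D
  π m a = ⟦ π₂ ⟧ (m ◂ a ◂ ⟨⟩)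

  abstract
    π-spec : ∀ {m a w} → w ϵ π m a ↔ (¬¬ Σ D λ j → j ϵ m × j ϵ a × w ≃ π j a)
    π-spec {m} {a} {w} =
      (λ i → proj₁ r i >>= λ { (inj₁ p) → ⊥-elim (∅-spec p) ; (inj₂ q) → q >>= λ (j , k , l) →
        let e , x = proj₁ sp l in return (j , k , ϵˡ fst-op x , Qtr e snd-op) }) ,
      (λ h → proj₂ r (return (inj₂ (h >>= λ (j , k , x , e) → return (j , k , proj₂ sp (Qtr e (Qsym snd-op) , ϵˡ (Qsym fst-op) x))))))
      where
      sp : ∀ {p w} → w ϵ cls collφ (p ◂ a ◂ ⟨⟩) ↔ (w ≃ snd p × fst p ϵ a)
      sp {p} = cls-bounded (up (snd p) (snd p)) λ w (e , _) → ϵˡ (Qsym e) upˡ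
      r : w ϵ π m a ↔ (¬¬ (w ϵ ∅ ⊎ (¬¬ Σ D λ y → y ϵ m × w ϵ cls collφ (op y (π y a) ◂ a ◂ ⟨⟩))))
      r = rec-spec ∅ᵗ ⁅ collφ ⁆ a {m} {w}

  module Collapse (a : D) (a⊆ω : a ⊆ ω) where
    π-in : ∀ {j m} → j ϵ m → j ϵ a → π j a ϵ π m a
    π-in i k = proj₂ π-spec (return (_ , i , k , Qrefl))

    π-cong : ∀ {m m'} → m ≃ m' → π m a ≃ π m' a
    π-cong e = rept π₂ {a ◂ ⟨⟩} e

    π-succ : ∀ {m} → ¬¬ ((m ϵ a × π (succ m) a ≃ succ (π m a)) ⊎ π (succ m) a ≃ π m a)
    π-succ {m} = em (m ϵ a) >>= λ
      { (inj₁ i) → return (inj₁ (i , ≃ext λ w →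
          (λ j → stE (proj₁ π-spec j >>= λ (k , l , x , e) → adj-elim l (λ l → return (adjˡ (ϵˡ (Qsym e) (π-in l x)))) λ q → return (adjʳ (Qtr e (π-cong q))))) ,
          (λ j → stE (adj-elim j (λ j → return (proj₂ π-spec (proj₁ π-spec j >>= λ (k , l , x , e) → return (k , adjˡ l , x , e))))
            λ e → return (ϵˡ (Qsym e) (π-in (adjʳ Qrefl) i))))))
      ; (inj₂ n) → return (inj₂ (≃ext λ w →
          (λ j → proj₂ π-spec (proj₁ π-spec j >>= λ (k , l , x , e) → adj-elim l (λ l → return (k , l , x , e)) λ q → ⊥-elim (n (ϵˡ q x)))) ,
          (λ j → proj₂ π-spec (proj₁ π-spec j >>= λ (k , l , x , e) → return (k , adjˡ l , x , e))))) }

    π-ω : ∀ m → m ϵ ω → π m a ϵ ω × π m a ϵ succ m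
    π-ω = ω-ind (π₂ ⟨ v0 ◂ v1 ◂ ⟨⟩ ⟩ ϵᶠ ωᵗ & π₂ ⟨ v0 ◂ v1 ◂ ⟨⟩ ⟩ ϵᶠ sucᵗ v0) (a ◂ ⟨⟩)
      (ϵˡ (Qsym z) 0ϵω , ϵˡ (Qsym z) (adjʳ Qrefl))
      λ m mω (i , j) → stS (v0 ϵᶠ ωᵗ & v0 ϵᶠ sucᵗ (sucᵗ v1)) {π (succ m) a ◂ m ◂ ⟨⟩} (π-succ {m} >>= λ
        { (inj₁ (_ , e)) → return (ϵˡ (Qsym e) (sucϵω i) , ϵˡ (Qsym e) (suc-mono (sucϵω mω) j))
        ; (inj₂ e) → return (ϵˡ (Qsym e) i , ϵˡ (Qsym e) (adjˡ j)) })
      where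
      z : π ∅ a ≃ ∅
      z = ≃ext λ w → (λ i → ⊥-elim (proj₁ π-spec i λ (j , k , _) → ∅-spec k)) , λ i → ⊥-elim (∅-spec i)

    π-inj : ∀ {m m'} → m ϵ a → m' ϵ a → π m a ≃ π m' a → m ≃ m'
    π-inj i j e = stQ (trichotomy (a⊆ω _ i) (a⊆ω _ j) >>= λ
      { (inj₁ p) → ⊥-elim (irrefl (ϵʳ (Qsym e) (π-in p i))) ; (inj₂ (inj₁ q)) → return q ; (inj₂ (inj₂ p)) → ⊥-elim (irrefl (ϵʳ e (π-in p j))) })

  initial : ∀ {t} → t ⊆ ω → Trans t → ¬¬ (t ≃ ω ⊎ t ϵ ω)
  initial {t} s tr = em (ω ⊆ t) >>= λ
    { (inj₁ x) → return (inj₁ (⊆-antisym s x))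
    ; (inj₂ nx) → minimal (negᶠ (v0 ϵᶠ v1)) (t ◂ ⟨⟩) ω (λ k → nx λ w i → stE λ n → k (w , i , n)) >>= λ (n , nω , nt , l) →
        return (inj₂ (ϵˡ (Qsym (⊆-antisym (λ y i → stE (trichotomy (s y i) nω >>= λ
          { (inj₁ p) → return p ; (inj₂ (inj₁ e)) → ⊥-elim (nt (ϵˡ e i)) ; (inj₂ (inj₂ p)) → ⊥-elim (nt (tr y i n p)) }))
          (λ y i → stE λ ny → l y i (ω-trans nω i) ny))) nω)) }

  IsFn : D → D → D → Set
  IsFn f a b = (∀ p → p ϵ f → ¬¬ Σ D λ x → x ϵ a × (¬¬ Σ D λ y → y ϵ b × p ≃ op x y)) ×
               (∀ x → x ϵ a → ¬¬ Σ D λ y → op x y ϵ f × (∀ y' → op x y' ϵ f → y' ≃ y))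

  Inj : D → Set
  Inj f = ∀ x x' y → op x y ϵ f → op x' y ϵ f → x ≃ x'

  Cnt Apx : D → D → Set
  Cnt w c = ¬¬ Σ D λ f → IsFn f c w × Inj f
  Apx a b = ¬¬ Σ D λ f → IsFn f a b × Inj f × (∀ y → y ϵ b → ¬¬ Σ D λ x → op x y ϵ f)

  pair-sat : (x y f : Fin n) (ρ : Vec D n) → sat (⟨ x , y ⟩∈ f) ρ ↔ op (lookup ρ x) (lookup ρ y) ϵ lookup ρ f
  pair-sat x y f ρ = (λ h → ϵˡ (Qsym op-def) (proj₁ (KP.sat-∈ x y f ρ) h)) , (λ h → proj₂ (KP.sat-∈ x y f ρ) (ϵˡ op-def h))

  fn-sat : (f a b : Fin n) (ρ : Vec D n) → IsFn (lookup ρ f) (lookup ρ a) (lookup ρ b) → sat (IsFunction f a b) ρ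
  fn-sat f a b ρ (h , k) = ∧-in
    (λ p i → ex-in (h p i >>= λ (x , j , h) → return (x , ∧-in j (ex-in (h >>= λ (y , l , e) →
      return (y , ∧-in l (proj₂ (KP.sat-opair (suc (suc zero)) (suc zero) zero (y ◂ x ◂ p ◂ ρ)) (Qtr e op-def))))))))
    (λ x i → ex-in (k x i >>= λ (y , j , u) → return (y , ∧-in (proj₂ (pair-sat (suc zero) zero (↑² f) (y ◂ x ◂ ρ)) j)
      λ y' l → u y' (proj₁ (pair-sat (suc (suc zero)) zero (suc (↑² f)) (y' ◂ y ◂ x ◂ ρ)) l))))

  fn-out : (f a b : Fin n) (ρ : Vec D n) → sat (IsFunction f a b) ρ → ¬¬ IsFn (lookup ρ f) (lookup ρ a) (lookup ρ b)
  fn-out f a b ρ s = ∧-out s >>= λ (h , k) → return (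
    (λ p i → ex-out (h p i) >>= λ (x , h) → ∧-out h >>= λ (j , h) → return (x , j , ex-out h >>= λ (y , h) → ∧-out h >>= λ (l , e) →
      return (y , l , Qtr (proj₁ (KP.sat-opair (suc (suc zero)) (suc zero) zero (y ◂ x ◂ p ◂ ρ)) e) (Qsym op-def)))) ,
    (λ x i → ex-out (k x i) >>= λ (y , h) → ∧-out h >>= λ (j , u) → return (y , proj₁ (pair-sat (suc zero) zero (↑² f) (y ◂ x ◂ ρ)) j ,
      λ y' l → u y' (proj₂ (pair-sat (suc (suc zero)) zero (suc (↑² f)) (y' ◂ y ◂ x ◂ ρ)) l))))

  inj-sat : (f : Fin n) (ρ : Vec D n) → sat (Injective f) ρ ↔ Inj (lookup ρ f)
  inj-sat f ρ =
    (λ h x x' y i j → h x x' y (proj₂ (pair-sat (suc (suc zero)) zero (↑³ f) (y ◂ x' ◂ x ◂ ρ)) i) (proj₂ (pair-sat (suc zero) zero (↑³ f) (y ◂ x' ◂ x ◂ ρ)) j)) ,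
    (λ h x x' y i j → h x x' y (proj₁ (pair-sat (suc (suc zero)) zero (↑³ f) (y ◂ x' ◂ x ◂ ρ)) i) (proj₁ (pair-sat (suc zero) zero (↑³ f) (y ◂ x' ◂ x ◂ ρ)) j))

  cnt-in : (w c : Fin n) (ρ : Vec D n) → Cnt (lookup ρ w) (lookup ρ c) → sat (Countable w c) ρ
  cnt-in w c ρ h = ex-in (h >>= λ (f , i , j) → return (f , ∧-in (fn-sat zero (suc c) (suc w) (f ◂ ρ) i) (proj₂ (inj-sat zero (f ◂ ρ)) j)))

  cnt-out : (w c : Fin n) (ρ : Vec D n) → sat (Countable w c) ρ → Cnt (lookup ρ w) (lookup ρ c)
  cnt-out w c ρ h = ex-out h >>= λ (f , h) → ∧-out h >>= λ (i , j) → fn-out zero (suc c) (suc w) (f ◂ ρ) i >>= λ i → return (f , i , proj₁ (inj-sat zero (f ◂ ρ)) j)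

  apx-in : (a b : Fin n) (ρ : Vec D n) → Apx (lookup ρ a) (lookup ρ b) → sat (a ≈ b) ρ
  apx-in a b ρ h = ex-in (h >>= λ (f , i , j , k) → return (f , ∧-in (fn-sat zero (suc a) (suc b) (f ◂ ρ) i) (∧-in (proj₂ (inj-sat zero (f ◂ ρ)) j)
    λ y l → ex-in (k y l >>= λ (x , m) → return (x , proj₂ (pair-sat zero (suc zero) (suc (suc zero)) (x ◂ y ◂ f ◂ ρ)) m)))))

  apx-out : (a b : Fin n) (ρ : Vec D n) → sat (a ≈ b) ρ → Apx (lookup ρ a) (lookup ρ b)
  apx-out a b ρ h = ex-out h >>= λ (f , h) → ∧-out h >>= λ (i , h) → ∧-out h >>= λ (j , k) → fn-out zero (suc a) (suc b) (f ◂ ρ) i >>= λ i →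
    return (f , i , proj₁ (inj-sat zero (f ◂ ρ)) j , λ y l → ex-out (k y l) >>= λ (x , m) → return (x , proj₁ (pair-sat zero (suc zero) (suc (suc zero)) (x ◂ y ◂ f ◂ ρ)) m))

  apx-cong : ∀ {a b b'} → b ≃ b' → Apx a b → Apx a b'
  apx-cong e h = h >>= λ (f , (i , i') , j , k) → return (f , ((λ p l → i p l >>= λ (x , m , h) → return (x , m , h >>= λ (y , n , q) → return (y , ϵʳ e n , q))) , i') , j ,
    λ y l → k y (ϵʳ (Qsym e) l))

  Unb : D → Set
  Unb a = ∀ k → k ϵ ω → ¬¬ Σ D λ m → m ϵ a × k ϵ m

  -- The transitive collapse of a set of natural numbers: its image is an initial segment of ω, so
  -- either all of ω or a natural number.
  collapse : ∀ {a} → a ⊆ ω → ¬¬ Σ D λ t → Apx a t × (¬¬ (t ≃ ω ⊎ t ϵ ω)) × (∀ w → w ϵ t → ¬¬ Σ D λ m → m ϵ a × w ≃ π m a)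
  collapse {a} s = do
    t , ht ← image-set π₂ (a ◂ ⟨⟩) a
    f , hf ← image-set (opᵗ v0 (π₂ ⟨ v0 ◂ v1 ◂ ⟨⟩ ⟩)) (a ◂ ⟨⟩) a
    let val : ∀ {x y} → op x y ϵ f → ¬¬ (x ϵ a × y ≃ π x a)
        val i = proj₁ (hf _) i >>= λ (m , j , e) → return (ϵˡ (Qsym (op-inj₁ e)) j , Qtr (op-inj₂ e) (π-cong (Qsym (op-inj₁ e))))
        inn : ∀ {x} → x ϵ a → op x (π x a) ϵ f
        inn i = proj₂ (hf _) (return (_ , i , Qrefl))
    return (t , return (f ,
        ((λ p i → proj₁ (hf p) i >>= λ (m , j , e) → return (m , j , return (π m a , proj₂ (ht _) (return (m , j , Qrefl)) , e))) ,
         (λ x i → return (π x a , inn i , λ y' j → stQ (val j >>= λ (_ , e) → return e)))) ,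
        (λ x x' y i j → stQ (val i >>= λ (k , e) → val j >>= λ (k' , e') → return (π-inj k k' (Qtr (Qsym e) e')))) ,
        λ y i → proj₁ (ht y) i >>= λ (m , j , e) → return (m , ϵˡ (op-cong Qrefl (Qsym e)) (inn j))) ,
      initial {t} (λ w i → stE (proj₁ (ht w) i >>= λ (m , j , e) → return (ϵˡ (Qsym e) (proj₁ (π-ω m (s m j))))))
        (λ x i y j → stE (proj₁ (ht x) i >>= λ (m , k , e) → proj₁ π-spec (ϵʳ e j) >>= λ (l , _ , la , q) → return (proj₂ (ht y) (return (l , la , q))))) ,
      λ w i → proj₁ (ht w) i)
    where open Collapse a s

  -- By induction on k there is a bound b for all natural numbers that f sends below k; an element
  -- of a above b refutes this.
  unb-infinite : ∀ {a k} → a ⊆ ω → Unb a → k ϵ ω → ¬ Apx a k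
  unb-infinite {a} {k} s u kω h = h λ (f , (fn , tot) , inj , _) →
    ω-ind φ (f ◂ ⟨⟩) (return (∅ , 0ϵω , λ j i → ⊥-elim (∅-spec i))) (λ k _ h → h >>= λ (b , bω , hb) → em (¬¬ Σ D λ x → x ϵ ω × op x k ϵ f) >>= λ
        { (inj₁ e) → e >>= λ (x , xω , i) → directed bω xω >>= λ (b' , b'ω , bb' , xb') →
            return (b' , b'ω , λ j jk y yω l → stE (adj-elim jk (λ jk → return (nat-trans b'ω bb' (hb j jk y yω l)))
              λ q → return (ϵˡ (inj x y k i (ϵˡ (op-cong Qrefl q) l)) xb')))
        ; (inj₂ n) → return (b , bω , λ j jk y yω l → stE (adj-elim jk (λ jk → return (hb j jk y yω l)) λ q → ⊥-elim (n (return (y , yω , ϵˡ (op-cong Qrefl q) l))))) })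
      k kω λ (b , bω , hb) → u b bω λ (m , ma , bm) → tot m ma λ (y , i , _) → fn _ i λ (x , _ , h) → h λ (y' , y'k , e) →
        asym bm (hb y (ϵˡ (Qsym (op-inj₂ e)) y'k) m (s m ma) i)
    where
    φ : Fm 2
    φ = Ex (v0 ϵᶠ ωᵗ & All (v0 ϵᶠ v2 ⊃ All (v0 ϵᶠ ωᵗ ⊃ opᵗ v0 v1 ϵᶠ v4 ⊃ v0 ϵᶠ v2)))

  -- The collapse of a is then ω. Since the order type π m a is at most m, the element m of a with π
  -- m a = k + 2 exceeds k.
  infinite-unb : ∀ {a} → a ⊆ ω → (∀ k → k ϵ ω → ¬ Apx a k) → Unb a
  infinite-unb {a} s inf' k kω no = collapse s λ (t , ap , c , out) → c λ
    { (inj₂ tω) → inf' t tω ap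
    ; (inj₁ e) → out (succ (succ k)) (ϵʳ (Qsym e) (sucϵω (sucϵω kω))) λ (m , ma , q) →
        trichotomy (s m ma) kω λ
          { (inj₂ (inj₂ p)) → no (m , ma , p)
          ; (inj₂ (inj₁ r)) → small m ma q (adjʳ r)
          ; (inj₁ p) → small m ma q (adjˡ p) } }
    where
    small : ∀ m → m ϵ a → succ (succ k) ≃ π m a → m ϵ succ k → ⊥
    small m ma q i = irrefl (nat-trans (sucϵω (sucϵω kω)) (suc-mono (sucϵω kω) i) (ϵˡ (Qsym q) (proj₂ (Collapse.π-ω a s m (s m ma)))))

  unb-apx : ∀ {a} → a ⊆ ω → Unb a → Apx a ω
  unb-apx s u = collapse s >>= λ (t , ap , c , _) → c >>= λ { (inj₁ e) → apx-cong e ap ; (inj₂ tω) → ⊥-elim (unb-infinite s u tω ap) }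

  -- Keeping for each x only the least number related to it turns an injective relation into an
  -- injective function.
  counted : ∀ {c f} → (∀ x → x ϵ c → ¬¬ Σ D λ k → k ϵ ω × op x k ϵ f) → Inj f → Cnt ω c
  counted {c} {f} tot inj = separate (opᵗ (fstᵗ v0) (sndᵗ v0) ϵᶠ v1 & All (v0 ϵᶠ sndᵗ v1 ⊃ negᶠ (opᵗ (fstᵗ v1) v0 ϵᶠ v2))) (f ◂ ⟨⟩) (prod c ω) >>= λ (f' , h) →
    return (f' , (fn f' h , total f' h) , λ x x' y i j → inj x x' y (proj₁ (out f' h i)) (proj₁ (out f' h j)))
    where
    Least : D → D → Set
    Least x n = op x n ϵ f × (∀ m → m ϵ n → ¬ (op x m ϵ f))
    module _ (f' : D) (h : ∀ p → p ϵ f' ↔ (p ϵ prod c ω × op (fst p) (snd p) ϵ f × (∀ m → m ϵ snd p → ¬ (op (fst p) m ϵ f)))) where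
      out : ∀ {x n} → op x n ϵ f' → Least x n
      out {x} {n} i = let _ , a , b = proj₁ (h _) i in ϵˡ (op-cong fst-op snd-op) a , λ m j k → b m (ϵʳ (Qsym snd-op) j) (ϵˡ (op-cong (Qsym fst-op) Qrefl) k)
      into : ∀ {x n} → x ϵ c → n ϵ ω → Least x n → op x n ϵ f'
      into i j (a , b) = proj₂ (h _) (prod-in i j , ϵˡ (op-cong (Qsym fst-op) (Qsym snd-op)) a , λ m k l → b m (ϵʳ snd-op k) (ϵˡ (op-cong fst-op Qrefl) l))
      nat' : ∀ {x n} → op x n ϵ f' → n ϵ ω
      nat' i = stE (proj₁ prod-spec (proj₁ (proj₁ (h _) i)) >>= λ (_ , k) → k >>= λ (_ , _ , b , e) → return (ϵˡ (Qsym (op-inj₂ e)) b))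
      fn : ∀ p → p ϵ f' → ¬¬ Σ D λ x → x ϵ c × (¬¬ Σ D λ y → y ϵ ω × p ≃ op x y)
      fn p i = proj₁ prod-spec (proj₁ (proj₁ (h p) i)) >>= λ (x , k) → k >>= λ (y , a , b , e) → return (x , a , return (y , b , e))
      total : ∀ x → x ϵ c → ¬¬ Σ D λ y → op x y ϵ f' × (∀ y' → op x y' ϵ f' → y' ≃ y)
      total x i = minimal (opᵗ v1 v0 ϵᶠ v2) (x ◂ f ◂ ⟨⟩) ω (tot x i) >>= λ (n , nω , a , l) →
        return (n , into i nω (a , λ m j → l m j (ω-trans nω j)) , λ y' j → stQ (trichotomy (nat' j) nω >>= λ
          { (inj₁ p) → ⊥-elim (l y' p (nat' j) (proj₁ (out j))) ; (inj₂ (inj₁ e)) → return e ; (inj₂ (inj₂ p)) → ⊥-elim (proj₂ (out j) n p a) }))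

  is-succ : ∀ {u y} → (∀ z → ¬ ((z ϵ u → (¬ (z ϵ y) → z ≃ y)) → ¬ ((¬ (z ϵ y) → z ≃ y) → z ϵ u))) → u ≃ succ y
  is-succ su = ≃ext λ z → let f , f' = iff-out stE (λ k na → stQ λ nb → k λ j → nb (j na)) (su z) in
    (λ i → proj₂ adj-spec (proj₁ (or-out stQ) (f i))) , (λ i → f' (proj₂ (or-out stQ) (proj₁ adj-spec i)))

  isω : ∀ {w} → sat (Isω zero) (w ◂ ⟨⟩) → w ≃ ω
  isω {w} h = stQ (∧-out h >>= λ (i , l) → ∧-out i >>= λ (z , s) → return (⊆-antisym
    (λ x j → l ω ω-inductive x j)
    (λ x j → proj₁ ω-spec j w
      (stE (ex-out z >>= λ (e , h) → ∧-out h >>= λ (k , em) → return (ϵˡ (≃ext λ u → (λ p → ⊥-elim (em u p)) , λ p → ⊥-elim (∅-spec p)) k)) ,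
       λ y k → stE (ex-out (s y k) >>= λ (u , h) → ∧-out h >>= λ (uw , su) → return (ϵˡ (is-succ su) uw))))))
    where
    ω-inductive : sat (Inductive zero) (ω ◂ w ◂ ⟨⟩)
    ω-inductive = ∧-in (ex-in (return (∅ , ∧-in 0ϵω λ z → ∅-spec)))
      λ x i → ex-in (return (succ x , ∧-in (sucϵω i) λ z → iff-in ((λ j → proj₂ (or-out stQ) (proj₁ adj-spec j)) , (λ j → proj₂ adj-spec (proj₁ (or-out stQ) j)))))

  Adjacent : D → D → D → Set
  Adjacent c n x = ¬¬ Σ D λ m → m ϵ ω × op n m ϵ c × m ϵ x × succ m ϵ x

  adjacent₃ : Fm 3
  adjacent₃ = Ex (v0 ϵᶠ ωᵗ & opᵗ v2 v0 ϵᶠ v1 & v0 ϵᶠ v3 & sucᵗ v0 ϵᶠ v3)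

  module Assembly (X : D) (mem : ∀ x → x ϵ X → x ⊆ ω × Unb x)
    (unc : ∀ f → (∀ x → x ϵ X → ¬¬ Σ D λ k → k ϵ ω × op x k ϵ f) → ¬ Inj f)
    (cod : ∀ Y → Y ⊆ X → ¬¬ Σ D λ c → ∀ x → x ϵ X → x ϵ Y ↔ (∀ k → k ϵ ω → Adjacent c k x))
    (spl : ∀ a → a ⊆ ω → Unb a → ¬¬ Σ D λ R → Inj R × (∀ x → x ϵ X → ¬¬ (
       ((∀ k → k ϵ ω → ¬¬ Σ D λ m → m ϵ a × k ϵ m × m ϵ x) × (∀ k → k ϵ ω → ¬¬ Σ D λ m → m ϵ a × k ϵ m × ¬ (m ϵ x))) ⊎
       (¬¬ Σ D λ k → k ϵ ω × op x k ϵ R)))) where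

    infinite-members : ∀ x → x ϵ X → sat (∈[ω]^ω (suc (suc zero)) zero) (x ◂ X ◂ ω ◂ ⟨⟩)
    infinite-members x i = ∧-in (proj₁ (mem x i)) λ h → ex-out h λ (k , h) → ∧-out h λ (kω , ap) →
      unb-infinite (proj₁ (mem x i)) (proj₂ (mem x i)) kω (apx-out (suc zero) zero (k ◂ x ◂ X ◂ ω ◂ ⟨⟩) ap)

    uncountable' : ¬ sat (Countable (suc zero) zero) (X ◂ ω ◂ ⟨⟩)
    uncountable' h = cnt-out (suc zero) zero (X ◂ ω ◂ ⟨⟩) h λ (f , (fn , tot) , inj) → unc f (λ x i → tot x i >>= λ (y , j , _) →
      fn _ j >>= λ (x' , _ , h) → h >>= λ (y' , y'ω , e) → return (y , ϵˡ (Qsym (op-inj₂ e)) y'ω , j)) inj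

    module Delta (Y c : D) (h : ∀ x → x ϵ X → x ϵ Y ↔ (∀ k → k ϵ ω → Adjacent c k x)) where
      -- One term for two sets: with parameter 𝒫 ω it gives an open set, with parameter X the trace
      -- of this set on X.
      Vᵗ : Tm 3
      Vᵗ = ⁅ v0 ϵᶠ v2 & adjacent₃ ⟪ v3 ◂ v1 ◂ v0 ◂ ⟨⟩ ⟫ ⁆

      V' U' : D → D
      V' n = ⟦ Vᵗ ⟧ (n ◂ X ◂ c ◂ ⟨⟩)
      U' n = ⟦ Vᵗ ⟧ (n ◂ 𝒫 ω ◂ c ◂ ⟨⟩)

      abstract
        V-spec : ∀ {n x} → x ϵ V' n ↔ (x ϵ X × Adjacent c n x)
        V-spec = cls-bounded X λ _ → proj₁
        U-spec : ∀ {n x} → x ϵ U' n ↔ (x ϵ 𝒫 ω × Adjacent c n x)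
        U-spec = cls-bounded (𝒫 ω) λ _ → proj₁

      open-U : ∀ n (ρ : Vec D k) → sat (Open (suc zero) zero) (U' n ◂ ω ◂ ρ)
      open-U n ρ = ∧-in (λ x i → proj₁ 𝒫-spec (proj₁ (proj₁ U-spec i))) λ x i → ex-in (proj₂ (proj₁ U-spec i) >>= λ (m , mω , nm , mx , sx) →
        -- The neighbourhood fixes the digits below m + 2, the last two of which are those at m and
        -- m + 1.
        return (succ (succ m) , ∧-in (sucϵω (sucϵω mω)) λ y s ag → near x m mω nm mx sx y s λ j l → iff-out stE stE (ag j l)))
        where
        near : ∀ x m → m ϵ ω → op n m ϵ c → m ϵ x → succ m ϵ x → ∀ y → y ⊆ ω → (∀ j → j ϵ succ (succ m) → j ϵ y ↔ j ϵ x) → y ϵ U' n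
        near x m mω nm mx sx y s ag = proj₂ U-spec (proj₂ 𝒫-spec s , return z)
          where
          z : Σ D λ m → m ϵ ω × op n m ϵ c × m ϵ y × succ m ϵ y
          z = m , mω , nm , proj₂ (ag m (adjˡ (adjʳ Qrefl))) mx , proj₂ (ag (succ m) (adjʳ Qrefl)) sx

      module _ (G : D) (hG : ∀ o → o ϵ G ↔ (¬¬ Σ D λ n → n ϵ ω × o ≃ V' n)) where
        G-countable : Cnt ω G
        G-countable = image-set (opᵗ (Vᵗ ⟨ v0 ◂ v1 ◂ v2 ◂ ⟨⟩ ⟩) v0) (X ◂ c ◂ ⟨⟩) ω >>= λ (f , hf) → counted {G} {f}
          (λ o i → proj₁ (hG o) i >>= λ (n , nω , e) → return (n , nω , proj₂ (hf (op o n)) (return (n , nω , op-cong e Qrefl))))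
          λ o v' n i j → stQ (proj₁ (hf _) i >>= λ (k , _ , e) → proj₁ (hf _) j >>= λ (k' , _ , e') →
            return (Qtr (op-inj₁ e) (Qtr (rept Vᵗ (Qtr (Qsym (op-inj₂ e)) (op-inj₂ e'))) (Qsym (op-inj₁ e')))))

        G-open : ∀ o → o ϵ G → sat (RelativelyOpen (suc (suc (suc (suc zero)))) (suc (suc (suc zero))) zero) (o ◂ G ◂ Y ◂ X ◂ ω ◂ ⟨⟩)
        G-open o i = ex-in (proj₁ (hG o) i >>= λ (n , _ , e) → return (U' n , ∧-in (open-U n ⟨⟩) λ z → iff-in
          ((λ j → let a , b = proj₁ V-spec (ϵʳ e j) in ∧-in a (proj₂ U-spec (proj₂ 𝒫-spec (proj₁ (mem z a)) , b))) ,
           (λ j → stE (∧-out j >>= λ (a , b) → return (ϵʳ (Qsym e) (proj₂ V-spec (a , proj₂ (proj₁ U-spec b)))))))))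

        G-eq : Y ⊆ X → ∀ x → x ϵ Y ↔ (x ϵ X × (∀ o → o ϵ G → x ϵ o))
        G-eq s x = (λ i → s x i , λ o j → stE (proj₁ (hG o) j >>= λ (n , nω , e) → return (ϵʳ (Qsym e) (proj₂ V-spec (s x i , proj₁ (h x (s x i)) i n nω))))) ,
          (λ (i , j) → proj₂ (h x i) λ k kω → proj₂ (proj₁ V-spec (j (V' k) (proj₂ (hG (V' k)) (return (k , kω , Qrefl))))))

        gδ : Y ⊆ X → sat (RelativelyGδ (suc (suc zero)) (suc zero) zero) (Y ◂ X ◂ ω ◂ ⟨⟩)
        gδ s = ex-in (return (G , ∧-in (cnt-in (suc (suc (suc zero))) zero (G ◂ Y ◂ X ◂ ω ◂ ⟨⟩) G-countable) (∧-in G-open λ x → iff-in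
          ((λ i → let a , b = proj₁ (G-eq s x) i in ∧-in a b) ,
           (λ i → stE (∧-out i >>= λ p → return (proj₂ (G-eq s x) p)))))))

    q-set : sat (QSet (suc zero) zero) (X ◂ ω ◂ ⟨⟩)
    q-set = ∧-in (λ x i → proj₁ (mem x i)) (∧-in uncountable' λ Y s → st (RelativelyGδ (suc (suc zero)) (suc zero) zero) {Y ◂ X ◂ ω ◂ ⟨⟩}
      (cod Y s >>= λ (c , h) → image-set (Delta.Vᵗ Y c h) (X ◂ c ◂ ⟨⟩) ω >>= λ (G , hG) → return (Delta.gδ Y c h G hG s)))

    module _ (a : D) (a⊆ω : a ⊆ ω) (R : D) (inj : Inj R)
      (alt : ∀ x → x ϵ X → ¬¬ (
         ((∀ k → k ϵ ω → ¬¬ Σ D λ m → m ϵ a × k ϵ m × m ϵ x) × (∀ k → k ϵ ω → ¬¬ Σ D λ m → m ϵ a × k ϵ m × ¬ (m ϵ x))) ⊎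
         (¬¬ Σ D λ k → k ϵ ω × op x k ϵ R))) where
      splits-in : ∀ x e → (∀ k → k ϵ ω → ¬¬ Σ D λ m → m ϵ a × k ϵ m × m ϵ x) → (∀ k → k ϵ ω → ¬¬ Σ D λ m → m ϵ a × k ϵ m × ¬ (m ϵ x)) →
                  sat (Splits (suc (suc (suc (suc zero)))) zero (suc (suc zero))) (x ◂ e ◂ a ◂ X ◂ ω ◂ ⟨⟩)
      splits-in x e h k = ∧-in
        (ex-in (separate (v0 ϵᶠ v1) (x ◂ ⟨⟩) a >>= λ (c , hc) → return (c , ∧-in
          (λ z → iff-in ((λ i → let p , q = proj₁ (hc z) i in ∧-in q p) , (λ i → stE (∧-out i >>= λ (p , q) → return (proj₂ (hc z) (q , p))))))
          (apx-in zero (suc (suc (suc (suc (suc zero))))) (c ◂ x ◂ e ◂ a ◂ X ◂ ω ◂ ⟨⟩) (unb-apx (λ z i → a⊆ω z (proj₁ (proj₁ (hc z) i)))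
            λ j jω → h j jω >>= λ (m , ma , jm , mx) → return (m , proj₂ (hc m) (ma , mx) , jm))))))
        (ex-in (separate (negᶠ (v0 ϵᶠ v1)) (x ◂ ⟨⟩) a >>= λ (c , hc) → return (c , ∧-in
          (λ z → iff-in ((λ i → let p , q = proj₁ (hc z) i in ∧-in p q) , (λ i → stE (∧-out i >>= λ (p , q) → return (proj₂ (hc z) (p , q))))))
          (apx-in zero (suc (suc (suc (suc (suc zero))))) (c ◂ x ◂ e ◂ a ◂ X ◂ ω ◂ ⟨⟩) (unb-apx (λ z i → a⊆ω z (proj₁ (proj₁ (hc z) i)))
            λ j jω → k j jω >>= λ (m , ma , jm , mx) → return (m , proj₂ (hc m) (ma , mx) , jm))))))

      exceptional : sat (∃[ e ] (Countable (↑ (suc (suc zero))) e ∧̇ (∀[ x ] (x ∈̇ ↑ e ⇔ (x ∈̇ ↑² (suc zero) ∧̇ ¬̇ (Splits (↑² (suc (suc zero))) x (↑² zero))))))) (a ◂ X ◂ ω ◂ ⟨⟩)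
      exceptional = ex-in (sep-base (¬̇ (Splits (suc (suc zero)) zero (suc zero))) (a ◂ ω ◂ ⟨⟩) X >>= λ (e , he) → return (e , ∧-in
        (cnt-in (suc (suc (suc zero))) zero (e ◂ a ◂ X ◂ ω ◂ ⟨⟩) (counted {e} {R} (λ x i → let j , n = proj₁ (he x) i in alt x j >>= λ
          { (inj₁ (p , q)) → ⊥-elim (n (splits-in x e p q)) ; (inj₂ r) → r }) inj))
        λ x → iff-in ((λ i → let p , q = proj₁ (he x) i in ∧-in p q) , (λ i → stE (∧-out i >>= λ (p , q) → return (proj₂ (he x) (p , q)))))))

    strong : sat (StrongSplittingFamily (suc zero) zero) (X ◂ ω ◂ ⟨⟩)
    strong a h = st E' {a ◂ X ◂ ω ◂ ⟨⟩} (∧-out h >>= λ (s , inf') →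
      spl a s (infinite-unb s λ k kω ap → inf' (ex-in (return (k , ∧-in kω (apx-in (suc zero) zero (k ◂ a ◂ X ◂ ω ◂ ⟨⟩) ap))))) >>= λ (R , inj , alt) →
      return (exceptional a s R inj alt))
      where
      E' : Formula 3
      E' = ∃[ e ] (Countable (↑ (suc (suc zero))) e ∧̇ (∀[ x ] (x ∈̇ ↑ e ⇔ (x ∈̇ ↑² (suc zero) ∧̇ ¬̇ (Splits (↑² (suc (suc zero))) x (↑² zero))))))

    family : sat (∃[ X ] ((∀[ x ∊ X ] ∈[ω]^ω (suc (suc zero)) x) ∧̇ QSet (suc zero) X ∧̇ StrongSplittingFamily (suc zero) X)) (ω ◂ ⟨⟩)
    family = ex-in (return (X , ∧-in infinite-members (∧-in q-set strong)))

  module Extraction (X : D) where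
    ρ : Vec D 2
    ρ = X ◂ ω ◂ ⟨⟩

    ex-mem : sat (∀[ x ∊ zero ] (x ⊆̇ suc (suc zero) ∧̇ Unbounded (suc (suc zero)) x)) ρ → ∀ x → x ϵ X → x ⊆ ω × Unb x
    ex-mem h x i = (λ z j → stE (∧-out (h x i) >>= λ (s , _) → return (s z j))) ,
      (λ k kω → ∧-out (h x i) >>= λ (_ , u) → ex-out (u k kω) >>= λ (m , p) → ∧-out p >>= λ q → return (m , q))

    ex-unc : ¬ sat (CountedBy (suc zero) zero) ρ → ∀ f → (∀ x → x ϵ X → ¬¬ Σ D λ k → k ϵ ω × op x k ϵ f) → ¬ Inj f
    ex-unc nc f tot inj = nc (ex-in (return (f , ∧-in
      (λ x i → ex-in (tot x i >>= λ (k , kω , p) → return (k , ∧-in kω (proj₂ (pair-sat (suc zero) zero (suc (suc zero)) (k ◂ x ◂ f ◂ ρ)) p))))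
      (proj₂ (inj-sat zero (f ◂ ρ)) inj))))

    Rhsᶠ : Formula 5
    Rhsᶠ = ∀[ k ∊ suc (suc (suc (suc zero))) ] ∃[ m ∊ suc (suc (suc (suc (suc zero)))) ]
      (⟨ ↑ k , m ⟩∈ suc (suc (suc zero)) ∧̇ m ∈̇ suc (suc zero) ∧̇ (∃[ s ∊ suc (suc zero) ] IsSuccessor s (↑ m)))

    rhs : ∀ Y c x → sat Rhsᶠ (x ◂ c ◂ Y ◂ ρ) ↔ (∀ k → k ϵ ω → Adjacent c k x)
    rhs Y c x =
      (λ h k kω → do
        m , h ← ex-out (h k kω)
        mω , h ← ∧-out h
        p , h ← ∧-out h
        mx , h ← ∧-out h
        s , h ← ex-out h
        sx , su ← ∧-out h
        return (m , mω , proj₁ (pair-sat (suc zero) zero (suc (suc (suc zero))) (m ◂ k ◂ x ◂ c ◂ Y ◂ ρ)) p , mx , ϵˡ (is-succ su) sx)) ,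
      (λ h k kω → ex-in (h k kω >>= λ (m , mω , p , mx , sx) → return (m , ∧-in mω (∧-in
        (proj₂ (pair-sat (suc zero) zero (suc (suc (suc zero))) (m ◂ k ◂ x ◂ c ◂ Y ◂ ρ)) p) (∧-in mx (ex-in (return (succ m , ∧-in sx
          λ z → iff-in ((λ j → proj₂ (or-out stQ) (proj₁ adj-spec j)) , (λ j → proj₂ adj-spec (proj₁ (or-out stQ) j)))))))))))

    ex-cod : ∀ Y → sat (Coded (suc (suc zero)) (suc zero) zero) (Y ◂ ρ) →
             ¬¬ Σ D λ c → ∀ x → x ϵ X → x ϵ Y ↔ (∀ k → k ϵ ω → Adjacent c k x)
    ex-cod Y h = ex-out h >>= λ (c , h) → return (c , λ x i → let f , f' = iff-out stE (st Rhsᶠ {x ◂ c ◂ Y ◂ ρ}) (h x i) in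
      (λ j → proj₁ (rhs Y c x) (f j)) , (λ j → f' (proj₂ (rhs Y c x) j)))

    ex-spl : ∀ a → sat (AlmostSplit (suc (suc zero)) (suc zero) zero) (a ◂ ρ) →
      ¬¬ Σ D λ R → Inj R × (∀ x → x ϵ X → ¬¬ (
        ((∀ k → k ϵ ω → ¬¬ Σ D λ m → m ϵ a × k ϵ m × m ϵ x) × (∀ k → k ϵ ω → ¬¬ Σ D λ m → m ϵ a × k ϵ m × ¬ (m ϵ x))) ⊎
        (¬¬ Σ D λ k → k ϵ ω × op x k ϵ R)))
    ex-spl a h = ex-out h >>= λ (R , h) → ∧-out h >>= λ (inj , alt) → return (R , proj₁ (inj-sat zero (R ◂ a ◂ ρ)) inj , λ x i →
      proj₁ (or-out λ s f → s λ g → g f) (alt x i) >>= λ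
        { (inj₁ p) → ∧-out p >>= λ (u , w) → return (inj₁ (
            (λ k kω → ex-out (u k kω) >>= λ (m , q) → ∧-out q >>= λ (ma , q) → ∧-out q >>= λ (km , mx) → return (m , ma , km , mx)) ,
            (λ k kω → ex-out (w k kω) >>= λ (m , q) → ∧-out q >>= λ (ma , q) → ∧-out q >>= λ (km , mx) → return (m , ma , km , mx))))
        ; (inj₂ p) → return (inj₂ (ex-out p >>= λ (k , q) → ∧-out q >>= λ (kω , r) →
            return (k , kω , proj₁ (pair-sat (suc zero) zero (suc (suc zero)) (k ◂ x ◂ R ◂ a ◂ ρ)) r))) })

  sufficient : sat Combinatorial ⟨⟩ → sat ExistsStrongSplittingQSet ⟨⟩
  sufficient h = st ExistsStrongSplittingQSet {⟨⟩} do
    w , h ← ex-out h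
    iw , h ← ∧-out h
    let w≃ω = isω iw
        to-ω = λ (φ : Formula 1) → sat-cong {ρ = w ◂ ⟨⟩} {σ = ω ◂ ⟨⟩} (λ { zero → w≃ω }) φ
    X , h ← ex-out (to-ω (CombinatorialFamily zero) h)
    mem , h ← ∧-out h
    nc , h ← ∧-out h
    cod , spl ← ∧-out h
    let open Extraction X
    return (ex-in (return (ω , ∧-in (to-ω (Isω zero) iw) (Assembly.family X (ex-mem mem) (ex-unc nc) (λ Y s → ex-cod Y (cod Y s))
      λ a s u → ex-spl a (spl a s λ k kω → ex-in (u k kω >>= λ (m , ma , km) → return (m , ∧-in ma km)))))))

-- Enumeration of formulas

-- Cantor's walk along the antidiagonals.
step : ℕ × ℕ → ℕ × ℕ
step (zero , b)  = suc b , 0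
step (suc a , b) = a , suc b

unpair : ℕ → ℕ × ℕ
unpair zero    = 0 , 0
unpair (suc n) = step (unpair n)

unpair-surj : ∀ a b → Σ ℕ λ c → unpair c ≡ (a , b)
unpair-surj a b = go (a + b) b a refl
  where
  go : ∀ s b a → a + b ≡ s → Σ ℕ λ c → unpair c ≡ (a , b)
  go zero    zero    zero    e = 0 , refl
  go (suc s) zero    (suc a) e = let c , q = go s a zero (ℕ.suc-injective (trans (sym (ℕ.+-identityʳ (suc a))) e))
                                 in suc c , cong step q
  go s       (suc b) a       e = let c , q = go s b (suc a) (trans (sym (ℕ.+-suc a b)) e) in suc c , cong step q

-- Ensures that the constants of a formula enumerated by `enum-surj` at stage N are at most N, hence
-- already present.
unpair-≤ : ∀ n → proj₁ (unpair n) + proj₂ (unpair n) ≤ n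
unpair-≤ zero = z≤n
unpair-≤ (suc n) with unpair n | unpair-≤ n
... | zero , b  | p = s≤s (ℕ.≤-trans (ℕ.≤-reflexive (ℕ.+-identityʳ b)) p)
... | suc a , b | p = ℕ.≤-trans (ℕ.≤-reflexive (ℕ.+-suc a b)) (ℕ.m≤n⇒m≤1+n p)

clamp : ∀ n → ℕ → Fin (suc n)
clamp n a = fromℕ< {a ⊓ n} (s≤s (ℕ.m⊓n≤n a n))

clamp-toℕ : (i : Fin (suc n)) → clamp n (toℕ i) ≡ i
clamp-toℕ {n} i = toℕ-injective (trans (toℕ-fromℕ< _) (ℕ.m≤n⇒m⊓n≡m (s≤s⁻¹ (toℕ<n i))))

-- The first argument is fuel. Any sufficiently large amount gives the same formula, and `enum`
-- reads it off its argument along with the code.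
decode : ℕ → ℕ → ∀ n → Formula (suc n)
decode-tag : ℕ → ℕ → ℕ → ∀ n → Formula (suc n)
decode zero    c n = ⊥̇
decode (suc f) c n = decode-tag (proj₁ (unpair c)) f (proj₂ (unpair c)) n
decode-tag 0 f m n = clamp n (proj₁ (unpair m)) ∈̇ clamp n (proj₂ (unpair m))
decode-tag 1 f m n = clamp n (proj₁ (unpair m)) ≐ clamp n (proj₂ (unpair m))
decode-tag 2 f m n = decode f (proj₁ (unpair m)) n ⇒ decode f (proj₂ (unpair m)) n
decode-tag 3 f m n = ∀̇ (decode f m (suc n))
decode-tag _ f m n = ⊥̇

decode-surj : (φ : Formula (suc n)) → Σ ℕ λ c → Σ ℕ λ d → ∀ f → d ≤ f → decode f c n ≡ φ
decode-surj {n} (x ∈̇ y) with unpair-surj (toℕ x) (toℕ y)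
... | m , p with unpair-surj 0 m
... | c , q = c , 1 , λ { (suc f) _ → lem f }
  where
  lem : ∀ f → decode (suc f) c n ≡ (x ∈̇ y)
  lem f rewrite q | p = cong₂ _∈̇_ (clamp-toℕ x) (clamp-toℕ y)
decode-surj {n} (x ≐ y) with unpair-surj (toℕ x) (toℕ y)
... | m , p with unpair-surj 1 m
... | c , q = c , 1 , λ { (suc f) _ → lem f }
  where
  lem : ∀ f → decode (suc f) c n ≡ (x ≐ y)
  lem f rewrite q | p = cong₂ _≐_ (clamp-toℕ x) (clamp-toℕ y)
decode-surj {n} ⊥̇ with unpair-surj 4 0
... | c , q = c , 1 , λ { (suc f) _ → lem f }
  where
  lem : ∀ f → decode (suc f) c n ≡ ⊥̇
  lem f rewrite q = refl
decode-surj {n} (φ ⇒ ψ) with decode-surj φ | decode-surj ψ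
... | a , d , p | b , e , r with unpair-surj a b
... | m , s with unpair-surj 2 m
... | c , q = c , suc (d ⊔ e) , λ { (suc f) (s≤s l) → lem f l }
  where
  lem : ∀ f → d ⊔ e ≤ f → decode (suc f) c n ≡ (φ ⇒ ψ)
  lem f l rewrite q | s = cong₂ _⇒_ (p f (ℕ.m⊔n≤o⇒m≤o d e l)) (r f (ℕ.m⊔n≤o⇒n≤o d e l))
decode-surj {n} (∀̇ φ) with decode-surj φ
... | m , d , p with unpair-surj 3 m
... | c , q = c , suc d , λ { (suc f) (s≤s l) → lem f l }
  where
  lem : ∀ f → d ≤ f → decode (suc f) c n ≡ ∀̇ φ
  lem f l rewrite q = cong ∀̇ (p f l)

-- The Henkin model

-- Stage N of the Henkin construction lives in scope suc N; the constant c ≤ N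
-- is the variable with de Bruijn index N ∸ c.

abstract
  idx : ∀ N → ℕ → Fin (suc N)
  idx N c = fromℕ< {N ∸ c} (s≤s (ℕ.m∸n≤m N c))

  toℕ-idx : ∀ N c → toℕ (idx N c) ≡ N ∸ c
  toℕ-idx N c = toℕ-fromℕ< _

idx-suc : ∀ N c → c ≤ N → suc (idx N c) ≡ idx (suc N) c
idx-suc N c l = toℕ-injective (trans (cong suc (toℕ-idx N c))
  (trans (sym (ℕ.+-∸-assoc 1 l)) (sym (toℕ-idx (suc N) c))))

idx-new : ∀ N → zero ≡ idx (suc N) (suc N)
idx-new N = toℕ-injective (trans (sym (ℕ.n∸n≡0 N)) (sym (toℕ-idx (suc N) (suc N))))

inst : ∀ N → Formula k → Vec ℕ k → Formula (suc N)
inst N φ ρ = ren (λ i → idx N (lookup ρ i)) φ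

Bounded : Vec ℕ k → ℕ → Set
Bounded ρ N = ∀ i → lookup ρ i ≤ N

bound : (ρ : Vec ℕ k) → Σ ℕ (Bounded ρ)
bound ⟨⟩ = 0 , λ ()
bound (c ◂ ρ) with bound ρ
... | N , h = c ⊔ N , λ { zero → ℕ.m≤m⊔n c N ; (suc i) → ℕ.≤-trans (h i) (ℕ.m≤n⊔m c N) }

abstract
  -- A formula decoded in scope `suc a` speaks about the constants up to a, its variable i standing
  -- for the constant a ∸ i; the renaming moves it to stage N.
  enum : ∀ N → Formula (suc N)
  enum N with unpair N
  ... | a , r = ren (λ i → idx N (a ∸ toℕ i)) (decode (proj₁ (unpair r)) (proj₂ (unpair r)) a)

  enum-surj : (φ : Formula k) (ρ : Vec ℕ k) → Σ ℕ λ N → Bounded ρ N × enum N ≡ inst N φ ρ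
  enum-surj φ ρ with bound ρ
  ... | B , b with decode-surj (inst B φ ρ)
  ... | c , d , p with unpair-surj d c
  ... | r , q with unpair-surj B r
  ... | N , s = N , (λ i → ℕ.≤-trans (b i) B≤N) , lem
    where
    B≤N : B ≤ N
    B≤N = ℕ.m+n≤o⇒m≤o B (subst (λ z → proj₁ z + proj₂ z ≤ N) s (unpair-≤ N))
    lem : enum N ≡ inst N φ ρ
    lem rewrite s | q | p d ℕ.≤-refl = ren-ren _ _ _ (λ i → cong (idx N)
      (trans (cong (B ∸_) (toℕ-idx B (lookup ρ i))) (ℕ.m∸[m∸n]≡n (b i)))) φ

module Completeness (T : Theory) (con : Consistent T) (χ₀ : Formula 1) (inhabited : T ∣ [] ⊢ ∃̇ χ₀) where

  Entails : (Formula n → Set) → Formula n → Set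
  Entails Θ φ = Σ (List (Formula _)) λ L → (∀ {ψ} → ψ ∈ L → Θ ψ) × (T ∣ L ⊢ φ)

  Con : (Formula n → Set) → Set
  Con Θ = ¬ Entails Θ ⊥̇

  add : (Formula n → Set) → Formula n → Formula n → Set
  add Θ φ ψ = Θ ψ ⊎ ψ ≡ φ

  henkin : Formula n → Formula (suc n)
  henkin (∀̇ φ) = φ ⇒ ren ↑_ (∀̇ φ)
  henkin _     = ⊥̇ ⇒ ⊥̇

  -- Lindenbaum's step without a decision: the consistency of `enum N` with `Θ N` is part of what it
  -- means for it to belong to `Θ' N`. Then the Henkin axiom for `enum N` is added with the constant
  -- that is new in stage N + 1.
  Θ Θ' : ∀ N → Formula (suc N) → Set
  Θ zero    χ = ⊥
  Θ (suc N) χ = (Σ _ λ χ' → Θ' N χ' × χ ≡ ren ↑_ χ') ⊎ χ ≡ henkin (enum N)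
  Θ' N χ = Θ N χ ⊎ (χ ≡ enum N × Con (add (Θ N) (enum N)))

  deduct : {Θ : Formula n → Set} {φ ψ : Formula n} → Entails (add Θ φ) ψ → Entails Θ (φ ⇒ ψ)
  deduct {Θ = Θ} {φ} (L , h , d) = go L h (⇒I (weaken there d))
    where
    go : ∀ L → (∀ {ψ} → ψ ∈ L → add Θ φ ψ) → ∀ {ψ} → T ∣ L ⊢ φ ⇒ ψ → Entails Θ (φ ⇒ ψ)
    go [] h d = [] , (λ ()) , d
    go (χ ∷ L) h d with h (here refl) | go L (h ∘ there)
      {χ ⇒ _} (⇒I (⇒I (⇒E (weaken (λ { (here e) → here e ; (there i) → there (there i) }) d) (hyp (there (here refl))))))
    ... | inj₂ refl | K , k , e = K , k , ⇒I (⇒E (⇒E (weaken there e) (hyp (here refl))) (hyp (here refl)))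
    ... | inj₁ θ | K , k , e = χ ∷ K , (λ { (here refl) → θ ; (there i) → k i }) ,
      ⇒I (⇒E (⇒E (weaken (there ∘ there) e) (hyp (here refl))) (hyp (there (here refl))))

  con-0 : Con (Θ 0)
  con-0 (_ ∷ _ , h , d) = h (here refl)
  -- `Θ 0` already has one free variable. A contradiction in this scope generalises and refutes
  -- `∃̇ χ₀`, which is provable.
  con-0 ([] , h , d) = con (⇒E inhabited (∀I (⇒I (weaken (λ ()) d))))

  -- A finite list of members of `Θ' N` either lies in `Θ N` or contains evidence that `enum N` may
  -- be added consistently.
  con-' : ∀ N → Con (Θ N) → Con (Θ' N)
  con-' N c (L , h , d) with go L h
    where
    go : ∀ L → (∀ {ψ} → ψ ∈ L → Θ' N ψ) → (∀ {ψ} → ψ ∈ L → Θ N ψ) ⊎ Con (add (Θ N) (enum N))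
    go [] h = inj₁ λ ()
    go (χ ∷ L) h with h (here refl) | go L (h ∘ there)
    ... | inj₂ (_ , p) | _      = inj₂ p
    ... | inj₁ _       | inj₂ p = inj₂ p
    ... | inj₁ t       | inj₁ f = inj₁ λ { (here refl) → t ; (there i) → f i }
  ... | inj₁ f = c (L , f , d)
  ... | inj₂ p = p (L , (λ i → case h i of λ { (inj₁ t) → inj₁ t ; (inj₂ (e , _)) → inj₂ e }) , d)

  ren-↑-[] : (φ : Formula n) (x : Fin n) → ren ↑_ φ [ x ] ≡ φ
  ren-↑-[] φ x = trans (ren-ren (x V.∷ id) ↑_ id (λ _ → refl) φ) (ren-id id (λ _ → refl) φ)

  -- If φ → ∀ φ at a new variable is refutable from L, then L proves ¬ ∀ φ, and it proves φ at the
  -- new variable, hence ∀ φ. In the trivial cases the new variable is replaced by an old one.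
  henkin-con : (L : List (Formula (suc n))) (φ : Formula (suc n)) →
               T ∣ henkin φ ∷ map (ren ↑_) L ⊢ ⊥̇ → T ∣ L ⊢ ⊥̇
  henkin-con {n} L φ d = by-cases φ d
    where
    trivial : T ∣ (⊥̇ ⇒ ⊥̇) ∷ map (ren ↑_) L ⊢ ⊥̇ → T ∣ L ⊢ ⊥̇
    trivial d = ∀E (∀I (⇒E (⇒I d) (⇒I (hyp (here refl))))) zero
    by-cases : ∀ φ → T ∣ henkin φ ∷ map (ren ↑_) L ⊢ ⊥̇ → T ∣ L ⊢ ⊥̇
    by-cases (x ∈̇ y) d = trivial d
    by-cases (x ≐ y) d = trivial d
    by-cases ⊥̇       d = trivial d
    by-cases (φ ⇒ ψ) d = trivial d
    by-cases (∀̇ φ)   d = ⇒E (subst (λ ψ → T ∣ L ⊢ ¬̇ ψ) (ren-↑-[] (∀̇ φ) zero) (∀E (∀I notAll) zero)) (∀I allφ)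
      where
      notAll : T ∣ map (ren ↑_) L ⊢ ¬̇ (ren ↑_ (∀̇ φ))
      notAll = ⇒I (⇒E (⇒I (weaken (λ { (here e) → here e ; (there i) → there (there i) }) d))
                      (⇒I (hyp (there (here refl)))))
      allφ : T ∣ map (ren ↑_) L ⊢ φ
      allφ = raa (⇒E (⇒I (weaken (λ { (here e) → here e ; (there i) → there (there i) }) d))
                     (⇒I (raa (⇒E (hyp (there (there (here refl)))) (hyp (there (here refl)))))))

  con-suc : ∀ N → Con (Θ' N) → Con (Θ (suc N))
  con-suc N c (L , h , d) with go L h
    where
    go : ∀ L → (∀ {ψ} → ψ ∈ L → Θ (suc N) ψ) → Σ (List (Formula (suc N))) λ K →
         (∀ {ψ} → ψ ∈ K → Θ' N ψ) × (∀ {ψ} → ψ ∈ L → ψ ∈ henkin (enum N) ∷ map (ren ↑_) K)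
    go [] h = [] , (λ ()) , λ ()
    go (χ ∷ L) h with h (here refl) | go L (h ∘ there)
    ... | inj₂ refl           | K , k , s = K , k , λ { (here refl) → here refl ; (there i) → s i }
    ... | inj₁ (ψ , t , refl) | K , k , s = ψ ∷ K , (λ { (here refl) → t ; (there i) → k i }) ,
      λ { (here refl) → there (here refl)
        ; (there i) → case s i of λ { (here e) → here e ; (there j) → there (there j) } }
  ... | K , k , s = c (K , k , henkin-con K (enum N) (weaken s d))

  con-Θ : ∀ N → Con (Θ N)
  con-Θ zero    = con-0
  con-Θ (suc N) = con-suc N (con-' N (con-Θ N))

  Prov : Formula k → Vec ℕ k → Set
  Prov φ ρ = Σ ℕ λ N → Bounded ρ N × Entails (Θ N) (inst N φ ρ)

  inst-suc : ∀ N (φ : Formula k) ρ → Bounded ρ N → ren ↑_ (inst N φ ρ) ≡ inst (suc N) φ ρ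
  inst-suc N φ ρ b = ren-ren _ _ _ (λ i → idx-suc N _ (b i)) φ

  lift-entails : ∀ N {φ : Formula (suc N)} → Entails (Θ' N) φ → Entails (Θ (suc N)) (ren ↑_ φ)
  lift-entails N (L , h , d) = map (ren ↑_) L ,
    (λ i → case ∈-map⁻ (ren ↑_) i of λ { (χ , j , refl) → inj₁ (χ , h j , refl) }) ,
    rename ↑_ (∈-map⁺ (ren ↑_)) d

  raise : ∀ {N M} (φ : Formula k) ρ → N ≤ M → Bounded ρ N → Entails (Θ N) (inst N φ ρ) → Entails (Θ M) (inst M φ ρ)
  raise {N = N} {M} φ ρ l b e = go M (ℕ.≤⇒≤′ l)
    where
    go : ∀ M → N ≤′ M → Entails (Θ M) (inst M φ ρ)
    go M (≤′-reflexive refl) = e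
    go (suc M) (≤′-step l) = let L , h , d = go M l in
      subst (Entails (Θ (suc M))) (inst-suc M φ ρ λ i → ℕ.≤-trans (b i) (ℕ.≤′⇒≤ l))
        (lift-entails M (L , inj₁ ∘ h , d))

  prov-re : (φ : Formula k) (ρ : Vec ℕ k) (φ' : Formula m) (ρ' : Vec ℕ m) →
            (∀ N → inst N φ ρ ≡ inst N φ' ρ') → Prov φ ρ → Prov φ' ρ'
  prov-re φ ρ φ' ρ' q (N , b , e) = let M , b' = bound ρ' in
    N ⊔ M , (λ i → ℕ.≤-trans (b' i) (ℕ.m≤n⊔m N M)) ,
    subst (Entails (Θ (N ⊔ M))) (q (N ⊔ M)) (raise φ ρ (ℕ.m≤m⊔n N M) b e)

  mp : (φ ψ : Formula k) (ρ : Vec ℕ k) → Prov (φ ⇒ ψ) ρ → Prov φ ρ → Prov ψ ρ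
  mp φ ψ ρ (N , b , e) (M , b' , e') with raise (φ ⇒ ψ) ρ (ℕ.m≤m⊔n N M) b e | raise φ ρ (ℕ.m≤n⊔m N M) b' e'
  ... | L , h , d | K , k , c = N ⊔ M , (λ i → ℕ.≤-trans (b i) (ℕ.m≤m⊔n N M)) , L ++ K ,
    (λ i → case ∈-++⁻ L i of λ { (inj₁ j) → h j ; (inj₂ j) → k j }) ,
    ⇒E (weaken ∈-++⁺ˡ d) (weaken (∈-++⁺ʳ L) c)

  prov : {φ : Formula k} (ρ : Vec ℕ k) → T ∣ [] ⊢ φ → Prov φ ρ
  prov ρ d = let N , b = bound ρ in N , b , [] , (λ ()) , rename _ (λ ()) d

  consistent : (ρ : Vec ℕ k) → ¬ Prov ⊥̇ ρ
  consistent ρ (N , b , e) = con-Θ N e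

  -- Truth as the unprovability of the negation is itself a negation and therefore stable; by
  -- `U⇒prov` it nevertheless yields an actual derivation.
  U : Formula k → Vec ℕ k → Set
  U φ ρ = ¬ Prov (¬̇ φ) ρ

  prov⇒U : (φ : Formula k) (ρ : Vec ℕ k) → Prov φ ρ → U φ ρ
  prov⇒U φ ρ p q = consistent ρ (mp φ ⊥̇ ρ q p)

  -- Let φ be enumerated at stage N. As ¬ φ is never provable, φ is consistent with `Θ N` and so
  -- belongs to `Θ' N`.
  U⇒prov : (φ : Formula k) (ρ : Vec ℕ k) → U φ ρ → Prov φ ρ
  U⇒prov φ ρ u with enum-surj φ ρ
  ... | N , b , q = suc N , (λ i → ℕ.m≤n⇒m≤1+n (b i)) ,
    subst (Entails (Θ (suc N))) (inst-suc N φ ρ b)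
      (lift-entails N (inst N φ ρ ∷ [] ,
        (λ { (here refl) → inj₂ (sym q , subst (Con ∘ add (Θ N)) (sym q) λ e → u (N , b , deduct e)) }) ,
        hyp (here refl)))

  -- The witness is the constant introduced right after the stage that enumerates ∀ φ, where its
  -- Henkin axiom is added.
  drinker : (φ : Formula (suc k)) (ρ : Vec ℕ k) → Σ ℕ λ c → U φ (c ◂ ρ) → U (∀̇ φ) ρ
  drinker φ ρ with enum-surj (∀̇ φ) ρ
  ... | N , b , q = suc N , λ u → prov⇒U (∀̇ φ) ρ
    (prov-re (ren ↑_ (∀̇ φ)) (suc N ◂ ρ) (∀̇ φ) ρ (λ M → ren-ren (λ i → idx M (lookup (suc N ◂ ρ) i)) ↑_ (λ i → idx M (lookup ρ i)) (λ _ → refl) (∀̇ φ))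
      (mp φ (ren ↑_ (∀̇ φ)) (suc N ◂ ρ) henkin-axiom (U⇒prov φ (suc N ◂ ρ) u)))
    where
    e : (i : Fin (suc _)) → lift (λ j → idx N (lookup ρ j)) i ≡ idx (suc N) (lookup (suc N ◂ ρ) i)
    e zero    = idx-new N
    e (suc i) = idx-suc N _ (b i)
    χ = ren (lift (λ j → idx N (lookup ρ j))) φ
    henkin-axiom : Prov (φ ⇒ ren ↑_ (∀̇ φ)) (suc N ◂ ρ)
    henkin-axiom = suc N , (λ { zero → ℕ.≤-refl ; (suc i) → ℕ.m≤n⇒m≤1+n (b i) }) ,
      henkin (enum N) ∷ [] , (λ { (here refl) → inj₂ refl }) ,
      subst (λ ψ → T ∣ henkin (enum N) ∷ [] ⊢ ψ) eq (hyp (here refl))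
      where
      eq₁ : χ ≡ inst (suc N) φ (suc N ◂ ρ)
      eq₁ = trans (sym (ren-id id (λ _ → refl) χ)) (ren-ren id _ _ e φ)
      eq₂ : ren ↑_ (inst N (∀̇ φ) ρ) ≡ inst (suc N) (ren ↑_ (∀̇ φ)) (suc N ◂ ρ)
      eq₂ = trans (inst-suc N (∀̇ φ) ρ b) (sym (ren-ren (λ i → idx (suc N) (lookup (suc N ◂ ρ) i)) ↑_ (λ i → idx (suc N) (lookup ρ i)) (λ _ → refl) (∀̇ φ)))
      eq : henkin (enum N) ≡ inst (suc N) (φ ⇒ ren ↑_ (∀̇ φ)) (suc N ◂ ρ)
      eq = trans (cong henkin q) (cong₂ _⇒_ eq₁ eq₂)

  U-∀ : (φ : Formula (suc k)) (ρ : Vec ℕ k) → U (∀̇ φ) ρ → ∀ c → U φ (c ◂ ρ)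
  U-∀ φ ρ u c with U⇒prov (∀̇ φ) ρ u
  ... | N , b , e with raise (∀̇ φ) ρ (ℕ.m≤n⊔m c N) b e
  ... | L , h , d = prov⇒U φ (c ◂ ρ) (c ⊔ N , (λ { zero → ℕ.m≤m⊔n c N ; (suc i) → ℕ.≤-trans (b i) (ℕ.m≤n⊔m c N) }) ,
    L , h , subst (T ∣ L ⊢_) (ren-ren (idx (c ⊔ N) c V.∷ id) (lift λ i → idx (c ⊔ N) (lookup ρ i)) (λ i → idx (c ⊔ N) (lookup (c ◂ ρ) i))
      (λ { zero → refl ; (suc i) → refl }) φ) (∀E d (idx (c ⊔ N) c)))

  taut₁ : (φ ψ : Formula k) → T ∣ [] ⊢ ¬̇ (φ ⇒ ψ) ⇒ φ
  taut₁ φ ψ = ⇒I (raa (⇒E (hyp (there (here refl))) (⇒I (raa (⇒E (hyp (there (there (here refl)))) (hyp (there (here refl))))))))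

  taut₂ : (φ ψ : Formula k) → T ∣ [] ⊢ ¬̇ (φ ⇒ ψ) ⇒ ¬̇ ψ
  taut₂ φ ψ = ⇒I (⇒I (⇒E (hyp (there (here refl))) (⇒I (hyp (there (here refl))))))

  U-⇒ : (φ ψ : Formula k) (ρ : Vec ℕ k) → (U φ ρ → U ψ ρ) → U (φ ⇒ ψ) ρ
  U-⇒ φ ψ ρ f p = f (prov⇒U φ ρ (mp (¬̇ (φ ⇒ ψ)) φ ρ (prov ρ (taut₁ φ ψ)) p)) (mp (¬̇ (φ ⇒ ψ)) (¬̇ ψ) ρ (prov ρ (taut₂ φ ψ)) p)

  U-mp : (φ ψ : Formula k) (ρ : Vec ℕ k) → U (φ ⇒ ψ) ρ → U φ ρ → U ψ ρ
  U-mp φ ψ ρ u w = prov⇒U ψ ρ (mp φ ψ ρ (U⇒prov (φ ⇒ ψ) ρ u) (U⇒prov φ ρ w))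

  U-re : (φ : Formula k) (ρ : Vec ℕ k) (φ' : Formula m) (ρ' : Vec ℕ m) →
         (∀ N → inst N φ ρ ≡ inst N φ' ρ') → U φ ρ → U φ' ρ'
  U-re φ ρ φ' ρ' q u p = u (prov-re (¬̇ φ') ρ' (¬̇ φ) ρ (λ N → cong ¬̇_ (sym (q N))) p)

  E₀ Q₀ : ℕ → ℕ → Set
  E₀ c d = U (zero ∈̇ suc zero) (c ◂ d ◂ ⟨⟩)
  Q₀ c d = U (zero ≐ suc zero) (c ◂ d ◂ ⟨⟩)

  leibniz : (φ : Formula (suc k)) (ρ : Vec ℕ k) (c d : ℕ) → Q₀ c d → U φ (c ◂ ρ) → U φ (d ◂ ρ)
  leibniz {k} φ ρ c d q u =
    U-re (ren g φ) σ φ (d ◂ ρ) (λ N → ren-ren (λ i → idx N (lookup σ i)) g (λ i → idx N (lookup (d ◂ ρ) i))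
        (λ { zero → refl ; (suc i) → refl }) φ)
      (U-mp (ren f φ) (ren g φ) σ
        (U-mp (zero ≐ suc zero) (ren f φ ⇒ ren g φ) σ
          (prov⇒U (zero ≐ suc zero ⇒ ren f φ ⇒ ren g φ) σ (prov σ thm))
          (U-re (zero ≐ suc zero) (c ◂ d ◂ ⟨⟩) (zero ≐ suc zero) σ (λ _ → refl) q))
        (U-re φ (c ◂ ρ) (ren f φ) σ
          (λ N → sym (ren-ren (λ i → idx N (lookup σ i)) f (λ i → idx N (lookup (c ◂ ρ) i))
            (λ { zero → refl ; (suc i) → refl }) φ)) u))
    where
    σ = c ◂ d ◂ ρ
    f g : Fin (suc k) → Fin (suc (suc k))
    f = zero V.∷ ↑²_
    g = suc zero V.∷ ↑²_
    h : Fin (suc k) → Fin (suc (suc (suc k)))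
    h = zero V.∷ ↑³_
    thm : T ∣ [] ⊢ zero ≐ suc zero ⇒ ren f φ ⇒ ren g φ
    thm = ⇒I (⇒I (subst (T ∣ ren f φ ∷ (zero ≐ suc zero) ∷ [] ⊢_)
      (ren-ren (suc zero V.∷ id) h g (λ { zero → refl ; (suc i) → refl }) φ)
      (≐E {x = zero} {y = suc zero} (ren h φ) (hyp (there (here refl)))
        (subst (T ∣ ren f φ ∷ (zero ≐ suc zero) ∷ [] ⊢_)
          (sym (ren-ren (zero V.∷ id) h f (λ { zero → refl ; (suc i) → refl }) φ)) (hyp (here refl))))))

  Q₀-refl : ∀ {c} → Q₀ c c
  Q₀-refl {c} = U-re (zero ≐ zero) (c ◂ ⟨⟩) (zero ≐ suc zero) (c ◂ c ◂ ⟨⟩) (λ _ → refl)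
    (prov⇒U (zero ≐ zero) (c ◂ ⟨⟩) (prov {φ = zero ≐ zero} (c ◂ ⟨⟩) ≐I))

  Q₀-sym : ∀ {c d} → Q₀ c d → Q₀ d c
  Q₀-sym {c} {d} q = leibniz (zero ≐ suc zero) (c ◂ ⟨⟩) c d q Q₀-refl

  Q₀-trans : ∀ {c d e} → Q₀ c d → Q₀ d e → Q₀ c e
  Q₀-trans {c} {d} {e} p q = leibniz (zero ≐ suc zero) (e ◂ ⟨⟩) d c (Q₀-sym p) q

  congE₀ : ∀ {x y x' y'} → Q₀ x x' → Q₀ y y' → E₀ x y → E₀ x' y'
  congE₀ {x} {y} {x'} {y'} p q u =
    U-re (suc zero ∈̇ zero) (y' ◂ x' ◂ ⟨⟩) (zero ∈̇ suc zero) (x' ◂ y' ◂ ⟨⟩) (λ _ → refl)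
    (leibniz (suc zero ∈̇ zero) (x' ◂ ⟨⟩) y y' q
      (U-re (zero ∈̇ suc zero) (x' ◂ y ◂ ⟨⟩) (suc zero ∈̇ zero) (y ◂ x' ◂ ⟨⟩) (λ _ → refl)
        (leibniz (zero ∈̇ suc zero) (y ◂ ⟨⟩) x x' p u)))

  structure : Structure
  structure = record { D = ℕ ; E = E₀ ; Q = Q₀ ; stE = λ h p → h λ u → u p ; stQ = λ h p → h λ u → u p
    ; Qrefl = Q₀-refl ; Qsym = Q₀-sym ; Qtr = Q₀-trans ; congE = congE₀ }

  open Semantics structure

  truth : (φ : Formula k) (ρ : Vec ℕ k) → (sat φ ρ → U φ ρ) × (U φ ρ → sat φ ρ)
  truth (x ∈̇ y) ρ = U-re (zero ∈̇ suc zero) (lookup ρ x ◂ lookup ρ y ◂ ⟨⟩) (x ∈̇ y) ρ (λ _ → refl) ,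
    U-re (x ∈̇ y) ρ (zero ∈̇ suc zero) (lookup ρ x ◂ lookup ρ y ◂ ⟨⟩) (λ _ → refl)
  truth (x ≐ y) ρ = U-re (zero ≐ suc zero) (lookup ρ x ◂ lookup ρ y ◂ ⟨⟩) (x ≐ y) ρ (λ _ → refl) ,
    U-re (x ≐ y) ρ (zero ≐ suc zero) (lookup ρ x ◂ lookup ρ y ◂ ⟨⟩) (λ _ → refl)
  truth ⊥̇ ρ = ⊥-elim , λ u → consistent ρ (U⇒prov ⊥̇ ρ u)
  truth (φ ⇒ ψ) ρ = (λ f → U-⇒ φ ψ ρ λ u → proj₁ (truth ψ ρ) (f (proj₂ (truth φ ρ) u))) ,
                    (λ u a → proj₂ (truth ψ ρ) (U-mp φ ψ ρ u (proj₁ (truth φ ρ) a)))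
  truth (∀̇ φ) ρ = (λ f → let c , g = drinker φ ρ in g (proj₁ (truth φ (c ◂ ρ)) (f c))) ,
                  (λ u c → proj₂ (truth φ (c ◂ ρ)) (U-∀ φ ρ u c))

  models : Models T
  models φ t = proj₂ (truth φ ⟨⟩) (prov⇒U φ ⟨⟩ (subst (λ ψ → Prov ψ ⟨⟩) (ren-id (λ ()) (λ ()) φ) (prov ⟨⟩ (axiom t))))

  choose : (φ : Formula (suc k)) (ρ : Vec ℕ k) → Σ ℕ λ c → ∀ d → sat φ (d ◂ ρ) → sat φ (c ◂ ρ)
  -- If the Henkin constant for ∀ ¬ φ does not satisfy φ, then nothing does.
  choose φ ρ with drinker (¬̇ φ) ρ
  ... | c , f = c , λ d a → st φ λ na →
    proj₂ (truth (∀̇ (¬̇ φ)) ρ) (f (proj₁ (truth (¬̇ φ) (c ◂ ρ)) na)) d a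

-- Consistency

zfc-inhabited : ∀ {T} → T infinity → T ∣ [] ⊢ ∃̇ (Inductive zero)
zfc-inhabited {T} t = subst (T ∣ [] ⊢_) (ren-id (λ ()) (λ ()) infinity) (axiom t)

henkin-model : ∀ {T} → (∀ φ → ZFC φ → T φ) → Consistent T →
               Σ ZFCModel λ 𝔙 → ZFCModel.Models 𝔙 T
henkin-model {T} ax con = record { 𝔐 = structure ; choose = choose ; elem = id ; elem-surj = λ d → d , refl
    ; zfc = λ φ t → models φ (ax φ t) } , models
  where open Completeness T con (Inductive zero) (zfc-inhabited (ax infinity inf))

combinatorial-consistent : Consistent ZFC → Consistent (ZFC ⊹ Combinatorial)
combinatorial-consistent con = N.models⇒consistent λ { φ (inj₁ t) → N-zfc φ t ; φ (inj₂ refl) → N-combinatorial }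
  where open Verification (proj₁ (henkin-model (λ _ t → t) con))

theorem5 : Consistent ZFC → Consistent (ZFC ⊹ ExistsStrongSplittingQSet)
theorem5 con = models⇒consistent λ { φ (inj₁ t) → zfc φ t ; φ (inj₂ refl) → sufficient (proj₂ 𝔙×models _ (inj₂ refl)) }
  where
  -- Completeness is applied a second time because `sufficient` is proved in the term language,
  -- which needs the Henkin witnesses that are not at hand for N.
  𝔙×models = henkin-model (λ _ → inj₁) (combinatorial-consistent con)
  open ZFCModel (proj₁ 𝔙×models)
  open Sufficiency (proj₁ 𝔙×models) using (sufficient)
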